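{- There is a polynomial-time algorithm which, given a quantifier-free Horn formula $\phi$ over $(\mathbb{Z};+)$ with integer parameters (all integers represented in binary), decides whether $\phi$ is satisfiable in $\mathbb{Z}$.
   Context: A quantifier-free Horn formula over $(\mathbb{Z};+)$ with parameters is a finite conjunction of clauses of the form $\bigvee_{i=1}^n\neg\phi_i\vee\phi_0$, where each $\phi_j$ is a linear equation $\sum_k a_kx_k=b$ with integer coefficients $a_k,b$; satisfiability means existence of an integer assignment to the variables making all clauses true. -}

module Defs where

open import Data.Nat using (ℕ; zero; suc; _+_; _^_)
open import Data.Nat.Binary using (ℕᵇ; zero; 2[1+_]; 1+[2_]) renaming (fromℕ to toℕᵇ)
open import Data.Integer as ℤ using (ℤ; +_; -[1+_])
open import Data.Fin using (Fin)
open import Data.Bool using (Bool; true)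
open import Data.List using (List; []; _∷_; _++_; concatMap; foldr; length)
open import Data.List.Relation.Unary.All using (All)
open import Data.List.Relation.Unary.Any using (Any)
open import Data.Maybe using (Maybe; just; nothing)
open import Data.Sum using (_⊎_; inj₁; inj₂)
open import Data.Product using (_×_; _,_; Σ)
open import Relation.Binary.PropositionalEquality using (_≡_)
open import Relation.Nullary using (¬_)

-- A linear term a·x_k : (coefficient a , variable index k)
Term : Set
Term = ℤ × ℕ

-- A linear equation  Σ a_k x_k = b  : (list of terms , right-hand side b)
Equation : Set
Equation = List Term × ℤ

-- A Horn clause  ¬φ_1 ∨ … ∨ ¬φ_n ∨ φ_0 : (body [φ_1 … φ_n] , head φ_0)
Clause : Set
Clause = List Equation × Equation

HornFormula : Set
HornFormula = List Clause

Assignment : Set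
Assignment = ℕ → ℤ

evalTerms : Assignment → List Term → ℤ
evalTerms σ = foldr (λ { (a , k) r → a ℤ.* σ k ℤ.+ r }) (+ 0)

HoldsEq : Assignment → Equation → Set
HoldsEq σ (ts , b) = evalTerms σ ts ≡ b

HoldsClause : Assignment → Clause → Set
HoldsClause σ (body , hd) = Any (λ e → ¬ HoldsEq σ e) body ⊎ HoldsEq σ hd

Satisfiable : HornFormula → Set
Satisfiable φ = Σ Assignment λ σ → All (HoldsClause σ) φ

data Sym : Set where
  one two    : Sym   -- digits of bijective base-2 numerals (binary size)
  plus minus : Sym
  sep        : Sym
  eqEnd      : Sym
  arrow      : Sym
  clauseEnd  : Sym

encℕᵇ : ℕᵇ → List Sym
encℕᵇ zero = []
encℕᵇ 2[1+ x ] = two ∷ encℕᵇ x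
encℕᵇ 1+[2 x ] = one ∷ encℕᵇ x

encℕ : ℕ → List Sym
encℕ n = encℕᵇ (toℕᵇ n)

encℤ : ℤ → List Sym
encℤ (+ n) = plus ∷ encℕ n
encℤ -[1+ n ] = minus ∷ encℕ n

encTerm : Term → List Sym
encTerm (a , k) = encℤ a ++ sep ∷ encℕ k ++ sep ∷ []

encEq : Equation → List Sym
encEq (ts , b) = concatMap encTerm ts ++ encℤ b ++ eqEnd ∷ []

encClause : Clause → List Sym
encClause (body , hd) = concatMap encEq body ++ arrow ∷ encEq hd ++ clauseEnd ∷ []

encode : HornFormula → List Sym
encode = concatMap encClause

data Move : Set where
  left right stay : Move

-- tape symbols with e extra work symbols:
-- nothing = blank, inj₁ = input symbol, inj₂ = extra symbol
TapeSym : ℕ → Set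
TapeSym e = Maybe (Sym ⊎ Fin e)

data Action (q e : ℕ) : Set where
  halt  : Bool → Action q e
  write : Fin q → TapeSym e → Move → Action q e

record TM : Set where
  field
    nStates : ℕ
    nExtra  : ℕ
    start   : Fin nStates
    δ       : Fin nStates → TapeSym nExtra → Action nStates nExtra

module _ (M : TM) where
  open TM M
  private
    TS = TapeSym nExtra

  record Config : Set where
    constructor cfg
    field
      state : Fin nStates
      lft   : List TS   -- cells left of the head, nearest first
      hd    : TS
      rgt   : List TS   -- cells right of the head, nearest first

  move : Move → List TS → TS → List TS → Config → Config
  move left  []      c r (cfg q _ _ _) = cfg q [] c r          -- left end: stay
  move left  (x ∷ l) c r (cfg q _ _ _) = cfg q l x (c ∷ r)
  move right l c []      (cfg q _ _ _) = cfg q (c ∷ l) nothing []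
  move right l c (x ∷ r) (cfg q _ _ _) = cfg q (c ∷ l) x r
  move stay  l c r       (cfg q _ _ _) = cfg q l c r

  step : Config → Bool ⊎ Config
  step (cfg q l c r) with δ q c
  ... | halt b = inj₁ b
  ... | write q' c' m = inj₂ (move m l c' r (cfg q' l c' r))

  run : ℕ → Config → Maybe Bool
  run zero    _ = nothing
  run (suc t) c with step c
  ... | inj₁ b  = just b
  ... | inj₂ c' = run t c'

  initial : List Sym → Config
  initial []      = cfg start [] nothing []
  initial (s ∷ w) = cfg start [] (just (inj₁ s)) (Data.List.map (λ x → just (inj₁ x)) w)

  HaltsWithin : List Sym → ℕ → Bool → Set
  HaltsWithin w t b = run t (initial w) ≡ just b

PolyTimeDecidesHornSat : TM → ℕ → Set
PolyTimeDecidesHornSat M k =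
  (φ : HornFormula) → Σ Bool λ b →
    HaltsWithin M (encode φ) (length (encode φ) ^ k + k) b
    × ((b ≡ true → Satisfiable φ) × (Satisfiable φ → b ≡ true))

{-# OPTIONS --safe #-}
-- Collect the heads of all clauses whose bodies follow, over the rationals, from the heads
-- collected so far. Every solution satisfies the collected system E. Conversely, if E has an
-- integer solution, then each remaining clause has a body equation that is not constant on the
-- integer solutions of E, and finitely many such hyperplanes are avoided by moving a solution
-- along suitable directions in the kernel of E. So the formula is satisfiable iff E is solvable
-- over the integers.
--
-- E is kept as a reduced row echelon form with primitive integer rows. By Siegel's lemma
-- (pigeonhole) the entries of such rows have polynomially many bits. In a reduced form each pivot
-- column has a single nonzero entry, so solvability over the integers is a system of congruences
-- modulo the pivots, which is solved by Euclidean column operations on residues.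
--
-- The algorithm is a composition of functions from a class that is closed under structural
-- recursion with polynomially bounded results. Its functions are computed by while programs on four
-- stacks of symbols, and these stacks are the tracks of the tape of the Turing machine.

module Submission where

open import Defs
open import Data.Bool using (Bool; true; false; if_then_else_; not)
open import Data.Empty using (⊥; ⊥-elim)
open import Data.Fin using (Fin; zero; suc; combine; remQuot; splitAt; join)
import Data.Fin as F
import Data.Fin.Properties as FP
open import Data.List using (List; []; _∷_; _++_; _ʳ++_; map; foldr; foldl; length; replicate; reverse; concatMap; head; drop)
import Data.List.Properties as LP
open import Data.List.Relation.Unary.All using (All; []; _∷_)
import Data.List.Relation.Unary.All as All
import Data.List.Relation.Unary.All.Properties as AllP
open import Data.List.Relation.Unary.Any using (Any; here; there)
open import Data.Maybe using (Maybe; just; nothing)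
open import Data.Nat using (ℕ; zero; suc; _+_; _*_; _^_; _∸_; _≤_; _<_; z≤n; s≤s)
import Data.Nat as ℕ
import Data.Nat.Properties as ℕP
open import Data.Product using (Σ; _×_; _,_; proj₁; proj₂)
open import Data.Sum using (_⊎_; inj₁; inj₂; [_,_]′)
open import Data.Unit using (⊤; tt)
open import Data.Vec using (Vec; []; _∷_; lookup; updateAt)
import Data.Vec.Properties as VP
open import Function using (_∘_; id)
open import Relation.Binary.PropositionalEquality using (_≡_; _≢_; refl; sym; trans; cong; cong₂; subst; subst₂; module ≡-Reasoning)
open import Relation.Nullary using (¬_; yes; no; does; contradiction)
open import Data.Nat.Tactic.RingSolver using (solve-∀)

-- Right-hand sides are homogenised: an equation becomes a row whose entry 0 is the right-hand side,
-- solutions are kernel points with coordinate 0 equal to -1, and entailment is tested on the whole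
-- kernel. Kernel and slice can disagree about entailment only if the slice is empty over the
-- rationals; then some row is supported on entry 0 and the answer is `false`. Rational entailment
-- is the right test for the integer problem because kernel directions may be scaled to integral
-- ones. The obstacle is coefficient growth: one reduction adds up the bits of all rows, so repeated
-- insertion could multiply bit lengths each time. No step-by-step estimate is attempted. A
-- primitive row that vanishes at the other pivots is determined up to sign by the span of the
-- equations and the pivots, so it suffices to exhibit one short nonzero vector of the span with
-- these zeros, and that vector is taken from the original equations. The resulting bound does not
-- depend on the history of the elimination.

-- Finite types, numbered for use as states and tape symbols.

record Finite (A : Set) : Set where
  field
    card    : ℕ
    index   : A → Fin card
    elem    : Fin card → A
    -- A one-sided inverse: states and symbols are always encoded before they are decoded.
    section : ∀ a → elem (index a) ≡ a
open Finite

finite-⊤ : Finite ⊤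
finite-⊤ = record { card = 1 ; index = λ _ → zero ; elem = λ _ → tt ; section = λ _ → refl }

finite-Bool : Finite Bool
finite-Bool = record
  { card = 2
  ; index = λ { false → zero ; true → suc zero }
  ; elem = λ { zero → false ; (suc _) → true }
  ; section = λ { false → refl ; true → refl } }

finite-Maybe : ∀ {A} → Finite A → Finite (Maybe A)
finite-Maybe {A} F = record
  { card = suc (card F) ; index = ix ; elem = el ; section = sec }
  where
  ix : Maybe A → Fin (suc (card F))
  ix nothing  = zero
  ix (just a) = suc (index F a)
  el : Fin (suc (card F)) → Maybe A
  el zero    = nothing
  el (suc i) = just (elem F i)
  sec : ∀ a → el (ix a) ≡ a
  sec nothing  = refl
  sec (just a) = cong just (section F a)

finite-⊎ : ∀ {A B} → Finite A → Finite B → Finite (A ⊎ B)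
finite-⊎ {A} {B} F G = record
  { card = card F + card G ; index = ix ; elem = el ; section = sec }
  where
  ix : A ⊎ B → Fin (card F + card G)
  ix x = join (card F) (card G) (Data.Sum.map (index F) (index G) x)
  el : Fin (card F + card G) → A ⊎ B
  el i = Data.Sum.map (elem F) (elem G) (splitAt (card F) i)
  sec : ∀ x → el (ix x) ≡ x
  sec x rewrite FP.splitAt-join (card F) (card G) (Data.Sum.map (index F) (index G) x) with x
  ... | inj₁ a = cong inj₁ (section F a)
  ... | inj₂ b = cong inj₂ (section G b)

finite-× : ∀ {A B} → Finite A → Finite B → Finite (A × B)
finite-× {A} {B} F G = record
  { card = card F * card G ; index = ix ; elem = el ; section = sec }
  where
  ix : A × B → Fin (card F * card G)
  ix (a , b) = combine (index F a) (index G b)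
  el : Fin (card F * card G) → A × B
  el i = Data.Product.map (elem F) (elem G) (remQuot (card G) i)
  sec : ∀ x → el (ix x) ≡ x
  sec (a , b) = trans (cong (Data.Product.map (elem F) (elem G)) (FP.remQuot-combine (index F a) (index G b)))
    (cong₂ _,_ (section F a) (section G b))

finite-Vec : ∀ {A} → Finite A → ∀ n → Finite (Vec A n)
finite-Vec F zero = record
  { card = 1 ; index = λ _ → zero ; elem = λ _ → [] ; section = λ { [] → refl } }
finite-Vec {A} F (suc n) = record
  { card = card F×V
  ; index = λ { (x ∷ xs) → index F×V (x , xs) }
  ; elem = λ i → proj₁ (elem F×V i) ∷ proj₂ (elem F×V i)
  ; section = λ { (x ∷ xs) → cong (λ p → proj₁ p ∷ proj₂ p) (section F×V (x , xs)) } }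
  where
  F×V : Finite (A × Vec A n)
  F×V = finite-× F (finite-Vec F n)

finite-Sym : Finite Sym
finite-Sym = record { card = 8 ; index = ix ; elem = el ; section = sec }
  where
  ix : Sym → Fin 8
  ix one = zero
  ix two = suc zero
  ix plus = suc (suc zero)
  ix minus = suc (suc (suc zero))
  ix sep = suc (suc (suc (suc zero)))
  ix eqEnd = suc (suc (suc (suc (suc zero))))
  ix arrow = suc (suc (suc (suc (suc (suc zero)))))
  ix clauseEnd = suc (suc (suc (suc (suc (suc (suc zero))))))
  el : Fin 8 → Sym
  el zero = one
  el (suc zero) = two
  el (suc (suc zero)) = plus
  el (suc (suc (suc zero))) = minus
  el (suc (suc (suc (suc zero)))) = sep
  el (suc (suc (suc (suc (suc zero))))) = eqEnd
  el (suc (suc (suc (suc (suc (suc zero)))))) = arrow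
  el (suc (suc (suc (suc (suc (suc (suc zero))))))) = clauseEnd
  sec : ∀ s → el (ix s) ≡ s
  sec one = refl
  sec two = refl
  sec plus = refl
  sec minus = refl
  sec sep = refl
  sec eqEnd = refl
  sec arrow = refl
  sec clauseEnd = refl

-- A while language on four stacks

Stacks : Set
Stacks = Vec (List Sym) 4

infixr 5 _⨾_
data Prog : Set where
  skip  : Prog
  push  : Fin 4 → Sym → Prog
  pop   : Fin 4 → Prog
  _⨾_   : Prog → Prog → Prog
  cond  : Fin 4 → (Maybe Sym → Bool) → Prog → Prog → Prog
  while : Fin 4 → (Maybe Sym → Bool) → Prog → Prog

top : Fin 4 → Stacks → Maybe Sym
top i σ = head (lookup σ i)

-- Termination is part of a derivation. Because of `relax` the last index is an upper bound on the
-- cost, so costs may be rounded up wherever that simplifies them.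
data Exec : Prog → Stacks → Stacks → ℕ → Set where
  skip  : ∀ {σ} → Exec skip σ σ 1
  push  : ∀ {i s σ} → Exec (push i s) σ (updateAt σ i (s ∷_)) 1
  pop   : ∀ {i σ} → Exec (pop i) σ (updateAt σ i (drop 1)) 1
  _⨾_   : ∀ {P Q σ τ ρ m n} → Exec P σ τ m → Exec Q τ ρ n → Exec (P ⨾ Q) σ ρ (m + n)
  then  : ∀ {i p P Q σ τ n} → p (top i σ) ≡ true → Exec P σ τ n → Exec (cond i p P Q) σ τ (suc n)
  else  : ∀ {i p P Q σ τ n} → p (top i σ) ≡ false → Exec Q σ τ n → Exec (cond i p P Q) σ τ (suc n)
  done  : ∀ {i p P σ} → p (top i σ) ≡ false → Exec (while i p P) σ σ 1
  again : ∀ {i p P σ τ ρ m n} → p (top i σ) ≡ true → Exec P σ τ m → Exec (while i p P) τ ρ n →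
          Exec (while i p P) σ ρ (suc (m + n))
  relax : ∀ {P σ τ m n} → m ≤ n → Exec P σ τ m → Exec P σ τ n

-- Wrapped as a record so that `h` and `σ` can be inferred from the type; the same is done below for
-- other pointwise bounds.
record Height≤ (h : ℕ) (σ : Stacks) : Set where
  constructor height
  field length≤ : ∀ i → length (lookup σ i) ≤ h
open Height≤

height-mono : ∀ {h h′ σ} → h ≤ h′ → Height≤ h σ → Height≤ h′ σ
height-mono h≤ (height H) = height (λ i → ℕP.≤-trans (H i) h≤)

height-updateAt : ∀ {h h′ σ} i (f : List Sym → List Sym) → h ≤ h′ →
                  (∀ l → length l ≤ h → length (f l) ≤ h′) → Height≤ h σ → Height≤ h′ (updateAt σ i f)
height-updateAt {h′ = h′} {σ} i f h≤ g (height H) = height bound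
  where
  bound : ∀ j → length (lookup (updateAt σ i f) j) ≤ h′
  bound j with j FP.≟ i
  ... | yes refl rewrite VP.lookup∘updateAt i {f = f} σ = g (lookup σ i) (H i)
  ... | no j≢i rewrite VP.lookup∘updateAt′ j i {f = f} j≢i σ = ℕP.≤-trans (H j) h≤

-- A unit of cost pushes at most one symbol, so time bounds space. This gives both the reach of the
-- tape head and the size of every computed result.
height-exec : ∀ {P σ τ n h} → Exec P σ τ n → Height≤ h σ → Height≤ (h + n) τ
height-exec skip H = height-mono (ℕP.m≤m+n _ _) H
height-exec {h = h} (push {i} {s}) H =
  height-updateAt i (s ∷_) (ℕP.m≤m+n h 1)
    (λ l l≤ → ℕP.≤-trans (s≤s l≤) (ℕP.≤-reflexive (ℕP.+-comm 1 h))) H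
height-exec {h = h} (pop {i}) H =
  height-updateAt i (drop 1) (ℕP.m≤m+n h 1)
    (λ l l≤ → ℕP.≤-trans (ℕP.≤-reflexive (LP.length-drop 1 l))
      (ℕP.≤-trans (ℕP.m∸n≤m (length l) 1) (ℕP.≤-trans l≤ (ℕP.m≤m+n h 1)))) H
height-exec {h = h} (_⨾_ {m = m} {n} p q) H =
  height-mono (ℕP.≤-reflexive (ℕP.+-assoc h m n)) (height-exec q (height-exec p H))
height-exec {h = h} (then {n = n} _ p) H = height-mono (ℕP.+-monoʳ-≤ h (ℕP.n≤1+n n)) (height-exec p H)
height-exec {h = h} (else {n = n} _ p) H = height-mono (ℕP.+-monoʳ-≤ h (ℕP.n≤1+n n)) (height-exec p H)
height-exec (done _) H = height-mono (ℕP.m≤m+n _ _) H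
height-exec {h = h} (again {m = m} {n} _ p q) H =
  height-mono (ℕP.≤-trans (ℕP.≤-reflexive (ℕP.+-assoc h m n)) (ℕP.+-monoʳ-≤ h (ℕP.n≤1+n (m + n))))
    (height-exec q (height-exec p H))
height-exec {h = h} (relax m≤n p) H = height-mono (ℕP.+-monoʳ-≤ h m≤n) (height-exec p H)

-- Flowcharts

data Op : Set where
  push : Sym → Op
  pop  : Op
  test : (Maybe Sym → Bool) → Op

data Instr (L : Set) : Set where
  halt : Bool → Instr L
  act  : Fin 4 → Op → (Bool → L) → Instr L

branch : ∀ {L : Set} → L → L → Bool → L
branch l l′ b = if b then l else l′

Lab : Prog → Set
Lab skip           = ⊤
Lab (push _ _)     = ⊤
Lab (pop _)        = ⊤
Lab (P ⨾ Q)        = Lab P ⊎ Lab Q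
Lab (cond _ _ P Q) = ⊤ ⊎ (Lab P ⊎ Lab Q)
Lab (while _ _ P)  = ⊤ ⊎ Lab P

finite-Lab : ∀ P → Finite (Lab P)
finite-Lab skip           = finite-⊤
finite-Lab (push _ _)     = finite-⊤
finite-Lab (pop _)        = finite-⊤
finite-Lab (P ⨾ Q)        = finite-⊎ (finite-Lab P) (finite-Lab Q)
finite-Lab (cond _ _ P Q) = finite-⊎ finite-⊤ (finite-⊎ (finite-Lab P) (finite-Lab Q))
finite-Lab (while _ _ P)  = finite-⊎ finite-⊤ (finite-Lab P)

entry : ∀ P → Lab P
entry skip           = tt
entry (push _ _)     = tt
entry (pop _)        = tt
entry (P ⨾ _)        = inj₁ (entry P)
entry (cond _ _ _ _) = inj₁ tt
entry (while _ _ _)  = inj₁ tt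

-- The instruction at a label of P, when the labels of P are embedded by e into a larger
-- flowchart and control leaves P at the label x.
instr : ∀ P {L : Set} → (Lab P → L) → L → Lab P → Instr L
-- `skip` still occupies one instruction, a test with equal branches, in agreement with its cost of
-- 1.
instr skip           e x _        = act zero (test (λ _ → true)) (λ _ → x)
instr (push i s)     e x _        = act i (push s) (λ _ → x)
instr (pop i)        e x _        = act i pop (λ _ → x)
instr (P ⨾ Q)        e x (inj₁ l) = instr P (e ∘ inj₁) (e (inj₂ (entry Q))) l
instr (P ⨾ Q)        e x (inj₂ l) = instr Q (e ∘ inj₂) x l
instr (cond i p P Q) e x (inj₁ _) =
  act i (test p) (branch (e (inj₂ (inj₁ (entry P)))) (e (inj₂ (inj₂ (entry Q)))))
instr (cond i p P Q) e x (inj₂ (inj₁ l)) = instr P (e ∘ inj₂ ∘ inj₁) x l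
instr (cond i p P Q) e x (inj₂ (inj₂ l)) = instr Q (e ∘ inj₂ ∘ inj₂) x l
instr (while i p P)  e x (inj₁ _) = act i (test p) (branch (e (inj₂ (entry P))) x)
instr (while i p P)  e x (inj₂ l) = instr P (e ∘ inj₂) (e (inj₁ tt)) l

-- A tape cell carries a mark, set only on the leftmost cell, and one track per stack:
-- cell n of track i holds the n-th symbol of stack i counted from the bottom.
Cell : Set
Cell = Bool × Vec (Maybe Sym) 4

opaque
  -- Opaque, so that type checking never computes with the 13122 cells.
  finite-Cell : Finite Cell
  finite-Cell = finite-× finite-Bool (finite-Vec (finite-Maybe finite-Sym) 4)

TSym : Set
TSym = TapeSym (card finite-Cell)

-- Blanks and raw input symbols count as cells too, so the input needs no conversion pass: it
-- already is stack 0, with the first symbol of the word at the bottom.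
read : TSym → Cell
read nothing         = false , nothing ∷ nothing ∷ nothing ∷ nothing ∷ []
read (just (inj₁ s)) = false , just s ∷ nothing ∷ nothing ∷ nothing ∷ []
read (just (inj₂ i)) = elem finite-Cell i

print : Cell → TSym
print c = just (inj₂ (index finite-Cell c))

read-print : ∀ c → read (print c) ≡ c
read-print = section finite-Cell

marked : TSym → Bool
marked = proj₁ ∘ read

track : Fin 4 → TSym → Maybe Sym
track i c = lookup (proj₂ (read c)) i

setTrack : Fin 4 → Maybe Sym → TSym → TSym
setTrack i s c = print (marked c , updateAt (proj₂ (read c)) i (λ _ → s))

setMark : TSym → TSym
setMark c = print (true , proj₂ (read c))

marked-setTrack : ∀ i s c → marked (setTrack i s c) ≡ marked c
marked-setTrack i s c = cong proj₁ (read-print _)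

track-setTrack : ∀ i s c → track i (setTrack i s c) ≡ s
track-setTrack i s c =
  trans (cong (λ x → lookup (proj₂ x) i) (read-print _)) (VP.lookup∘updateAt i (proj₂ (read c)))

track-setTrack-≢ : ∀ i j s c → j ≢ i → track j (setTrack i s c) ≡ track j c
track-setTrack-≢ i j s c j≢i =
  trans (cong (λ x → lookup (proj₂ x) j) (read-print _)) (VP.lookup∘updateAt′ j i j≢i (proj₂ (read c)))

marked-setMark : ∀ c → marked (setMark c) ≡ true
marked-setMark c = cong proj₁ (read-print _)

track-setMark : ∀ i c → track i (setMark c) ≡ track i c
track-setMark i c = cong (λ x → lookup (proj₂ x) i) (read-print _)

-- One stack instruction is a round trip of the head: `seek` runs right from the marked cell to the
-- first blank of the track, `touch` acts on the topmost symbol just left of it, and `back` carries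
-- the outcome of a test home.
data Phase : Set where
  seek  : Phase
  touch : Phase
  back  : Bool → Phase

finite-Phase : Finite Phase
finite-Phase = record
  { card = 4
  ; index = λ { seek → zero ; touch → suc zero
              ; (back false) → suc (suc zero) ; (back true) → suc (suc (suc zero)) }
  ; elem = λ { zero → seek ; (suc zero) → touch
             ; (suc (suc zero)) → back false ; (suc (suc (suc _))) → back true }
  ; section = λ { seek → refl ; touch → refl ; (back false) → refl ; (back true) → refl } }

-- Simulation of a flowchart on a single tape.

module Machine {L : Set} (finL : Finite L) (chart : L → Instr L) (l₀ : L) where

  State : Set
  State = ⊤ ⊎ (L × Phase)

  finite-State : Finite State
  finite-State = finite-⊎ finite-⊤ (finite-× finL finite-Phase)

  StateAction : Set
  StateAction = Bool ⊎ (State × TSym × Move)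

  -- If the stack is empty, the blank is the leftmost cell and a move to the left stays there. So
  -- `touch` meets `nothing`, which is what `pop` and `test` expect of an empty stack.
  atBlank : L → Fin 4 → Op → TSym → StateAction
  atBlank l i (push s) c = inj₂ (inj₂ (l , back true) , setTrack i (just s) c , stay)
  atBlank l i pop      c = inj₂ (inj₂ (l , touch) , c , left)
  atBlank l i (test _) c = inj₂ (inj₂ (l , touch) , c , left)

  touching : L → Fin 4 → Op → TSym → StateAction
  -- Never reached: a push is completed at the blank.
  touching l i (push _) c = inj₁ false
  touching l i pop      c = inj₂ (inj₂ (l , back true) , setTrack i nothing c , stay)
  touching l i (test p) c = inj₂ (inj₂ (l , back (p (track i c))) , c , stay)

  transition : L → Phase → Instr L → TSym → StateAction
  transition l ph (halt b) c = inj₁ b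
  transition l seek (act i o nx) c with track i c
  ... | just _  = inj₂ (inj₂ (l , seek) , c , right)
  ... | nothing = atBlank l i o c
  transition l touch (act i o nx) c = touching l i o c
  transition l (back b) (act i o nx) c =
    if marked c then inj₂ (inj₂ (nx b , seek) , c , stay) else inj₂ (inj₂ (l , back b) , c , left)

  next : State → TSym → StateAction
  -- The only step outside the flowchart marks the leftmost cell, so that `back` can recognise it.
  next (inj₁ _) c = inj₂ (inj₂ (l₀ , seek) , setMark c , stay)
  next (inj₂ (l , ph)) c = transition l ph (chart l) c

  toAction : StateAction → Action (card finite-State) (card finite-Cell)
  toAction (inj₁ b) = halt b
  toAction (inj₂ (q , c , m)) = write (index finite-State q) c m

  machine : TM
  machine = record
    { nStates = card finite-State
    ; nExtra  = card finite-Cell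
    ; start   = index finite-State (inj₁ tt)
    ; δ       = λ q c → toAction (next (elem finite-State q) c) }

  conf : State → List TSym → TSym → List TSym → Config machine
  conf q = cfg (index finite-State q)

  moved : Move → State → List TSym → TSym → List TSym → Config machine
  moved m q l c r = move machine m l c r (conf q l c r)

  -- Quantifying over the remaining fuel `s` makes segments of a run compose by transitivity.
  record Reach (t : ℕ) (c c′ : Config machine) : Set where
    constructor reaches
    field runs : ∀ s → run machine (t + s) c ≡ run machine s c′
  open Reach

  reach-trans : ∀ {t u c c′ c″} → Reach t c c′ → Reach u c′ c″ → Reach (t + u) c c″
  reach-trans {t} {u} {c} (reaches p) (reaches q) = reaches λ s →
    trans (cong (λ k → run machine k c) (ℕP.+-assoc t u s)) (trans (p (u + s)) (q s))

  step-write : ∀ q l c r {q′ c′ m} → next q c ≡ inj₂ (q′ , c′ , m) →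
               step machine (conf q l c r) ≡ inj₂ (moved m q′ l c′ r)
  step-write q l c r eq rewrite section finite-State q | eq = refl

  step-halt : ∀ q l c r {b} → next q c ≡ inj₁ b → step machine (conf q l c r) ≡ inj₁ b
  step-halt q l c r eq rewrite section finite-State q | eq = refl

  run-step : ∀ c {c′} s → step machine c ≡ inj₂ c′ → run machine (suc s) c ≡ run machine s c′
  run-step c s eq rewrite eq = refl

  run-halt : ∀ c {b} s → step machine c ≡ inj₁ b → run machine (suc s) c ≡ just b
  run-halt c s eq rewrite eq = refl

  reach-write : ∀ q l c r {q′ c′ m} → next q c ≡ inj₂ (q′ , c′ , m) → Reach 1 (conf q l c r) (moved m q′ l c′ r)
  reach-write q l c r eq = reaches λ s → run-step (conf q l c r) s (step-write q l c r eq)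

  -- The padding `k` differs from track to track: all tracks share the length of the visited tape,
  -- which other stacks or the input may have extended.
  Column : List TSym → Stacks → Fin 4 → Set
  Column T σ i = Σ ℕ λ k → map (track i) T ≡ map just (reverse (lookup σ i)) ++ replicate k nothing

  Marks : List TSym → Set
  Marks []      = ⊥
  Marks (c ∷ T) = marked c ≡ true × All (λ x → marked x ≡ false) T

  record Good (T : List TSym) (σ : Stacks) : Set where
    constructor good
    field
      marks   : Marks T
      columns : ∀ i → Column T σ i
  open Good

  marks-∷ʳ : ∀ T → Marks T → Marks (T ++ nothing ∷ [])
  marks-∷ʳ (c ∷ T) (m , ms) = m , AllP.++⁺ ms (refl ∷ [])

  replicate-∷ʳ : ∀ {A : Set} k (x : A) → replicate k x ++ x ∷ [] ≡ replicate (suc k) x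
  replicate-∷ʳ zero    x = refl
  replicate-∷ʳ (suc k) x = cong (x ∷_) (replicate-∷ʳ k x)

  track-blank : ∀ i → track i nothing ≡ nothing
  track-blank zero = refl
  track-blank (suc zero) = refl
  track-blank (suc (suc zero)) = refl
  track-blank (suc (suc (suc zero))) = refl

  -- Stepping off the visited tape appends a cell that is unmarked and blank on every track.
  good-∷ʳ : ∀ {T σ} → Good T σ → Good (T ++ nothing ∷ []) σ
  good-∷ʳ {T} {σ} (good m cs) = good (marks-∷ʳ T m) col
    where
    col : ∀ i → Column (T ++ nothing ∷ []) σ i
    col i with cs i
    ... | k , eq = suc k , trans (LP.map-++ (track i) T (nothing ∷ []))
           (trans (cong₂ (λ a b → a ++ b ∷ []) eq (track-blank i))
           (trans (LP.++-assoc (map just (reverse (lookup σ i))) (replicate k nothing) (nothing ∷ []))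
             (cong (map just (reverse (lookup σ i)) ++_) (replicate-∷ʳ k nothing))))

  record Seeked (l : L) (i : Fin 4) (σ : Stacks) (st : List Sym) (t : ℕ) (c₀ : Config machine) : Set where
    constructor seeked
    field
      lft  : List TSym
      cur  : TSym
      rgt  : List TSym
      k    : ℕ
      isGood : Good (lft ʳ++ (cur ∷ rgt)) σ
      lftCol : map (track i) lft ≡ map just st
      rgtCol : map (track i) (cur ∷ rgt) ≡ replicate (suc k) nothing
      reach  : Reach t c₀ (conf (inj₂ (l , seek)) lft cur rgt)

  -- `st` is the part of the stack already passed, top first, and `b` the part still to come. If the
  -- tape ends together with the stack, the head steps onto a fresh blank.
  seeking : ∀ {l i o nx} → chart l ≡ act i o nx → ∀ {σ} b st L c R k →
            Good (L ʳ++ (c ∷ R)) σ → map (track i) L ≡ map just st →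
            map (track i) (c ∷ R) ≡ map just b ++ replicate k nothing →
            Seeked l i σ (b ʳ++ st) (length b) (conf (inj₂ (l , seek)) L c R)
  seeking eqi [] st L c R (suc k) g eqL eqR = seeked L c R k g eqL eqR (reaches λ s → refl)
  seeking {l} {i} {o} {nx} eqi {σ} (x ∷ b) st L c R k g eqL eqR with R | eqR
  ... | d ∷ R′ | eqR′ = seeked _ _ _ _ (Seeked.isGood r) (Seeked.lftCol r) (Seeked.rgtCol r)
          (reach-trans (reach-write (inj₂ (l , seek)) L c (d ∷ R′) nxt) (Seeked.reach r))
    where
    nxt : next (inj₂ (l , seek)) c ≡ inj₂ (inj₂ (l , seek) , c , right)
    nxt rewrite eqi | LP.∷-injectiveˡ eqR′ = refl
    r = seeking eqi b (x ∷ st) (c ∷ L) d R′ k g (cong₂ _∷_ (LP.∷-injectiveˡ eqR′) eqL) (LP.∷-injectiveʳ eqR′)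
  ... | [] | eqR′ with b | k | LP.∷-injectiveʳ eqR′
  ... | [] | zero | _ = seeked (c ∷ L) nothing [] 0
          (subst (λ T → Good T σ) (trans (cong (_++ _) (LP.ʳ++-defn L))
             (trans (LP.++-assoc (reverse L) (c ∷ []) (nothing ∷ [])) (sym (LP.ʳ++-defn L)))) (good-∷ʳ g))
          (cong₂ _∷_ (LP.∷-injectiveˡ eqR′) eqL) (cong (_∷ []) (track-blank i))
          (reach-write (inj₂ (l , seek)) L c [] nxt)
    where
    nxt : next (inj₂ (l , seek)) c ≡ inj₂ (inj₂ (l , seek) , c , right)
    nxt rewrite eqi | LP.∷-injectiveˡ eqR′ = refl

  unmarked-right : ∀ L x T → Marks (L ʳ++ (x ∷ T)) → All (λ y → marked y ≡ false) T
  unmarked-right []      x T (_ , ms) = ms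
  unmarked-right (z ∷ L) x T m with unmarked-right L z (x ∷ T) m
  ... | _ ∷ ms = ms

  returning : ∀ {l i o nx} → chart l ≡ act i o nx → ∀ b L c R → Marks (L ʳ++ (c ∷ R)) →
              Σ TSym λ c₀ → Σ (List TSym) λ R₀ → (c₀ ∷ R₀ ≡ L ʳ++ (c ∷ R)) ×
              Reach (suc (length L)) (conf (inj₂ (l , back b)) L c R) (conf (inj₂ (nx b , seek)) [] c₀ R₀)
  returning {l} {nx = nx} eqi b [] c R (m , _) = c , R , refl , reach-write (inj₂ (l , back b)) [] c R nxt
    where
    nxt : next (inj₂ (l , back b)) c ≡ inj₂ (inj₂ (nx b , seek) , c , stay)
    nxt rewrite eqi | m = refl
  returning {l} eqi b (x ∷ L) c R m with returning eqi b L x (c ∷ R) m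
  ... | c₀ , R₀ , eq , rch = c₀ , R₀ , eq , reach-trans {t = 1} (reach-write (inj₂ (l , back b)) (x ∷ L) c R nxt) rch
    where
    nxt : next (inj₂ (l , back b)) c ≡ inj₂ (inj₂ (l , back b) , c , left)
    nxt with unmarked-right L x (c ∷ R) m
    ... | m′ ∷ _ rewrite eqi | m′ = refl

  marks-replace : ∀ L c c′ R → marked c′ ≡ marked c → Marks (L ʳ++ (c ∷ R)) → Marks (L ʳ++ (c′ ∷ R))
  marks-replace [] c c′ R e (m , ms) = trans e m , ms
  marks-replace (x ∷ L) c c′ R e m = go L x (c ∷ R) (c′ ∷ R) f m
    where
    f : All (λ y → marked y ≡ false) (c ∷ R) → All (λ y → marked y ≡ false) (c′ ∷ R)
    f (p ∷ ps) = trans e p ∷ ps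
    go : ∀ L x T T′ → (All (λ y → marked y ≡ false) T → All (λ y → marked y ≡ false) T′) →
         Marks (L ʳ++ (x ∷ T)) → Marks (L ʳ++ (x ∷ T′))
    go [] x T T′ f (m , ms) = m , f ms
    go (z ∷ L) x T T′ f m = go L z (x ∷ T) (x ∷ T′) (λ { (p ∷ ps) → p ∷ f ps }) m

  column-replace : ∀ {σ} L c c′ R j → track j c′ ≡ track j c → Column (L ʳ++ (c ∷ R)) σ j → Column (L ʳ++ (c′ ∷ R)) σ j
  column-replace L c c′ R j e (k , eq) = k , trans
    (trans (LP.map-ʳ++ (track j) L) (trans (cong (λ z → map (track j) L ʳ++ (z ∷ map (track j) R)) e) (sym (LP.map-ʳ++ (track j) L)))) eq

  good-replace : ∀ {σ i f} L c c′ R → marked c′ ≡ marked c → (∀ j → j ≢ i → track j c′ ≡ track j c) →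
                 Column (L ʳ++ (c′ ∷ R)) (updateAt σ i f) i → Good (L ʳ++ (c ∷ R)) σ → Good (L ʳ++ (c′ ∷ R)) (updateAt σ i f)
  good-replace {σ} {i} {f} L c c′ R me te ci (good m cs) = good (marks-replace L c c′ R me m) col
    where
    col : ∀ j → Column (L ʳ++ (c′ ∷ R)) (updateAt σ i f) j
    col j with j FP.≟ i
    ... | yes refl = ci
    ... | no j≢i with column-replace {σ = σ} L c c′ R j (te j j≢i) (cs j)
    ... | k , eq = k , trans eq (cong (λ l → map just (reverse l) ++ replicate k nothing) (sym (VP.lookup∘updateAt′ j i j≢i σ)))

  column-intro : ∀ L T st k {τ i} → lookup τ i ≡ st → map (track i) L ≡ map just st →
                 map (track i) T ≡ replicate k nothing → Column (L ʳ++ T) τ i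
  column-intro L T st k {τ} {i} e eqL eqT = k , (begin
    map (track i) (L ʳ++ T)                        ≡⟨ LP.map-ʳ++ (track i) L ⟩
    map (track i) L ʳ++ map (track i) T            ≡⟨ cong₂ _ʳ++_ eqL eqT ⟩
    map just st ʳ++ replicate k nothing            ≡⟨ LP.ʳ++-defn (map just st) ⟩
    reverse (map just st) ++ replicate k nothing   ≡⟨ cong (_++ _) (sym (LP.reverse-map just st)) ⟩
    map just (reverse st) ++ replicate k nothing   ≡⟨ cong (λ l → map just (reverse l) ++ replicate k nothing) (sym e) ⟩
    map just (reverse (lookup τ i)) ++ replicate k nothing ∎)
    where open ≡-Reasoning

  record Home (l : L) (σ : Stacks) (c : Config machine) : Set where
    constructor home
    field
      {cur}  : TSym
      {rgt}  : List TSym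
      isConf : c ≡ conf (inj₂ (l , seek)) [] cur rgt
      isGood : Good (cur ∷ rgt) σ

  record Arrive (l : L) (σ : Stacks) (n : ℕ) (c : Config machine) : Set where
    constructor arrive
    field
      {dest} : Config machine
      isHome : Home l σ dest
      {time} : ℕ
      time≤  : time ≤ n
      reach  : Reach time c dest

  effect : Fin 4 → Op → Stacks → Stacks
  effect i (push s) σ = updateAt σ i (s ∷_)
  effect i pop      σ = updateAt σ i (drop 1)
  effect i (test _) σ = σ

  outcome : Fin 4 → Op → Stacks → Bool
  outcome i (test p) σ = p (top i σ)
  outcome i _        σ = true

  record Acted (l : L) (i : Fin 4) (o : Op) (σ : Stacks) (t n : ℕ) (c₀ : Config machine) : Set where
    constructor acted
    field
      {lft}  : List TSym
      {cur}  : TSym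
      {rgt}  : List TSym
      isGood : Good (lft ʳ++ (cur ∷ rgt)) (effect i o σ)
      len≤   : length lft ≤ n
      reach  : Reach t c₀ (conf (inj₂ (l , back (outcome i o σ))) lft cur rgt)

  lft-length : ∀ {i} (L : List TSym) (st : List Sym) → map (track i) L ≡ map just st → length L ≡ length st
  lft-length {i} L st eq = trans (sym (LP.length-map (track i) L)) (trans (cong length eq) (LP.length-map just st))

  -- A push takes one step at the blank; `pop` and `test` take a second one, for `touch`.
  acting : ∀ {l i o nx} → chart l ≡ act i o nx → ∀ {σ t c₀} st → lookup σ i ≡ st → Seeked l i σ st t c₀ →
           Acted l i o σ (t + 2) (length st) c₀ ⊎ Acted l i o σ (t + 1) (length st) c₀
  acting {l} {i} {push s} {nx} eqi {σ} st est (seeked L c R k g eqL eqR rch) =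
    inj₂ (acted (good-replace L c (setTrack i (just s) c) R (marked-setTrack i (just s) c)
                  (λ j → track-setTrack-≢ i j (just s) c) col g)
                (ℕP.≤-reflexive (lft-length L st eqL))
                (reach-trans rch (reach-write (inj₂ (l , seek)) L c R nxt)))
    where
    blank : track i c ≡ nothing
    blank = LP.∷-injectiveˡ eqR
    nxt : next (inj₂ (l , seek)) c ≡ inj₂ (inj₂ (l , back true) , setTrack i (just s) c , stay)
    nxt rewrite eqi | blank = refl
    col : Column (L ʳ++ (setTrack i (just s) c ∷ R)) (updateAt σ i (s ∷_)) i
    col = column-intro (setTrack i (just s) c ∷ L) R (s ∷ st) k {updateAt σ i (s ∷_)}
            (trans (VP.lookup∘updateAt i σ) (cong (s ∷_) est))
            (cong₂ _∷_ (track-setTrack i (just s) c) eqL) (LP.∷-injectiveʳ eqR)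
  acting {l} {i} {pop} eqi {σ} [] est (seeked [] c R k g eqL eqR rch) =
    inj₁ (acted (good-replace [] c (setTrack i nothing c) R (marked-setTrack i nothing c)
                  (λ j → track-setTrack-≢ i j nothing c) col g) z≤n
      (reach-trans rch (reach-trans {t = 1} (reach-write (inj₂ (l , seek)) [] c R nxt)
         (reach-write (inj₂ (l , touch)) [] c R nxt′))))
    where
    nxt : next (inj₂ (l , seek)) c ≡ inj₂ (inj₂ (l , touch) , c , left)
    nxt rewrite eqi | LP.∷-injectiveˡ eqR = refl
    nxt′ : next (inj₂ (l , touch)) c ≡ inj₂ (inj₂ (l , back true) , setTrack i nothing c , stay)
    nxt′ rewrite eqi = refl
    col : Column (setTrack i nothing c ∷ R) (updateAt σ i (drop 1)) i
    col = column-intro [] (setTrack i nothing c ∷ R) [] (suc k) {updateAt σ i (drop 1)}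
            (trans (VP.lookup∘updateAt i σ) (cong (drop 1) est)) refl
            (cong₂ _∷_ (track-setTrack i nothing c) (LP.∷-injectiveʳ eqR))
  acting {l} {i} {pop} eqi {σ} (s ∷ st) est (seeked (x ∷ L) c R k g eqL eqR rch) =
    inj₁ (acted (good-replace L x (setTrack i nothing x) (c ∷ R) (marked-setTrack i nothing x)
                  (λ j → track-setTrack-≢ i j nothing x) col g)
      (ℕP.≤-trans (ℕP.≤-reflexive (lft-length L st (LP.∷-injectiveʳ eqL))) (ℕP.n≤1+n _))
      (reach-trans rch (reach-trans {t = 1} (reach-write (inj₂ (l , seek)) (x ∷ L) c R nxt)
         (reach-write (inj₂ (l , touch)) L x (c ∷ R) nxt′))))
    where
    nxt : next (inj₂ (l , seek)) c ≡ inj₂ (inj₂ (l , touch) , c , left)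
    nxt rewrite eqi | LP.∷-injectiveˡ eqR = refl
    nxt′ : next (inj₂ (l , touch)) x ≡ inj₂ (inj₂ (l , back true) , setTrack i nothing x , stay)
    nxt′ rewrite eqi = refl
    col : Column (L ʳ++ (setTrack i nothing x ∷ c ∷ R)) (updateAt σ i (drop 1)) i
    col = column-intro L (setTrack i nothing x ∷ c ∷ R) st (suc (suc k)) {updateAt σ i (drop 1)}
            (trans (VP.lookup∘updateAt i σ) (cong (drop 1) est)) (LP.∷-injectiveʳ eqL)
            (cong₂ _∷_ (track-setTrack i nothing x) eqR)
  acting {l} {i} {test p} eqi {σ} [] est (seeked [] c R k g eqL eqR rch) =
    inj₁ (acted g z≤n
      (reach-trans rch (reach-trans {t = 1} (reach-write (inj₂ (l , seek)) [] c R nxt)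
         (reach-write (inj₂ (l , touch)) [] c R nxt′))))
    where
    nxt : next (inj₂ (l , seek)) c ≡ inj₂ (inj₂ (l , touch) , c , left)
    nxt rewrite eqi | LP.∷-injectiveˡ eqR = refl
    nxt′ : next (inj₂ (l , touch)) c ≡ inj₂ (inj₂ (l , back (p (top i σ))) , c , stay)
    nxt′ rewrite eqi | LP.∷-injectiveˡ eqR | est = refl
  acting {l} {i} {test p} eqi {σ} (s ∷ st) est (seeked (x ∷ L) c R k g eqL eqR rch) =
    inj₁ (acted g (ℕP.≤-trans (ℕP.≤-reflexive (lft-length L st (LP.∷-injectiveʳ eqL))) (ℕP.n≤1+n _))
      (reach-trans rch (reach-trans {t = 1} (reach-write (inj₂ (l , seek)) (x ∷ L) c R nxt)
         (reach-write (inj₂ (l , touch)) L x (c ∷ R) nxt′))))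
    where
    nxt : next (inj₂ (l , seek)) c ≡ inj₂ (inj₂ (l , touch) , c , left)
    nxt rewrite eqi | LP.∷-injectiveˡ eqR = refl
    nxt′ : next (inj₂ (l , touch)) x ≡ inj₂ (inj₂ (l , back (p (top i σ))) , x , stay)
    nxt′ rewrite eqi | LP.∷-injectiveˡ eqL | est = refl

  -- The head travels at most `h` cells out, acts for at most 2 steps, and needs `h + 1` steps to
  -- come home, the last of which enters the next instruction.
  instruction : ∀ {l i o nx h σ c} → chart l ≡ act i o nx → Height≤ h σ → Home l σ c →
                Arrive (nx (outcome i o σ)) (effect i o σ) (h + (h + 3)) c
  instruction {l} {i} {o} {nx} {h} {σ} eqi (height H) (home {c} {R} refl g) with columns g i
  ... | k , eq = [ finish 2 (s≤s (s≤s z≤n)) , finish 1 (s≤s z≤n) ]′ (acting eqi st refl sk)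
    where
    st = lookup σ i
    sk : Seeked l i σ st (length st) (conf (inj₂ (l , seek)) [] c R)
    sk = subst₂ (λ a n → Seeked l i σ a n (conf (inj₂ (l , seek)) [] c R)) (LP.reverse-involutive st) (LP.length-reverse st)
           (seeking eqi (reverse st) [] [] c R k g refl eq)
    finish : ∀ t → t ≤ 2 → Acted l i o σ (length st + t) (length st) (conf (inj₂ (l , seek)) [] c R) →
             Arrive (nx (outcome i o σ)) (effect i o σ) (h + (h + 3)) (conf (inj₂ (l , seek)) [] c R)
    finish t t≤ (acted {L′} {c′} {R′} g′ len rch) with returning eqi (outcome i o σ) L′ c′ R′ (marks g′)
    ... | c₀ , R₀ , eq₀ , rch′ = arrive (home refl (subst (λ T → Good T _) (sym eq₀) g′)) tb (reach-trans rch rch′)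
      where
      open ℕP.≤-Reasoning
      tb : length st + t + suc (length L′) ≤ h + (h + 3)
      tb = begin
        length st + t + suc (length L′)   ≤⟨ ℕP.+-mono-≤ (ℕP.+-mono-≤ (H i) t≤) (s≤s (ℕP.≤-trans len (H i))) ⟩
        h + 2 + suc h                     ≡⟨ ℕP.+-assoc h 2 (suc h) ⟩
        h + (2 + suc h)                   ≡⟨ cong (h +_) (ℕP.+-comm 3 h) ⟩
        h + (h + 3) ∎

  arrive-trans : ∀ {l l′ σ σ′ m n} {c : Config machine} → Arrive l σ m c → (∀ {c′} → Home l σ c′ → Arrive l′ σ′ n c′) → Arrive l′ σ′ (m + n) c
  arrive-trans (arrive h t≤ r) f with f h
  ... | arrive h′ t≤′ r′ = arrive h′ (ℕP.+-mono-≤ t≤ t≤′) (reach-trans r r′)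

  arrive-mono : ∀ {l σ m n c} → m ≤ n → Arrive l σ m c → Arrive l σ n c
  arrive-mono m≤n (arrive h t≤ r) = arrive h (ℕP.≤-trans t≤ m≤n) r

  Embedded : ∀ P → (Lab P → L) → L → Set
  Embedded P e x = ∀ l → chart (e l) ≡ instr P e x l

  -- Heights grow by at most the cost, so `H` bounds every stack throughout the run. Hence each unit
  -- of cost is worth at most `H + (H + 3)` machine steps.
  simulate : ∀ {P σ τ n h} H {e x c} → Exec P σ τ n → Embedded P e x → Height≤ h σ → h + n ≤ H →
             Home (e (entry P)) σ c → Arrive x τ (n * (H + (H + 3))) c
  simulate {n = n} H (skip {σ}) em hσ le hm = arrive-mono
    (ℕP.≤-reflexive (sym (ℕP.+-identityʳ _))) (instruction (em tt) (height-mono (ℕP.≤-trans (ℕP.m≤m+n _ n) le) hσ) hm)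
  simulate {n = n} H (push {i} {s} {σ}) em hσ le hm = arrive-mono
    (ℕP.≤-reflexive (sym (ℕP.+-identityʳ _))) (instruction (em tt) (height-mono (ℕP.≤-trans (ℕP.m≤m+n _ n) le) hσ) hm)
  simulate {n = n} H (pop {i} {σ}) em hσ le hm = arrive-mono
    (ℕP.≤-reflexive (sym (ℕP.+-identityʳ _))) (instruction (em tt) (height-mono (ℕP.≤-trans (ℕP.m≤m+n _ n) le) hσ) hm)
  simulate {h = h} H (_⨾_ {m = m} {n} p q) em hσ le hm =
    arrive-mono (ℕP.≤-reflexive (sym (ℕP.*-distribʳ-+ (H + (H + 3)) m n)))
      (arrive-trans (simulate H p (λ l → em (inj₁ l)) hσ (ℕP.≤-trans (ℕP.+-monoʳ-≤ h (ℕP.m≤m+n m n)) le) hm)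
        (simulate H q (λ l → em (inj₂ l)) (height-exec p hσ) (ℕP.≤-trans (ℕP.≤-reflexive (ℕP.+-assoc h m n)) le)))
  simulate {h = h} H {e} {x} (then {i} {p} {P} {Q} {σ} {τ} {n} b pe) em hσ le hm =
    arrive-trans
      (subst (λ v → Arrive (branch (e (inj₂ (inj₁ (entry P)))) (e (inj₂ (inj₂ (entry Q)))) v) σ _ _) b
        (instruction (em (inj₁ tt)) (height-mono (ℕP.≤-trans (ℕP.m≤m+n _ _) le) hσ) hm))
      (simulate H pe (λ l → em (inj₂ (inj₁ l))) hσ (ℕP.≤-trans (ℕP.+-monoʳ-≤ h (ℕP.n≤1+n n)) le))
  simulate {h = h} H {e} {x} (else {i} {p} {P} {Q} {σ} {τ} {n} b pe) em hσ le hm =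
    arrive-trans
      (subst (λ v → Arrive (branch (e (inj₂ (inj₁ (entry P)))) (e (inj₂ (inj₂ (entry Q)))) v) σ _ _) b
        (instruction (em (inj₁ tt)) (height-mono (ℕP.≤-trans (ℕP.m≤m+n _ _) le) hσ) hm))
      (simulate H pe (λ l → em (inj₂ (inj₂ l))) hσ (ℕP.≤-trans (ℕP.+-monoʳ-≤ h (ℕP.n≤1+n n)) le))
  simulate {n = n} H {e} {x} (done {i} {p} {P} {σ} b) em hσ le hm = arrive-mono
    (ℕP.≤-reflexive (sym (ℕP.+-identityʳ _)))
      (subst (λ v → Arrive (branch (e (inj₂ (entry P))) x v) σ _ _) b
        (instruction (em (inj₁ tt)) (height-mono (ℕP.≤-trans (ℕP.m≤m+n _ n) le) hσ) hm))
  simulate {h = h} H {e} {x} (again {i} {p} {P} {σ} {τ} {ρ} {m} {n} b pe qe) em hσ le hm =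
    arrive-mono (ℕP.≤-reflexive (cong ((H + (H + 3)) +_) (sym (ℕP.*-distribʳ-+ (H + (H + 3)) m n))))
    (arrive-trans
      (subst (λ v → Arrive (branch (e (inj₂ (entry P))) x v) σ _ _) b
        (instruction (em (inj₁ tt)) (height-mono (ℕP.≤-trans (ℕP.m≤m+n _ _) le) hσ) hm))
      (λ hm′ → arrive-trans
        (simulate H pe (λ l → em (inj₂ l)) hσ (ℕP.≤-trans (ℕP.+-monoʳ-≤ h (ℕP.≤-trans (ℕP.m≤m+n m n) (ℕP.n≤1+n _))) le) hm′)
        (simulate H qe em (height-exec pe hσ)
          (ℕP.≤-trans (ℕP.≤-reflexive (ℕP.+-assoc h m n)) (ℕP.≤-trans (ℕP.+-monoʳ-≤ h (ℕP.n≤1+n _)) le)))))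
  simulate {h = h} H (relax m≤n pe) em hσ le hm =
    arrive-mono (ℕP.*-monoˡ-≤ (H + (H + 3)) m≤n) (simulate H pe em hσ (ℕP.≤-trans (ℕP.+-monoʳ-≤ h m≤n) le) hm)

  startStacks : List Sym → Stacks
  startStacks w = reverse w ∷ [] ∷ [] ∷ [] ∷ []

  input : List Sym → List TSym
  input = map (λ s → just (inj₁ s))

  private
    blanks : ∀ w i → map (track (suc i)) (input w) ≡ replicate (length w) nothing
    blanks [] i = refl
    blanks (s ∷ w) zero = cong (nothing ∷_) (blanks w zero)
    blanks (s ∷ w) (suc zero) = cong (nothing ∷_) (blanks w (suc zero))
    blanks (s ∷ w) (suc (suc zero)) = cong (nothing ∷_) (blanks w (suc (suc zero)))

    inputs : ∀ w → map (track zero) (input w) ≡ map just w ++ []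
    inputs [] = refl
    inputs (s ∷ w) = cong (just s ∷_) (inputs w)

    unmarked : ∀ w → All (λ c → marked c ≡ false) (input w)
    unmarked [] = []
    unmarked (s ∷ w) = refl ∷ unmarked w

    goodInput : ∀ s w → Good (setMark (just (inj₁ s)) ∷ input w) (startStacks (s ∷ w))
    goodInput s w = good (marked-setMark (just (inj₁ s)) , unmarked w) col
      where
      col : ∀ i → Column (setMark (just (inj₁ s)) ∷ input w) (startStacks (s ∷ w)) i
      col zero rewrite LP.reverse-involutive (s ∷ w) = 0 , cong₂ _∷_ (track-setMark zero (just (inj₁ s))) (inputs w)
      col (suc zero) = suc (length w) , cong₂ _∷_ (track-setMark (suc zero) (just (inj₁ s))) (blanks w zero)
      col (suc (suc zero)) = suc (length w) , cong₂ _∷_ (track-setMark (suc (suc zero)) (just (inj₁ s))) (blanks w (suc zero))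
      col (suc (suc (suc zero))) = suc (length w) , cong₂ _∷_ (track-setMark (suc (suc (suc zero))) (just (inj₁ s))) (blanks w (suc (suc zero)))

    goodBlank : Good (setMark nothing ∷ []) (startStacks [])
    goodBlank = good (marked-setMark nothing , []) col
      where
      col : ∀ i → Column (setMark nothing ∷ []) (startStacks []) i
      col zero = 1 , cong (_∷ []) (track-setMark zero nothing)
      col (suc zero) = 1 , cong (_∷ []) (track-setMark (suc zero) nothing)
      col (suc (suc zero)) = 1 , cong (_∷ []) (track-setMark (suc (suc zero)) nothing)
      col (suc (suc (suc zero))) = 1 , cong (_∷ []) (track-setMark (suc (suc (suc zero))) nothing)

  starting : ∀ w → Arrive l₀ (startStacks w) 1 (initial machine w)
  starting [] = arrive (home refl goodBlank) ℕP.≤-refl (reach-write (inj₁ tt) [] nothing [] refl)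
  starting (s ∷ w) = arrive (home refl (goodInput s w)) ℕP.≤-refl (reach-write (inj₁ tt) [] (just (inj₁ s)) (input w) refl)

-- Turing machines from programs that leave a Boolean answer on a stack.

module Compile (P : Prog) (i : Fin 4) (p : Maybe Sym → Bool) where

  Label : Set
  Label = Lab P ⊎ (⊤ ⊎ Bool)

  chart : Label → Instr Label
  chart (inj₁ l)        = instr P inj₁ (inj₂ (inj₁ tt)) l
  chart (inj₂ (inj₁ _)) = act i (test p) (λ b → inj₂ (inj₂ b))
  chart (inj₂ (inj₂ b)) = halt b

  open Machine (finite-⊎ (finite-Lab P) (finite-⊎ finite-⊤ finite-Bool)) chart (inj₁ (entry P)) public

  run-mono : ∀ {m n c b} → m ≤ n → run machine m c ≡ just b → run machine n c ≡ just b
  run-mono {suc m} {suc n} {c} (s≤s m≤n) eq with step machine c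
  ... | inj₁ _ = eq
  ... | inj₂ c′ = run-mono {m} {n} {c′} m≤n eq

  compile-time : ℕ → ℕ → ℕ
  compile-time h n = suc (n * (h + n + (h + n + 3)) + (h + n + (h + n + 3))) + 1

  compiled : ∀ w {τ n} → Exec P (startStacks w) τ n →
             HaltsWithin machine w (compile-time (length w) n) (p (top i τ))
  compiled w {τ} {n} ex = finish whole
    where
    h = length w
    hw : Height≤ h (startStacks w)
    hw = height λ { zero → ℕP.≤-reflexive (LP.length-reverse w)
                  ; (suc zero) → z≤n ; (suc (suc zero)) → z≤n ; (suc (suc (suc zero))) → z≤n }
    whole : Arrive (inj₂ (inj₂ (p (top i τ)))) τ (1 + (n * (h + n + (h + n + 3)) + (h + n + (h + n + 3)))) (initial machine w)
    whole = arrive-trans (starting w) (λ hm → arrive-trans (simulate (h + n) ex (λ _ → refl) hw ℕP.≤-refl hm)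
              (instruction refl (height-exec ex hw)))
    finish : ∀ {b m} → Arrive (inj₂ (inj₂ b)) τ m (initial machine w) → HaltsWithin machine w (m + 1) b
    finish {b} {m} (arrive {d} (home {c} {R} refl _) {t} t≤ r) =
      run-mono (ℕP.+-monoˡ-≤ 1 t≤)
        (trans (Reach.runs r 1) (run-halt (conf (inj₂ (inj₂ (inj₂ b) , seek)) [] c R) 0 (step-halt (inj₂ (inj₂ (inj₂ b) , seek)) [] c R refl)))

-- Binary trees serialised on stacks.

-- The one data type of the programs. Its prefix code is self-delimiting, so values can be piled up
-- without separators.
data Tree : Set where
  leaf : Tree
  node : Tree → Tree → Tree

weight : Tree → ℕ
weight leaf       = 1
weight (node a b) = suc (weight a + weight b)

-- Prefix notation: false is a leaf, true a node.
bits : Tree → List Bool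
bits leaf       = false ∷ []
bits (node a b) = true ∷ bits a ++ bits b

sym? : Bool → Sym
sym? false = one
sym? true  = two

serialize : Tree → List Sym
serialize t = map sym? (bits t)

serialize-node : ∀ a b v → serialize (node a b) ++ v ≡ two ∷ serialize a ++ serialize b ++ v
serialize-node a b v = cong (two ∷_)
  (trans (cong (_++ v) (LP.map-++ sym? (bits a) (bits b))) (LP.++-assoc (serialize a) (serialize b) v))

length-bits : ∀ t → length (bits t) ≡ weight t
length-bits leaf       = refl
length-bits (node a b) = cong suc (trans (LP.length-++ (bits a)) (cong₂ _+_ (length-bits a) (length-bits b)))

length-serialize : ∀ t → length (serialize t) ≡ weight t
length-serialize t = trans (LP.length-map sym? (bits t)) (length-bits t)

-- Stack 0 is scratch space (and holds the input at the start), stack 1 holds values,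
-- stack 2 counts the subtrees still to be read, stack 3 is a dump.
pattern scratch = zero
pattern values  = suc zero
pattern counter = suc (suc zero)
pattern dump    = suc (suc (suc zero))

isTwo : Maybe Sym → Bool
isTwo (just two) = true
isTwo _          = false

nonEmpty : Maybe Sym → Bool
nonEmpty (just _) = true
nonEmpty nothing  = false

data Source : Set where
  fromValues fromDump : Source

source : Source → Fin 4
source fromValues = values
source fromDump   = dump

stacks : Source → (a x c y : List Sym) → Stacks
stacks fromValues a x c y = a ∷ x ∷ c ∷ y ∷ []
stacks fromDump   a x c y = a ∷ y ∷ c ∷ x ∷ []

keepIf : Bool → Sym → Prog
keepIf true  s = push scratch s
keepIf false s = skip

walkBody : Source → Bool → Prog
walkBody i k = pop counter ⨾ cond (source i) isTwo
  (pop (source i) ⨾ keepIf k two ⨾ push counter one ⨾ push counter one)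
  (pop (source i) ⨾ keepIf k one)

-- Removes one tree from a stack; if k, leaves it reversed on the scratch stack.
walk : Source → Bool → Prog
walk i k = push counter one ⨾ while counter nonEmpty (walkBody i k)

-- The switch lets discarding a tree and copying it share one correctness proof.
kept : Bool → List Bool → List Sym → List Sym
kept true  bs a = map sym? bs ʳ++ a
kept false bs a = a

exec-≡ : ∀ {P σ σ′ τ τ′ n n′} → σ ≡ σ′ → τ ≡ τ′ → n ≡ n′ → Exec P σ τ n → Exec P σ′ τ′ n′
exec-≡ refl refl refl p = p

exec-keepIf : ∀ i k b {a x c y} → Exec (keepIf k (sym? b)) (stacks i a x c y) (stacks i (kept k (b ∷ []) a) x c y) 1
exec-keepIf fromValues true  b = push
exec-keepIf fromDump   true  b = push
exec-keepIf fromValues false b = skip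
exec-keepIf fromDump   false b = skip

exec-walkBody-leaf : ∀ i k {a x c y} →
  Exec (walkBody i k) (stacks i a (one ∷ x) (one ∷ c) y) (stacks i (kept k (false ∷ []) a) x c y) 4
exec-walkBody-leaf fromValues k = pop ⨾ else refl (pop ⨾ exec-keepIf fromValues k false)
exec-walkBody-leaf fromDump   k = pop ⨾ else refl (pop ⨾ exec-keepIf fromDump k false)

exec-walkBody-node : ∀ i k {a x c y} →
  Exec (walkBody i k) (stacks i a (two ∷ x) (one ∷ c) y) (stacks i (kept k (true ∷ []) a) x (one ∷ one ∷ c) y) 6
exec-walkBody-node fromValues k = pop ⨾ then refl (pop ⨾ exec-keepIf fromValues k true ⨾ push ⨾ push)
exec-walkBody-node fromDump   k = pop ⨾ then refl (pop ⨾ exec-keepIf fromDump k true ⨾ push ⨾ push)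

kept-++ : ∀ k bs cs a → kept k (bs ++ cs) a ≡ kept k cs (kept k bs a)
kept-++ false bs cs a = refl
kept-++ true  bs cs a = trans (cong (_ʳ++ a) (LP.map-++ sym? bs cs)) (LP.++-ʳ++ (map sym? bs))

nonEmpty-counter : ∀ i {a x s c y} → nonEmpty (top counter (stacks i a x (s ∷ c) y)) ≡ true
nonEmpty-counter fromValues = refl
nonEmpty-counter fromDump   = refl

-- The rest of the loop is passed as the derivation `r`, so that a node chains the loops of its two
-- subtrees without splitting a `while`. The factor 7 is the node body of cost 6 and the loop test.
walk-loop : ∀ i k t {a x c y ρ n} →
  Exec (while counter nonEmpty (walkBody i k)) (stacks i (kept k (bits t) a) x c y) ρ n →
  Exec (while counter nonEmpty (walkBody i k)) (stacks i a (serialize t ++ x) (one ∷ c) y) ρ (7 * weight t + n)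
walk-loop i k leaf r =
  -- A leaf costs 5, rounded up to the 7 of a node.
  relax (ℕP.+-monoˡ-≤ _ (s≤s (s≤s (s≤s (s≤s (s≤s z≤n)))))) (again (nonEmpty-counter i) (exec-walkBody-leaf i k) r)
walk-loop i k (node t u) {a} {x} {c} {y} {ρ} {n} r =
  exec-≡ (cong (λ v → stacks i a v (one ∷ c) y) (sym (serialize-node t u x))) refl time
    (again (nonEmpty-counter i) (exec-walkBody-node i k)
      (walk-loop i k t (walk-loop i k u (exec-≡ (cong (λ v → stacks i v x c y)
        (trans (kept-++ k (true ∷ bits t) (bits u) a) (cong (kept k (bits u)) (kept-++ k (true ∷ []) (bits t) a)))) refl refl r))))
  where
  time : suc (6 + (7 * weight t + (7 * weight u + n))) ≡ 7 * weight (node t u) + n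
  time = begin
    7 + (7 * weight t + (7 * weight u + n))  ≡⟨ cong (7 +_) (sym (ℕP.+-assoc (7 * weight t) _ n)) ⟩
    7 + (7 * weight t + 7 * weight u + n)    ≡⟨ cong (λ z → 7 + (z + n)) (sym (ℕP.*-distribˡ-+ 7 (weight t) (weight u))) ⟩
    7 + (7 * (weight t + weight u) + n)      ≡⟨ sym (ℕP.+-assoc 7 _ n) ⟩
    7 + 7 * (weight t + weight u) + n        ≡⟨ cong (_+ n) (sym (ℕP.*-suc 7 (weight t + weight u))) ⟩
    7 * weight (node t u) + n ∎
    where open ≡-Reasoning

exec-walk : ∀ i k t {a x y} →
  Exec (walk i k) (stacks i a (serialize t ++ x) [] y) (stacks i (kept k (bits t) a) x [] y) (7 * weight t + 2)
exec-walk i k t {a} {x} {y} = exec-≡ refl refl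
  (trans (ℕP.+-comm 1 _) (ℕP.+-assoc (7 * weight t) 1 1)) (start i ⨾ walk-loop i k t (stop i))
  where
  start : ∀ i {a x} → Exec (push counter one) (stacks i a x [] y) (stacks i a x (one ∷ []) y) 1
  start fromValues = push
  start fromDump   = push
  stop : ∀ i {a x} → Exec (while counter nonEmpty (walkBody i k)) (stacks i a x [] y) (stacks i a x [] y) 1
  stop fromValues = done refl
  stop fromDump   = done refl

pushIf : Bool → Fin 4 → Sym → Prog
pushIf true  i s = push i s
pushIf false i s = skip

-- Undoes the reversal left by `walk`; with both switches on it duplicates the tree.
pour : Bool → Bool → Prog
pour p q = while scratch nonEmpty (cond scratch isTwo
  (pop scratch ⨾ pushIf p values two ⨾ pushIf q dump two)
  (pop scratch ⨾ pushIf p values one ⨾ pushIf q dump one))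

exec-pushIf₁ : ∀ p b {a v c d} →
  Exec (pushIf p values (sym? b)) (a ∷ v ∷ c ∷ d ∷ []) (a ∷ kept p (b ∷ []) v ∷ c ∷ d ∷ []) 1
exec-pushIf₁ true  b = push
exec-pushIf₁ false b = skip

exec-pushIf₃ : ∀ p b {a v c d} →
  Exec (pushIf p dump (sym? b)) (a ∷ v ∷ c ∷ d ∷ []) (a ∷ v ∷ c ∷ kept p (b ∷ []) d ∷ []) 1
exec-pushIf₃ true  b = push
exec-pushIf₃ false b = skip

exec-pour : ∀ p q bs {v c d} →
  Exec (pour p q) (map sym? bs ∷ v ∷ c ∷ d ∷ []) ([] ∷ kept p bs v ∷ c ∷ kept q bs d ∷ []) (5 * length bs + 1)
exec-pour p q [] {v} {c} {d} =
  exec-≡ refl (cong₂ (λ a b → [] ∷ a ∷ c ∷ b ∷ []) (nil p v) (nil q d)) refl (done refl)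
  where
  nil : ∀ p v → v ≡ kept p [] v
  nil true  v = refl
  nil false v = refl
exec-pour p q (b ∷ bs) {v} {c} {d} =
  exec-≡ refl (cong₂ (λ a b → [] ∷ a ∷ c ∷ b ∷ []) (sym (kept-++ p (b ∷ []) bs v)) (sym (kept-++ q (b ∷ []) bs d)))
    time (again refl (body b) (exec-pour p q bs))
  where
  body : ∀ b {a} → Exec _ ((sym? b ∷ a) ∷ v ∷ c ∷ d ∷ []) (a ∷ kept p (b ∷ []) v ∷ c ∷ kept q (b ∷ []) d ∷ []) 4
  body true  = then refl (pop ⨾ exec-pushIf₁ p true ⨾ exec-pushIf₃ q true)
  body false = else refl (pop ⨾ exec-pushIf₁ p false ⨾ exec-pushIf₃ q false)
  time : suc (4 + (5 * length bs + 1)) ≡ 5 * suc (length bs) + 1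
  time = trans (sym (ℕP.+-assoc 5 (5 * length bs) 1)) (cong (_+ 1) (sym (ℕP.*-suc 5 (length bs))))

-- Polynomial bounds

opaque
  -- With base `2 + n` every constant, sum, product and composite of such powers lies below another
  -- one, even at `n = 0`. So a polynomial bound is a single exponent, without coefficients.
  pw : ℕ → ℕ → ℕ
  pw k n = (2 + n) ^ k

  pw-def : ∀ k n → pw k n ≡ (2 + n) ^ k
  pw-def k n = refl

  pw-monoʳ : ∀ k {m n} → m ≤ n → pw k m ≤ pw k n
  pw-monoʳ k m≤n = ℕP.^-monoˡ-≤ k (s≤s (s≤s m≤n))

  pw-monoˡ : ∀ n {j k} → j ≤ k → pw j n ≤ pw k n
  pw-monoˡ n j≤k = ℕP.^-monoʳ-≤ (2 + n) j≤k

  pw-size : ∀ n → n ≤ pw 1 n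
  pw-size n = ℕP.≤-trans (ℕP.m≤n+m n 2) (ℕP.≤-reflexive (sym (ℕP.^-identityʳ (2 + n))))

  pw-const : ∀ c n → c ≤ pw c n
  pw-const c n = ℕP.≤-trans (c≤2^c c) (ℕP.^-monoˡ-≤ c (s≤s (s≤s z≤n)))
    where
    c≤2^c : ∀ c → c ≤ 2 ^ c
    c≤2^c zero = z≤n
    c≤2^c (suc c) = ℕP.≤-trans (ℕP.+-mono-≤ (ℕP.m^n>0 2 c) (c≤2^c c)) (ℕP.≤-reflexive (cong ((2 ^ c) +_) (sym (ℕP.+-identityʳ (2 ^ c)))))

  pw-* : ∀ j k n → pw j n * pw k n ≡ pw (j + k) n
  pw-* j k n = sym (ℕP.^-distribˡ-+-* (2 + n) j k)

  pw-+ : ∀ j k n → pw j n + pw k n ≤ pw (suc (j + k)) n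
  pw-+ j k n = begin
    pw j n + pw k n             ≤⟨ ℕP.+-mono-≤ (pw-monoˡ n (ℕP.m≤m+n j k)) (pw-monoˡ n (ℕP.m≤n+m k j)) ⟩
    pw (j + k) n + pw (j + k) n ≡⟨ cong (pw (j + k) n +_) (sym (ℕP.+-identityʳ _)) ⟩
    2 * pw (j + k) n            ≤⟨ ℕP.*-monoˡ-≤ (pw (j + k) n) {2} {2 + n} (s≤s (s≤s z≤n)) ⟩
    pw (suc (j + k)) n ∎
    where open ℕP.≤-Reasoning

  2+x≤m*m*x : ∀ {m x} → 2 ≤ m → 1 ≤ x → 2 + x ≤ m * (m * x)
  2+x≤m*m*x {m} {x} 2≤m 1≤x = begin
    2 + x              ≤⟨ ℕP.+-monoˡ-≤ x (ℕP.*-monoʳ-≤ 2 1≤x) ⟩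
    2 * x + x          ≤⟨ ℕP.+-monoʳ-≤ (2 * x) (ℕP.m≤m+n x (x + 0)) ⟩
    2 * x + 2 * x      ≡⟨ cong (2 * x +_) (sym (ℕP.+-identityʳ (2 * x))) ⟩
    2 * (2 * x)        ≤⟨ ℕP.*-mono-≤ 2≤m (ℕP.*-monoˡ-≤ x 2≤m) ⟩
    m * (m * x) ∎
    where open ℕP.≤-Reasoning

  -- The `2 +` of the outer base is absorbed by two further factors of the inner one.
  pw-pw : ∀ j k n → pw k (pw j n) ≤ pw ((2 + j) * k) n
  pw-pw j k n = ℕP.≤-trans
    (ℕP.^-monoˡ-≤ k (2+x≤m*m*x {2 + n} (s≤s (s≤s z≤n)) (ℕP.m^n>0 (2 + n) j)))
    (ℕP.≤-reflexive (ℕP.^-*-assoc (2 + n) (2 + j) k))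

-- Encodings of types as trees, and bounds in the size of the code.

record Enc (A : Set) : Set where
  field enc : A → Tree
open Enc {{...}} public

size : {A : Set} {{_ : Enc A}} → A → ℕ
size x = weight (enc x)

ser : {A : Set} {{_ : Enc A}} → A → List Sym
ser x = serialize (enc x)

weight>0 : ∀ t → 1 ≤ weight t
weight>0 leaf       = s≤s z≤n
weight>0 (node _ _) = s≤s z≤n

encList : ∀ {A} {{_ : Enc A}} → List A → Tree
encList []       = leaf
encList (x ∷ xs) = node (enc x) (encList xs)

instance
  enc-⊤ : Enc ⊤
  enc-⊤ = record { enc = λ _ → leaf }
  enc-Bool : Enc Bool
  enc-Bool = record { enc = λ b → if b then node leaf leaf else leaf }
  enc-× : ∀ {A B} {{_ : Enc A}} {{_ : Enc B}} → Enc (A × B)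
  enc-× = record { enc = λ p → node (enc (proj₁ p)) (enc (proj₂ p)) }
  enc-List : ∀ {A} {{_ : Enc A}} → Enc (List A)
  enc-List = record { enc = encList }

record Poly {A : Set} {{_ : Enc A}} (g : A → ℕ) : Set where
  constructor poly
  field
    degree : ℕ
    bound  : ∀ x → g x ≤ pw degree (size x)

module _ {A : Set} {{_ : Enc A}} where
  poly-const : ∀ c → Poly {A} (λ _ → c)
  poly-const c = poly c (λ x → pw-const c (size x))

  poly-size : Poly {A} size
  poly-size = poly 1 (λ x → pw-size (size x))

  infixl 6 _poly-+_
  infixl 7 _poly-*_
  _poly-+_ : ∀ {f g : A → ℕ} → Poly f → Poly g → Poly (λ x → f x + g x)
  poly j p poly-+ poly k q = poly (suc (j + k)) (λ x → ℕP.≤-trans (ℕP.+-mono-≤ (p x) (q x)) (pw-+ j k (size x)))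

  _poly-*_ : ∀ {f g : A → ℕ} → Poly f → Poly g → Poly (λ x → f x * g x)
  poly j p poly-* poly k q = poly (j + k) (λ x → ℕP.≤-trans (ℕP.*-mono-≤ (p x) (q x)) (ℕP.≤-reflexive (pw-* j k (size x))))

  poly-pw : ∀ {f : A → ℕ} k → Poly f → Poly (λ x → pw k (f x))
  poly-pw k (poly j p) = poly ((2 + j) * k) (λ x → ℕP.≤-trans (pw-monoʳ k (p x)) (pw-pw j k (size x)))

  poly-≤ : ∀ {f g : A → ℕ} → (∀ x → f x ≤ g x) → Poly g → Poly f
  poly-≤ f≤ (poly k p) = poly k (λ x → ℕP.≤-trans (f≤ x) (p x))

poly-∘ : ∀ {A B : Set} {{_ : Enc A}} {{_ : Enc B}} {g : B → ℕ} (f : A → B) →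
         Poly g → Poly (λ x → size (f x)) → Poly (λ x → g (f x))
poly-∘ f (poly k p) q = poly-≤ (λ x → p (f x)) (poly-pw k q)

-- Polynomial-time functions

values-dump : List Sym → List Sym → Stacks
values-dump v d = [] ∷ v ∷ [] ∷ d ∷ []

-- The program replaces the code of `x` by that of `f x`, leaving everything below it (`v`) and the
-- whole dump (`d`) intact. Together with empty scratch and counter this lets programs serve as
-- subroutines of one another.
record PT {A B : Set} {{_ : Enc A}} {{_ : Enc B}} (f : A → B) : Set where
  constructor pt
  field
    prog : Prog
    {time} : A → ℕ
    time-poly : Poly time
    exec : ∀ x v d → Exec prog (values-dump (ser x ++ v) d) (values-dump (ser (f x) ++ v) d) (time x)

length-ser : ∀ {A : Set} {{_ : Enc A}} (x : A) → length (ser x) ≡ size x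
length-ser x = length-serialize (enc x)

opaque
  walkCost pourCost : ℕ → ℕ
  walkCost n = 7 * n + 2
  pourCost n = 5 * n + 1

  walkCost-mono : ∀ {m n} → m ≤ n → walkCost m ≤ walkCost n
  walkCost-mono m≤n = ℕP.+-monoˡ-≤ 2 (ℕP.*-monoʳ-≤ 7 m≤n)

  pourCost-mono : ∀ {m n} → m ≤ n → pourCost m ≤ pourCost n
  pourCost-mono m≤n = ℕP.+-monoˡ-≤ 1 (ℕP.*-monoʳ-≤ 5 m≤n)

  poly-walk : ∀ {A} {{_ : Enc A}} {f : A → ℕ} → Poly f → Poly (λ x → walkCost (f x))
  poly-walk pf = poly-const 7 poly-* pf poly-+ poly-const 2

  poly-pour : ∀ {A} {{_ : Enc A}} {f : A → ℕ} → Poly f → Poly (λ x → pourCost (f x))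
  poly-pour pf = poly-const 5 poly-* pf poly-+ poly-const 1

  pour-back : ∀ bs v → kept true (bs ʳ++ []) v ≡ map sym? bs ++ v
  pour-back bs v = trans (cong (_ʳ++ v) (LP.map-ʳ++ sym? bs)) (trans (LP.ʳ++-ʳ++ (map sym? bs)) refl)

  kept-empty : ∀ bs → kept true bs [] ≡ map sym? (bs ʳ++ [])
  kept-empty bs = sym (LP.map-ʳ++ sym? bs)

  length-reversed : ∀ t → 5 * length (bits t ʳ++ []) + 1 ≡ 5 * weight t + 1
  length-reversed t = cong (λ n → 5 * n + 1) (trans (LP.length-ʳ++ (bits t)) (trans (ℕP.+-identityʳ _) (length-bits t)))

  exec-grab : ∀ i t {x y} → Exec (walk i true) (stacks i [] (serialize t ++ x) [] y)
                (stacks i (map sym? (bits t ʳ++ [])) x [] y) (walkCost (weight t))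
  exec-grab i t {x} {y} = exec-≡ refl (cong (λ a → stacks i a x [] y) (kept-empty (bits t))) refl (exec-walk i true t)

  exec-put : ∀ t {v d} → Exec (pour true false) (map sym? (bits t ʳ++ []) ∷ v ∷ [] ∷ d ∷ [])
               (values-dump (serialize t ++ v) d) (pourCost (weight t))
  exec-put t {v} {d} = exec-≡ refl (cong (λ a → values-dump a d) (pour-back (bits t) v)) (length-reversed t) (exec-pour true false (bits t ʳ++ []))

  exec-save : ∀ t {v d} → Exec (pour false true) (map sym? (bits t ʳ++ []) ∷ v ∷ [] ∷ d ∷ [])
               (values-dump v (serialize t ++ d)) (pourCost (weight t))
  exec-save t {v} {d} = exec-≡ refl (cong (λ a → values-dump v a) (pour-back (bits t) d)) (length-reversed t) (exec-pour false true (bits t ʳ++ []))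

  exec-both : ∀ t {v d} → Exec (pour true true) (map sym? (bits t ʳ++ []) ∷ v ∷ [] ∷ d ∷ [])
               (values-dump (serialize t ++ v) (serialize t ++ d)) (pourCost (weight t))
  exec-both t {v} {d} = exec-≡ refl (cong₂ values-dump (pour-back (bits t) v) (pour-back (bits t) d)) (length-reversed t) (exec-pour true true (bits t ʳ++ []))

  exec-drop : ∀ t {a v d} → Exec (walk fromValues false) (a ∷ (serialize t ++ v) ∷ [] ∷ d ∷ []) (a ∷ v ∷ [] ∷ d ∷ []) (walkCost (weight t))
  exec-drop t = exec-walk fromValues false t

opaque
  -- Heights grow by at most the cost, so the running time bounds the output as well.
  out-poly : ∀ {A B} {{_ : Enc A}} {{_ : Enc B}} {f : A → B} → PT f → Poly (λ x → size (f x))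
  out-poly {f = f} (pt P {t} tp ex) = poly-≤ le (poly-size poly-+ tp)
    where
    le : ∀ x → size (f x) ≤ size x + t x
    le x = begin
      size (f x)                  ≡⟨ sym (length-ser (f x)) ⟩
      length (ser (f x))          ≡⟨ cong length (sym (LP.++-identityʳ (ser (f x)))) ⟩
      length (ser (f x) ++ [])    ≤⟨ Height≤.length≤ (height-exec (ex x [] []) init) values ⟩
      size x + t x ∎
      where
      open ℕP.≤-Reasoning
      init : Height≤ (size x) (values-dump (ser x ++ []) [])
      init = height λ { scratch → z≤n
                      ; values → ℕP.≤-reflexive (trans (cong length (LP.++-identityʳ (ser x))) (length-ser x))
                      ; counter → z≤n ; dump → z≤n }

  pt-∘ : ∀ {A B C} {{_ : Enc A}} {{_ : Enc B}} {{_ : Enc C}} {g : B → C} {f : A → B} → PT g → PT f → PT (λ x → g (f x))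
  pt-∘ {g = g} {f} (pt Q uq ey) p@(pt P tp ex) =
    pt (P ⨾ Q) (tp poly-+ poly-∘ f uq (out-poly p)) (λ x v d → ex x v d ⨾ ey (f x) v d)

  -- A change of type that preserves the code costs nothing. Numbers, integers and symbols are
  -- thereby treated as the lists and pairs that encode them.
  pt-recode : ∀ {A B} {{_ : Enc A}} {{_ : Enc B}} {f : A → B} → (∀ x → enc (f x) ≡ enc x) → PT f
  pt-recode eq = pt skip (poly-const 1) (λ x v d → exec-≡ refl (cong (λ t → values-dump (serialize t ++ v) d) (sym (eq x))) refl skip)

  pt-≗ : ∀ {A B} {{_ : Enc A}} {{_ : Enc B}} {f g : A → B} → (∀ x → f x ≡ g x) → PT f → PT g
  pt-≗ eq (pt P tp ex) = pt P tp (λ x v d → exec-≡ refl (cong (λ y → values-dump (ser y ++ v) d) (eq x)) refl (ex x v d))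

  -- The argument is kept on the dump while `g` runs. Since `f` runs second its result ends up on
  -- top, and pushing the symbol `two` turns both results into a pair.
  pt-pair : ∀ {A B C} {{_ : Enc A}} {{_ : Enc B}} {{_ : Enc C}} {f : A → B} {g : A → C} → PT f → PT g → PT (λ x → f x , g x)
  pt-pair {f = f} {g} (pt P tp ex) (pt Q uq ey) = pt
    (walk fromValues true ⨾ pour true true ⨾ Q ⨾ walk fromDump true ⨾ pour true false ⨾ P ⨾ push values two)
    (poly-walk poly-size poly-+ (poly-pour poly-size poly-+ (uq poly-+ (poly-walk poly-size poly-+ (poly-pour poly-size poly-+ (tp poly-+ poly-const 1))))))
    (λ x v d → exec-≡ refl (cong (λ a → values-dump a d) (sym (serialize-node (enc (f x)) (enc (g x)) v))) refl
      (exec-grab fromValues (enc x) ⨾ exec-both (enc x) ⨾ ey x v (ser x ++ d) ⨾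
       exec-grab fromDump (enc x) ⨾ exec-put (enc x) ⨾ ex x (ser (g x) ++ v) d ⨾ push))

  poly-proj₁ : ∀ {A B} {{_ : Enc A}} {{_ : Enc B}} → Poly {A × B} (λ x → size (proj₁ x))
  poly-proj₁ = poly-≤ (λ x → ℕP.≤-trans (ℕP.m≤m+n _ _) (ℕP.n≤1+n _)) poly-size

  poly-proj₂ : ∀ {A B} {{_ : Enc A}} {{_ : Enc B}} → Poly {A × B} (λ x → size (proj₂ x))
  poly-proj₂ = poly-≤ (λ x → ℕP.≤-trans (ℕP.m≤n+m _ _) (ℕP.n≤1+n _)) poly-size

  pt-proj₁ : ∀ {A B} {{_ : Enc A}} {{_ : Enc B}} → PT {A × B} proj₁
  pt-proj₁ = pt (pop values ⨾ walk fromValues true ⨾ walk fromValues false ⨾ pour true false)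
    (poly-const 1 poly-+ (poly-walk poly-proj₁ poly-+ (poly-walk poly-proj₂ poly-+ poly-pour poly-proj₁)))
    (λ { (a , b) v d → exec-≡ (cong (λ s → values-dump s d) (sym (serialize-node (enc a) (enc b) v))) refl refl
      (pop ⨾ exec-grab fromValues (enc a) ⨾ exec-drop (enc b) ⨾ exec-put (enc a)) })

  pt-proj₂ : ∀ {A B} {{_ : Enc A}} {{_ : Enc B}} → PT {A × B} proj₂
  pt-proj₂ = pt (pop values ⨾ walk fromValues false)
    (poly-const 1 poly-+ poly-walk poly-proj₁)
    (λ { (a , b) v d → exec-≡ (cong (λ s → values-dump s d) (sym (serialize-node (enc a) (enc b) v))) refl refl
      (pop ⨾ exec-drop (enc a)) })

  pushAll : List Sym → Prog
  pushAll []      = skip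
  pushAll (s ∷ l) = pushAll l ⨾ push values s

  exec-pushAll : ∀ l {a v c d} → Exec (pushAll l) (a ∷ v ∷ c ∷ d ∷ []) (a ∷ (l ++ v) ∷ c ∷ d ∷ []) (suc (length l))
  exec-pushAll []      = skip
  exec-pushAll (s ∷ l) = exec-≡ refl refl (ℕP.+-comm _ 1) (exec-pushAll l ⨾ push)

  pt-const : ∀ {A B} {{_ : Enc A}} {{_ : Enc B}} (b : B) → PT {A} (λ _ → b)
  pt-const b = pt (walk fromValues false ⨾ pushAll (ser b))
    (poly-walk poly-size poly-+ poly-const _)
    (λ x v d → exec-drop (enc x) ⨾ exec-pushAll (ser b))

  pt-if : ∀ {A B} {{_ : Enc A}} {{_ : Enc B}} {c : A → Bool} {f g : A → B} →
          PT c → PT f → PT g → PT (λ x → if c x then f x else g x)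
  pt-if {c = c} {f} {g} pc (pt P {t} tp ex) (pt Q {u} uq ey) with pt-pair pc (pt-recode {f = id} (λ _ → refl))
  ... | pt R {w} wr ez = pt
    -- The code of `(c x , x)` is `two`, then the Boolean, then `x`. The code of `true` has three
    -- symbols and that of `false` one, which accounts for the pops.
    (R ⨾ pop values ⨾ cond values isTwo (pop values ⨾ pop values ⨾ pop values ⨾ P) (pop values ⨾ Q))
    (wr poly-+ (poly-const 5 poly-+ (tp poly-+ uq)))
    (λ x v d → ez x v d ⨾ choose x v d)
    where
    choose : ∀ x v d → Exec (pop values ⨾ cond values isTwo (pop values ⨾ pop values ⨾ pop values ⨾ P) (pop values ⨾ Q))
      (values-dump (ser (c x , x) ++ v) d) (values-dump (ser (if c x then f x else g x) ++ v) d) (5 + (t x + u x))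
    choose x v d with c x
    ... | true  = relax (ℕP.+-monoʳ-≤ 5 (ℕP.m≤m+n (t x) (u x))) (pop ⨾ then refl (pop ⨾ pop ⨾ pop ⨾ ex x v d))
    ... | false = relax (ℕP.+-mono-≤ {3} {5} (s≤s (s≤s (s≤s z≤n))) (ℕP.m≤n+m (u x) (t x))) (pop ⨾ else refl (pop ⨾ ey x v d))

listCase : ∀ {A B : Set} → B → (A → List A → B) → List A → B
listCase n c []       = n
listCase n c (a ∷ as) = c a as

opaque
  pt-listCase : ∀ {Γ A B} {{_ : Enc Γ}} {{_ : Enc A}} {{_ : Enc B}} {l : Γ → List A} {n : Γ → B} {c : Γ → A → List A → B} →
    PT l → PT n → PT {(A × List A) × Γ} (λ γ → c (proj₂ γ) (proj₁ (proj₁ γ)) (proj₂ (proj₁ γ))) →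
    PT (λ γ → listCase (n γ) (c γ) (l γ))
  pt-listCase {Γ} {A} {B} {l} {n} {c} pl (pt P {t} tp ex) (pt Q {u} (poly k uq) ey) with pt-pair pl (pt-recode {f = id} (λ _ → refl))
  ... | rp@(pt R {w} wr ez) = pt
    -- The code of `(a ∷ as , x)` is also the code of `((a , as) , x)`, so for a nonempty list the
    -- popped `two` is just put back.
    (R ⨾ pop values ⨾ cond values isTwo (push values two ⨾ Q) (pop values ⨾ P))
    (wr poly-+ (poly-const 3 poly-+ (tp poly-+ poly-pw k (out-poly rp))))
    (λ x v d → ez x v d ⨾ choose x v d)
    where
    choose : ∀ x v d → Exec (pop values ⨾ cond values isTwo (push values two ⨾ Q) (pop values ⨾ P))
      (values-dump (ser (l x , x) ++ v) d) (values-dump (ser (listCase (n x) (c x) (l x)) ++ v) d) (3 + (t x + pw k (size (l x , x))))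
    choose x v d with l x
    ... | []     = relax (ℕP.+-monoʳ-≤ 3 (ℕP.m≤m+n (t x) _)) (pop ⨾ else refl (pop ⨾ ex x v d))
    ... | a ∷ as = relax (ℕP.+-monoʳ-≤ 3 (ℕP.≤-trans (uq ((a , as) , x)) (ℕP.m≤n+m _ (t x)))) (pop ⨾ then refl (push ⨾ ey ((a , as) , x) v d))

size-++ʳ : ∀ {A} {{_ : Enc A}} (l m : List A) → size m ≤ size (l ++ m)
size-++ʳ []      m = ℕP.≤-refl
size-++ʳ (x ∷ l) m = ℕP.≤-trans (size-++ʳ l m) (ℕP.≤-trans (ℕP.m≤n+m _ (size x)) (ℕP.n≤1+n _))

length≤size : ∀ {A} {{_ : Enc A}} (l : List A) → length l ≤ size l
length≤size []      = z≤n
length≤size (x ∷ l) = s≤s (ℕP.≤-trans (length≤size l) (ℕP.m≤n+m _ (size x)))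

-- Folds and structural recursion as loops.

foldCost : ℕ → ℕ → ℕ
foldCost k M = suc (1 + (walkCost M + (pourCost M + (1 + pw k M))))

foldTime : ℕ → ℕ → ℕ → ℕ → ℕ
foldTime k s n M = 1 + (walkCost s + (pourCost s + ((n * foldCost k M + 1) + 1)))

foldBody : Prog → Prog
foldBody P = pop dump ⨾ walk fromDump true ⨾ pour true false ⨾ push values two ⨾ P

-- The list waits on the dump while the state stays on the values. `isTwo` distinguishes a further
-- element from the end of the list, and the final `pop` removes the code of the empty list.
foldLoop : Prog → Prog
foldLoop P = pop values ⨾ walk fromValues true ⨾ pour false true ⨾ while dump isTwo (foldBody P) ⨾ pop dump

module _ {A S : Set} {{_ : Enc A}} {{_ : Enc S}} (step : S → A → S) (P : Prog) (k : ℕ)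
  (ex : ∀ a s v d → Exec P (values-dump (ser (a , s) ++ v) d) (values-dump (ser (step s a) ++ v) d) (pw k (size (a , s)))) (M : ℕ) where

  exec-foldLoop : ∀ l s v d → (∀ l₁ a l₂ → l ≡ l₁ ++ a ∷ l₂ → size (a , foldl step s l₁) ≤ M) →
    Exec (while dump isTwo (foldBody P)) (values-dump (ser s ++ v) (ser l ++ d)) (values-dump (ser (foldl step s l) ++ v) (one ∷ d)) (length l * foldCost k M + 1)
  exec-foldLoop [] s v d H = done refl
  exec-foldLoop (a ∷ l) s v d H =
    relax (ℕP.≤-reflexive (trans (cong suc (sym (ℕP.+-assoc c (length l * foldCost k M) 1))) (cong (_+ 1) (refl {x = foldCost k M + length l * foldCost k M}))))
    (exec-≡ (cong (λ x → values-dump (ser s ++ v) x) (sym (serialize-node (enc a) (enc l) d))) refl refl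
      (again refl (relax cost≤ body) (exec-foldLoop l (step s a) v d (λ l₁ b l₂ eq → H (a ∷ l₁) b l₂ (cong (a ∷_) eq)))))
    where
    c = 1 + (walkCost M + (pourCost M + (1 + pw k M)))
    as≤M : size (a , s) ≤ M
    as≤M = H [] a l refl
    a≤M : size a ≤ M
    a≤M = ℕP.≤-trans (ℕP.≤-trans (ℕP.m≤m+n _ _) (ℕP.n≤1+n _)) as≤M
    cost≤ : 1 + (walkCost (size a) + (pourCost (size a) + (1 + pw k (size (a , s))))) ≤ c
    cost≤ = ℕP.+-monoʳ-≤ 1 (ℕP.+-mono-≤ (walkCost-mono a≤M)
              (ℕP.+-mono-≤ (pourCost-mono a≤M) (ℕP.+-monoʳ-≤ 1 (pw-monoʳ k as≤M))))
    body : Exec (foldBody P) (values-dump (ser s ++ v) (two ∷ ser a ++ ser l ++ d)) (values-dump (ser (step s a) ++ v) (ser l ++ d)) _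
    body = pop ⨾ exec-grab fromDump (enc a) ⨾ exec-put (enc a) ⨾
           exec-≡ refl (cong (λ x → values-dump x (ser l ++ d)) (sym (serialize-node (enc a) (enc s) v))) refl push ⨾ ex a s v (ser l ++ d)

  exec-fold : ∀ l s v d → (∀ l₁ a l₂ → l ≡ l₁ ++ a ∷ l₂ → size (a , foldl step s l₁) ≤ M) →
    Exec (foldLoop P) (values-dump (ser (l , s) ++ v) d) (values-dump (ser (foldl step s l) ++ v) d)
      (foldTime k (size l) (length l) M)
  exec-fold l s v d H = exec-≡ (cong (λ x → values-dump x d) (sym (serialize-node (enc l) (enc s) v))) refl refl
    (pop ⨾ exec-grab fromValues (enc l) ⨾ exec-save (enc l) ⨾ exec-foldLoop l s v d H ⨾ pop)

-- The loop body sees only the element and the state, so the environment has to travel inside the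
-- state.
foldl-env : ∀ {Γ S A : Set} (step : Γ → S → A → S) γ s l →
  foldl (λ (p : Γ × S) a → proj₁ p , step (proj₁ p) (proj₂ p) a) (γ , s) l ≡ (γ , foldl (step γ) s l)
foldl-env step γ s []      = refl
foldl-env step γ s (a ∷ l) = foldl-env step γ (step γ s a) l

opaque
  -- The bound `g` on all intermediate states is what keeps the class polynomial: iterating a step
  -- that merely doubles its argument would already be exponential.
  pt-foldl : ∀ {Γ A S} {{_ : Enc Γ}} {{_ : Enc A}} {{_ : Enc S}} {step : Γ → S → A → S} {s : Γ → S} {l : Γ → List A} →
    PT {(Γ × S) × A} (λ γ → step (proj₁ (proj₁ γ)) (proj₂ (proj₁ γ)) (proj₂ γ)) → PT s → PT l → ∀ {g : Γ → ℕ} → Poly g →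
    (∀ γ l₁ l₂ → l γ ≡ l₁ ++ l₂ → size (foldl (step γ) (s γ) l₁) ≤ g γ) →
    PT (λ γ → foldl (step γ) (s γ) (l γ))
  pt-foldl {Γ} {A} {S} {step} {s} {l} pstep ps pl {g} pg H
    with pt-pair pl (pt-pair (pt-recode {Γ} {f = id} (λ _ → refl)) ps)
       | pt-pair (pt-∘ {f = λ (γ : A × (Γ × S)) → proj₁ (proj₂ γ)} (pt-recode {Γ} {f = id} (λ _ → refl)) (pt-∘ pt-proj₁ pt-proj₂))
           (pt-∘ {f = λ (γ : A × (Γ × S)) → (proj₂ γ , proj₁ γ)} pstep (pt-pair pt-proj₂ pt-proj₁))
       | pt-proj₂ {Γ} {S}
  ... | ip@(pt I {t} ti ei) | pt P {u} (poly k uk) ep | pt R {w} rw er = pt (I ⨾ foldLoop P ⨾ R)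
        (ti poly-+ ((poly-const 1 poly-+ (poly-walk (out-poly pl) poly-+ (poly-pour (out-poly pl)
           poly-+ ((out-poly pl poly-* (poly-const 1 poly-+ (poly-const 1 poly-+ (poly-walk pM poly-+ (poly-pour pM poly-+ (poly-const 1 poly-+ poly-pw k pM)))))
             poly-+ poly-const 1) poly-+ poly-const 1))))
          poly-+ poly-≤ (λ γ → Poly.bound rw (γ , foldl (step γ) (s γ) (l γ))) (poly-pw (Poly.degree rw) (poly-const 1 poly-+ (poly-size poly-+ pg′)))))
        λ γ v d → ei γ v d ⨾ relax (cost γ) (body γ v d) ⨾ er (γ , foldl (step γ) (s γ) (l γ)) v d
    where
    step′ : Γ × S → A → Γ × S
    step′ p a = proj₁ p , step (proj₁ p) (proj₂ p) a
    M : Γ → ℕ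
    M γ = 1 + (size (l γ) + (1 + (size γ + g γ)))
    pM : Poly M
    pM = poly-const 1 poly-+ (out-poly pl poly-+ (poly-const 1 poly-+ (poly-size poly-+ pg)))
    pg′ : Poly (λ γ → size (foldl (step γ) (s γ) (l γ)))
    pg′ = poly-≤ (λ γ → H γ (l γ) [] (sym (LP.++-identityʳ (l γ)))) pg
    small : ∀ γ l₁ a l₂ → l γ ≡ l₁ ++ a ∷ l₂ → size (a , foldl step′ (γ , s γ) l₁) ≤ M γ
    small γ l₁ a l₂ eq rewrite foldl-env step γ (s γ) l₁ =
      s≤s (ℕP.+-mono-≤ (ℕP.≤-trans (ℕP.≤-trans (ℕP.m≤m+n (size a) (size l₂)) (ℕP.n≤1+n _)) (ℕP.≤-trans (size-++ʳ l₁ (a ∷ l₂)) (ℕP.≤-reflexive (cong size (sym eq)))))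
        (s≤s (ℕP.+-monoʳ-≤ (size γ) (H γ l₁ (a ∷ l₂) eq))))
    body : ∀ γ v d → Exec (foldLoop P) (values-dump (ser (l γ , γ , s γ) ++ v) d) (values-dump (ser (γ , foldl (step γ) (s γ) (l γ)) ++ v) d) (foldTime k (size (l γ)) (length (l γ)) (M γ))
    body γ v d = exec-≡ refl (cong (λ x → values-dump (ser x ++ v) d) (foldl-env step γ (s γ) (l γ))) refl
      (exec-fold step′ P k (λ a s v d → relax (uk (a , s)) (ep (a , s) v d)) (M γ) (l γ) (γ , s γ) v d (small γ))
    cost : ∀ γ → foldTime k (size (l γ)) (length (l γ)) (M γ) ≤ foldTime k (size (l γ)) (size (l γ)) (M γ)
    cost γ = ℕP.+-monoʳ-≤ 1 (ℕP.+-monoʳ-≤ (walkCost (size (l γ))) (ℕP.+-monoʳ-≤ (pourCost (size (l γ))) (ℕP.+-monoˡ-≤ 1 (ℕP.+-monoˡ-≤ 1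
       (ℕP.*-monoˡ-≤ (foldCost k (M γ)) (length≤size (l γ)))))))

-- Terms over a context: a context is a left-nested product, the last variable outermost.

pt-id : ∀ {A} {{_ : Enc A}} → PT {A} (λ x → x)
pt-id = pt-recode (λ _ → refl)

module _ {Γ A : Set} {{_ : Enc Γ}} {{_ : Enc A}} where
  var0 : PT {Γ × A} proj₂
  var0 = pt-proj₂

  weaken : ∀ {B} {{_ : Enc B}} {f : Γ → B} → PT f → PT {Γ × A} (λ γ → f (proj₁ γ))
  weaken p = pt-∘ p pt-proj₁

pt-∷ : ∀ {Γ A} {{_ : Enc Γ}} {{_ : Enc A}} {a : Γ → A} {l : Γ → List A} → PT a → PT l → PT (λ γ → a γ ∷ l γ)
pt-∷ p q = pt-∘ {g = λ x → proj₁ x ∷ proj₂ x} (pt-recode (λ _ → refl)) (pt-pair p q)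

pt-app₂ : ∀ {Γ A B C} {{_ : Enc Γ}} {{_ : Enc A}} {{_ : Enc B}} {{_ : Enc C}} {g : A → B → C} {a : Γ → A} {b : Γ → B} →
  PT {A × B} (λ x → g (proj₁ x) (proj₂ x)) → PT a → PT b → PT (λ γ → g (a γ) (b γ))
pt-app₂ p q r = pt-∘ p (pt-pair q r)

size-ʳ++ : ∀ {A} {{_ : Enc A}} (l m : List A) → suc (size (l ʳ++ m)) ≡ size l + size m
size-ʳ++ [] m = refl
size-ʳ++ (x ∷ l) m = trans (size-ʳ++ l (x ∷ m)) (begin
  size l + suc (size x + size m)   ≡⟨ ℕP.+-suc (size l) _ ⟩
  suc (size l + (size x + size m)) ≡⟨ cong suc (sym (ℕP.+-assoc (size l) (size x) (size m))) ⟩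
  suc (size l + size x + size m)   ≡⟨ cong (λ n → suc (n + size m)) (ℕP.+-comm (size l) (size x)) ⟩
  suc (size x + size l + size m)   ∎)
  where open ≡-Reasoning

size-++ˡ : ∀ {A} {{_ : Enc A}} (l m : List A) → size l ≤ size (l ++ m)
size-++ˡ []      m = weight>0 (enc m)
size-++ˡ (x ∷ l) m = s≤s (ℕP.+-monoʳ-≤ (size x) (size-++ˡ l m))

size-proj₁ : ∀ {A B} {{_ : Enc A}} {{_ : Enc B}} (p : A × B) → size (proj₁ p) ≤ size p
size-proj₁ p = ℕP.≤-trans (ℕP.m≤m+n _ _) (ℕP.n≤1+n _)

size-proj₂ : ∀ {A B} {{_ : Enc A}} {{_ : Enc B}} (p : A × B) → size (proj₂ p) ≤ size p
size-proj₂ p = ℕP.≤-trans (ℕP.m≤n+m _ _) (ℕP.n≤1+n _)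

opaque
  pt-reverse : ∀ {Γ A} {{_ : Enc Γ}} {{_ : Enc A}} {l : Γ → List A} → PT l → PT (λ γ → reverse (l γ))
  pt-reverse {l = l} p = pt-foldl {step = λ _ acc a → a ∷ acc} {s = λ _ → []} (pt-∷ var0 (weaken var0)) (pt-const []) p (out-poly p)
    (λ γ l₁ l₂ eq → ℕP.≤-trans (ℕP.≤-reflexive (ℕP.suc-injective (trans (size-ʳ++ l₁ []) (ℕP.+-comm (size l₁) 1))))
                     (ℕP.≤-trans (size-++ˡ l₁ l₂) (ℕP.≤-reflexive (cong size (sym eq)))))

  pt-foldr : ∀ {Γ A B} {{_ : Enc Γ}} {{_ : Enc A}} {{_ : Enc B}} {c : Γ → A → B → B} {n : Γ → B} {l : Γ → List A} →
    PT {(Γ × B) × A} (λ γ → c (proj₁ (proj₁ γ)) (proj₂ γ) (proj₂ (proj₁ γ))) → PT n → PT l → ∀ {g : Γ → ℕ} → Poly g →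
    (∀ γ l₁ l₂ → l γ ≡ l₁ ++ l₂ → size (foldr (c γ) (n γ) l₂) ≤ g γ) → PT (λ γ → foldr (c γ) (n γ) (l γ))
  pt-foldr {c = c} {n} {l} pc pn pl pg H =
    pt-≗ (λ γ → LP.reverse-foldl (λ r a → c γ a r) (n γ) (l γ))
      (pt-foldl {step = λ γ r a → c γ a r} pc pn (pt-reverse pl) pg λ γ m₁ m₂ eq →
        ℕP.≤-trans (ℕP.≤-reflexive (cong size (sym (LP.reverse-foldr (c γ) (n γ) m₁))))
          (H γ (reverse m₂) (reverse m₁) (trans (sym (LP.reverse-involutive (l γ))) (trans (cong reverse eq) (LP.reverse-++ m₁ m₂)))))

  size-drop₁ : ∀ {A} {{_ : Enc A}} (l : List A) → size (drop 1 l) ≤ size l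
  size-drop₁ []      = ℕP.≤-refl
  size-drop₁ (x ∷ l) = ℕP.≤-trans (ℕP.m≤n+m _ (size x)) (ℕP.n≤1+n _)

  pt-tail : ∀ {Γ A} {{_ : Enc Γ}} {{_ : Enc A}} {l : Γ → List A} → PT l → PT (λ γ → drop 1 (l γ))
  pt-tail {l = l} p = pt-≗ (λ γ → eq (l γ)) (pt-listCase {n = λ _ → []} {c = λ _ _ as → as} p (pt-const []) (pt-∘ pt-proj₂ pt-proj₁))
    where
    eq : ∀ {A : Set} (l : List A) → listCase [] (λ _ as → as) l ≡ drop 1 l
    eq []      = refl
    eq (x ∷ l) = refl

module Descent {A P : Set} {{_ : Enc A}} {{_ : Enc P}} (t : P → P) (t≤ : ∀ p → size (t p) ≤ size p) where

  Entry : Set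
  Entry = (A × List A) × P

  entries : List A → P → List Entry
  entries []       p = []
  entries (x ∷ xs) p = ((x , xs) , p) ∷ entries xs (t p)

  final : List A → P → P
  final []       p = p
  final (x ∷ xs) p = final xs (t p)

  descend : (List A × P) × List Entry → A → (List A × P) × List Entry
  descend ((l , p) , acc) x = (drop 1 l , t p) , (((x , drop 1 l) , p) ∷ acc)

  descend-correct : ∀ l p acc → foldl descend ((l , p) , acc) l ≡ (([] , final l p) , entries l p ʳ++ acc)
  descend-correct []       p acc = refl
  descend-correct (x ∷ xs) p acc = descend-correct xs (t p) (((x , xs) , p) ∷ acc)

  descend-size : ∀ X l₁ l₂ r p acc → (∀ m₁ x m₂ → l₁ ≡ m₁ ++ x ∷ m₂ → size x ≤ X) → size r + size p ≤ l₂ →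
    size (foldl descend ((r , p) , acc) l₁) ≤ 2 + l₂ + size acc + length l₁ * (4 + X + l₂)
  descend-size X [] l₂ r p acc H rp = ℕP.≤-trans (s≤s (s≤s (ℕP.+-monoˡ-≤ (size acc) rp))) (ℕP.m≤m+n _ _)
  descend-size X (x ∷ l₁) l₂ r p acc H rp = ℕP.≤-trans
    (descend-size X l₁ l₂ (drop 1 r) (t p) (((x , drop 1 r) , p) ∷ acc) (λ m₁ y m₂ eq → H (x ∷ m₁) y m₂ (cong (x ∷_) eq))
      (ℕP.≤-trans (ℕP.+-mono-≤ (size-drop₁ r) (t≤ p)) rp))
    (begin
      2 + l₂ + suc (2 + (size x + size (drop 1 r)) + size p + size acc) + Z
        ≤⟨ ℕP.+-monoˡ-≤ Z (ℕP.+-monoʳ-≤ (2 + l₂) (s≤s (s≤s (s≤s (ℕP.+-monoˡ-≤ (size acc) sz))))) ⟩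
      2 + l₂ + (3 + (X + l₂) + size acc) + Z
        ≤⟨ ℕP.+-monoˡ-≤ Z (ℕP.+-monoʳ-≤ (2 + l₂) (ℕP.n≤1+n _)) ⟩
      2 + l₂ + (Y + size acc) + Z   ≡⟨ cong (λ z → 2 + l₂ + z + Z) (ℕP.+-comm Y (size acc)) ⟩
      2 + l₂ + (size acc + Y) + Z   ≡⟨ cong (_+ Z) (sym (ℕP.+-assoc (2 + l₂) (size acc) Y)) ⟩
      2 + l₂ + size acc + Y + Z     ≡⟨ ℕP.+-assoc (2 + l₂ + size acc) Y Z ⟩
      2 + l₂ + size acc + (Y + Z)   ∎)
    where
    open ℕP.≤-Reasoning
    Y = 4 + X + l₂
    Z = length l₁ * Y
    sz : size x + size (drop 1 r) + size p ≤ X + l₂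
    sz = ℕP.≤-trans (ℕP.≤-reflexive (ℕP.+-assoc (size x) _ _))
           (ℕP.+-mono-≤ (H [] x l₁ refl) (ℕP.≤-trans (ℕP.+-monoˡ-≤ (size p) (size-drop₁ r)) rp))

  -- A suffix of the records is the record list of a smaller call. Hence every intermediate result
  -- of the climb is a value of the recursive function and inherits its size bound.
  entries-suffix : ∀ l p E₁ E₂ → entries l p ≡ E₁ ++ E₂ → Σ (List A) λ l′ → Σ P λ p′ →
    E₂ ≡ entries l′ p′ × final l p ≡ final l′ p′ × size l′ ≤ size l × size p′ ≤ size p
  entries-suffix l p [] E₂ eq = l , p , sym eq , refl , ℕP.≤-refl , ℕP.≤-refl
  entries-suffix (x ∷ xs) p (e ∷ E₁) E₂ eq with entries-suffix xs (t p) E₁ E₂ (LP.∷-injectiveʳ eq)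
  ... | l′ , p′ , e₁ , e₂ , s₁ , s₂ = l′ , p′ , e₁ , e₂ , ℕP.≤-trans s₁ (ℕP.≤-trans (ℕP.m≤n+m _ (size x)) (ℕP.n≤1+n _)) , ℕP.≤-trans s₂ (t≤ p)

size-element : ∀ {A} {{_ : Enc A}} {l : List A} m₁ x m₂ → l ≡ m₁ ++ x ∷ m₂ → size x ≤ size l
size-element m₁ x m₂ refl = ℕP.≤-trans (ℕP.≤-trans (ℕP.m≤m+n (size x) (size m₂)) (ℕP.n≤1+n _)) (size-++ʳ m₁ (x ∷ m₂))

opaque
  -- Recursion in which the parameter changes on the way down. One fold descends, applying `t` and
  -- recording head, tail and parameter of each level; a second fold climbs back over the records.
  -- As `t` does not enlarge its argument, the records stay small.
  pt-zrec : ∀ {Γ A P B} {{_ : Enc Γ}} {{_ : Enc A}} {{_ : Enc P}} {{_ : Enc B}}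
    {f : Γ → List A → P → B} {n : Γ → P → B} {c : Γ → A → List A → P → B → B} {t : P → P} →
    (∀ γ p → f γ [] p ≡ n γ p) → (∀ γ x xs p → f γ (x ∷ xs) p ≡ c γ x xs p (f γ xs (t p))) →
    PT {Γ × P} (λ q → n (proj₁ q) (proj₂ q)) →
    PT {(((Γ × A) × List A) × P) × B} (λ q → c (proj₁ (proj₁ (proj₁ (proj₁ q)))) (proj₂ (proj₁ (proj₁ (proj₁ q)))) (proj₂ (proj₁ (proj₁ q))) (proj₂ (proj₁ q)) (proj₂ q)) →
    PT t → (∀ p → size (t p) ≤ size p) →
    Poly {(Γ × List A) × P} (λ q → size (f (proj₁ (proj₁ q)) (proj₂ (proj₁ q)) (proj₂ q))) →
    PT {(Γ × List A) × P} (λ q → f (proj₁ (proj₁ q)) (proj₂ (proj₁ q)) (proj₂ q))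
  pt-zrec {Γ} {A} {P} {B} {f} {n} {c} {t} fn fc pn pc ptt t≤ (poly k fk) = pt-≗ correct up
    where
    open Descent {A} {P} t t≤
    Q : Set
    Q = (Γ × List A) × P
    D : Set
    D = (List A × P) × List Entry
    down : Q → D
    down q = foldl descend ((proj₂ (proj₁ q) , proj₂ q) , []) (proj₂ (proj₁ q))
    down-correct : ∀ q → down q ≡ (([] , final (proj₂ (proj₁ q)) (proj₂ q)) , reverse (entries (proj₂ (proj₁ q)) (proj₂ q)))
    down-correct q = descend-correct (proj₂ (proj₁ q)) (proj₂ q) []
    list : PT {Q} (λ q → proj₂ (proj₁ q))
    list = pt-∘ pt-proj₂ pt-proj₁
    pdown : PT down
    pdown = pt-foldl {step = λ _ → descend}
      (pt-pair (pt-pair rest (pt-∘ ptt par)) (pt-∷ (pt-pair (pt-pair var0 rest) par) (weaken (pt-∘ pt-proj₂ pt-proj₂))))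
      (pt-pair (pt-pair list pt-proj₂) (pt-const [])) list
      (poly-const 2 poly-+ (out-poly list poly-+ poly-proj₂) poly-+ poly-const 1 poly-+
         out-poly list poly-* (poly-const 4 poly-+ out-poly list poly-+ (out-poly list poly-+ poly-proj₂)))
      (λ q l₁ l₂ eq → ℕP.≤-trans
        (descend-size (size (proj₂ (proj₁ q))) l₁ (size (proj₂ (proj₁ q)) + size (proj₂ q)) (proj₂ (proj₁ q)) (proj₂ q) []
          (λ m₁ x m₂ eq′ → size-element m₁ x (m₂ ++ l₂) (trans eq (trans (cong (_++ l₂) eq′) (LP.++-assoc m₁ (x ∷ m₂) l₂)))) ℕP.≤-refl)
        (ℕP.+-monoʳ-≤ (2 + (size (proj₂ (proj₁ q)) + size (proj₂ q)) + 1)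
          (ℕP.*-monoˡ-≤ (4 + size (proj₂ (proj₁ q)) + (size (proj₂ (proj₁ q)) + size (proj₂ q)))
            (ℕP.≤-trans (length≤size l₁) (ℕP.≤-trans (size-++ˡ l₁ l₂) (ℕP.≤-reflexive (cong size (sym eq))))))))
      where
      rest : PT {(Q × D) × A} (λ q → drop 1 (proj₁ (proj₁ (proj₂ (proj₁ q)))))
      rest = pt-tail (weaken (pt-∘ pt-proj₁ (pt-∘ pt-proj₁ pt-proj₂)))
      par : PT {(Q × D) × A} (λ q → proj₂ (proj₁ (proj₂ (proj₁ q))))
      par = weaken (pt-∘ pt-proj₂ (pt-∘ pt-proj₁ pt-proj₂))
    cons : Q → Entry → B → B
    cons q e r = c (proj₁ (proj₁ q)) (proj₁ (proj₁ e)) (proj₂ (proj₁ e)) (proj₂ e) r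
    ascend : ∀ q l p → foldr (cons q) (n (proj₁ (proj₁ q)) (final l p)) (entries l p) ≡ f (proj₁ (proj₁ q)) l p
    ascend q [] p = sym (fn _ p)
    ascend q (x ∷ xs) p = trans (cong (c (proj₁ (proj₁ q)) x xs p) (ascend q xs (t p))) (sym (fc _ x xs p))
    start : Q → B
    start q = n (proj₁ (proj₁ q)) (proj₂ (proj₁ (down q)))
    small : ∀ q E₁ E₂ → reverse (proj₂ (down q)) ≡ E₁ ++ E₂ → size (foldr (cons q) (start q) E₂) ≤ pw k (size q)
    small q E₁ E₂ eq rewrite down-correct q | LP.reverse-involutive (entries (proj₂ (proj₁ q)) (proj₂ q))
      with entries-suffix (proj₂ (proj₁ q)) (proj₂ q) E₁ E₂ eq
    ... | l′ , p′ , refl , e , s₁ , s₂ rewrite e = ℕP.≤-trans (ℕP.≤-reflexive (cong size (ascend q l′ p′)))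
      (ℕP.≤-trans (fk ((proj₁ (proj₁ q) , l′) , p′))
        (pw-monoʳ k (s≤s (ℕP.+-mono-≤ (s≤s (ℕP.+-monoʳ-≤ (size (proj₁ (proj₁ q))) s₁)) s₂))))
    up : PT (λ q → foldr (cons q) (start q) (reverse (proj₂ (down q))))
    up = pt-foldr {c = cons} {n = start}
      (pt-∘ {f = λ (z : (Q × B) × Entry) → ((((proj₁ (proj₁ (proj₁ (proj₁ z))) , proj₁ (proj₁ (proj₂ z))) , proj₂ (proj₁ (proj₂ z))) , proj₂ (proj₂ z)) , proj₂ (proj₁ z))}
        pc (pt-pair (pt-pair (pt-pair (pt-pair (weaken (weaken (pt-∘ pt-proj₁ pt-proj₁))) (pt-∘ (pt-∘ pt-proj₁ pt-proj₁) pt-proj₂))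
          (pt-∘ (pt-∘ pt-proj₂ pt-proj₁) pt-proj₂)) (pt-∘ pt-proj₂ pt-proj₂)) (weaken pt-proj₂)))
      (pt-∘ {f = λ q → (proj₁ (proj₁ q) , proj₂ (proj₁ (down q)))} pn (pt-pair (pt-∘ pt-proj₁ pt-proj₁) (pt-∘ (pt-∘ pt-proj₂ pt-proj₁) pdown)))
      (pt-reverse (pt-∘ pt-proj₂ pdown)) (poly k (λ _ → ℕP.≤-refl)) small
    correct : ∀ q → foldr (cons q) (start q) (reverse (proj₂ (down q))) ≡ f (proj₁ (proj₁ q)) (proj₂ (proj₁ q)) (proj₂ q)
    correct q rewrite down-correct q | LP.reverse-involutive (entries (proj₂ (proj₁ q)) (proj₂ q)) = ascend q (proj₂ (proj₁ q)) (proj₂ q)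

  pt-rec : ∀ {Γ A B} {{_ : Enc Γ}} {{_ : Enc A}} {{_ : Enc B}}
    {f : Γ → List A → B} {n : Γ → B} {c : Γ → A → List A → B → B} →
    (∀ γ → f γ [] ≡ n γ) → (∀ γ x xs → f γ (x ∷ xs) ≡ c γ x xs (f γ xs)) → PT n →
    PT {((Γ × A) × List A) × B} (λ q → c (proj₁ (proj₁ (proj₁ q))) (proj₂ (proj₁ (proj₁ q))) (proj₂ (proj₁ q)) (proj₂ q)) →
    Poly {Γ × List A} (λ q → size (f (proj₁ q) (proj₂ q))) →
    PT {Γ × List A} (λ q → f (proj₁ q) (proj₂ q))
  pt-rec {Γ} {A} {B} {f} {n} {c} fn fc pn pc fk =
    pt-∘ {f = λ q → (q , tt)} (pt-zrec {f = λ γ l _ → f γ l} {n = λ γ _ → n γ} {c = λ γ x xs _ r → c γ x xs r} {t = λ p → p}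
        (λ γ _ → fn γ) (λ γ x xs _ → fc γ x xs) (weaken pn)
        (pt-∘ {f = λ (z : (((Γ × A) × List A) × ⊤) × B) → (proj₁ (proj₁ z) , proj₂ z)} pc (pt-pair (weaken pt-proj₁) pt-proj₂))
        pt-id (λ _ → ℕP.≤-refl) (poly-∘ proj₁ fk poly-proj₁))
      (pt-pair pt-id (pt-const tt))

-- Natural numbers as lists of digits in bijective base 2: false is the digit 1, true the digit 2.

bcons : Bool → ℕ → ℕ
bcons false n = 1 + 2 * n
bcons true  n = 2 + 2 * n

val : List Bool → ℕ
val []      = 0
val (b ∷ l) = bcons b (val l)

inc : List Bool → List Bool
inc []          = false ∷ []
inc (false ∷ l) = true ∷ l
inc (true ∷ l)  = false ∷ inc l

dig : ℕ → List Bool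
dig zero    = []
dig (suc n) = inc (dig n)

bcons-suc : ∀ b n → bcons b (suc n) ≡ 2 + bcons b n
bcons-suc false n = cong suc (ℕP.*-suc 2 n)
bcons-suc true  n = cong (2 +_) (ℕP.*-suc 2 n)

val-inc : ∀ l → val (inc l) ≡ suc (val l)
val-inc []          = refl
val-inc (false ∷ l) = refl
val-inc (true ∷ l)  = trans (cong (bcons false) (val-inc l)) (bcons-suc false (val l))

val-dig : ∀ n → val (dig n) ≡ n
val-dig zero    = refl
val-dig (suc n) = trans (val-inc (dig n)) (cong suc (val-dig n))

dig-bcons : ∀ b n → dig (bcons b n) ≡ b ∷ dig n
dig-bcons false zero    = refl
dig-bcons true  zero    = refl
dig-bcons false (suc n) = trans (cong dig (bcons-suc false n)) (cong (inc ∘ inc) (dig-bcons false n))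
dig-bcons true  (suc n) = trans (cong dig (bcons-suc true n)) (cong (inc ∘ inc) (dig-bcons true n))

dig-val : ∀ l → dig (val l) ≡ l
dig-val []      = refl
dig-val (b ∷ l) = trans (dig-bcons b (val l)) (cong (b ∷_) (dig-val l))

instance
  enc-ℕ : Enc ℕ
  enc-ℕ = record { enc = λ n → enc (dig n) }

2^-mono : ∀ {m n} → m ≤ n → 2 ^ m ≤ 2 ^ n
2^-mono = ℕP.^-monoʳ-≤ 2

2^-cancel : ∀ {m n} → 2 ^ m ≤ 2 ^ n → m ≤ n
2^-cancel {m} {n} le with m ℕ.≤? n
... | yes m≤n = m≤n
... | no m≰n = contradiction (ℕP.<-≤-trans (ℕP.^-monoʳ-< 2 (s≤s (s≤s z≤n)) (ℕP.≰⇒> m≰n)) le) (ℕP.<-irrefl refl)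

2*-suc : ∀ n → 2 * suc n ≡ 2 + 2 * n
2*-suc n = ℕP.*-suc 2 n

val-lower : ∀ l → 2 ^ length l ≤ suc (val l)
val-lower [] = ℕP.≤-refl
val-lower (b ∷ l) = ℕP.≤-trans (ℕP.*-monoʳ-≤ 2 (val-lower l)) (ℕP.≤-trans (ℕP.≤-reflexive (2*-suc (val l))) (lem b))
  where
  lem : ∀ b → 2 + 2 * val l ≤ suc (bcons b (val l))
  lem false = ℕP.≤-refl
  lem true  = ℕP.n≤1+n _

bcons≤ : ∀ b n → bcons b n ≤ 2 + 2 * n
bcons≤ false n = ℕP.n≤1+n _
bcons≤ true  n = ℕP.≤-refl

double-bound : ∀ {x y} m → x ≤ 2 + 2 * y → 2 + y ≤ 2 ^ suc m → 2 + x ≤ 2 ^ suc (suc m)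
double-bound {x} {y} m x≤ y≤ = ℕP.≤-trans (s≤s (s≤s x≤)) (ℕP.≤-trans (ℕP.≤-reflexive (sym (ℕP.*-distribˡ-+ 2 2 y))) (ℕP.*-monoʳ-≤ 2 y≤))

val-upper : ∀ l → 2 + val l ≤ 2 ^ suc (length l)
val-upper []      = ℕP.≤-refl
val-upper (b ∷ l) = double-bound (length l) (bcons≤ b (val l)) (val-upper l)

size-bools≤ : ∀ (l : List Bool) → size l ≤ 4 * length l + 1
size-bools≤ [] = ℕP.≤-refl
size-bools≤ (b ∷ l) = ℕP.≤-trans (s≤s (ℕP.+-mono-≤ (sb b) (size-bools≤ l)))
  (ℕP.≤-reflexive (trans (sym (ℕP.+-assoc 4 (4 * length l) 1)) (cong (_+ 1) (sym (ℕP.*-suc 4 (length l))))))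
  where
  sb : ∀ b → size b ≤ 3
  sb true  = ℕP.≤-refl
  sb false = s≤s z≤n

length<size : ∀ {A} {{_ : Enc A}} (l : List A) → suc (length l) ≤ size l
length<size []      = ℕP.≤-refl
length<size (x ∷ l) = s≤s (ℕP.≤-trans (length<size l) (ℕP.m≤n+m _ (size x)))

ℕ-size : ∀ {n m} → n < 2 ^ m → size n ≤ 4 * m + 1
ℕ-size {n} {m} n< = ℕP.≤-trans (size-bools≤ (dig n)) (ℕP.+-monoˡ-≤ 1 (ℕP.*-monoʳ-≤ 4 (2^-cancel {length (dig n)} {m}
  (ℕP.≤-trans (val-lower (dig n)) (ℕP.≤-trans (ℕP.≤-reflexive (cong suc (val-dig n))) n<)))))

ℕ-value : ∀ n → 2 + n ≤ 2 ^ size n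
ℕ-value n = ℕP.≤-trans (ℕP.≤-reflexive (cong (2 +_) (sym (val-dig n)))) (ℕP.≤-trans (val-upper (dig n)) (2^-mono (length<size (dig n))))

poly-ℕ : ∀ {A} {{_ : Enc A}} {f : A → ℕ} {g : A → ℕ} → (∀ x → f x < 2 ^ g x) → Poly g → Poly (λ x → size (f x))
poly-ℕ {g = g} H pg = poly-≤ (λ x → ℕ-size {m = g x} (H x)) (poly-const 4 poly-* pg poly-+ poly-const 1)

-- The product `(2 + a) * (2 + b)` dominates the sum as well as the product of `a` and `b`, even
-- with 2 added. This is why bit bounds carry the summand 2 throughout.
+<2^ : ∀ {a b m n} → 2 + a ≤ 2 ^ m → 2 + b ≤ 2 ^ n → 2 + (a + b) ≤ 2 ^ (m + n)
+<2^ {a} {b} {m} {n} p q = begin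
  2 + (a + b)       ≤⟨ ℕP.+-monoʳ-≤ 2 (ℕP.+-mono-≤ (ℕP.m≤m+n a (a + 0)) (ℕP.≤-trans (ℕP.m≤m+n b (b + 0)) (ℕP.m≤m+n (2 * b) (2 + a * b)))) ⟩
  2 + (2 * a + (2 * b + (2 + a * b))) ≡⟨ arith a b ⟩
  (2 + a) * (2 + b) ≤⟨ ℕP.*-mono-≤ p q ⟩
  2 ^ m * 2 ^ n     ≡⟨ sym (ℕP.^-distribˡ-+-* 2 m n) ⟩
  2 ^ (m + n) ∎
  where
  open ℕP.≤-Reasoning
  arith : ∀ a b → 2 + (2 * a + (2 * b + (2 + a * b))) ≡ (2 + a) * (2 + b)
  arith = solve-∀

*<2^ : ∀ {a b m n} → 2 + a ≤ 2 ^ m → 2 + b ≤ 2 ^ n → 2 + a * b ≤ 2 ^ (m + n)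
*<2^ {a} {b} {m} {n} p q = begin
  2 + a * b         ≤⟨ ℕP.m≤m+n (2 + a * b) (2 + (2 * a + 2 * b)) ⟩
  2 + a * b + (2 + (2 * a + 2 * b)) ≡⟨ arith a b ⟩
  (2 + a) * (2 + b) ≤⟨ ℕP.*-mono-≤ p q ⟩
  2 ^ m * 2 ^ n     ≡⟨ sym (ℕP.^-distribˡ-+-* 2 m n) ⟩
  2 ^ (m + n) ∎
  where
  open ℕP.≤-Reasoning
  arith : ∀ a b → 2 + a * b + (2 + (2 * a + 2 * b)) ≡ (2 + a) * (2 + b)
  arith = solve-∀

val-size : ∀ (l : List Bool) → size (val l) ≡ size l
val-size l = cong size (dig-val l)

val-value : ∀ (l : List Bool) → 2 + val l ≤ 2 ^ size l
val-value l = ℕP.≤-trans (ℕ-value (val l)) (ℕP.≤-reflexive (cong (2 ^_) (val-size l)))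

module _ {Γ : Set} {{_ : Enc Γ}} where

  pt-val : {l : Γ → List Bool} → PT l → PT (λ γ → val (l γ))
  pt-val p = pt-∘ {g = val} (pt-recode (λ l → cong enc (dig-val l))) p

  pt-dig : {n : Γ → ℕ} → PT n → PT (λ γ → dig (n γ))
  pt-dig p = pt-∘ {g = dig} (pt-recode (λ n → refl)) p

  pt-bcons : {b : Γ → Bool} {n : Γ → ℕ} → PT b → PT n → PT (λ γ → bcons (b γ) (n γ))
  pt-bcons {b} {n} p q = pt-≗ (λ γ → cong (bcons (b γ)) (val-dig (n γ))) (pt-val (pt-∷ p (pt-dig q)))

  pt-digits : ∀ {B} {{_ : Enc B}} {f : Γ → ℕ → B} → PT {Γ × List Bool} (λ q → f (proj₁ q) (val (proj₂ q))) →
              PT {Γ × ℕ} (λ q → f (proj₁ q) (proj₂ q))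
  pt-digits {f = f} p = pt-≗ (λ q → cong (f (proj₁ q)) (val-dig (proj₂ q)))
    (pt-∘ {f = λ q → (proj₁ q , dig (proj₂ q))} p (pt-recode (λ q → refl)))

opaque
  pt-suc : ∀ {Γ} {{_ : Enc Γ}} {n : Γ → ℕ} → PT n → PT (λ γ → suc (n γ))
  pt-suc {n = n} p = pt-∘ {g = λ q → suc (proj₂ q)} {f = λ γ → (tt , n γ)} (pt-digits {f = λ _ n → suc n} rec) (pt-pair (pt-const tt) p)
    where
    eq : ∀ (γ : ⊤) x xs → suc (val (x ∷ xs)) ≡ (if x then bcons false (suc (val xs)) else bcons true (val xs))
    eq _ false xs = refl
    eq _ true  xs = sym (bcons-suc false (val xs))
    rec : PT {⊤ × List Bool} (λ q → suc (val (proj₂ q)))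
    rec = pt-rec {f = λ _ l → suc (val l)} {n = λ _ → 1} {c = λ _ x xs r → if x then bcons false r else bcons true (val xs)}
      (λ _ → refl) eq (pt-const 1)
      (pt-if (weaken (weaken var0)) (pt-bcons (pt-const false) var0) (pt-bcons (pt-const true) (pt-val (weaken var0))))
      (poly-ℕ {g = λ q → size (proj₂ q)} (λ q → val-value (proj₂ q)) poly-proj₂)

  pt-double : ∀ {Γ} {{_ : Enc Γ}} {n : Γ → ℕ} → PT n → PT (λ γ → 2 * n γ)
  pt-double {n = n} p = pt-∘ {g = λ q → 2 * proj₂ q} {f = λ γ → (tt , n γ)} (pt-digits {f = λ _ n → 2 * n} rec) (pt-pair (pt-const tt) p)
    where
    eq : ∀ (γ : ⊤) x xs → 2 * val (x ∷ xs) ≡ (if x then bcons true (bcons false (val xs)) else bcons true (2 * val xs))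
    eq _ false xs = 2*-suc (2 * val xs)
    eq _ true  xs = trans (2*-suc (suc (2 * val xs))) refl
    rec : PT {⊤ × List Bool} (λ q → 2 * val (proj₂ q))
    rec = pt-rec {f = λ _ l → 2 * val l} {n = λ _ → 0} {c = λ _ x xs r → if x then bcons true (bcons false (val xs)) else bcons true r}
      (λ _ → refl) eq (pt-const 0)
      (pt-if (weaken (weaken var0)) (pt-bcons (pt-const true) (pt-bcons (pt-const false) (pt-val (weaken var0)))) (pt-bcons (pt-const true) var0))
      (poly-ℕ {g = λ q → suc (size (proj₂ q))}
        (λ q → ℕP.≤-trans (ℕP.≤-trans (ℕP.n≤1+n _) (s≤s (s≤s (ℕP.m≤n+m _ 2)))) (ℕP.≤-trans (ℕP.≤-reflexive (sym (ℕP.*-distribˡ-+ 2 2 (val (proj₂ q))))) (ℕP.*-monoʳ-≤ 2 (val-value (proj₂ q)))))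
        (poly-const 1 poly-+ poly-proj₂))

isZero : ℕ → Bool
isZero zero    = true
isZero (suc _) = false

isZero-val : ∀ l → isZero (val l) ≡ listCase true (λ _ _ → false) l
isZero-val []          = refl
isZero-val (false ∷ l) = refl
isZero-val (true ∷ l)  = refl

opaque
  pt-isZero : ∀ {Γ} {{_ : Enc Γ}} {n : Γ → ℕ} → PT n → PT (λ γ → isZero (n γ))
  pt-isZero {n = n} p = pt-≗ (λ γ → trans (sym (isZero-val (dig (n γ)))) (cong isZero (val-dig (n γ))))
    (pt-listCase {n = λ _ → true} {c = λ _ _ _ → false} (pt-dig p) (pt-const true) (pt-const false))

  pt-pred : ∀ {Γ} {{_ : Enc Γ}} {n : Γ → ℕ} → PT n → PT (λ γ → ℕ.pred (n γ))
  pt-pred {n = n} p = pt-≗ (λ γ → trans (eq (dig (n γ))) (cong ℕ.pred (val-dig (n γ))))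
    (pt-listCase {n = λ _ → 0} {c = λ _ b l → if b then bcons false (val l) else 2 * val l} (pt-dig p) (pt-const 0)
      (pt-if (pt-∘ pt-proj₁ pt-proj₁) (pt-bcons (pt-const false) (pt-val (pt-∘ pt-proj₂ pt-proj₁))) (pt-double (pt-val (pt-∘ pt-proj₂ pt-proj₁)))))
    where
    eq : ∀ l → listCase 0 (λ b l → if b then bcons false (val l) else 2 * val l) l ≡ ℕ.pred (val l)
    eq []          = refl
    eq (false ∷ l) = refl
    eq (true ∷ l)  = refl

  pt-+ : ∀ {Γ} {{_ : Enc Γ}} {m n : Γ → ℕ} → PT m → PT n → PT (λ γ → m γ + n γ)
  pt-+ {m = m} {n} p q = pt-≗ (λ γ → cong₂ _+_ (val-dig (m γ)) (val-dig (n γ)))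
    (pt-∘ {g = λ (z : (⊤ × List Bool) × List Bool) → val (proj₂ (proj₁ z)) + val (proj₂ z)} rec (pt-pair (pt-pair (pt-const tt) (pt-dig p)) (pt-dig q)))
    where
    -- The digit of the second operand is added to `bcons b r` by one or two successors, so the
    -- recursion passes no carry.
    cn : Bool → List Bool → ℕ → ℕ
    cn b y r = listCase (bcons b r) (λ d _ → if d then suc (suc (bcons b r)) else suc (bcons b r)) y
    bcons-+ : ∀ b m n → bcons b (m + n) ≡ bcons b m + 2 * n
    bcons-+ false m n = cong suc (ℕP.*-distribˡ-+ 2 m n)
    bcons-+ true  m n = cong (2 +_) (ℕP.*-distribˡ-+ 2 m n)
    eq : ∀ (γ : ⊤) b x y → val (b ∷ x) + val y ≡ cn b y (val x + val (drop 1 y))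
    eq _ b x [] = trans (ℕP.+-identityʳ _) (cong (bcons b) (sym (ℕP.+-identityʳ (val x))))
    eq _ b x (false ∷ y) = trans (ℕP.+-suc (bcons b (val x)) (2 * val y)) (cong suc (sym (bcons-+ b (val x) (val y))))
    eq _ b x (true ∷ y) = trans (ℕP.+-suc (bcons b (val x)) (suc (2 * val y))) (cong suc (trans (ℕP.+-suc (bcons b (val x)) (2 * val y)) (cong suc (sym (bcons-+ b (val x) (val y))))))
    rec : PT {(⊤ × List Bool) × List Bool} (λ z → val (proj₂ (proj₁ z)) + val (proj₂ z))
    rec = pt-zrec {f = λ _ x y → val x + val y} {n = λ _ y → val y} {c = λ _ b _ y r → cn b y r} {t = drop 1}
      (λ _ _ → refl) eq (pt-val var0)
      (pt-listCase (weaken var0) bc (pt-if (pt-∘ pt-proj₁ pt-proj₁) (pt-suc (pt-suc (pt-∘ bc pt-proj₂))) (pt-suc (pt-∘ bc pt-proj₂))))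
      (pt-tail pt-id) size-drop₁
      (poly-ℕ {g = λ z → size (proj₂ (proj₁ z)) + size (proj₂ z)}
        (λ z → ℕP.≤-trans (ℕP.n≤1+n _) (+<2^ {m = size (proj₂ (proj₁ z))} (val-value (proj₂ (proj₁ z))) (val-value (proj₂ z))))
        (out-poly (weaken var0) poly-+ poly-proj₂))
      where
      bc : PT {(((⊤ × Bool) × List Bool) × List Bool) × ℕ} (λ q → bcons (proj₂ (proj₁ (proj₁ (proj₁ q)))) (proj₂ q))
      bc = pt-bcons (weaken (weaken (weaken var0))) var0

  pt-* : ∀ {Γ} {{_ : Enc Γ}} {m n : Γ → ℕ} → PT m → PT n → PT (λ γ → m γ * n γ)
  pt-* {m = m} {n} p q = pt-∘ {g = λ z → proj₂ z * proj₁ z} (pt-digits {f = λ n m → m * n} rec) (pt-pair q p)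
    where
    eq : ∀ (y : ℕ) b x → val (b ∷ x) * y ≡ (if b then y + (y + 2 * (val x * y)) else y + 2 * (val x * y))
    eq y false x = cong (y +_) (ℕP.*-assoc 2 (val x) y)
    eq y true  x = cong (λ z → y + (y + z)) (ℕP.*-assoc 2 (val x) y)
    rec : PT {ℕ × List Bool} (λ z → val (proj₂ z) * proj₁ z)
    rec = pt-rec {f = λ y x → val x * y} {n = λ _ → 0} {c = λ y b _ r → if b then y + (y + 2 * r) else y + 2 * r}
      (λ _ → refl) eq (pt-const 0)
      (pt-if (weaken (weaken var0)) (pt-+ y (pt-+ y (pt-double var0))) (pt-+ y (pt-double var0)))
      (poly-ℕ {g = λ z → size (proj₂ z) + size (proj₁ z)}
        (λ z → ℕP.≤-trans (ℕP.n≤1+n _) (*<2^ {m = size (proj₂ z)} (val-value (proj₂ z)) (ℕ-value (proj₁ z)))) (poly-proj₂ poly-+ poly-proj₁))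
      where
      y : PT {((ℕ × Bool) × List Bool) × ℕ} (λ q → proj₁ (proj₁ (proj₁ q)))
      y = weaken (weaken (weaken pt-id))

-- Comparison and difference are computed together, since at the lowest digit both depend on how the
-- remaining digits compare.
subBorrow : ℕ → ℕ → Bool × ℕ
subBorrow x y = (x ℕ.<ᵇ y) , (x ∸ y)

-- x - y for x = 2x' + dx and y = 2y' + dy, from the borrow and difference of x' and y'.
subStep : Bool → List Bool → Bool × ℕ → Bool × ℕ
subStep b y (true  , r) = true , 0
subStep b y (false , r) = listCase (false , bcons b r)
  (λ d _ → if d then (if isZero (ℕ.pred (bcons b r)) then (true , 0) else (false , ℕ.pred (ℕ.pred (bcons b r))))
           else (false , ℕ.pred (bcons b r))) y

<ᵇ-true : ∀ {m n} → m < n → (m ℕ.<ᵇ n) ≡ true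
<ᵇ-true {zero}  (s≤s _) = refl
<ᵇ-true {suc m} (s≤s p) = <ᵇ-true p

<ᵇ-false : ∀ {m n} → n ≤ m → (m ℕ.<ᵇ n) ≡ false
<ᵇ-false z≤n     = refl
<ᵇ-false (s≤s p) = <ᵇ-false p

bcons≡ : ∀ b n → bcons b n ≡ bcons b 0 + 2 * n
bcons≡ false n = refl
bcons≡ true  n = refl

subBorrow-shift : ∀ k x y → subBorrow (k + x) (k + y) ≡ subBorrow x y
subBorrow-shift zero    x y = refl
subBorrow-shift (suc k) x y = subBorrow-shift k x y

-- If the higher parts satisfy `x < y`, no choice of lowest digits can reverse it, because a digit
-- is at least 1 and at most 2. Otherwise twice the smaller higher part is cancelled on both sides
-- and only the digits are left to compare.
subStep-correct : ∀ b x y → subBorrow (val (b ∷ x)) (val y) ≡ subStep b y (subBorrow (val x) (val (drop 1 y)))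
subStep-correct b x [] = cong₂ _,_ (<ᵇ-false {bcons b (val x)} z≤n) refl
subStep-correct b x (d ∷ y) with val x ℕ.<? val y
... | yes x<y rewrite <ᵇ-true x<y = cong₂ _,_ (<ᵇ-true lt) (ℕP.m≤n⇒m∸n≡0 (ℕP.<⇒≤ lt))
  where
  lt : bcons b (val x) < bcons d (val y)
  lt = ℕP.≤-<-trans (bcons≤ b (val x)) (ℕP.≤-<-trans (ℕP.≤-trans (ℕP.≤-reflexive (sym (2*-suc (val x)))) (ℕP.*-monoʳ-≤ 2 x<y)) (l d))
    where
    l : ∀ d → 2 * val y < bcons d (val y)
    l false = ℕP.≤-refl
    l true  = s≤s (ℕP.n≤1+n _)
... | no x≮y = trans shifted (cong (subStep b (d ∷ y)) (sym (cong₂ _,_ (<ᵇ-false {val x} {val y} y≤x) refl)))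
  where
  y≤x : val y ≤ val x
  y≤x = ℕP.≮⇒≥ x≮y
  r = val x ∸ val y
  digit : ∀ b d r → subBorrow (bcons b r) (bcons d 0) ≡ subStep b (d ∷ y) (false , r)
  digit false false r = cong₂ _,_ (<ᵇ-false {2 * r} z≤n) refl
  digit true  false r = refl
  digit false true  zero = refl
  digit false true  (suc r) = refl
  digit true  true  r = cong₂ _,_ (<ᵇ-false {2 * r} z≤n) refl
  shifted : subBorrow (bcons b (val x)) (bcons d (val y)) ≡ subStep b (d ∷ y) (false , r)
  shifted = begin
    subBorrow (bcons b (val x)) (bcons d (val y))
      ≡⟨ cong (λ z → subBorrow (bcons b z) (bcons d (val y))) (sym (ℕP.m+[n∸m]≡n y≤x)) ⟩
    subBorrow (bcons b (val y + r)) (bcons d (val y))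
      ≡⟨ cong₂ subBorrow (lhs b) (rhs d) ⟩
    subBorrow (2 * val y + bcons b r) (2 * val y + bcons d 0)
      ≡⟨ subBorrow-shift (2 * val y) (bcons b r) (bcons d 0) ⟩
    subBorrow (bcons b r) (bcons d 0) ≡⟨ digit b d r ⟩
    subStep b (d ∷ y) (false , r) ∎
    where
    open ≡-Reasoning
    lhs : ∀ b → bcons b (val y + r) ≡ 2 * val y + bcons b r
    lhs false = l (val y) r
      where
      l : ∀ y r → 1 + 2 * (y + r) ≡ 2 * y + (1 + 2 * r)
      l = solve-∀
    lhs true = l (val y) r
      where
      l : ∀ y r → 2 + 2 * (y + r) ≡ 2 * y + (2 + 2 * r)
      l = solve-∀
    rhs : ∀ d → bcons d (val y) ≡ 2 * val y + bcons d 0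
    rhs false = ℕP.+-comm 1 (2 * val y)
    rhs true  = ℕP.+-comm 2 (2 * val y)

size-Bool≤ : ∀ (b : Bool) → size b ≤ 3
size-Bool≤ true  = ℕP.≤-refl
size-Bool≤ false = s≤s z≤n

opaque
  pt-subBorrow : ∀ {Γ} {{_ : Enc Γ}} {m n : Γ → ℕ} → PT m → PT n → PT (λ γ → subBorrow (m γ) (n γ))
  pt-subBorrow {m = m} {n} p q = pt-≗ (λ γ → cong₂ subBorrow (val-dig (m γ)) (val-dig (n γ)))
    (pt-∘ {g = λ (z : (⊤ × List Bool) × List Bool) → subBorrow (val (proj₂ (proj₁ z))) (val (proj₂ z))} rec (pt-pair (pt-pair (pt-const tt) (pt-dig p)) (pt-dig q)))
    where
    C : Set
    C = (((⊤ × Bool) × List Bool) × List Bool) × (Bool × ℕ)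
    subStep′ : Bool → List Bool → Bool × ℕ → Bool × ℕ
    subStep′ b y s = if proj₁ s then (true , 0) else listCase (false , bcons b (proj₂ s))
      (λ d _ → if d then (if isZero (ℕ.pred (bcons b (proj₂ s))) then (true , 0) else (false , ℕ.pred (ℕ.pred (bcons b (proj₂ s)))))
               else (false , ℕ.pred (bcons b (proj₂ s)))) y
    subStep≡ : ∀ b y s → subStep b y s ≡ subStep′ b y s
    subStep≡ b y (true  , r) = refl
    subStep≡ b y (false , r) = refl
    bc : PT {C} (λ q → bcons (proj₂ (proj₁ (proj₁ (proj₁ q)))) (proj₂ (proj₂ q)))
    bc = pt-bcons (weaken (weaken (weaken var0))) (pt-∘ pt-proj₂ pt-proj₂)
    bc′ : PT {(Bool × List Bool) × C} (λ q → bcons (proj₂ (proj₁ (proj₁ (proj₁ (proj₂ q))))) (proj₂ (proj₂ (proj₂ q))))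
    bc′ = pt-∘ bc pt-proj₂
    base : ∀ y → subBorrow 0 (val y) ≡ (not (isZero (val y)) , 0)
    base [] = refl
    base (false ∷ y) = refl
    base (true ∷ y) = refl
    pnot : ∀ {Γ} {{_ : Enc Γ}} {b : Γ → Bool} → PT b → PT (λ γ → not (b γ))
    pnot {b = b} p = pt-≗ (λ γ → l (b γ)) (pt-if p (pt-const false) (pt-const true))
      where
      l : ∀ b → (if b then false else true) ≡ not b
      l true = refl
      l false = refl
    rec : PT {(⊤ × List Bool) × List Bool} (λ z → subBorrow (val (proj₂ (proj₁ z))) (val (proj₂ z)))
    rec = pt-zrec {f = λ _ x y → subBorrow (val x) (val y)} {n = λ _ y → not (isZero (val y)) , 0} {c = λ _ b _ y r → subStep′ b y r} {t = drop 1}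
      (λ _ y → base y) (λ _ b x y → trans (subStep-correct b x y) (subStep≡ b y _))
      (pt-pair (pnot (pt-isZero (pt-val var0))) (pt-const 0))
      (pt-if (pt-∘ pt-proj₁ pt-proj₂) (pt-const (true , 0))
        (pt-listCase (weaken var0) (pt-pair (pt-const false) bc)
          (pt-if (pt-∘ pt-proj₁ pt-proj₁)
            (pt-if (pt-isZero (pt-pred bc′)) (pt-const (true , 0)) (pt-pair (pt-const false) (pt-pred (pt-pred bc′))))
            (pt-pair (pt-const false) (pt-pred bc′)))))
      (pt-tail pt-id) size-drop₁
      (poly-≤ (λ z → s≤s (ℕP.+-monoˡ-≤ _ (size-Bool≤ (val (proj₂ (proj₁ z)) ℕ.<ᵇ val (proj₂ z)))))
        (poly-const 1 poly-+ (poly-const 3 poly-+ poly-ℕ {f = λ z → val (proj₂ (proj₁ z)) ∸ val (proj₂ z)} {g = λ z → size (proj₂ (proj₁ z))}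
          (λ z → ℕP.≤-<-trans (ℕP.m∸n≤m (val (proj₂ (proj₁ z))) (val (proj₂ z))) (ℕP.≤-trans (ℕP.n≤1+n _) (val-value (proj₂ (proj₁ z)))))
          (out-poly (weaken var0)))))

  pt-<ᵇ : ∀ {Γ} {{_ : Enc Γ}} {m n : Γ → ℕ} → PT m → PT n → PT (λ γ → m γ ℕ.<ᵇ n γ)
  pt-<ᵇ p q = pt-∘ pt-proj₁ (pt-subBorrow p q)

  pt-∸ : ∀ {Γ} {{_ : Enc Γ}} {m n : Γ → ℕ} → PT m → PT n → PT (λ γ → m γ ∸ n γ)
  pt-∸ p q = pt-∘ pt-proj₂ (pt-subBorrow p q)

-- Division with remainder and the Euclidean algorithm.

-- Long division in bijective base 2. From `r < d` the next partial remainder is at most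
-- `2 + 2 * r`, hence at most `2 * d`, so up to two subtractions may be due; they give the quotient
-- `2 * q`, `1 + 2 * q` or `2 + 2 * q`.
divStep : ℕ → Bool → ℕ × ℕ → ℕ × ℕ
divStep d b (q , r) =
  if bcons b r ℕ.<ᵇ d then (2 * q , bcons b r)
  else (if (bcons b r ∸ d) ℕ.<ᵇ d then (bcons false q , bcons b r ∸ d) else (bcons true q , bcons b r ∸ d ∸ d))

divDigits : ℕ → List Bool → ℕ × ℕ
divDigits d []      = 0 , 0
divDigits d (b ∷ l) = divStep d b (divDigits d l)

quot rem : ℕ → ℕ → ℕ
quot n d = proj₁ (divDigits d (dig n))
rem  n d = proj₂ (divDigits d (dig n))

if-elim : ∀ {A : Set} (P : A → Set) (b : Bool) {x y : A} → (b ≡ true → P x) → (b ≡ false → P y) → P (if b then x else y)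
if-elim P true  f g = f refl
if-elim P false f g = g refl

<ᵇ-true⁻¹ : ∀ {m n} → (m ℕ.<ᵇ n) ≡ true → m < n
<ᵇ-true⁻¹ {m} {n} e = ℕP.<ᵇ⇒< m n (subst Data.Bool.T (sym e) tt)

<ᵇ-false⁻¹ : ∀ {m n} → (m ℕ.<ᵇ n) ≡ false → n ≤ m
<ᵇ-false⁻¹ {m} {n} e = ℕP.≮⇒≥ (λ lt → subst Data.Bool.T e (ℕP.<⇒<ᵇ lt))

divDigits-correct : ∀ d l → 0 < d → (val l ≡ proj₁ (divDigits d l) * d + proj₂ (divDigits d l)) × (proj₂ (divDigits d l) < d)
divDigits-correct d [] d>0 = refl , d>0
divDigits-correct d (b ∷ l) d>0 with divDigits d l | divDigits-correct d l d>0
... | q , r | eq , r<d = if-elim P (m ℕ.<ᵇ d) c₁ (λ e → if-elim P ((m ∸ d) ℕ.<ᵇ d) (c₂ e) (c₃ e))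
  where
  m = bcons b r
  P : ℕ × ℕ → Set
  P (q′ , r′) = (val (b ∷ l) ≡ q′ * d + r′) × (r′ < d)
  base : val (b ∷ l) ≡ 2 * q * d + m
  base = trans (bcons≡ b (val l)) (trans (cong (λ z → bcons b 0 + 2 * z) eq) (trans (l₁ (bcons b 0) q d r) (cong (2 * q * d +_) (sym (bcons≡ b r)))))
    where
    l₁ : ∀ c q d r → c + 2 * (q * d + r) ≡ 2 * q * d + (c + 2 * r)
    l₁ = solve-∀
  c₁ : (m ℕ.<ᵇ d) ≡ true → P (2 * q , m)
  c₁ e = base , <ᵇ-true⁻¹ e
  c₂ : (m ℕ.<ᵇ d) ≡ false → ((m ∸ d) ℕ.<ᵇ d) ≡ true → P (bcons false q , m ∸ d)
  c₂ e e′ = trans base (trans (cong (2 * q * d +_) (sym (ℕP.m+[n∸m]≡n {d} {m} (<ᵇ-false⁻¹ {m} {d} e)))) (l₁ q d (m ∸ d))) , <ᵇ-true⁻¹ e′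
    where
    l₁ : ∀ q d k → 2 * q * d + (d + k) ≡ (1 + 2 * q) * d + k
    l₁ = solve-∀
  c₃ : (m ℕ.<ᵇ d) ≡ false → ((m ∸ d) ℕ.<ᵇ d) ≡ false → P (bcons true q , m ∸ d ∸ d)
  c₃ e e′ = trans base (trans (cong (2 * q * d +_) (sym (trans (cong (d +_) (ℕP.m+[n∸m]≡n d≤)) (ℕP.m+[n∸m]≡n {d} {m} (<ᵇ-false⁻¹ {m} {d} e))))) (l₁ q d (m ∸ d ∸ d)))
           , ℕP.≤-<-trans (ℕP.≤-trans (ℕP.∸-monoˡ-≤ d (ℕP.≤-trans (ℕP.∸-monoˡ-≤ d m≤) (ℕP.≤-reflexive (l₂ d)))) (ℕP.≤-reflexive (ℕP.n∸n≡0 d))) d>0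
    where
    d≤ = <ᵇ-false⁻¹ {m ∸ d} {d} e′
    l₁ : ∀ q d k → 2 * q * d + (d + (d + k)) ≡ (2 + 2 * q) * d + k
    l₁ = solve-∀
    m≤ : m ≤ 2 * d
    m≤ = ℕP.≤-trans (bcons≤ b r) (ℕP.≤-trans (ℕP.≤-reflexive (sym (2*-suc r))) (ℕP.*-monoʳ-≤ 2 r<d))
    l₂ : ∀ d → 2 * d ∸ d ≡ d
    l₂ d = trans (ℕP.m+n∸m≡n d (d + 0)) (ℕP.+-identityʳ d)

-- A size bound is owed at every input, also at `d = 0`, where `divDigits-correct` says nothing.
divDigits-bound : ∀ d l → (2 + proj₁ (divDigits d l) ≤ 2 ^ suc (length l)) × (2 + proj₂ (divDigits d l) ≤ 2 ^ suc (length l))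
divDigits-bound d [] = ℕP.≤-refl , ℕP.≤-refl
divDigits-bound d (b ∷ l) with divDigits d l | divDigits-bound d l
... | q , r | q≤ , r≤ = if-elim P (bcons b r ℕ.<ᵇ d)
      (λ _ → double-bound (length l) (ℕP.m≤n+m (2 * q) 2) q≤ , rb ℕP.≤-refl)
      (λ _ → if-elim P ((bcons b r ∸ d) ℕ.<ᵇ d)
        (λ _ → double-bound (length l) (bcons≤ false q) q≤ , rb (ℕP.m∸n≤m (bcons b r) d))
        (λ _ → double-bound (length l) (bcons≤ true q) q≤ , rb (ℕP.≤-trans (ℕP.m∸n≤m (bcons b r ∸ d) d) (ℕP.m∸n≤m (bcons b r) d))))
  where
  P : ℕ × ℕ → Set
  P (q′ , r′) = (2 + q′ ≤ 2 ^ suc (length (b ∷ l))) × (2 + r′ ≤ 2 ^ suc (length (b ∷ l)))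
  rb : ∀ {x} → x ≤ bcons b r → 2 + x ≤ 2 ^ suc (suc (length l))
  rb x≤ = double-bound (length l) (ℕP.≤-trans x≤ (bcons≤ b r)) r≤

quot-rem : ∀ n d → 0 < d → n ≡ quot n d * d + rem n d
quot-rem n d d>0 = trans (sym (val-dig n)) (proj₁ (divDigits-correct d (dig n) d>0))

rem< : ∀ n d → 0 < d → rem n d < d
rem< n d d>0 = proj₂ (divDigits-correct d (dig n) d>0)

opaque
  pt-divDigits : PT {ℕ × List Bool} (λ z → divDigits (proj₁ z) (proj₂ z))
  pt-divDigits = pt-rec {f = divDigits} {n = λ _ → 0 , 0} {c = λ d b _ s → divStep d b s}
    (λ _ → refl) (λ _ _ _ → refl) (pt-const (0 , 0))
    (pt-if (pt-<ᵇ m d) (pt-pair (pt-double q) m)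
      (pt-if (pt-<ᵇ (pt-∸ m d) d) (pt-pair (pt-bcons (pt-const false) q) (pt-∸ m d)) (pt-pair (pt-bcons (pt-const true) q) (pt-∸ (pt-∸ m d) d))))
    (poly-const 1 poly-+
      (poly-ℕ {f = λ z → proj₁ (divDigits (proj₁ z) (proj₂ z))} {g = λ z → size (proj₂ z)}
         (λ z → ℕP.≤-trans (ℕP.≤-trans (ℕP.n≤1+n _) (proj₁ (divDigits-bound (proj₁ z) (proj₂ z)))) (2^-mono (length<size (proj₂ z)))) poly-proj₂
       poly-+ poly-ℕ {f = λ z → proj₂ (divDigits (proj₁ z) (proj₂ z))} {g = λ z → size (proj₂ z)}
         (λ z → ℕP.≤-trans (ℕP.≤-trans (ℕP.n≤1+n _) (proj₂ (divDigits-bound (proj₁ z) (proj₂ z)))) (2^-mono (length<size (proj₂ z)))) poly-proj₂))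
    where
    C : Set
    C = ((ℕ × Bool) × List Bool) × (ℕ × ℕ)
    m : PT {C} (λ z → bcons (proj₂ (proj₁ (proj₁ z))) (proj₂ (proj₂ z)))
    m = pt-bcons (weaken (weaken var0)) (pt-∘ pt-proj₂ pt-proj₂)
    d : PT {C} (λ z → proj₁ (proj₁ (proj₁ z)))
    d = weaken (weaken (weaken pt-id))
    q : PT {C} (λ z → proj₁ (proj₂ z))
    q = pt-∘ pt-proj₁ pt-proj₂

  pt-quot : ∀ {Γ} {{_ : Enc Γ}} {m n : Γ → ℕ} → PT m → PT n → PT (λ γ → quot (m γ) (n γ))
  pt-quot p q = pt-∘ pt-proj₁ (pt-app₂ {g = divDigits} pt-divDigits q (pt-dig p))

  pt-rem : ∀ {Γ} {{_ : Enc Γ}} {m n : Γ → ℕ} → PT m → PT n → PT (λ γ → rem (m γ) (n γ))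
  pt-rem p q = pt-∘ pt-proj₂ (pt-app₂ {g = divDigits} pt-divDigits q (pt-dig p))

euclidStep : ℕ × ℕ → ℕ × ℕ
euclidStep (a , b) = if isZero b then (a , b) else (b , rem a b)

steps : ∀ {A : Set} → (A → A) → A → List Bool → A
steps f = foldl (λ x _ → f x)

-- Once the pair is in order, each step at least halves its product, so the digits of the product
-- count the steps. Of the two extra steps one puts the pair in order; the other is due to a number
-- with `n` digits being below `2 ^ (n + 1)` only.
euclidFuel : ℕ → ℕ → List Bool
euclidFuel a b = true ∷ true ∷ dig (a * b)

gcd′ : ℕ → ℕ → ℕ
gcd′ a b = proj₁ (steps euclidStep (a , b) (euclidFuel a b))

-- The sum bounds both entries throughout the iteration, which is the size bound that the loop
-- needs.
euclid-sum : ∀ p → proj₁ (euclidStep p) + proj₂ (euclidStep p) ≤ proj₁ p + proj₂ p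
euclid-sum (a , zero) = ℕP.≤-refl
euclid-sum (a , suc b) = ℕP.≤-trans (ℕP.+-monoʳ-≤ (suc b) (ℕP.≤-trans (ℕP.m≤n+m (rem a (suc b)) (quot a (suc b) * suc b)) (ℕP.≤-reflexive (sym (quot-rem a (suc b) (s≤s z≤n))))))
  (ℕP.≤-reflexive (ℕP.+-comm (suc b) a))

euclid-sums : ∀ p l → proj₁ (steps euclidStep p l) + proj₂ (steps euclidStep p l) ≤ proj₁ p + proj₂ p
euclid-sums p []      = ℕP.≤-refl
euclid-sums p (_ ∷ l) = ℕP.≤-trans (euclid-sums (euclidStep p) l) (euclid-sum p)

euclid-zero : ∀ a l → steps euclidStep (a , 0) l ≡ (a , 0)
euclid-zero a []      = refl
euclid-zero a (_ ∷ l) = euclid-zero a l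

-- One step halves the product of the two numbers, once they are in order.
rem-halves : ∀ a b → suc b ≤ a → 2 * (suc b * rem a (suc b)) ≤ a * suc b
rem-halves a b b≤a = begin
  2 * (suc b * r)  ≡⟨ l (suc b) r ⟩
  (r + r) * suc b  ≤⟨ ℕP.*-monoˡ-≤ (suc b) r+r≤a ⟩
  a * suc b ∎
  where
  open ℕP.≤-Reasoning
  r = rem a (suc b)
  q = quot a (suc b)
  l : ∀ b r → 2 * (b * r) ≡ (r + r) * b
  l = solve-∀
  eq : a ≡ q * suc b + r
  eq = quot-rem a (suc b) (s≤s z≤n)
  r< : r < suc b
  r< = rem< a (suc b) (s≤s z≤n)
  q>0 : 0 < q
  q>0 = ℕP.n≢0⇒n>0 λ q≡0 → ℕP.<-irrefl refl (ℕP.<-≤-trans (subst (_< suc b) (sym (trans eq (cong (λ z → z * suc b + r) q≡0))) r<) b≤a)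
  r+r≤a : r + r ≤ a
  r+r≤a = ℕP.≤-trans (ℕP.+-monoˡ-≤ r (ℕP.≤-trans (ℕP.<⇒≤ r<) (ℕP.≤-trans (ℕP.≤-reflexive (sym (ℕP.*-identityˡ (suc b)))) (ℕP.*-monoˡ-≤ (suc b) q>0))))
            (ℕP.≤-reflexive (sym eq))

euclid-ends : ∀ a b l → b ≤ a → a * b < 2 ^ length l → proj₂ (steps euclidStep (a , b) l) ≡ 0
euclid-ends a zero    l b≤a ab< = cong proj₂ (euclid-zero a l)
euclid-ends (suc a) (suc b) [] b≤a (s≤s ())
euclid-ends a (suc b) (_ ∷ l) b≤a ab< = euclid-ends (suc b) (rem a (suc b)) l (ℕP.<⇒≤ (rem< a (suc b) (s≤s z≤n)))
  (ℕP.*-cancelˡ-< 2 _ _ (ℕP.≤-<-trans (rem-halves a b b≤a) ab<))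

euclid-finishes : ∀ a b → proj₂ (steps euclidStep (a , b) (euclidFuel a b)) ≡ 0
euclid-finishes a zero    = cong proj₂ (euclid-zero a (euclidFuel a zero))
euclid-finishes a (suc b) = euclid-ends (suc b) (rem a (suc b)) (true ∷ dig (a * suc b)) (ℕP.<⇒≤ (rem< a (suc b) (s≤s z≤n)))
  (ℕP.≤-<-trans (ℕP.≤-trans (ℕP.≤-reflexive (ℕP.*-comm (suc b) _)) (ℕP.*-monoˡ-≤ (suc b)
     (ℕP.≤-trans (ℕP.m≤n+m (rem a (suc b)) (quot a (suc b) * suc b)) (ℕP.≤-reflexive (sym (quot-rem a (suc b) (s≤s z≤n)))))))
   (ℕP.≤-trans (ℕP.≤-trans (ℕP.n≤1+n _) (ℕP.≤-reflexive (cong (2 +_) (sym (val-dig (a * suc b)))))) (val-upper (dig (a * suc b)))))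

opaque
  pt-euclidStep : ∀ {Γ} {{_ : Enc Γ}} {p : Γ → ℕ × ℕ} → PT p → PT (λ γ → euclidStep (p γ))
  pt-euclidStep p = pt-if (pt-isZero (pt-∘ pt-proj₂ p)) (pt-pair (pt-∘ pt-proj₁ p) (pt-∘ pt-proj₂ p))
    (pt-pair (pt-∘ pt-proj₂ p) (pt-rem (pt-∘ pt-proj₁ p) (pt-∘ pt-proj₂ p)))

  pt-gcd : ∀ {Γ} {{_ : Enc Γ}} {m n : Γ → ℕ} → PT m → PT n → PT (λ γ → gcd′ (m γ) (n γ))
  pt-gcd {Γ} p q = pt-∘ {g = λ z → gcd′ (proj₁ z) (proj₂ z)} (pt-∘ pt-proj₁ (pt-foldl {step = λ _ s _ → euclidStep s} {l = λ (z : ℕ × ℕ) → euclidFuel (proj₁ z) (proj₂ z)}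
      (pt-euclidStep (weaken var0)) pt-id (pt-∷ (pt-const true) (pt-∷ (pt-const true) (pt-dig (pt-* pt-proj₁ pt-proj₂))))
      (poly-const 1 poly-+ (szP poly-+ szP)) bound)) (pt-pair p q)
    where
    sz : ℕ × ℕ → ℕ
    sz z = 4 * (size (proj₁ z) + size (proj₂ z)) + 1
    szP : Poly sz
    szP = poly-const 4 poly-* (poly-proj₁ poly-+ poly-proj₂) poly-+ poly-const 1
    bound : ∀ z l₁ l₂ → euclidFuel (proj₁ z) (proj₂ z) ≡ l₁ ++ l₂ → size (steps euclidStep z l₁) ≤ 1 + (sz z + sz z)
    bound z l₁ l₂ _ = s≤s (ℕP.+-mono-≤ (ℕ-size {proj₁ (steps euclidStep z l₁)} {m = size (proj₁ z) + size (proj₂ z)} (ℕP.≤-<-trans (ℕP.m≤m+n (proj₁ (steps euclidStep z l₁)) _) s<))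
                                   (ℕ-size {proj₂ (steps euclidStep z l₁)} {m = size (proj₁ z) + size (proj₂ z)} (ℕP.≤-<-trans (ℕP.m≤n+m _ (proj₁ (steps euclidStep z l₁))) s<)))
      where
      s< : proj₁ (steps euclidStep z l₁) + proj₂ (steps euclidStep z l₁) < 2 ^ (size (proj₁ z) + size (proj₂ z))
      s< = ℕP.≤-<-trans (euclid-sums z l₁) (ℕP.≤-trans (ℕP.n≤1+n _) (+<2^ {m = size (proj₁ z)} (ℕ-value (proj₁ z)) (ℕ-value (proj₂ z))))

open import Data.Integer as ℤ using (ℤ; +_; -[1+_])
import Data.Integer.Properties as ℤP
import Data.Integer.Tactic.RingSolver as ℤSolver
import Data.Nat.Divisibility as ND
open import Data.Nat.Divisibility using (_∣_)
open import Data.List.Membership.Propositional using (_∈_)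
open import Data.List.Membership.Propositional.Properties using (∈-++⁺ˡ; ∈-++⁺ʳ; ∈-++⁻; ∈-map⁺; ∈-map⁻)
import Data.Nat.Binary as ℕᵇ
import Data.Nat.Binary.Properties as ℕᵇP

-- Integers

unsign : ℤ → Bool × ℕ
unsign (+ n)    = false , n
unsign -[1+ n ] = true , n

resign : Bool × ℕ → ℤ
resign (false , n) = + n
resign (true  , n) = -[1+ n ]

unsign-resign : ∀ p → unsign (resign p) ≡ p
unsign-resign (false , n) = refl
unsign-resign (true  , n) = refl

instance
  enc-ℤ : Enc ℤ
  enc-ℤ = record { enc = λ z → enc (unsign z) }

ℤ-size : ∀ {z m} → ℤ.∣ z ∣ < 2 ^ m → size z ≤ 4 * m + 5
ℤ-size {+ n} {m} lt = ℕP.≤-trans (s≤s (s≤s (ℕ-size {n} {m} lt)))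
  (ℕP.≤-trans (ℕP.≤-reflexive (ℕP.+-comm 2 (4 * m + 1))) (ℕP.≤-trans (ℕP.≤-reflexive (ℕP.+-assoc (4 * m) 1 2)) (ℕP.+-monoʳ-≤ (4 * m) (s≤s (s≤s (s≤s z≤n))))))
ℤ-size { -[1+ n ]} {m} lt = ℕP.≤-trans (s≤s (s≤s (s≤s (s≤s (ℕ-size {n} {m} (ℕP.<-trans (ℕP.n<1+n n) lt))))))
  (ℕP.≤-reflexive (trans (ℕP.+-comm 4 (4 * m + 1)) (ℕP.+-assoc (4 * m) 1 4)))

ℤ-value : ∀ z → 2 + ℤ.∣ z ∣ ≤ 2 ^ size z
ℤ-value (+ n)    = ℕP.≤-trans (ℕ-value n) (2^-mono {size n} (ℕP.m≤n+m (size n) 2))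
ℤ-value -[1+ n ] = ℕP.≤-trans (s≤s (ℕ-value n)) (ℕP.≤-trans (ℕP.+-monoˡ-≤ (2 ^ size n) (ℕP.m^n>0 2 (size n)))
   (ℕP.≤-trans (ℕP.≤-reflexive (cong (λ z → 2 ^ size n + z) (sym (ℕP.+-identityʳ (2 ^ size n))))) (2^-mono {suc (size n)} (ℕP.+-monoˡ-≤ (size n) {1} {4} (s≤s z≤n)))))

negate : ℤ → ℤ
negate z = if proj₁ (unsign z) then + suc (proj₂ (unsign z))
           else (if isZero (proj₂ (unsign z)) then + 0 else -[1+ ℕ.pred (proj₂ (unsign z)) ])

negate≡ : ∀ z → negate z ≡ ℤ.- z
negate≡ (+ zero)   = refl
negate≡ (+ suc n)  = refl
negate≡ -[1+ n ]   = refl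

monusℤ : ℕ → ℕ → ℤ
monusℤ m n = if m ℕ.<ᵇ n then -[1+ ℕ.pred (n ∸ m) ] else + (m ∸ n)

monusℤ≡ : ∀ m n → monusℤ m n ≡ m ℤ.⊖ n
monusℤ≡ m n = if-elim (_≡ m ℤ.⊖ n) (m ℕ.<ᵇ n)
  (λ e → trans (l (n ∸ m) (ℕP.m<n⇒0<n∸m {m} {n} (<ᵇ-true⁻¹ {m} {n} e))) (sym (ℤP.⊖-< {m} {n} (<ᵇ-true⁻¹ {m} {n} e))))
  (λ e → sym (ℤP.⊖-≥ {m} {n} (<ᵇ-false⁻¹ {m} {n} e)))
  where
  l : ∀ k → 0 < k → -[1+ ℕ.pred k ] ≡ ℤ.- (+ k)
  l (suc k) _ = refl

addℤ : ℤ → ℤ → ℤ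
addℤ x y = if proj₁ (unsign x)
  then (if proj₁ (unsign y) then -[1+ suc (proj₂ (unsign x) + proj₂ (unsign y)) ] else monusℤ (proj₂ (unsign y)) (suc (proj₂ (unsign x))))
  else (if proj₁ (unsign y) then monusℤ (proj₂ (unsign x)) (suc (proj₂ (unsign y))) else + (proj₂ (unsign x) + proj₂ (unsign y)))

addℤ≡ : ∀ x y → addℤ x y ≡ x ℤ.+ y
addℤ≡ (+ m)    (+ n)    = refl
addℤ≡ (+ m)    -[1+ n ] = monusℤ≡ m (suc n)
addℤ≡ -[1+ m ] (+ n)    = monusℤ≡ n (suc m)
addℤ≡ -[1+ m ] -[1+ n ] = refl

absℤ : ℤ → ℕ
absℤ z = if proj₁ (unsign z) then suc (proj₂ (unsign z)) else proj₂ (unsign z)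

absℤ≡ : ∀ z → absℤ z ≡ ℤ.∣ z ∣
absℤ≡ (+ n)    = refl
absℤ≡ -[1+ n ] = refl

mulℤ : ℤ → ℤ → ℤ
mulℤ x y = if proj₁ (unsign x)
  then (if proj₁ (unsign y) then + (ℤ.∣ x ∣ * ℤ.∣ y ∣) else ℤ.- (+ (ℤ.∣ x ∣ * ℤ.∣ y ∣)))
  else (if proj₁ (unsign y) then ℤ.- (+ (ℤ.∣ x ∣ * ℤ.∣ y ∣)) else + (ℤ.∣ x ∣ * ℤ.∣ y ∣))

mulℤ≡ : ∀ x y → mulℤ x y ≡ x ℤ.* y
mulℤ≡ (+ m)    (+ n)    = sym (ℤP.+◃n≡+n (m * n))
mulℤ≡ (+ m)    -[1+ n ] = sym (ℤP.-◃n≡-n (m * suc n))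
mulℤ≡ -[1+ m ] (+ n)    = sym (ℤP.-◃n≡-n (suc m * n))
mulℤ≡ -[1+ m ] -[1+ n ] = refl

divℤ : ℤ → ℕ → ℤ
divℤ z g = if proj₁ (unsign z) then ℤ.- (+ quot ℤ.∣ z ∣ g) else + quot ℤ.∣ z ∣ g

-- A negative number `- (n + 1)` has residue `d - 1 - (n mod d)`.
modℤ : ℤ → ℕ → ℕ
modℤ z d = if proj₁ (unsign z) then d ∸ suc (rem (proj₂ (unsign z)) d) else rem (proj₂ (unsign z)) d

isZeroℤ : ℤ → Bool
isZeroℤ z = isZero ℤ.∣ z ∣

module _ {Γ : Set} {{_ : Enc Γ}} where
  pt-unsign : {z : Γ → ℤ} → PT z → PT (λ γ → unsign (z γ))
  pt-unsign p = pt-∘ {g = unsign} (pt-recode (λ _ → refl)) p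

  pt-resign : {z : Γ → Bool × ℕ} → PT z → PT (λ γ → resign (z γ))
  pt-resign p = pt-∘ {g = resign} (pt-recode (λ z → cong enc (unsign-resign z))) p

  pt-pos : {n : Γ → ℕ} → PT n → PT (λ γ → + n γ)
  pt-pos p = pt-resign (pt-pair (pt-const false) p)

  pt--[1+_] : {n : Γ → ℕ} → PT n → PT (λ γ → -[1+ n γ ])
  pt--[1+ p ] = pt-resign (pt-pair (pt-const true) p)

  private
    sgn : {z : Γ → ℤ} → PT z → PT (λ γ → proj₁ (unsign (z γ)))
    sgn p = pt-∘ pt-proj₁ (pt-unsign p)
    mag : {z : Γ → ℤ} → PT z → PT (λ γ → proj₂ (unsign (z γ)))
    mag p = pt-∘ pt-proj₂ (pt-unsign p)
    pt-monusℤ : {m n : Γ → ℕ} → PT m → PT n → PT (λ γ → monusℤ (m γ) (n γ))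
    pt-monusℤ p q = pt-if (pt-<ᵇ p q) (pt--[1+ pt-pred (pt-∸ q p) ]) (pt-pos (pt-∸ p q))

  opaque
    pt-neg : {z : Γ → ℤ} → PT z → PT (λ γ → ℤ.- z γ)
    pt-neg {z} p = pt-≗ (λ γ → negate≡ (z γ)) (pt-if (sgn p) (pt-pos (pt-suc (mag p))) (pt-if (pt-isZero (mag p)) (pt-const (+ 0)) (pt--[1+ pt-pred (mag p) ])))

    pt-addℤ : {x y : Γ → ℤ} → PT x → PT y → PT (λ γ → x γ ℤ.+ y γ)
    pt-addℤ {x} {y} p q = pt-≗ (λ γ → addℤ≡ (x γ) (y γ)) (pt-if (sgn p)
      (pt-if (sgn q) (pt--[1+ pt-suc (pt-+ (mag p) (mag q)) ]) (pt-monusℤ (mag q) (pt-suc (mag p))))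
      (pt-if (sgn q) (pt-monusℤ (mag p) (pt-suc (mag q))) (pt-pos (pt-+ (mag p) (mag q)))))

    pt-abs : {z : Γ → ℤ} → PT z → PT (λ γ → ℤ.∣ z γ ∣)
    pt-abs {z} p = pt-≗ (λ γ → absℤ≡ (z γ)) (pt-if (sgn p) (pt-suc (mag p)) (mag p))

    pt-mulℤ : {x y : Γ → ℤ} → PT x → PT y → PT (λ γ → x γ ℤ.* y γ)
    pt-mulℤ {x} {y} p q = pt-≗ (λ γ → mulℤ≡ (x γ) (y γ)) (pt-if (sgn p) (pt-if (sgn q) pos (pt-neg pos)) (pt-if (sgn q) (pt-neg pos) pos))
      where
      pos : PT (λ γ → + (ℤ.∣ x γ ∣ * ℤ.∣ y γ ∣))
      pos = pt-pos (pt-* (pt-abs p) (pt-abs q))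

    pt-divℤ : {z : Γ → ℤ} {g : Γ → ℕ} → PT z → PT g → PT (λ γ → divℤ (z γ) (g γ))
    pt-divℤ p q = pt-if (sgn p) (pt-neg (pt-pos (pt-quot (pt-abs p) q))) (pt-pos (pt-quot (pt-abs p) q))

    pt-modℤ : {z : Γ → ℤ} {d : Γ → ℕ} → PT z → PT d → PT (λ γ → modℤ (z γ) (d γ))
    pt-modℤ p q = pt-if (sgn p) (pt-∸ q (pt-suc (pt-rem (mag p) q))) (pt-rem (mag p) q)

    pt-isZeroℤ : {z : Γ → ℤ} → PT z → PT (λ γ → isZeroℤ (z γ))
    pt-isZeroℤ p = pt-isZero (pt-abs p)

-- List operations, and bounds in a single numerical variable.

headOr : ∀ {A : Set} → A → List A → A
headOr d []      = d
headOr d (x ∷ l) = x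

pt-headOr : ∀ {Γ A} {{_ : Enc Γ}} {{_ : Enc A}} {d : Γ → A} {l : Γ → List A} → PT d → PT l → PT (λ γ → headOr (d γ) (l γ))
pt-headOr {d = d} {l} p q = pt-≗ (λ γ → eq (d γ) (l γ)) (pt-listCase {c = λ _ x _ → x} q p (pt-∘ pt-proj₁ pt-proj₁))
  where
  eq : ∀ {A : Set} (d : A) l → listCase d (λ x _ → x) l ≡ headOr d l
  eq d []      = refl
  eq d (x ∷ l) = refl

size-map : ∀ {A B} {{_ : Enc A}} {{_ : Enc B}} (f : A → B) M (l : List A) → (∀ m₁ x m₂ → l ≡ m₁ ++ x ∷ m₂ → size (f x) ≤ M) →
           size (map f l) ≤ 1 + length l * (1 + M)
size-map f M [] H = ℕP.≤-refl
size-map f M (x ∷ l) H = ℕP.≤-trans (s≤s (ℕP.+-mono-≤ (H [] x l refl) (size-map f M l (λ m₁ y m₂ eq → H (x ∷ m₁) y m₂ (cong (x ∷_) eq)))))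
  (ℕP.≤-reflexive (cong suc (ℕP.+-suc M (length l * (1 + M)))))

size-append : ∀ {A} {{_ : Enc A}} (l m : List A) → size (l ++ m) ≤ size l + size m
size-append []      m = ℕP.n≤1+n _
size-append (x ∷ l) m = s≤s (ℕP.≤-trans (ℕP.+-monoʳ-≤ (size x) (size-append l m)) (ℕP.≤-reflexive (sym (ℕP.+-assoc (size x) (size l) (size m)))))

opaque
  pt-map : ∀ {Γ A B} {{_ : Enc Γ}} {{_ : Enc A}} {{_ : Enc B}} {f : Γ → A → B} {l : Γ → List A} →
           PT {Γ × A} (λ q → f (proj₁ q) (proj₂ q)) → PT l → PT (λ γ → map (f γ) (l γ))
  pt-map {Γ} {A} {B} {f} {l} pf pl = pt-∘ {g = λ (q : Γ × List A) → map (f (proj₁ q)) (proj₂ q)} {f = λ γ → γ , l γ} rec (pt-pair pt-id pl)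
    where
    k : ℕ
    k = Poly.degree (out-poly pf)
    rec : PT {Γ × List A} (λ q → map (f (proj₁ q)) (proj₂ q))
    rec = pt-rec {f = λ γ l → map (f γ) l} {n = λ _ → []} {c = λ γ x _ r → f γ x ∷ r} (λ _ → refl) (λ _ _ _ → refl) (pt-const [])
      (pt-∷ (pt-∘ {f = λ (q : ((Γ × A) × List A) × List B) → proj₁ (proj₁ q)} pf (pt-∘ pt-proj₁ pt-proj₁)) var0)
      (poly-≤ (λ q → ℕP.≤-trans
          (size-map (f (proj₁ q)) (pw k (size q)) (proj₂ q) (λ m₁ x m₂ eq → ℕP.≤-trans (Poly.bound (out-poly pf) (proj₁ q , x))
             (pw-monoʳ k (s≤s (ℕP.+-monoʳ-≤ (size (proj₁ q)) (size-element m₁ x m₂ eq))))))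
          (ℕP.+-monoʳ-≤ 1 (ℕP.*-monoˡ-≤ (1 + pw k (size q)) (length≤size (proj₂ q)))))
        (poly-const 1 poly-+ poly-proj₂ poly-* (poly-const 1 poly-+ poly-pw k poly-size)))

  pt-++ : ∀ {Γ A} {{_ : Enc Γ}} {{_ : Enc A}} {l m : Γ → List A} → PT l → PT m → PT (λ γ → l γ ++ m γ)
  pt-++ {Γ} {A} pl pm = pt-∘ {g = λ (q : List A × List A) → proj₂ q ++ proj₁ q} rec (pt-pair pm pl)
    where
    rec : PT {List A × List A} (λ q → proj₂ q ++ proj₁ q)
    rec = pt-rec {f = λ m l → l ++ m} {n = λ m → m} {c = λ _ x _ r → x ∷ r} (λ _ → refl) (λ _ _ _ → refl) pt-id
      (pt-∷ (weaken (weaken var0)) var0) (poly-≤ (λ q → size-append (proj₂ q) (proj₁ q)) (poly-proj₂ poly-+ poly-proj₁))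

allᵇ anyᵇ : ∀ {A : Set} → (A → Bool) → List A → Bool
allᵇ p []      = true
allᵇ p (x ∷ l) = if p x then allᵇ p l else false
anyᵇ p []      = false
anyᵇ p (x ∷ l) = if p x then true else anyᵇ p l

poly-Bool : ∀ {A} {{_ : Enc A}} {b : A → Bool} → Poly (λ x → size (b x))
poly-Bool {b = b} = poly-≤ (λ x → size-Bool≤ (b x)) (poly-const 3)

opaque
  pt-all : ∀ {Γ A} {{_ : Enc Γ}} {{_ : Enc A}} {p : Γ → A → Bool} {l : Γ → List A} →
           PT {Γ × A} (λ q → p (proj₁ q) (proj₂ q)) → PT l → PT (λ γ → allᵇ (p γ) (l γ))
  pt-all {Γ} {A} {p} {l} pp pl = pt-∘ {g = λ (q : Γ × List A) → allᵇ (p (proj₁ q)) (proj₂ q)} {f = λ γ → γ , l γ}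
    (pt-rec {f = λ γ l → allᵇ (p γ) l} {n = λ _ → true} {c = λ γ x _ r → if p γ x then r else false} (λ _ → refl) (λ _ _ _ → refl) (pt-const true)
      (pt-if (pt-∘ {f = λ (q : ((Γ × A) × List A) × Bool) → proj₁ (proj₁ q)} pp (pt-∘ pt-proj₁ pt-proj₁)) var0 (pt-const false)) poly-Bool)
    (pt-pair pt-id pl)

  pt-any : ∀ {Γ A} {{_ : Enc Γ}} {{_ : Enc A}} {p : Γ → A → Bool} {l : Γ → List A} →
           PT {Γ × A} (λ q → p (proj₁ q) (proj₂ q)) → PT l → PT (λ γ → anyᵇ (p γ) (l γ))
  pt-any {Γ} {A} {p} {l} pp pl = pt-∘ {g = λ (q : Γ × List A) → anyᵇ (p (proj₁ q)) (proj₂ q)} {f = λ γ → γ , l γ}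
    (pt-rec {f = λ γ l → anyᵇ (p γ) l} {n = λ _ → false} {c = λ γ x _ r → if p γ x then true else r} (λ _ → refl) (λ _ _ _ → refl) (pt-const false)
      (pt-if (pt-∘ {f = λ (q : ((Γ × A) × List A) × Bool) → proj₁ (proj₁ q)} pp (pt-∘ pt-proj₁ pt-proj₁)) (pt-const true) var0) poly-Bool)
    (pt-pair pt-id pl)

-- Estimates in several parameters are majorised by functions of the total size alone, whose
-- polynomiality is then read off their shape.
record PolyN (h : ℕ → ℕ) : Set where
  constructor polyN
  field
    degree : ℕ
    bound  : ∀ n → h n ≤ pw degree n

constN : ∀ c → PolyN (λ _ → c)
constN c = polyN c (pw-const c)

idN : PolyN (λ n → n)
idN = polyN 1 pw-size

infixl 6 _+N_
infixl 7 _*N_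
_+N_ : ∀ {f g} → PolyN f → PolyN g → PolyN (λ n → f n + g n)
polyN j p +N polyN k q = polyN (suc (j + k)) (λ n → ℕP.≤-trans (ℕP.+-mono-≤ (p n) (q n)) (pw-+ j k n))

_*N_ : ∀ {f g} → PolyN f → PolyN g → PolyN (λ n → f n * g n)
polyN j p *N polyN k q = polyN (j + k) (λ n → ℕP.≤-trans (ℕP.*-mono-≤ (p n) (q n)) (ℕP.≤-reflexive (pw-* j k n)))

poly-N : ∀ {A} {{_ : Enc A}} {f : A → ℕ} (h : ℕ → ℕ) → PolyN h → (∀ x → f x ≤ h (size x)) → Poly f
poly-N h (polyN k p) le = poly k (λ x → ℕP.≤-trans (le x) (p (size x)))

-- Elimination and saturation on integer rows.

Row : Set
Row = List ℤ

-- Missing entries count as zero, so rows of different lengths can be combined freely.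
at : Row → ℕ → ℤ
at []      _       = + 0
at (x ∷ u) zero    = x
at (x ∷ u) (suc i) = at u i

-- Indices are stored in unary.
Index : Set
Index = List ⊤

comb : ℤ → Row → ℤ → Row → Row
comb a []      b v = map (λ y → b ℤ.* y) v
comb a (x ∷ u) b v = (a ℤ.* x ℤ.+ b ℤ.* headOr (+ 0) v) ∷ comb a u b (drop 1 v)

Pivoted : Set
Pivoted = Index × Row

-- Fraction-free elimination: the row is first multiplied by the leading coefficient of the pivot
-- row, so everything stays integral.
elim : Pivoted → Row → Row
elim (p , R) v = comb (at R (length p)) v (ℤ.- at v (length p)) R

reduce : List Pivoted → Row → Row
reduce []      v = v
reduce (R ∷ S) v = elim R (reduce S v)

isZeroRow : Row → Bool
isZeroRow = allᵇ isZeroℤ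

gcdRow : Row → ℕ
gcdRow []      = 0
gcdRow (x ∷ v) = gcd′ ℤ.∣ x ∣ (gcdRow v)

normalize : Row → Row
normalize v = map (λ x → divℤ x (gcdRow v)) v

firstNonzero : Row → Index
firstNonzero []      = []
firstNonzero (x ∷ v) = if isZeroℤ x then tt ∷ firstNonzero v else []

-- Entry 0 of a row is the right-hand side; it is a pivot only as a last resort.
pivot : Row → Index
pivot w = if isZeroRow (drop 1 w) then [] else tt ∷ firstNonzero (drop 1 w)

-- The new row already vanishes at the old pivots. Eliminating its own pivot from the old rows keeps
-- the form fully reduced, and normalising them afterwards keeps the rows primitive.
adjoin : Row → List Pivoted → List Pivoted
adjoin w S = (pivot w , w) ∷ map (λ R → proj₁ R , normalize (elim (pivot w , w) (proj₂ R))) S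

insert : List Pivoted → Row → List Pivoted
insert S e = if isZeroRow (reduce S e) then S else adjoin (normalize (reduce S e)) S

RowClause : Set
RowClause = List Row × Row

implied : List Pivoted → Row → Bool
implied S e = isZeroRow (reduce S e)

fire : List Pivoted → RowClause → List Pivoted
fire S c = if allᵇ (implied S) (proj₁ c) then insert S (proj₂ c) else S

copies : ∀ {A B : Set} → List A → List B → List B
copies []      m = []
copies (x ∷ l) m = m ++ copies l m

-- One pass per clause is enough, since a pass that changes the system makes at least one more head
-- implied.
saturate : List RowClause → List Pivoted
saturate cs = foldl fire [] (copies cs cs)

-- Bit lengths in single row operations, and their running times.

record Small (m n : ℕ) : Set where
  constructor small
  field bound : 2 + n ≤ 2 ^ m

Bounded : ℕ → Row → Set
Bounded m = All (λ x → Small m ℤ.∣ x ∣)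

small-mono : ∀ {m n x} → m ≤ n → Small m x → Small n x
small-mono {m} {n} m≤n (small p) = small (ℕP.≤-trans p (2^-mono {m} {n} m≤n))

small-≤ : ∀ {m x y} → x ≤ y → Small m y → Small m x
small-≤ x≤y (small p) = small (ℕP.≤-trans (s≤s (s≤s x≤y)) p)

small-0 : ∀ {m} → 1 ≤ m → Small m 0
small-0 {m} le = small (2^-mono {1} {m} le)

small-size : ∀ z {m} → size z ≤ m → Small m ℤ.∣ z ∣
small-size z {m} le = small (ℕP.≤-trans (ℤ-value z) (2^-mono {size z} {m} le))

small-ℤ : ∀ {z m} → Small m ℤ.∣ z ∣ → size z ≤ 4 * m + 5
small-ℤ {z} {m} (small p) = ℤ-size {z} {m} (ℕP.≤-trans (ℕP.n≤1+n _) p)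

bounded-mono : ∀ {m n u} → m ≤ n → Bounded m u → Bounded n u
bounded-mono m≤n = All.map (small-mono m≤n)

bounded-size : ∀ {m} u → Bounded m u → size u ≤ 1 + length u * (4 * m + 6)
bounded-size [] [] = ℕP.≤-refl
bounded-size {m} (x ∷ u) (p ∷ ps) = s≤s (begin
  size x + size u                          ≤⟨ ℕP.+-mono-≤ (small-ℤ {x} p) (bounded-size u ps) ⟩
  (4 * m + 5) + (1 + length u * (4 * m + 6)) ≡⟨ l m (length u * (4 * m + 6)) ⟩
  4 * m + 6 + length u * (4 * m + 6) ∎)
  where
  open ℕP.≤-Reasoning
  l : ∀ m z → 4 * m + 5 + (1 + z) ≡ 4 * m + 6 + z
  l = solve-∀

size-bounded : ∀ u {m} → size u ≤ m → Bounded m u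
size-bounded [] le = []
size-bounded (x ∷ u) {m} le =
  small-size x (ℕP.≤-trans (ℕP.≤-trans (ℕP.m≤m+n (size x) (size u)) (ℕP.n≤1+n _)) le)
  ∷ size-bounded u (ℕP.≤-trans (ℕP.≤-trans (ℕP.m≤n+m (size u) (size x)) (ℕP.n≤1+n _)) le)

at-bounded : ∀ {m} u i → 1 ≤ m → Bounded m u → Small m ℤ.∣ at u i ∣
at-bounded []      i       b _ = small-0 b
at-bounded (x ∷ u) zero    b (p ∷ _)  = p
at-bounded (x ∷ u) (suc i) b (_ ∷ ps) = at-bounded u i b ps

*-bounded : ∀ a x {m n M} → Small m ℤ.∣ a ∣ → Small n ℤ.∣ x ∣ → m + n ≤ M → Small M ℤ.∣ a ℤ.* x ∣
*-bounded a x {m} {n} (small p) (small q) le = small-mono le (small (ℕP.≤-trans (ℕP.≤-reflexive (cong (λ z → 2 + z) (ℤP.abs-* a x)))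
  (*<2^ {m = m} {n} p q)))

+-bounded : ∀ x y {M} → Small M ℤ.∣ x ∣ → Small M ℤ.∣ y ∣ → Small (suc M) ℤ.∣ x ℤ.+ y ∣
+-bounded x y {M} (small p) (small q) = small (begin
  2 + ℤ.∣ x ℤ.+ y ∣                  ≤⟨ s≤s (s≤s (ℤP.∣i+j∣≤∣i∣+∣j∣ x y)) ⟩
  2 + (ℤ.∣ x ∣ + ℤ.∣ y ∣)            ≤⟨ s≤s (s≤s (ℕP.+-monoʳ-≤ ℤ.∣ x ∣ (ℕP.m≤n+m ℤ.∣ y ∣ 2))) ⟩
  (2 + ℤ.∣ x ∣) + (2 + ℤ.∣ y ∣)      ≤⟨ ℕP.+-mono-≤ p q ⟩
  2 ^ M + 2 ^ M                      ≡⟨ cong (λ z → 2 ^ M + z) (sym (ℕP.+-identityʳ (2 ^ M))) ⟩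
  2 ^ suc M ∎)
  where open ℕP.≤-Reasoning

drop₁-bounded : ∀ {m} v → Bounded m v → Bounded m (drop 1 v)
drop₁-bounded []      _        = []
drop₁-bounded (x ∷ v) (_ ∷ ps) = ps

headOr-bounded : ∀ {m} v → 1 ≤ m → Bounded m v → Small m ℤ.∣ headOr (+ 0) v ∣
headOr-bounded []      b _       = small-0 b
headOr-bounded (x ∷ v) b (p ∷ _) = p

comb-bounded : ∀ {a b ma mb mu mv M} u v → Small ma ℤ.∣ a ∣ → Small mb ℤ.∣ b ∣ → Bounded mu u → Bounded mv v → 1 ≤ mv →
  ma + mu ≤ M → mb + mv ≤ M → Bounded (suc M) (comb a u b v)
comb-bounded {a} {b} {mv = mv} {M} [] v pa pb pu pv 1≤ le₁ le₂ = go v pv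
  where
  go : ∀ v → Bounded mv v → Bounded (suc M) (map (λ y → b ℤ.* y) v)
  go []      []       = []
  go (y ∷ v) (p ∷ ps) = *-bounded b y pb p (ℕP.≤-trans le₂ (ℕP.n≤1+n M)) ∷ go v ps
comb-bounded {a} {b} (x ∷ u) v pa pb (p ∷ ps) pv 1≤ le₁ le₂ =
  +-bounded (a ℤ.* x) (b ℤ.* headOr (+ 0) v) (*-bounded a x pa p le₁) (*-bounded b (headOr (+ 0) v) pb (headOr-bounded v 1≤ pv) le₂)
  ∷ comb-bounded u (drop 1 v) pa pb ps (drop₁-bounded v pv) 1≤ le₁ le₂

rowBound : ℕ → ℕ → ℕ
rowBound m n = 1 + n * (4 * m + 6)

rowBoundN : ∀ {f g} → PolyN f → PolyN g → PolyN (λ n → rowBound (f n) (g n))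
rowBoundN p q = constN 1 +N q *N (constN 4 *N p +N constN 6)

row-size : ∀ {m N} u → Bounded m u → length u ≤ N → size u ≤ rowBound m N
row-size {m} u b le = ℕP.≤-trans (bounded-size u b) (ℕP.+-monoʳ-≤ 1 (ℕP.*-monoˡ-≤ (4 * m + 6) le))

length-comb : ∀ a u b v {N} → length u ≤ N → length v ≤ N → length (comb a u b v) ≤ N
length-comb a [] b v p q = ℕP.≤-trans (ℕP.≤-reflexive (LP.length-map _ v)) q
length-comb a (x ∷ u) b v {suc N} (s≤s p) q = s≤s (length-comb a u b (drop 1 v) p
  (ℕP.≤-trans (ℕP.≤-reflexive (LP.length-drop 1 v)) (ℕP.∸-monoˡ-≤ 1 q)))

size>0 : ∀ {A} {{_ : Enc A}} (x : A) → 1 ≤ size x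
size>0 x = weight>0 (enc x)

opaque
  pt-at : ∀ {Γ} {{_ : Enc Γ}} {u : Γ → Row} {p : Γ → Index} → PT u → PT p → PT (λ γ → at (u γ) (length (p γ)))
  pt-at {Γ} {u = u} {p} pu pp = pt-∘ {g = λ (q : (⊤ × Row) × Index) → at (proj₂ (proj₁ q)) (length (proj₂ q))}
    (pt-zrec {f = λ _ u p → at u (length p)} {n = λ _ _ → + 0} {c = λ _ x _ p r → listCase x (λ _ _ → r) p} {t = drop 1}
      (λ _ _ → refl) eq (pt-const (+ 0)) (pt-listCase (weaken var0) (weaken (weaken (weaken var0))) (pt-∘ var0 pt-proj₂))
      (pt-tail pt-id) size-drop₁ (poly-≤ (λ q → sz (proj₂ (proj₁ q)) (length (proj₂ q))) (out-poly (weaken var0) poly-+ poly-const 3)))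
    (pt-pair (pt-pair (pt-const tt) pu) pp)
    where
    eq : ∀ (γ : ⊤) x xs (p : Index) → at (x ∷ xs) (length p) ≡ listCase x (λ _ _ → at xs (length (drop 1 p))) p
    eq _ x xs []      = refl
    eq _ x xs (_ ∷ p) = refl
    sz : ∀ u i → size (at u i) ≤ size u + 3
    sz []      i       = s≤s (s≤s (s≤s z≤n))
    sz (x ∷ u) zero    = ℕP.≤-trans (size-element {l = x ∷ u} [] x u refl) (ℕP.m≤m+n _ 3)
    sz (x ∷ u) (suc i) = ℕP.≤-trans (sz u i) (ℕP.+-monoˡ-≤ 3 (size-++ʳ (x ∷ []) u))

  pt-comb : ∀ {Γ} {{_ : Enc Γ}} {a b : Γ → ℤ} {u v : Γ → Row} → PT a → PT u → PT b → PT v → PT (λ γ → comb (a γ) (u γ) (b γ) (v γ))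
  pt-comb {Γ} pa pu pb pv = pt-∘ {g = λ (q : ((ℤ × ℤ) × Row) × Row) → comb (proj₁ (proj₁ (proj₁ q))) (proj₂ (proj₁ q)) (proj₂ (proj₁ (proj₁ q))) (proj₂ q)}
    (pt-zrec {f = λ ab u v → comb (proj₁ ab) u (proj₂ ab) v} {n = λ ab v → map (λ y → proj₂ ab ℤ.* y) v}
       {c = λ ab x _ v r → (proj₁ ab ℤ.* x ℤ.+ proj₂ ab ℤ.* headOr (+ 0) v) ∷ r} {t = drop 1}
      (λ _ _ → refl) (λ _ _ _ _ → refl) (pt-map (pt-mulℤ (weaken (pt-∘ pt-proj₂ pt-proj₁)) var0) var0)
      (pt-∷ (pt-addℤ (pt-mulℤ (pt-∘ pt-proj₁ ab) (weaken (weaken (weaken var0)))) (pt-mulℤ (pt-∘ pt-proj₂ ab) (pt-headOr (pt-const (+ 0)) (weaken var0)))) var0)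
      (pt-tail pt-id) size-drop₁
      (poly-N (λ n → rowBound (1 + (n + n)) n) (rowBoundN (constN 1 +N (idN +N idN)) idN)
        (λ { q@(((a , b) , u) , v) → sz a b u v (size q) ℕP.≤-refl })))
    (pt-pair (pt-pair (pt-pair pa pb) pu) pv)
    where
    C : Set
    C = ((((ℤ × ℤ) × ℤ) × Row) × Row) × Row
    ab : PT {C} (λ q → proj₁ (proj₁ (proj₁ (proj₁ q))))
    ab = weaken (weaken (weaken pt-proj₁))
    sz : ∀ a b u v n → size (((a , b) , u) , v) ≤ n → size (comb a u b v) ≤ rowBound (1 + (n + n)) n
    sz a b u v n le = row-size (comb a u b v)
        (comb-bounded {M = n + n} u v (small-size a a≤) (small-size b b≤) (size-bounded u u≤) (size-bounded v v≤) (ℕP.≤-trans (size>0 v) v≤) ℕP.≤-refl ℕP.≤-refl)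
        (length-comb a u b v (ℕP.≤-trans (length≤size u) u≤) (ℕP.≤-trans (length≤size v) v≤))
      where
      abu≤ : size ((a , b) , u) ≤ n
      abu≤ = ℕP.≤-trans (size-proj₁ (((a , b) , u) , v)) le
      v≤ : size v ≤ n
      v≤ = ℕP.≤-trans (size-proj₂ (((a , b) , u) , v)) le
      u≤ : size u ≤ n
      u≤ = ℕP.≤-trans (size-proj₂ ((a , b) , u)) abu≤
      a≤ : size a ≤ n
      a≤ = ℕP.≤-trans (size-proj₁ (a , b)) (ℕP.≤-trans (size-proj₁ ((a , b) , u)) abu≤)
      b≤ : size b ≤ n
      b≤ = ℕP.≤-trans (size-proj₂ (a , b)) (ℕP.≤-trans (size-proj₁ ((a , b) , u)) abu≤)

  pt-elim : ∀ {Γ} {{_ : Enc Γ}} {R : Γ → Pivoted} {v : Γ → Row} → PT R → PT v → PT (λ γ → elim (R γ) (v γ))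
  pt-elim pR pv = pt-comb (pt-at (pt-∘ pt-proj₂ pR) (pt-∘ pt-proj₁ pR)) pv (pt-neg (pt-at pv (pt-∘ pt-proj₁ pR))) (pt-∘ pt-proj₂ pR)

elim-bounded : ∀ {m n} p R v → 1 ≤ m → 1 ≤ n → Bounded m R → Bounded n v → Bounded (suc (m + n)) (elim (p , R) v)
elim-bounded {m} {n} p R v 1≤m 1≤n pR pv = comb-bounded v R (at-bounded R (length p) 1≤m pR)
  (small-≤ (ℕP.≤-reflexive (ℤP.∣-i∣≡∣i∣ (at v (length p)))) (at-bounded v (length p) 1≤n pv))
  pv pR 1≤m ℕP.≤-refl (ℕP.≤-reflexive (ℕP.+-comm n m))

length-elim : ∀ p R v {N} → length R ≤ N → length v ≤ N → length (elim (p , R) v) ≤ N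
length-elim p R v lR lv = length-comb (at R (length p)) v (ℤ.- at v (length p)) R lv lR

-- One reduction adds up the bits of the rows, which is harmless by itself. Iterated over insertions
-- this estimate would be exponential, so the rows of the system itself are bounded differently, by
-- `rows-bound`.
reduce-bounded : ∀ {m n} S v → 1 ≤ m → 1 ≤ n → All (λ R → Bounded m (proj₂ R)) S → Bounded n v → Bounded (length S * suc m + n) (reduce S v)
reduce-bounded [] v 1≤m 1≤n [] pv = pv
reduce-bounded {m} {n} ((p , R) ∷ S) v 1≤m 1≤n (pR ∷ pS) pv =
  bounded-mono {suc (m + (length S * suc m + n))} {suc (length S) * suc m + n} (ℕP.≤-reflexive (sym (cong suc (ℕP.+-assoc m (length S * suc m) n))))
    (elim-bounded p R (reduce S v) 1≤m (ℕP.≤-trans 1≤n (ℕP.m≤n+m n _)) pR (reduce-bounded S v 1≤m 1≤n pS pv))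

length-reduce : ∀ S v {N} → All (λ R → length (proj₂ R) ≤ N) S → length v ≤ N → length (reduce S v) ≤ N
length-reduce [] v [] lv = lv
length-reduce ((p , R) ∷ S) v (lR ∷ lS) lv = length-elim p R (reduce S v) lR (length-reduce S v lS lv)

all-sizes : ∀ {P : Pivoted → Set} M S → size S ≤ M → (∀ p R → size R ≤ M → P (p , R)) → All P S
all-sizes M [] le H = []
all-sizes M ((p , R) ∷ S) le H = H p R (ℕP.≤-trans (size-proj₂ (p , R)) (ℕP.≤-trans (size-element {l = (p , R) ∷ S} [] (p , R) S refl) le))
  ∷ all-sizes M S (ℕP.≤-trans (size-++ʳ ((p , R) ∷ []) S) le) H

gcd′≤ : ∀ a b → gcd′ a b ≤ a + b
gcd′≤ a b = ℕP.≤-trans (ℕP.m≤m+n _ _) (euclid-sums (a , b) (euclidFuel a b))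

gcdRow-bound : ∀ v → 2 + gcdRow v ≤ 2 ^ size v
gcdRow-bound []      = ℕP.≤-refl
gcdRow-bound (x ∷ v) = ℕP.≤-trans (s≤s (s≤s (gcd′≤ ℤ.∣ x ∣ (gcdRow v))))
  (ℕP.≤-trans (+<2^ {m = size x} {size v} (ℤ-value x) (gcdRow-bound v)) (2^-mono {size x + size v} {suc (size x + size v)} (ℕP.n≤1+n _)))

opaque
  pt-reduce : ∀ {Γ} {{_ : Enc Γ}} {S : Γ → List Pivoted} {v : Γ → Row} → PT S → PT v → PT (λ γ → reduce (S γ) (v γ))
  pt-reduce {Γ} pS pv = pt-∘ {g = λ (q : Row × List Pivoted) → reduce (proj₂ q) (proj₁ q)}
    (pt-rec {f = λ v S → reduce S v} {n = λ v → v} {c = λ _ R _ r → elim R r} (λ _ → refl) (λ _ _ _ → refl) pt-id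
      (pt-elim (weaken (weaken var0)) var0)
      (poly-N (λ n → rowBound (n * (1 + n) + n) n) (rowBoundN (idN *N (constN 1 +N idN) +N idN) idN)
        (λ q → sz (proj₁ q) (proj₂ q) (size q) ℕP.≤-refl)))
    (pt-pair pv pS)
    where
    sz : ∀ v S n → size (v , S) ≤ n → size (reduce S v) ≤ rowBound (n * (1 + n) + n) n
    sz v S n le = row-size (reduce S v) (bounded-mono
        (ℕP.+-monoˡ-≤ n (ℕP.*-monoˡ-≤ (1 + n) (ℕP.≤-trans (length≤size S) S≤)))
        (reduce-bounded {n} {n} S v 1≤n 1≤n (all-sizes n S S≤ (λ p R le → size-bounded R le)) (size-bounded v v≤)))
      (length-reduce S v (all-sizes n S S≤ (λ p R le → ℕP.≤-trans (length≤size R) le)) (ℕP.≤-trans (length≤size v) v≤))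
      where
      S≤ : size S ≤ n
      S≤ = ℕP.≤-trans (size-proj₂ (v , S)) le
      v≤ : size v ≤ n
      v≤ = ℕP.≤-trans (size-proj₁ (v , S)) le
      1≤n : 1 ≤ n
      1≤n = ℕP.≤-trans (size>0 v) v≤

  pt-isZeroRow : ∀ {Γ} {{_ : Enc Γ}} {v : Γ → Row} → PT v → PT (λ γ → isZeroRow (v γ))
  pt-isZeroRow pv = pt-all (pt-isZeroℤ var0) pv

  pt-gcdRow : ∀ {Γ} {{_ : Enc Γ}} {v : Γ → Row} → PT v → PT (λ γ → gcdRow (v γ))
  pt-gcdRow pv = pt-∘ {g = λ (q : ⊤ × Row) → gcdRow (proj₂ q)}
    (pt-rec {f = λ _ v → gcdRow v} {n = λ _ → 0} {c = λ _ x _ r → gcd′ ℤ.∣ x ∣ r} (λ _ → refl) (λ _ _ _ → refl) (pt-const 0)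
      (pt-gcd (pt-abs (weaken (weaken var0))) var0)
      (poly-ℕ {g = λ q → size (proj₂ q)} (λ q → ℕP.≤-trans (ℕP.n≤1+n _) (gcdRow-bound (proj₂ q))) poly-proj₂))
    (pt-pair (pt-const tt) pv)

  pt-normalize : ∀ {Γ} {{_ : Enc Γ}} {v : Γ → Row} → PT v → PT (λ γ → normalize (v γ))
  pt-normalize {v = v} pv = pt-∘ {g = normalize} (pt-map {f = λ v x → divℤ x (gcdRow v)} (pt-divℤ var0 (pt-gcdRow (weaken pt-id))) pt-id) pv

  pt-pivot : ∀ {Γ} {{_ : Enc Γ}} {v : Γ → Row} → PT v → PT (λ γ → pivot (v γ))
  pt-pivot pv = pt-if (pt-isZeroRow (pt-tail pv)) (pt-const []) (pt-∷ (pt-const tt) (pt-∘ {g = λ (q : ⊤ × Row) → firstNonzero (proj₂ q)}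
    (pt-rec {f = λ _ v → firstNonzero v} {n = λ _ → []} {c = λ _ x _ r → if isZeroℤ x then tt ∷ r else []} (λ _ → refl) (λ _ _ _ → refl) (pt-const [])
      (pt-if (pt-isZeroℤ (weaken (weaken var0))) (pt-∷ (pt-const tt) var0) (pt-const []))
      (poly-≤ (λ q → sz (proj₂ q)) (poly-const 2 poly-* poly-proj₂)))
    (pt-pair (pt-const tt) (pt-tail pv))))
    where
    sz : ∀ v → size (firstNonzero v) ≤ 2 * size v
    sz [] = s≤s z≤n
    sz (x ∷ v) = if-elim (λ (z : Index) → size z ≤ 2 * size (x ∷ v)) (isZeroℤ x)
      (λ _ → ℕP.≤-trans (s≤s (s≤s (sz v))) (ℕP.≤-trans (ℕP.≤-reflexive (sym (2*-suc (size v)))) (ℕP.*-monoʳ-≤ 2 (s≤s (ℕP.m≤n+m (size v) (size x))))))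
      (λ _ → s≤s z≤n)

  pt-insert : ∀ {Γ} {{_ : Enc Γ}} {S : Γ → List Pivoted} {e : Γ → Row} → PT S → PT e → PT (λ γ → insert (S γ) (e γ))
  pt-insert {Γ} {S = S} {e} pS pe = pt-∘ {g = λ (q : List Pivoted × Row) → insert (proj₁ q) (proj₂ q)}
    (pt-if (pt-isZeroRow red) pt-proj₁ (pt-∘ {g = λ (q : Row × List Pivoted) → adjoin (proj₁ q) (proj₂ q)}
        (pt-∷ (pt-pair (pt-pivot pt-proj₁) pt-proj₁)
           (pt-map {f = λ (q : Row × List Pivoted) R → proj₁ R , normalize (elim (pivot (proj₁ q) , proj₁ q) (proj₂ R))}
             (pt-pair (pt-∘ pt-proj₁ var0) (pt-normalize (pt-elim (weaken (pt-pair (pt-pivot pt-proj₁) pt-proj₁)) (pt-∘ pt-proj₂ var0)))) pt-proj₂))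
        (pt-pair (pt-normalize red) pt-proj₁)))
    (pt-pair pS pe)
    where
    red : PT {List Pivoted × Row} (λ q → reduce (proj₁ q) (proj₂ q))
    red = pt-reduce pt-proj₁ pt-proj₂

  pt-fire : ∀ {Γ} {{_ : Enc Γ}} {S : Γ → List Pivoted} {c : Γ → RowClause} → PT S → PT c → PT (λ γ → fire (S γ) (c γ))
  pt-fire pS pc = pt-if (pt-all (pt-isZeroRow (pt-reduce (weaken pS) var0)) (pt-∘ pt-proj₁ pc)) (pt-insert pS (pt-∘ pt-proj₂ pc)) pS

-- Linear algebra over the integers

Point : Set
Point = ℕ → ℤ

ev : Row → Point → ℤ
ev []      x = + 0
ev (a ∷ u) x = a ℤ.* x 0 ℤ.+ ev u (x ∘ suc)

unit : ℕ → Point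
unit zero    zero    = + 1
unit zero    (suc j) = + 0
unit (suc i) zero    = + 0
unit (suc i) (suc j) = unit i j

unit-≢ : ∀ i j → j ≢ i → unit i j ≡ + 0
unit-≢ zero    zero    ne = contradiction refl ne
unit-≢ zero    (suc j) ne = refl
unit-≢ (suc i) zero    ne = refl
unit-≢ (suc i) (suc j) ne = unit-≢ i j (λ e → ne (cong suc e))

ev-null : ∀ u {x} → (∀ i → x i ≡ + 0) → ev u x ≡ + 0
ev-null []      z = refl
ev-null (a ∷ u) z = trans (cong₂ ℤ._+_ (trans (cong (a ℤ.*_) (z 0)) (ℤP.*-zeroʳ a)) (ev-null u (z ∘ suc))) refl

-- Entries are values at unit vectors, so identities between entries follow from those between
-- evaluations.
ev-unit : ∀ u i → ev u (unit i) ≡ at u i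
ev-unit []      i       = refl
ev-unit (a ∷ u) zero    = trans (cong₂ ℤ._+_ (ℤP.*-identityʳ a) (ev-null u (λ _ → refl))) (ℤP.+-identityʳ a)
ev-unit (a ∷ u) (suc i) = trans (cong₂ ℤ._+_ (ℤP.*-zeroʳ a) (ev-unit u i)) (ℤP.+-identityˡ _)

ev-map : ∀ b v x → ev (map (λ y → b ℤ.* y) v) x ≡ b ℤ.* ev v x
ev-map b []      x = sym (ℤP.*-zeroʳ b)
ev-map b (y ∷ v) x = trans (cong (λ z → b ℤ.* y ℤ.* x 0 ℤ.+ z) (ev-map b v (x ∘ suc))) (l b y (x 0) (ev v (x ∘ suc)))
  where
  l : ∀ b y x z → b ℤ.* y ℤ.* x ℤ.+ b ℤ.* z ≡ b ℤ.* (y ℤ.* x ℤ.+ z)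
  l = ℤSolver.solve-∀

ev-comb : ∀ a u b v x → ev (comb a u b v) x ≡ a ℤ.* ev u x ℤ.+ b ℤ.* ev v x
ev-comb a [] b v x = trans (ev-map b v x) (sym (trans (cong (ℤ._+ b ℤ.* ev v x) (ℤP.*-zeroʳ a)) (ℤP.+-identityˡ _)))
ev-comb a (y ∷ u) b [] x = trans (cong (λ z → (a ℤ.* y ℤ.+ b ℤ.* + 0) ℤ.* x 0 ℤ.+ z) (ev-comb a u b [] (x ∘ suc))) (l a y b (x 0) (ev u (x ∘ suc)))
  where
  l : ∀ a y b x u → (a ℤ.* y ℤ.+ b ℤ.* + 0) ℤ.* x ℤ.+ (a ℤ.* u ℤ.+ b ℤ.* + 0) ≡ a ℤ.* (y ℤ.* x ℤ.+ u) ℤ.+ b ℤ.* + 0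
  l = ℤSolver.solve-∀
ev-comb a (y ∷ u) b (z ∷ v) x = trans (cong (λ w → (a ℤ.* y ℤ.+ b ℤ.* z) ℤ.* x 0 ℤ.+ w) (ev-comb a u b v (x ∘ suc))) (l a y b z (x 0) (ev u (x ∘ suc)) (ev v (x ∘ suc)))
  where
  l : ∀ a y b z x u v → (a ℤ.* y ℤ.+ b ℤ.* z) ℤ.* x ℤ.+ (a ℤ.* u ℤ.+ b ℤ.* v) ≡ a ℤ.* (y ℤ.* x ℤ.+ u) ℤ.+ b ℤ.* (z ℤ.* x ℤ.+ v)
  l = ℤSolver.solve-∀

at-comb : ∀ a u b v i → at (comb a u b v) i ≡ a ℤ.* at u i ℤ.+ b ℤ.* at v i
at-comb a u b v i = trans (sym (ev-unit (comb a u b v) i)) (trans (ev-comb a u b v (unit i)) (cong₂ (λ p q → a ℤ.* p ℤ.+ b ℤ.* q) (ev-unit u i) (ev-unit v i)))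

_·_⊕_·_ : ℤ → Point → ℤ → Point → Point
(s · x ⊕ t · y) i = s ℤ.* x i ℤ.+ t ℤ.* y i

ev-⊕ : ∀ u s x t y → ev u (s · x ⊕ t · y) ≡ s ℤ.* ev u x ℤ.+ t ℤ.* ev u y
ev-⊕ [] s x t y = sym (trans (cong₂ ℤ._+_ (ℤP.*-zeroʳ s) (ℤP.*-zeroʳ t)) refl)
ev-⊕ (a ∷ u) s x t y = trans (cong (λ z → a ℤ.* (s ℤ.* x 0 ℤ.+ t ℤ.* y 0) ℤ.+ z) (ev-⊕ u s (x ∘ suc) t (y ∘ suc)))
  (l a s (x 0) t (y 0) (ev u (x ∘ suc)) (ev u (y ∘ suc)))
  where
  l : ∀ a s x t y p q → a ℤ.* (s ℤ.* x ℤ.+ t ℤ.* y) ℤ.+ (s ℤ.* p ℤ.+ t ℤ.* q) ≡ s ℤ.* (a ℤ.* x ℤ.+ p) ℤ.+ t ℤ.* (a ℤ.* y ℤ.+ q)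
  l = ℤSolver.solve-∀

isZeroℤ-true : ∀ {z} → isZeroℤ z ≡ true → z ≡ + 0
isZeroℤ-true {+ zero} _ = refl

isZeroℤ-false : ∀ {z} → isZeroℤ z ≡ false → z ≢ + 0
isZeroℤ-false { + zero} () _
isZeroℤ-false {+ suc n} _ ()
isZeroℤ-false { -[1+ n ]} _ ()

isZeroRow-true : ∀ u → isZeroRow u ≡ true → ∀ i → at u i ≡ + 0
isZeroRow-true []      e i = refl
isZeroRow-true (a ∷ u) e i with isZeroℤ a in eq
isZeroRow-true (a ∷ u) e zero    | true = isZeroℤ-true eq
isZeroRow-true (a ∷ u) e (suc i) | true = isZeroRow-true u e i

isZeroRow-false : ∀ u → isZeroRow u ≡ false → Σ ℕ λ i → at u i ≢ + 0
isZeroRow-false (a ∷ u) e with isZeroℤ a in eq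
... | false = 0 , isZeroℤ-false eq
... | true with isZeroRow-false u e
...   | i , ne = suc i , ne

ev-zero : ∀ u → (∀ i → at u i ≡ + 0) → ∀ x → ev u x ≡ + 0
ev-zero []      z x = refl
ev-zero (a ∷ u) z x = cong₂ ℤ._+_ (cong (ℤ._* x 0) (z 0)) (ev-zero u (z ∘ suc) (x ∘ suc))

row : Pivoted → Row
row = proj₂

piv : Pivoted → ℕ
piv R = length (proj₁ R)

lead : Pivoted → ℤ
lead R = at (row R) (piv R)

ev-elim : ∀ R v x → ev (elim R v) x ≡ lead R ℤ.* ev v x ℤ.- at v (piv R) ℤ.* ev (row R) x
ev-elim R v x = trans (ev-comb (lead R) v (ℤ.- at v (piv R)) (row R) x) (cong (λ z → lead R ℤ.* ev v x ℤ.+ z) (sym (ℤP.neg-distribˡ-* (at v (piv R)) (ev (row R) x))))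

at-elim : ∀ R v i → at (elim R v) i ≡ lead R ℤ.* at v i ℤ.- at v (piv R) ℤ.* at (row R) i
at-elim R v i = trans (sym (ev-unit (elim R v) i)) (trans (ev-elim R v (unit i)) (cong₂ (λ p q → lead R ℤ.* p ℤ.- at v (piv R) ℤ.* q) (ev-unit v i) (ev-unit (row R) i)))

Apart : Pivoted → Pivoted → Set
Apart R R′ = at (row R) (piv R′) ≡ + 0 × at (row R′) (piv R) ≡ + 0

Reduced : List Pivoted → Set
Reduced []      = ⊤
Reduced (R ∷ S) = lead R ≢ + 0 × All (Apart R) S × Reduced S

Ker : List Pivoted → Point → Set
Ker S x = All (λ R → ev (row R) x ≡ + 0) S

Clear : List Pivoted → Row → Set
Clear S w = All (λ R → at w (piv R) ≡ + 0) S

-- The factor that fraction-free reduction introduces, as seen on the kernel in `ev-reduce`.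
scale : List Pivoted → ℤ
scale []      = + 1
scale (R ∷ S) = lead R ℤ.* scale S

*-≢0 : ∀ a b → a ≢ + 0 → b ≢ + 0 → a ℤ.* b ≢ + 0
*-≢0 a b p q e with ℤP.i*j≡0⇒i≡0∨j≡0 a e
... | inj₁ z = p z
... | inj₂ z = q z

scale≢0 : ∀ S → Reduced S → scale S ≢ + 0
scale≢0 []      _           = λ ()
scale≢0 (R ∷ S) (l , _ , r) = *-≢0 (lead R) (scale S) l (scale≢0 S r)

x-0* : ∀ a b c → b ≡ + 0 → a ℤ.- c ℤ.* b ≡ a
x-0* a b c refl = trans (cong (λ z → a ℤ.- z) (ℤP.*-zeroʳ c)) (ℤP.+-identityʳ a)

ev-reduce : ∀ S v x → Ker S x → ev (reduce S v) x ≡ scale S ℤ.* ev v x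
ev-reduce [] v x [] = sym (ℤP.*-identityˡ _)
ev-reduce (R ∷ S) v x (k ∷ ks) = begin
  ev (elim R (reduce S v)) x                     ≡⟨ ev-elim R (reduce S v) x ⟩
  lead R ℤ.* ev (reduce S v) x ℤ.- at (reduce S v) (piv R) ℤ.* ev (row R) x ≡⟨ x-0* (lead R ℤ.* ev (reduce S v) x) _ (at (reduce S v) (piv R)) k ⟩
  lead R ℤ.* ev (reduce S v) x                   ≡⟨ cong (lead R ℤ.*_) (ev-reduce S v x ks) ⟩
  lead R ℤ.* (scale S ℤ.* ev v x)                ≡⟨ sym (ℤP.*-assoc (lead R) (scale S) (ev v x)) ⟩
  scale (R ∷ S) ℤ.* ev v x ∎
  where open ≡-Reasoning

clear-elim : ∀ R S w → All (Apart R) S → Clear S w → Clear S (elim R w)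
clear-elim R [] w [] [] = []
clear-elim R (R′ ∷ S) w ((a , _) ∷ as) (c ∷ cs) =
  trans (at-elim R w (piv R′)) (trans (x-0* _ _ (at w (piv R)) a) (trans (cong (lead R ℤ.*_) c) (ℤP.*-zeroʳ (lead R)))) ∷ clear-elim R S w as cs

-- Eliminating one pivot does not spoil the zeros at the others, because a pivot row vanishes at all
-- other pivots.
reduce-clear : ∀ S v → Reduced S → Clear S (reduce S v)
reduce-clear [] v _ = []
reduce-clear (R ∷ S) v (l , a , r) =
  trans (at-elim R w (piv R)) (trans (cong (λ z → z ℤ.- at w (piv R) ℤ.* lead R) (ℤP.*-comm (lead R) (at w (piv R)))) (ℤP.+-inverseʳ (at w (piv R) ℤ.* lead R)))
  ∷ clear-elim R S w a (reduce-clear S v r)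
  where
  w : Row
  w = reduce S v

-- For w vanishing on all pivots, start from a unit vector and correct it at one pivot after the
-- other; the corrections do not change the value of w except for nonzero factors.
direction : ∀ S → Reduced S → ∀ w j → Clear S w → at w j ≢ + 0 →
  Σ Point λ v → Ker S v × ev w v ≢ + 0 × (∀ i → i ≢ j → All (λ R → i ≢ piv R) S → v i ≡ + 0)
direction [] _ w j [] ne = unit j , [] , (λ e → ne (trans (sym (ev-unit w j)) e)) , (λ i i≢j _ → unit-≢ j i i≢j)
direction (R ∷ S) (l , a , r) w j (c ∷ cs) ne with direction S r w j cs ne
... | v′ , k , nz , sp = v , first ∷ rest S a k , w≢0 , sup
  where
  v : Point
  v = lead R · v′ ⊕ ℤ.- ev (row R) v′ · unit (piv R)
  eval : ∀ u → ev u v ≡ lead R ℤ.* ev u v′ ℤ.+ ℤ.- ev (row R) v′ ℤ.* at u (piv R)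
  eval u = trans (ev-⊕ u (lead R) v′ (ℤ.- ev (row R) v′) (unit (piv R))) (cong (λ z → lead R ℤ.* ev u v′ ℤ.+ ℤ.- ev (row R) v′ ℤ.* z) (ev-unit u (piv R)))
  vanish : ∀ u → at u (piv R) ≡ + 0 → ev u v ≡ lead R ℤ.* ev u v′
  vanish u e = trans (eval u) (trans (cong (λ z → lead R ℤ.* ev u v′ ℤ.+ z) (trans (cong (ℤ.- ev (row R) v′ ℤ.*_) e) (ℤP.*-zeroʳ (ℤ.- ev (row R) v′)))) (ℤP.+-identityʳ _))
  first : ev (row R) v ≡ + 0
  first = trans (eval (row R)) (lem (lead R) (ev (row R) v′))
    where
    lem : ∀ a b → a ℤ.* b ℤ.+ ℤ.- b ℤ.* a ≡ + 0
    lem = ℤSolver.solve-∀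
  rest : ∀ S → All (Apart R) S → Ker S v′ → Ker S v
  rest []       []             []       = []
  rest (R′ ∷ S) ((_ , z) ∷ as) (k ∷ ks) = trans (vanish (row R′) z) (trans (cong (lead R ℤ.*_) k) (ℤP.*-zeroʳ (lead R))) ∷ rest S as ks
  w≢0 : ev w v ≢ + 0
  w≢0 e = *-≢0 (lead R) (ev w v′) l nz (trans (sym (vanish w c)) e)
  sup : ∀ i → i ≢ j → All (λ R → i ≢ piv R) (R ∷ S) → v i ≡ + 0
  sup i i≢j (n ∷ ns) = trans (cong₂ (λ p q → lead R ℤ.* p ℤ.+ ℤ.- ev (row R) v′ ℤ.* q) (sp i i≢j ns) (unit-≢ (piv R) i n))
    (trans (cong₂ ℤ._+_ (ℤP.*-zeroʳ (lead R)) (ℤP.*-zeroʳ (ℤ.- ev (row R) v′))) refl)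

implied-sound : ∀ S e → Reduced S → implied S e ≡ true → ∀ x → Ker S x → ev e x ≡ + 0
implied-sound S e r im x k with ℤP.i*j≡0⇒i≡0∨j≡0 (scale S) (trans (sym (ev-reduce S e x k)) (ev-zero (reduce S e) (isZeroRow-true (reduce S e) im) x))
... | inj₁ z = contradiction z (scale≢0 S r)
... | inj₂ z = z

-- A nonzero remainder vanishes at all pivots, so `direction` finds a kernel point where it, and
-- hence `e`, does not vanish. Implication thus depends only on the kernel and not on how `S` was
-- obtained.
implied-complete : ∀ S e → Reduced S → (∀ x → Ker S x → ev e x ≡ + 0) → implied S e ≡ true
implied-complete S e r H with implied S e in eq
... | true  = refl
... | false with isZeroRow-false (reduce S e) eq
...   | j , ne with direction S r (reduce S e) j (reduce-clear S e r) ne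
...     | v , k , nz , _ = contradiction (trans (ev-reduce S e v k) (trans (cong (scale S ℤ.*_) (H v k)) (ℤP.*-zeroʳ (scale S)))) nz

-- The greatest common divisor, in the form d ∣ c a, d ∣ c b ⇒ d ∣ c gcd(a,b).

IsGcd : ℕ → ℕ → ℕ → Set
IsGcd g a b = g ∣ a × g ∣ b × (∀ d c → d ∣ c * a → d ∣ c * b → d ∣ c * g)

isGcd-step : ∀ g a b → IsGcd g (suc b) (rem a (suc b)) → IsGcd g a (suc b)
isGcd-step g a b (gb , gr , un) = subst (g ∣_) (sym eq) (ND.∣m∣n⇒∣m+n (ND.∣n⇒∣m*n q gb) gr) , gb , un′
  where
  q r : ℕ
  q = quot a (suc b)
  r = rem a (suc b)
  eq : a ≡ q * suc b + r
  eq = quot-rem a (suc b) (s≤s z≤n)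
  lem : ∀ c q b r → c * (q * b + r) ≡ q * (c * b) + c * r
  lem = solve-∀
  un′ : ∀ d c → d ∣ c * a → d ∣ c * suc b → d ∣ c * g
  un′ d c da db = un d c db (ND.∣m+n∣m⇒∣n (subst (d ∣_) (trans (cong (c *_) eq) (lem c q (suc b) r)) da) (ND.∣n⇒∣m*n q db))

isGcd-steps : ∀ a b l → proj₂ (steps euclidStep (a , b) l) ≡ 0 → IsGcd (proj₁ (steps euclidStep (a , b) l)) a b
isGcd-steps a b [] refl = ND.∣-refl , (a ND.∣0) , (λ d c da _ → da)
isGcd-steps a zero (_ ∷ l) e = isGcd-steps a zero l e
isGcd-steps a (suc b) (_ ∷ l) e = isGcd-step _ a b (isGcd-steps (suc b) (rem a (suc b)) l e)

isGcd-gcd′ : ∀ a b → IsGcd (gcd′ a b) a b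
isGcd-gcd′ a b = isGcd-steps a b (euclidFuel a b) (euclid-finishes a b)

gcdRow-divides : ∀ v i → gcdRow v ∣ ℤ.∣ at v i ∣
gcdRow-divides []      i       = 0 ND.∣0
gcdRow-divides (x ∷ v) zero    = proj₁ (isGcd-gcd′ ℤ.∣ x ∣ (gcdRow v))
gcdRow-divides (x ∷ v) (suc i) = ND.∣-trans (proj₁ (proj₂ (isGcd-gcd′ ℤ.∣ x ∣ (gcdRow v)))) (gcdRow-divides v i)

gcdRow-universal : ∀ v d c → (∀ i → d ∣ c * ℤ.∣ at v i ∣) → d ∣ c * gcdRow v
gcdRow-universal []      d c H = H 0
gcdRow-universal (x ∷ v) d c H = proj₂ (proj₂ (isGcd-gcd′ ℤ.∣ x ∣ (gcdRow v))) d c (H 0) (gcdRow-universal v d c (H ∘ suc))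

gcdRow>0 : ∀ v i → at v i ≢ + 0 → 0 < gcdRow v
gcdRow>0 v i ne = ℕP.n≢0⇒n>0 (λ e → ne (ℤP.∣i∣≡0⇒i≡0 (ND.0∣⇒≡0 (subst (_∣ ℤ.∣ at v i ∣) e (gcdRow-divides v i)))))

multiple<⇒0 : ∀ {g} r → g ∣ r → r < g → r ≡ 0
multiple<⇒0 zero    _ _  = refl
multiple<⇒0 (suc r) d lt = contradiction (ND.∣⇒≤ d) (ℕP.<⇒≱ lt)

quot-exact : ∀ n g → 0 < g → g ∣ n → n ≡ g * quot n g
quot-exact n g g>0 g∣n = trans (quot-rem n g g>0) (trans (cong (λ z → quot n g * g + z) r≡0) (trans (ℕP.+-identityʳ _) (ℕP.*-comm (quot n g) g)))
  where
  r≡0 : rem n g ≡ 0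
  r≡0 = multiple<⇒0 (rem n g) (ND.∣m+n∣m⇒∣n (subst (g ∣_) (quot-rem n g g>0) g∣n) (ND.∣n⇒∣m*n (quot n g) ND.∣-refl)) (rem< n g g>0)

divℤ-exact : ∀ z g → 0 < g → g ∣ ℤ.∣ z ∣ → z ≡ + g ℤ.* divℤ z g
divℤ-exact (+ n) g g>0 d = trans (cong +_ (quot-exact n g g>0 d)) (ℤP.pos-* g (quot n g))
divℤ-exact -[1+ n ] g g>0 d = trans (cong (λ k → ℤ.- (+ k)) (quot-exact (suc n) g g>0 d))
  (trans (cong ℤ.-_ (ℤP.pos-* g (quot (suc n) g))) (ℤP.neg-distribʳ-* (+ g) (+ quot (suc n) g)))

map-divℤ-ev : ∀ g v x → 0 < g → (∀ i → g ∣ ℤ.∣ at v i ∣) → ev v x ≡ + g ℤ.* ev (map (λ y → divℤ y g) v) x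
map-divℤ-ev g [] x g>0 H = sym (ℤP.*-zeroʳ (+ g))
map-divℤ-ev g (y ∷ v) x g>0 H = trans (cong₂ (λ p q → p ℤ.* x 0 ℤ.+ q) (divℤ-exact y g g>0 (H 0)) (map-divℤ-ev g v (x ∘ suc) g>0 (H ∘ suc)))
  (l (+ g) (divℤ y g) (x 0) _)
  where
  l : ∀ g y x z → g ℤ.* y ℤ.* x ℤ.+ g ℤ.* z ≡ g ℤ.* (y ℤ.* x ℤ.+ z)
  l = ℤSolver.solve-∀

ev-normalize : ∀ v i x → at v i ≢ + 0 → ev v x ≡ + gcdRow v ℤ.* ev (normalize v) x
ev-normalize v i x ne = map-divℤ-ev (gcdRow v) v x (gcdRow>0 v i ne) (gcdRow-divides v)

at-normalize : ∀ v i j → at v i ≢ + 0 → at v j ≡ + gcdRow v ℤ.* at (normalize v) j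
at-normalize v i j ne = trans (sym (ev-unit v j)) (trans (ev-normalize v i (unit j) ne) (cong (+ gcdRow v ℤ.*_) (ev-unit (normalize v) j)))

at-normalize-≢ : ∀ v j → at v j ≢ + 0 → at (normalize v) j ≢ + 0
at-normalize-≢ v j ne e = ne (trans (at-normalize v j j ne) (trans (cong (+ gcdRow v ℤ.*_) e) (ℤP.*-zeroʳ (+ gcdRow v))))

+g≢0 : ∀ {g} → 0 < g → + g ≢ + 0
+g≢0 {suc g} _ ()

cancel-0 : ∀ a b → a ≢ + 0 → a ℤ.* b ≡ + 0 → b ≡ + 0
cancel-0 a b ne e with ℤP.i*j≡0⇒i≡0∨j≡0 a e
... | inj₁ z = contradiction z ne
... | inj₂ z = z

at-normalize-0 : ∀ v i j → at v i ≢ + 0 → at v j ≡ + 0 → at (normalize v) j ≡ + 0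
at-normalize-0 v i j ne e = cancel-0 (+ gcdRow v) _ (+g≢0 (gcdRow>0 v i ne)) (trans (sym (at-normalize v i j ne)) e)

-- Primitive rows and the invariant of insertion.

-- Content 1, stated with a multiplier `c` in the form in which proportional rows are compared; no
-- Bézout coefficients are involved.
Primitive : Row → Set
Primitive R = ∀ d c → (∀ i → d ∣ c * ℤ.∣ at R i ∣) → d ∣ c

normalize-primitive : ∀ v i → at v i ≢ + 0 → Primitive (normalize v)
normalize-primitive v i ne d c H = ND.*-cancelʳ-∣ g {{ℕ.>-nonZero (gcdRow>0 v i ne)}} (gcdRow-universal v (d * g) c dg)
  where
  g : ℕ
  g = gcdRow v
  dg : ∀ j → d * g ∣ c * ℤ.∣ at v j ∣
  dg j = subst (d * g ∣_) (trans (lem c ℤ.∣ at (normalize v) j ∣ g) (cong (c *_) (trans (sym (ℤP.abs-* (+ g) (at (normalize v) j))) (cong ℤ.∣_∣ (sym (at-normalize v i j ne))))))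
    (ND.*-monoˡ-∣ g (H j))
    where
    lem : ∀ c r g → c * r * g ≡ c * (g * r)
    lem = solve-∀

firstNonzero-≢ : ∀ v → isZeroRow v ≡ false → at v (length (firstNonzero v)) ≢ + 0
firstNonzero-≢ (a ∷ v) e with isZeroℤ a in eq
... | true  = firstNonzero-≢ v e
... | false = isZeroℤ-false eq

pivot-≢ : ∀ w i → at w i ≢ + 0 → at w (length (pivot w)) ≢ + 0
pivot-≢ [] i ne = contradiction refl ne
pivot-≢ (a ∷ w) i ne with isZeroRow w in eq
... | false = firstNonzero-≢ w eq
pivot-≢ (a ∷ w) zero    ne | true = ne
pivot-≢ (a ∷ w) (suc i) ne | true = contradiction (isZeroRow-true w eq i) ne

pivot-0 : ∀ w → length (pivot w) ≡ 0 → ∀ i → at w (suc i) ≡ + 0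
pivot-0 [] e i = refl
pivot-0 (a ∷ w) e i with isZeroRow w in eq
... | true = isZeroRow-true w eq i

-- A pivot in column 0 means that the row is the contradictory equation `0 = b` with `b` nonzero.
RHSPivot : Pivoted → Set
RHSPivot R = piv R ≡ 0 → ∀ i → at (row R) (suc i) ≡ + 0

record Invariant (S : List Pivoted) : Set where
  constructor invariant
  field
    reduced   : Reduced S
    prims     : All (λ R → Primitive (row R)) S
    rhs       : All RHSPivot S
open Invariant public

update : Row → Pivoted → Pivoted
update w R = proj₁ R , normalize (elim (pivot w , w) (row R))

module Adjoin (w : Row) (w-lead : at w (length (pivot w)) ≢ + 0) where
  P : Pivoted
  P = pivot w , w

  -- Since `w` vanishes at the pivot of `R`, elimination only multiplies the leading coefficient by
  -- that of `w`.
  elim-lead : ∀ R → lead R ≢ + 0 → at w (piv R) ≡ + 0 → at (elim P (row R)) (piv R) ≢ + 0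
  elim-lead R l c e = *-≢0 (lead P) (lead R) w-lead l
    (trans (sym (trans (at-elim P (row R) (piv R)) (x-0* (lead P ℤ.* lead R) (at w (piv R)) (at (row R) (piv P)) c))) e)

  elim-pivot : ∀ R → at (elim P (row R)) (piv P) ≡ + 0
  elim-pivot R = trans (at-elim P (row R) (piv P)) (trans (cong (λ z → z ℤ.- at (row R) (piv P) ℤ.* lead P) (ℤP.*-comm (lead P) (at (row R) (piv P)))) (ℤP.+-inverseʳ (at (row R) (piv P) ℤ.* lead P)))

  elim-other : ∀ R i → at w i ≡ + 0 → at (row R) i ≡ + 0 → at (elim P (row R)) i ≡ + 0
  elim-other R i wi Ri = trans (at-elim P (row R) i) (trans (x-0* _ _ (at (row R) (piv P)) wi) (trans (cong (lead P ℤ.*_) Ri) (ℤP.*-zeroʳ (lead P))))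

  apart-P : ∀ S → Reduced S → Clear S w → All (Apart P) (map (update w) S)
  apart-P [] _ [] = []
  apart-P (R ∷ S) (l , a , r) (c ∷ cs) = (c , at-normalize-0 (elim P (row R)) (piv R) (piv P) (elim-lead R l c) (elim-pivot R)) ∷ apart-P S r cs

  apart-R : ∀ R S → lead R ≢ + 0 → at w (piv R) ≡ + 0 → All (Apart R) S → Reduced S → Clear S w → All (Apart (update w R)) (map (update w) S)
  apart-R R [] l c [] _ [] = []
  apart-R R (R′ ∷ S) l c ((a , b) ∷ as) (l′ , _ , r) (c′ ∷ cs) =
    (at-normalize-0 (elim P (row R)) (piv R) (piv R′) (elim-lead R l c) (elim-other R (piv R′) c′ a) ,
     at-normalize-0 (elim P (row R′)) (piv R′) (piv R) (elim-lead R′ l′ c′) (elim-other R′ (piv R) c b)) ∷ apart-R R S l c as r cs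

  reduced-update : ∀ S → Reduced S → Clear S w → Reduced (map (update w) S)
  reduced-update [] _ [] = tt
  reduced-update (R ∷ S) (l , a , r) (c ∷ cs) = at-normalize-≢ (elim P (row R)) (piv R) (elim-lead R l c) , apart-R R S l c a r cs , reduced-update S r cs

  reduced-adjoin : ∀ S → Reduced S → Clear S w → Reduced (adjoin w S)
  reduced-adjoin S r c = w-lead , apart-P S r c , reduced-update S r c

  primitive-update : ∀ S → Reduced S → Clear S w → All (λ R → Primitive (row R)) (map (update w) S)
  primitive-update [] _ [] = []
  primitive-update (R ∷ S) (l , a , r) (c ∷ cs) = normalize-primitive (elim P (row R)) (piv R) (elim-lead R l c) ∷ primitive-update S r cs

  -- A row supported on column 0 has no entry at the new pivot, so elimination merely scales it.
  rhs-update : ∀ S → Reduced S → Clear S w → All RHSPivot S → All RHSPivot (map (update w) S)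
  rhs-update [] _ [] [] = []
  rhs-update (R ∷ S) (l , a , r) (c ∷ cs) (z ∷ zs) = one-row ∷ rhs-update S r cs zs
    where
    one-row : RHSPivot (update w R)
    one-row e i = at-normalize-0 (elim P (row R)) (piv R) (suc i) (elim-lead R l c)
      (trans (at-elim P (row R) (suc i)) (trans (cong₂ (λ p q → lead P ℤ.* p ℤ.- q ℤ.* at w (suc i)) (z e i) (Rp (piv P) refl)) (lem (lead P) (at w (suc i)))))
      where
      lem : ∀ a b → a ℤ.* + 0 ℤ.- + 0 ℤ.* b ≡ + 0
      lem = ℤSolver.solve-∀
      Rp : ∀ k → piv P ≡ k → at (row R) k ≡ + 0
      -- If the new pivot were column 0 too, `w` would vanish at its own pivot, because it is clear
      -- at the pivot of `R`.
      Rp zero    eq = contradiction (subst (λ k → at w k ≡ + 0) (trans e (sym eq)) c) w-lead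
      Rp (suc k) eq = z e k

  ker-update : ∀ S x → Reduced S → Clear S w → ev w x ≡ + 0 → Ker S x → Ker (map (update w) S) x
  ker-update [] x _ [] wz [] = []
  ker-update (R ∷ S) x (l , a , r) (c ∷ cs) wz (k ∷ ks) = cancel-0 (+ gcdRow u) _ (+g≢0 (gcdRow>0 u (piv R) ne))
      (trans (sym (ev-normalize u (piv R) x ne)) (trans (ev-elim P (row R) x) (trans (x-0* _ _ (at (row R) (piv P)) wz) (trans (cong (lead P ℤ.*_) k) (ℤP.*-zeroʳ (lead P))))))
    ∷ ker-update S x r cs wz ks
    where
    u : Row
    u = elim P (row R)
    ne : at u (piv R) ≢ + 0
    ne = elim-lead R l c

  ker-update⁻¹ : ∀ S x → Reduced S → Clear S w → ev w x ≡ + 0 → Ker (map (update w) S) x → Ker S x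
  ker-update⁻¹ [] x _ [] wz [] = []
  ker-update⁻¹ (R ∷ S) x (l , a , r) (c ∷ cs) wz (k ∷ ks) = cancel-0 (lead P) _ w-lead
      (trans (sym (x-0* _ _ (at (row R) (piv P)) wz)) (trans (sym (ev-elim P (row R) x)) (trans (ev-normalize u (piv R) x ne) (trans (cong (+ gcdRow u ℤ.*_) k) (ℤP.*-zeroʳ (+ gcdRow u))))))
    ∷ ker-update⁻¹ S x r cs wz ks
    where
    u : Row
    u = elim P (row R)
    ne : at u (piv R) ≢ + 0
    ne = elim-lead R l c

clear-normalize : ∀ S v i → at v i ≢ + 0 → Clear S v → Clear S (normalize v)
clear-normalize S v i ne = All.map (λ {R} → at-normalize-0 v i (piv R) ne)

-- The two outcomes of `insert` with an equation for each, so that later proofs rewrite the result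
-- instead of abstracting over the condition.
data InsertView (S : List Pivoted) (e : Row) : Set where
  redundant : implied S e ≡ true → insert S e ≡ S → InsertView S e
  new       : ∀ w → w ≡ normalize (reduce S e) → implied S e ≡ false → insert S e ≡ adjoin w S → InsertView S e

insertView : ∀ S e → InsertView S e
insertView S e = view (isZeroRow (reduce S e)) refl
  where
  view : ∀ b → isZeroRow (reduce S e) ≡ b → InsertView S e
  view true  eq = redundant eq (cong (λ b → if b then S else adjoin (normalize (reduce S e)) S) eq)
  view false eq = new (normalize (reduce S e)) refl eq (cong (λ b → if b then S else adjoin (normalize (reduce S e)) S) eq)

module _ (S : List Pivoted) (e : Row) (inv : Invariant S) where
  private
    r : Reduced S
    r = reduced inv

  module New (im : implied S e ≡ false) where
    v : Row
    v = reduce S e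
    i : ℕ
    i = proj₁ (isZeroRow-false v im)
    ne : at v i ≢ + 0
    ne = proj₂ (isZeroRow-false v im)
    w : Row
    w = normalize v
    w-lead : at w (length (pivot w)) ≢ + 0
    w-lead = pivot-≢ w i (at-normalize-≢ v i ne)
    clear : Clear S w
    clear = clear-normalize S v i ne (reduce-clear S e r)
    open Adjoin w w-lead public

    w→e : ∀ x → Ker S x → ev w x ≡ + 0 → ev e x ≡ + 0
    w→e x k z = cancel-0 (scale S) _ (scale≢0 S r)
      (trans (sym (ev-reduce S e x k)) (trans (ev-normalize v i x ne) (trans (cong (+ gcdRow v ℤ.*_) z) (ℤP.*-zeroʳ (+ gcdRow v)))))

    e→w : ∀ x → Ker S x → ev e x ≡ + 0 → ev w x ≡ + 0
    e→w x k z = cancel-0 (+ gcdRow v) _ (+g≢0 (gcdRow>0 v i ne))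
      (trans (sym (ev-normalize v i x ne)) (trans (ev-reduce S e x k) (trans (cong (scale S ℤ.*_) z) (ℤP.*-zeroʳ (scale S)))))

  invariant-insert : Invariant (insert S e)
  invariant-insert with insertView S e
  ... | redundant _ eq = subst Invariant (sym eq) inv
  ... | new _ refl im eq = subst Invariant (sym eq) (invariant (reduced-adjoin S r clear)
          (normalize-primitive v i ne ∷ primitive-update S r clear) (pivot-0 w ∷ rhs-update S r clear (rhs inv)))
    where open New im

  ker-insert : ∀ x → Ker S x → ev e x ≡ + 0 → Ker (insert S e) x
  ker-insert x k z with insertView S e
  ... | redundant _ eq = subst (λ T → Ker T x) (sym eq) k
  ... | new _ refl im eq = subst (λ T → Ker T x) (sym eq) (e→w x k z ∷ ker-update S x r clear (e→w x k z) k)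
    where open New im

  ker-insert⁻¹ : ∀ x → Ker (insert S e) x → Ker S x × ev e x ≡ + 0
  ker-insert⁻¹ x k with insertView S e
  ... | redundant im eq = let k′ = subst (λ T → Ker T x) eq k in k′ , implied-sound S e r im x k′
  ... | new _ refl im eq with subst (λ T → Ker T x) eq k
  ...   | wz ∷ ks = let open New im ; k′ = ker-update⁻¹ S x r clear wz ks in k′ , w→e x k′ wz

-- Siegel's lemma bounds the rows of a reduced system: a row is determined up to a factor by the
-- zeros at the other pivots, and by pigeonhole some small combination of the equations has them too.

combo : List Row → Point → Row
combo []      y = []
combo (e ∷ E) y = comb (y 0) e (+ 1) (combo E (y ∘ suc))

lin : List Row → Point → Point → ℤ
lin []      y x = + 0
lin (e ∷ E) y x = y 0 ℤ.* ev e x ℤ.+ lin E (y ∘ suc) x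

ev-combo : ∀ E y x → ev (combo E y) x ≡ lin E y x
ev-combo []      y x = refl
ev-combo (e ∷ E) y x = trans (ev-comb (y 0) e (+ 1) (combo E (y ∘ suc)) x)
  (cong (λ z → y 0 ℤ.* ev e x ℤ.+ z) (trans (ℤP.*-identityˡ _) (ev-combo E (y ∘ suc) x)))

lin-⊕ : ∀ E s y t z x → lin E (s · y ⊕ t · z) x ≡ s ℤ.* lin E y x ℤ.+ t ℤ.* lin E z x
lin-⊕ [] s y t z x = sym (trans (cong₂ ℤ._+_ (ℤP.*-zeroʳ s) (ℤP.*-zeroʳ t)) refl)
lin-⊕ (e ∷ E) s y t z x = trans (cong (λ w → (s ℤ.* y 0 ℤ.+ t ℤ.* z 0) ℤ.* ev e x ℤ.+ w) (lin-⊕ E s (y ∘ suc) t (z ∘ suc) x))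
  (l s (y 0) t (z 0) (ev e x) (lin E (y ∘ suc) x) (lin E (z ∘ suc) x))
  where
  l : ∀ s y t z e p q → (s ℤ.* y ℤ.+ t ℤ.* z) ℤ.* e ℤ.+ (s ℤ.* p ℤ.+ t ℤ.* q) ≡ s ℤ.* (y ℤ.* e ℤ.+ p) ℤ.+ t ℤ.* (z ℤ.* e ℤ.+ q)
  l = ℤSolver.solve-∀

Vanish : List Row → Point → Set
Vanish E x = All (λ e → ev e x ≡ + 0) E

lin-vanish : ∀ E y x → Vanish E x → lin E y x ≡ + 0
lin-vanish []      y x []       = refl
lin-vanish (e ∷ E) y x (z ∷ zs) = cong₂ ℤ._+_ (trans (cong (y 0 ℤ.*_) z) (ℤP.*-zeroʳ (y 0))) (lin-vanish E (y ∘ suc) x zs)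

-- Remembers the original equations, each of them not implied when it was inserted. They are as many
-- as the rows and independent, and, unlike the rows, small by assumption.
data Built : List Row → List Pivoted → Set where
  []   : Built [] []
  grow : ∀ {E S e} → Built E S → implied S e ≡ false → Built (e ∷ E) (insert S e)

built-invariant : ∀ {E S} → Built E S → Invariant S
built-invariant []                  = invariant tt [] []
built-invariant (grow {S = S} {e} b im) = invariant-insert S e (built-invariant b)

built-vanish : ∀ {E S} → Built E S → ∀ x → Ker S x → Vanish E x
built-vanish [] x k = []
built-vanish (grow {S = S} {e} b im) x k with ker-insert⁻¹ S e (built-invariant b) x k
... | k′ , z = z ∷ built-vanish b x k′

true≢false : ∀ {b} → b ≡ true → b ≡ false → ⊥
true≢false refl ()

built-length : ∀ {E S} → Built E S → length S ≡ length E
built-length [] = refl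
built-length (grow {S = S} {e} b im) with insertView S e
... | redundant im′ eq = ⊥-elim (true≢false im′ im)
... | new w _ _ eq = trans (cong length eq) (cong suc (trans (LP.length-map (update w) S) (built-length b)))

-- If the latest equation had a nonzero coefficient in a vanishing combination, it would vanish on
-- the kernel of the earlier ones and so have been implied. Its coefficient is therefore 0, and the
-- earlier ones follow by induction.
independent : ∀ {E S} → Built E S → ∀ y → (∀ x → lin E y x ≡ + 0) → ∀ k → k < length E → y k ≡ + 0
independent (grow {E} {S} {e} b im) y H k k< with y 0 ℤP.≟ + 0
... | no y₀≢0 = ⊥-elim (true≢false (implied-complete S e (reduced (built-invariant b)) H′) im)
  where
  H′ : ∀ x → Ker S x → ev e x ≡ + 0
  H′ x ker = cancel-0 (y 0) (ev e x) y₀≢0 (trans (sym (ℤP.+-identityʳ _))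
    (trans (cong (λ z → y 0 ℤ.* ev e x ℤ.+ z) (sym (lin-vanish E (y ∘ suc) x (built-vanish b x ker)))) (H x)))
independent (grow {E} b im) y H zero _ | yes y₀≡0 = y₀≡0
independent (grow {E} {e = e} b im) y H (suc k) (s≤s k<) | yes y₀≡0 = independent b (y ∘ suc) H′ k k<
  where
  H′ : ∀ x → lin E (y ∘ suc) x ≡ + 0
  H′ x = trans (sym (ℤP.+-identityˡ _)) (trans (cong (λ z → z ℤ.* ev e x ℤ.+ lin E (y ∘ suc) x) (sym y₀≡0)) (H x))

toPoint : ∀ {r} → (Fin r → ℕ) → Point
toPoint {zero}  f k       = + 0
toPoint {suc r} f zero    = + f zero
toPoint {suc r} f (suc k) = toPoint (f ∘ suc) k

toPoint-at : ∀ {r} (f : Fin r → ℕ) i → toPoint f (F.toℕ i) ≡ + f i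
toPoint-at f zero    = refl
toPoint-at f (suc i) = toPoint-at (f ∘ suc) i

toPoint-bound : ∀ {r B} (f g : Fin r → ℕ) → (∀ i → f i ≤ B) → (∀ i → g i ≤ B) → ∀ k → ℤ.∣ ((+ 1) · toPoint f ⊕ -[1+ 0 ] · toPoint g) k ∣ ≤ B
toPoint-bound {zero}  f g p q k       = z≤n
toPoint-bound {suc r} f g p q (suc k) = toPoint-bound (f ∘ suc) (g ∘ suc) (p ∘ suc) (q ∘ suc) k
toPoint-bound {suc r} {B} f g p q zero = ℕP.≤-trans (ℕP.≤-reflexive (cong ℤ.∣_∣ (trans (l (+ f zero) (+ g zero)) (ℤP.[+m]-[+n]≡m⊖n (f zero) (g zero)))))
  (ℕP.≤-trans (ℤP.∣m⊝n∣≤m⊔n (f zero) (g zero)) (ℕP.⊔-lub (p zero) (q zero)))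
  where
  l : ∀ a b → + 1 ℤ.* a ℤ.+ -[1+ 0 ] ℤ.* b ≡ a ℤ.- b
  l = ℤSolver.solve-∀

toPoint-bound₁ : ∀ {r B} (f : Fin r → ℕ) → (∀ i → f i ≤ B) → ∀ k → ℤ.∣ toPoint f k ∣ ≤ B
toPoint-bound₁ {zero}  f p k       = z≤n
toPoint-bound₁ {suc r} f p zero    = p zero
toPoint-bound₁ {suc r} f p (suc k) = toPoint-bound₁ (f ∘ suc) (p ∘ suc) k

combo-bound : ∀ {M B} E y i → All (λ e → ℤ.∣ at e i ∣ ≤ M) E → (∀ k → ℤ.∣ y k ∣ ≤ B) → ℤ.∣ at (combo E y) i ∣ ≤ length E * (M * B)
combo-bound [] y i [] H = z≤n
combo-bound {M} {B} (e ∷ E) y i (p ∷ ps) H = begin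
  ℤ.∣ at (combo (e ∷ E) y) i ∣                                ≡⟨ cong ℤ.∣_∣ (at-comb (y 0) e (+ 1) (combo E (y ∘ suc)) i) ⟩
  ℤ.∣ y 0 ℤ.* at e i ℤ.+ + 1 ℤ.* at (combo E (y ∘ suc)) i ∣   ≡⟨ cong (λ z → ℤ.∣ y 0 ℤ.* at e i ℤ.+ z ∣) (ℤP.*-identityˡ _) ⟩
  ℤ.∣ y 0 ℤ.* at e i ℤ.+ at (combo E (y ∘ suc)) i ∣           ≤⟨ ℤP.∣i+j∣≤∣i∣+∣j∣ (y 0 ℤ.* at e i) _ ⟩
  ℤ.∣ y 0 ℤ.* at e i ∣ + ℤ.∣ at (combo E (y ∘ suc)) i ∣       ≤⟨ ℕP.+-mono-≤ le (combo-bound E (y ∘ suc) i ps (H ∘ suc)) ⟩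
  M * B + length E * (M * B) ∎
  where
  open ℕP.≤-Reasoning
  le : ℤ.∣ y 0 ℤ.* at e i ∣ ≤ M * B
  le = ℕP.≤-trans (ℕP.≤-reflexive (trans (ℤP.abs-* (y 0) (at e i)) (ℕP.*-comm ℤ.∣ y 0 ∣ _))) (ℕP.*-mono-≤ p (H 0))

-- Moves the integers of absolute value at most `K` below `suc (K + K)`, so that they can be letters
-- of the pigeonhole hash.
shift : ℕ → ℤ → ℕ
shift K c = ℤ.∣ c ℤ.+ + K ∣

shift-correct : ∀ K c → ℤ.∣ c ∣ ≤ K → + shift K c ≡ c ℤ.+ + K
shift-correct K (+ n) le = refl
shift-correct K -[1+ n ] le = trans (cong (λ z → + ℤ.∣ z ∣) (ℤP.⊖-≥ {K} {suc n} le)) (sym (ℤP.⊖-≥ {K} {suc n} le))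

shift-injective : ∀ K c d → ℤ.∣ c ∣ ≤ K → ℤ.∣ d ∣ ≤ K → shift K c ≡ shift K d → c ≡ d
shift-injective K c d pc pd e = trans (back′ c (+ K)) (trans (cong (ℤ._- + K)
  (trans (sym (shift-correct K c pc)) (trans (cong +_ e) (shift-correct K d pd)))) (sym (back′ d (+ K))))
  where
  back′ : ∀ c k → c ≡ c ℤ.+ k ℤ.- k
  back′ = ℤSolver.solve-∀

shift-bound : ∀ K c → ℤ.∣ c ∣ ≤ K → shift K c < suc (K + K)
shift-bound K c p = s≤s (ℕP.≤-trans (ℤP.∣i+j∣≤∣i∣+∣j∣ c (+ K)) (ℕP.+-monoˡ-≤ K p))

funToFin-cong : ∀ {m n} (f g : Fin m → Fin n) → (∀ i → f i ≡ g i) → F.funToFin f ≡ F.funToFin g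
funToFin-cong {zero}  f g H = refl
funToFin-cong {suc m} f g H = cong₂ combine (H zero) (funToFin-cong (f ∘ suc) (g ∘ suc) (H ∘ suc))

finToFun-injective : ∀ {m n} (i j : Fin (n ^ m)) → (∀ k → F.finToFun {n} {m} i k ≡ F.finToFun j k) → i ≡ j
finToFun-injective {m} {n} i j H = trans (sym (FP.funToFin-finToFin {m} {n} i)) (trans (funToFin-cong _ _ H) (FP.funToFin-finToFin {m} {n} j))

m<2^m : ∀ m → m < 2 ^ m
m<2^m zero    = s≤s z≤n
m<2^m (suc m) = ℕP.≤-trans (s≤s (m<2^m m)) (ℕP.≤-trans (ℕP.+-monoˡ-≤ (2 ^ m) (ℕP.m^n>0 2 m)) (ℕP.≤-reflexive (cong (λ z → 2 ^ m + z) (sym (ℕP.+-identityʳ (2 ^ m))))))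

^-distribʳ-* : ∀ a b n → (a * b) ^ n ≡ a ^ n * b ^ n
^-distribʳ-* a b zero    = refl
^-distribʳ-* a b (suc n) = trans (cong (a * b *_) (^-distribʳ-* a b n)) (l a b (a ^ n) (b ^ n))
  where
  l : ∀ a b x y → a * b * (x * y) ≡ a * x * (b * y)
  l = solve-∀

-- With `B` choices per coefficient the entries stay within `K = r * 2 ^ m * B`, and `2 K + 1` is at
-- most `D * B` for `D = 2 ^ (2 + r + m)`. Pigeonhole on `n = r - 1` columns needs
-- `(D * B) ^ n < B ^ r`, that is `D ^ n < B`, which this exponent provides.
siegelExp : ℕ → ℕ → ℕ
siegelExp r m = suc ((2 + r + m) * r)

siegelBound : ℕ → ℕ → ℕ
siegelBound r m = r * (2 ^ m * 2 ^ siegelExp r m)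

siegel-count : ∀ n m → suc (siegelBound (suc n) m + siegelBound (suc n) m) ^ n < (2 ^ siegelExp (suc n) m) ^ suc n
siegel-count n m = begin-strict
  suc (K + K) ^ n               ≤⟨ ℕP.^-monoˡ-≤ n C≤ ⟩
  (D * B) ^ n                   ≡⟨ ^-distribʳ-* D B n ⟩
  D ^ n * B ^ n                 <⟨ ℕP.*-monoˡ-< (B ^ n) {{ℕP.m^n≢0 B n {{ℕP.m^n≢0 2 (siegelExp r m)}}}} D^n<B ⟩
  B * B ^ n ∎
  where
  open ℕP.≤-Reasoning
  r = suc n
  B = 2 ^ siegelExp r m
  K = siegelBound r m
  D = 2 ^ (2 + r + m)
  B>0 : 1 ≤ B
  B>0 = ℕP.m^n>0 2 (siegelExp r m)
  rM≤ : r * 2 ^ m ≤ 2 ^ (r + m)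
  rM≤ = ℕP.≤-trans (ℕP.*-monoˡ-≤ (2 ^ m) (ℕP.<⇒≤ (m<2^m r))) (ℕP.≤-reflexive (sym (ℕP.^-distribˡ-+-* 2 r m)))
  arith : ∀ x b → x * b + x * b + (x * b + x * b) ≡ 2 * (2 * x) * b
  arith = solve-∀
  C≤ : suc (K + K) ≤ D * B
  C≤ = begin
    suc (K + K)             ≡⟨ cong (λ z → suc (z + z)) (sym (ℕP.*-assoc r (2 ^ m) B)) ⟩
    suc (r * 2 ^ m * B + r * 2 ^ m * B) ≤⟨ s≤s (ℕP.+-mono-≤ (ℕP.*-monoˡ-≤ B rM≤) (ℕP.*-monoˡ-≤ B rM≤)) ⟩
    1 + (X * B + X * B)     ≤⟨ ℕP.+-monoˡ-≤ (X * B + X * B) (ℕP.≤-trans (ℕP.*-mono-≤ (ℕP.m^n>0 2 (r + m)) B>0) (ℕP.m≤m+n (X * B) (X * B))) ⟩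
    X * B + X * B + (X * B + X * B) ≡⟨ arith X B ⟩
    D * B ∎
    where
    X = 2 ^ (r + m)
  D^n<B : D ^ n < B
  D^n<B = begin-strict
    D ^ n                    ≡⟨ ℕP.^-*-assoc 2 (2 + r + m) n ⟩
    2 ^ ((2 + r + m) * n)    <⟨ ℕP.^-monoʳ-< 2 (s≤s (s≤s z≤n)) (s≤s (ℕP.*-monoʳ-≤ (2 + r + m) (ℕP.n≤1+n n))) ⟩
    B ∎

module Siegel {E S n m} (b : Built E S) (lenE : length E ≡ suc n) (bdE : ∀ i → All (λ e → ℤ.∣ at e i ∣ ≤ 2 ^ m) E) (col : Fin n → ℕ) where

  B K : ℕ
  B = 2 ^ siegelExp (suc n) m
  K = siegelBound (suc n) m

  coords : Fin (B ^ suc n) → Fin (suc n) → ℕ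
  coords i k = F.toℕ (F.finToFun {B} {suc n} i k)

  coords≤ : ∀ i k → coords i k ≤ B
  coords≤ i k = ℕP.<⇒≤ (FP.toℕ<n (F.finToFun {B} {suc n} i k))

  comb-row : Fin (B ^ suc n) → Row
  comb-row i = combo E (toPoint (coords i))

  K≡ : length E * (2 ^ m * B) ≡ K
  K≡ = cong (_* (2 ^ m * B)) lenE

  comb-row≤ : ∀ i q → ℤ.∣ at (comb-row i) q ∣ ≤ K
  comb-row≤ i q = ℕP.≤-trans (combo-bound E (toPoint (coords i)) q (bdE q) (toPoint-bound₁ (coords i) (coords≤ i))) (ℕP.≤-reflexive K≡)

  hash : Fin (B ^ suc n) → Fin (suc (K + K) ^ n)
  hash i = F.funToFin (λ j → F.fromℕ< (shift-bound K (at (comb-row i) (col j)) (comb-row≤ i (col j))))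

  opaque
    -- There are more coefficient vectors than value patterns on the `n` columns. Two vectors with
    -- the same pattern differ by a small vector whose combination vanishes on these columns, and
    -- independence of the equations makes the combination nonzero.
    small-row : Σ Row λ z → (∀ j → at z (col j) ≡ + 0) × (∀ q → ℤ.∣ at z q ∣ ≤ K) × (Σ ℕ λ q → at z q ≢ + 0) × (∀ x → Ker S x → ev z x ≡ + 0)
    small-row with FP.pigeonhole (siegel-count n m) hash
    ... | i , j , i<j , eq = z , zeros , bound , nonzero , (λ x k → trans (ev-combo E y x) (lin-vanish E y x (built-vanish b x k)))
      where
      y : Point
      y = (+ 1) · toPoint (coords i) ⊕ -[1+ 0 ] · toPoint (coords j)
      z : Row
      z = combo E y
      l : ∀ a b → + 1 ℤ.* a ℤ.+ -[1+ 0 ] ℤ.* b ≡ a ℤ.- b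
      l = ℤSolver.solve-∀
      at-z : ∀ q → at z q ≡ at (comb-row i) q ℤ.- at (comb-row j) q
      at-z q = trans (sym (ev-unit z q)) (trans (ev-combo E y (unit q)) (trans (lin-⊕ E (+ 1) (toPoint (coords i)) -[1+ 0 ] (toPoint (coords j)) (unit q))
        (trans (l (lin E (toPoint (coords i)) (unit q)) (lin E (toPoint (coords j)) (unit q)))
          (cong₂ ℤ._-_ (trans (sym (ev-combo E _ (unit q))) (ev-unit (comb-row i) q)) (trans (sym (ev-combo E _ (unit q))) (ev-unit (comb-row j) q))))))
      same : ∀ k → at (comb-row i) (col k) ≡ at (comb-row j) (col k)
      same k = shift-injective K _ _ (comb-row≤ i (col k)) (comb-row≤ j (col k))
        (trans (sym (FP.toℕ-fromℕ< _)) (trans (cong F.toℕ (trans (sym (FP.finToFun-funToFin _ k)) (trans (cong (λ h → F.finToFun h k) eq) (FP.finToFun-funToFin _ k)))) (FP.toℕ-fromℕ< _)))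
      zeros : ∀ k → at z (col k) ≡ + 0
      zeros k = trans (at-z (col k)) (trans (cong (ℤ._- at (comb-row j) (col k)) (same k)) (ℤP.+-inverseʳ (at (comb-row j) (col k))))
      bound : ∀ q → ℤ.∣ at z q ∣ ≤ K
      bound q = ℕP.≤-trans (combo-bound E y q (bdE q) (toPoint-bound (coords i) (coords j) (coords≤ i) (coords≤ j))) (ℕP.≤-reflexive K≡)
      not-zero : ¬ (∀ x → lin E y x ≡ + 0)
      not-zero H = FP.<-irrefl (finToFun-injective i j (λ k → FP.toℕ-injective (ℤP.+-injective (ℤP.i-j≡0⇒i≡j _ _ (diff k))))) i<j
        where
        diff : ∀ k → + coords i k ℤ.- + coords j k ≡ + 0
        diff k = trans (sym (l (+ coords i k) (+ coords j k))) (trans (cong₂ (λ p q → + 1 ℤ.* p ℤ.+ -[1+ 0 ] ℤ.* q) (sym (toPoint-at (coords i) k)) (sym (toPoint-at (coords j) k)))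
          (independent b y H (F.toℕ k) (subst (F.toℕ k <_) (sym lenE) (FP.toℕ<n k))))
      nonzero : Σ ℕ λ q → at z q ≢ + 0
      nonzero with isZeroRow z in eqz
      ... | false = isZeroRow-false z eqz
      ... | true  = ⊥-elim (not-zero (λ x → trans (sym (ev-combo E y x)) (ev-zero z (isZeroRow-true z eqz) x)))

-- The row `elim R z` vanishes at all pivots and on the whole kernel, and by `direction` only the
-- zero row does both. So `z` is proportional to the row of `R`.
row-divides : ∀ R S z → Reduced (R ∷ S) → (∀ x → Ker (R ∷ S) x → ev z x ≡ + 0) → Clear S z → ∀ i → lead R ℤ.* at z i ≡ at z (piv R) ℤ.* at (row R) i
row-divides R S z red@(l , a , r) H cl i with isZeroRow (elim R z) in eq
... | true  = ℤP.i-j≡0⇒i≡j _ _ (trans (sym (at-elim R z i)) (isZeroRow-true (elim R z) eq i))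
... | false with isZeroRow-false (elim R z) eq
...   | j , ne with direction (R ∷ S) red (elim R z) j (here′ ∷ clear-elim R S z a cl) ne
  where
  here′ : at (elim R z) (piv R) ≡ + 0
  here′ = trans (at-elim R z (piv R)) (trans (cong (λ w → w ℤ.- at z (piv R) ℤ.* lead R) (ℤP.*-comm (lead R) (at z (piv R)))) (ℤP.+-inverseʳ (at z (piv R) ℤ.* lead R)))
...     | v , k , nz , _ = contradiction (trans (ev-elim R z v) (trans (x-0* _ _ (at z (piv R)) (All.head k)) (trans (cong (lead R ℤ.*_) (H v k)) (ℤP.*-zeroʳ (lead R))))) nz

-- By proportionality the leading coefficient divides every entry of the row multiplied by the entry
-- of `z` at the pivot. Primitivity then makes it divide that entry of `z`, so `z` is a nonzero
-- integer multiple of the row up to sign.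
primitive-bound : ∀ R z K → lead R ≢ + 0 → Primitive (row R) → (∀ i → lead R ℤ.* at z i ≡ at z (piv R) ℤ.* at (row R) i) →
  (Σ ℕ λ q → at z q ≢ + 0) → (∀ q → ℤ.∣ at z q ∣ ≤ K) → ∀ i → ℤ.∣ at (row R) i ∣ ≤ K
primitive-bound R z K l pr eqs (q , zq) zK i = ℕP.≤-trans (row≤z (d∣c)) (zK i)
  where
  d c : ℕ
  d = ℤ.∣ lead R ∣
  c = ℤ.∣ at z (piv R) ∣
  abs-eq : ∀ i → d * ℤ.∣ at z i ∣ ≡ c * ℤ.∣ at (row R) i ∣
  abs-eq i = trans (sym (ℤP.abs-* (lead R) (at z i))) (trans (cong ℤ.∣_∣ (eqs i)) (ℤP.abs-* (at z (piv R)) (at (row R) i)))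
  d∣c : d ∣ c
  d∣c = pr d c (λ i → subst (d ∣_) (abs-eq i) (ND.∣m⇒∣m*n ℤ.∣ at z i ∣ ND.∣-refl))
  d>0 : ℕ.NonZero d
  d>0 = ℕ.≢-nonZero (λ e → l (ℤP.∣i∣≡0⇒i≡0 e))
  row≤z : d ∣ c → ℤ.∣ at (row R) i ∣ ≤ ℤ.∣ at z i ∣
  row≤z (ND.divides k c≡) with k
  ... | zero = contradiction (ℤP.∣i∣≡0⇒i≡0 (ℕP.m*n≡0⇒m≡0 ℤ.∣ at z q ∣ d {{d>0}}
                 (trans (ℕP.*-comm ℤ.∣ at z q ∣ d) (trans (abs-eq q) (cong (_* ℤ.∣ at (row R) q ∣) c≡))))) zq
  ... | suc k′ = ℕP.≤-trans (ℕP.m≤m+n _ (k′ * ℤ.∣ at (row R) i ∣))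
      (ℕP.≤-reflexive (sym (ℕP.*-cancelˡ-≡ ℤ.∣ at z i ∣ (suc k′ * ℤ.∣ at (row R) i ∣) d {{d>0}} (trans (abs-eq i) (trans (cong (_* ℤ.∣ at (row R) i ∣) c≡) (lem (suc k′) d ℤ.∣ at (row R) i ∣))))))
    where
    lem : ∀ k d r → k * d * r ≡ d * (k * r)
    lem = solve-∀

reduced-move : ∀ S₁ R S₂ → Reduced (S₁ ++ R ∷ S₂) → Reduced (R ∷ S₁ ++ S₂)
reduced-move [] R S₂ r = r
reduced-move (T ∷ S₁) R S₂ (l , a , r) with AllP.++⁻ S₁ a | reduced-move S₁ R S₂ r
... | a₁ , (a , b) ∷ a₂ | lR , aR , r′ = lR , (b , a) ∷ aR , l , AllP.++⁺ a₁ a₂ , r′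

all-move : ∀ {P : Pivoted → Set} S₁ R S₂ → All P (S₁ ++ R ∷ S₂) → All P (R ∷ S₁ ++ S₂)
all-move S₁ R S₂ ps with AllP.++⁻ S₁ ps
... | p₁ , p ∷ p₂ = p ∷ AllP.++⁺ p₁ p₂

all-move⁻¹ : ∀ {P : Pivoted → Set} S₁ R S₂ → All P (R ∷ S₁ ++ S₂) → All P (S₁ ++ R ∷ S₂)
all-move⁻¹ S₁ R S₂ (p ∷ ps) with AllP.++⁻ S₁ ps
... | p₁ , p₂ = AllP.++⁺ p₁ (p ∷ p₂)

clear-lookup : ∀ S z → (∀ j → at z (piv (Data.List.lookup S j)) ≡ + 0) → Clear S z
clear-lookup []      z H = []
clear-lookup (R ∷ S) z H = H zero ∷ clear-lookup S z (H ∘ suc)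

EntriesWithin : ℕ → Row → Set
EntriesWithin K u = ∀ i → ℤ.∣ at u i ∣ ≤ K

row-bound : ∀ {E S m} → Built E S → All (EntriesWithin (2 ^ m)) E → ∀ S₁ R S₂ → S ≡ S₁ ++ R ∷ S₂ → EntriesWithin (siegelBound (length E) m) (row R)
row-bound {E} {S} {m} b bd S₁ R S₂ refl = subst (λ r → EntriesWithin (siegelBound r m) (row R)) (sym lenE) bound
  where
  T : List Pivoted
  T = S₁ ++ S₂
  lenE : length E ≡ suc (length T)
  lenE = trans (sym (built-length b)) (trans (LP.length-++ S₁) (trans (ℕP.+-suc (length S₁) (length S₂)) (cong suc (sym (LP.length-++ S₁)))))
  red : Reduced (R ∷ T)
  red = reduced-move S₁ R S₂ (reduced (built-invariant b))
  -- The columns to be cleared are the pivots of the other rows, one fewer than there are equations.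
  open Siegel {m = m} b lenE (λ i → All.map (λ h → h i) bd) (λ j → piv (Data.List.lookup T j))
  bound : EntriesWithin (siegelBound (suc (length T)) m) (row R)
  bound = let (z , zeros , small-z , nonzero , van) = small-row in
    primitive-bound R z (siegelBound (suc (length T)) m) (proj₁ red) (All.head (all-move S₁ R S₂ (prims (built-invariant b))))
      (row-divides R T z red (λ x k → van x (all-move⁻¹ S₁ R S₂ k)) (clear-lookup T z zeros)) nonzero small-z

all-splits : ∀ {P : Pivoted → Set} S → (∀ S₁ R S₂ → S ≡ S₁ ++ R ∷ S₂ → P R) → All P S
all-splits []      H = []
all-splits (R ∷ S) H = H [] R S refl ∷ all-splits S (λ S₁ R′ S₂ eq → H (R ∷ S₁) R′ S₂ (cong (R ∷_) eq))

rows-bound : ∀ {E S m} → Built E S → All (EntriesWithin (2 ^ m)) E → All (λ R → EntriesWithin (siegelBound (length E) m) (row R)) S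
rows-bound {S = S} {m} b bd = all-splits S (row-bound {m = m} b bd)

siegelBits : ℕ → ℕ → ℕ
siegelBits r m = 2 + (r + (m + siegelExp r m))

siegel-small : ∀ r m → Small (siegelBits r m) (siegelBound r m)
siegel-small r m = small (begin
  2 + siegelBound r m             ≤⟨ s≤s (s≤s le) ⟩
  2 + X                           ≤⟨ ℕP.+-monoˡ-≤ X (ℕP.*-monoʳ-≤ 2 (ℕP.m^n>0 2 (r + (m + siegelExp r m)))) ⟩
  2 * X + X                       ≤⟨ ℕP.+-monoʳ-≤ (2 * X) (ℕP.m≤m+n X (X + 0)) ⟩
  2 * X + 2 * X                   ≡⟨ arith X ⟩
  2 ^ siegelBits r m ∎)
  where
  open ℕP.≤-Reasoning
  X = 2 ^ (r + (m + siegelExp r m))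
  arith : ∀ x → 2 * x + 2 * x ≡ 2 * (2 * x)
  arith = solve-∀
  le : siegelBound r m ≤ X
  le = begin
    r * (2 ^ m * 2 ^ siegelExp r m)     ≤⟨ ℕP.*-monoˡ-≤ (2 ^ m * 2 ^ siegelExp r m) (ℕP.<⇒≤ (m<2^m r)) ⟩
    2 ^ r * (2 ^ m * 2 ^ siegelExp r m) ≡⟨ cong (2 ^ r *_) (sym (ℕP.^-distribˡ-+-* 2 m (siegelExp r m))) ⟩
    2 ^ r * 2 ^ (m + siegelExp r m)     ≡⟨ sym (ℕP.^-distribˡ-+-* 2 r (m + siegelExp r m)) ⟩
    X ∎

siegelBits-mono : ∀ {r s} m → r ≤ s → siegelBits r m ≤ siegelBits s m
siegelBits-mono {r} {s} m le = s≤s (s≤s (ℕP.+-mono-≤ le (ℕP.+-monoʳ-≤ m (s≤s (ℕP.*-mono-≤ (ℕP.+-monoˡ-≤ m (s≤s (s≤s le))) le)))))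

within-bounded : ∀ {K m} u → Small m K → EntriesWithin K u → Bounded m u
within-bounded []      s H = []
within-bounded (x ∷ u) s H = small-≤ (H 0) s ∷ within-bounded u s (H ∘ suc)

bounded-within : ∀ {m} u → Bounded m u → EntriesWithin (2 ^ m) u
bounded-within []      []                 i       = z≤n
bounded-within (x ∷ u) (small p ∷ ps)     zero    = ℕP.≤-trans (ℕP.m≤n+m _ 2) p
bounded-within (x ∷ u) (_ ∷ ps)           (suc i) = bounded-within u ps i

at-outside : ∀ u i → at u i ≢ + 0 → i < length u
at-outside []      i       ne = contradiction refl ne
at-outside (x ∷ u) zero    ne = s≤s z≤n
at-outside (x ∷ u) (suc i) ne = s≤s (at-outside u i ne)

length-normalize : ∀ u → length (normalize u) ≡ length u
length-normalize u = LP.length-map (λ x → divℤ x (gcdRow u)) u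

lengths-update : ∀ w S {N} → length w ≤ N → All (λ R → length (row R) ≤ N) S → All (λ R → length (row R) ≤ N) (map (update w) S)
lengths-update w []      lw []       = []
lengths-update w (R ∷ S) lw (l ∷ ls) = ℕP.≤-trans (ℕP.≤-reflexive (length-normalize (elim (pivot w , w) (row R)))) (length-elim (pivot w) w (row R) lw l) ∷ lengths-update w S lw ls

built-lengths : ∀ {E S N} → Built E S → All (λ e → length e ≤ N) E → All (λ R → length (row R) ≤ N) S
built-lengths [] [] = []
built-lengths {N = N} (grow {S = S} {e} b im) (l ∷ ls) with insertView S e
... | redundant im′ eq = ⊥-elim (true≢false im′ im)
... | new w refl _ eq = subst (All (λ R → length (row R) ≤ N)) (sym eq) (lw ∷ lengths-update w S lw IH)
  where
  IH = built-lengths b ls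
  lw : length w ≤ N
  lw = ℕP.≤-trans (ℕP.≤-reflexive (length-normalize (reduce S e))) (length-reduce S e IH l)

size-Index : ∀ (p : Index) → size p ≡ 1 + 2 * length p
size-Index []      = refl
size-Index (x ∷ p) = cong suc (trans (cong suc (size-Index p)) (sym (2*-suc (length p))))

systemBound : ℕ → ℕ → ℕ → ℕ
systemBound r m N = 1 + r * (1 + (1 + (1 + 2 * N + rowBound m N)))

reduced-leads : ∀ S → Reduced S → All (λ R → lead R ≢ + 0) S
reduced-leads []      _           = []
reduced-leads (R ∷ S) (l , _ , r) = l ∷ reduced-leads S r

system-size : ∀ {m N} S → All (λ R → lead R ≢ + 0) S → All (λ R → Bounded m (row R)) S → All (λ R → length (row R) ≤ N) S → size S ≤ systemBound (length S) m N
system-size [] _ _ _ = ℕP.≤-refl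
system-size {m} {N} ((p , R) ∷ S) (ne ∷ nes) (b ∷ bs) (l ∷ ls) = s≤s (ℕP.≤-trans (ℕP.+-mono-≤ one-row (system-size S nes bs ls))
    (ℕP.≤-reflexive (ℕP.+-suc X (length S * (1 + X)))))
  where
  X = 1 + (1 + 2 * N + rowBound m N)
  one-row : size (p , R) ≤ X
  one-row = s≤s (ℕP.+-mono-≤ (ℕP.≤-trans (ℕP.≤-reflexive (size-Index p)) (ℕP.+-monoʳ-≤ 1 (ℕP.*-monoʳ-≤ 2 (ℕP.≤-trans (ℕP.<⇒≤ (at-outside R (length p) ne)) l)))) (row-size R b l))

systemBound-mono : ∀ {r r′ m m′} N → r ≤ r′ → m ≤ m′ → systemBound r m N ≤ systemBound r′ m′ N
systemBound-mono N r≤ m≤ = s≤s (ℕP.*-mono-≤ r≤ (s≤s (s≤s (ℕP.+-monoʳ-≤ (1 + 2 * N) (s≤s (ℕP.*-monoʳ-≤ N (ℕP.+-monoˡ-≤ 6 (ℕP.*-monoʳ-≤ 4 m≤))))))))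

-- Saturation

-- All that the size bound has to know about a stage of saturation: it comes from at most `n`
-- independent heads with property `P`. This makes the bound uniform over all stages.
record Reached (P : Row → Set) (n : ℕ) (S : List Pivoted) : Set where
  constructor reached
  field
    {origin} : List Row
    built    : Built origin S
    origin-P : All P origin
    length≤n : length origin ≤ n

reached-mono : ∀ {P m n S} → m ≤ n → Reached P m S → Reached P n S
reached-mono m≤n (reached b p l) = reached b p (ℕP.≤-trans l m≤n)

reached-insert : ∀ {P n S e} → P e → Reached P n S → Reached P (suc n) (insert S e)
reached-insert {P} {n} {S} {e} pe r@(reached b p l) with insertView S e
... | redundant _ eq = subst (Reached P (suc n)) (sym eq) (reached-mono (ℕP.n≤1+n n) r)
... | new _ _ im _   = reached (grow b im) (pe ∷ p) (s≤s l)

reached-fire : ∀ {P n S} c → P (proj₂ c) → Reached P n S → Reached P (suc n) (fire S c)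
reached-fire {P} {n} {S} c pc r = if-elim (Reached P (suc n)) (allᵇ (implied S) (proj₁ c)) (λ _ → reached-insert {P} pc r) (λ _ → reached-mono (ℕP.n≤1+n n) r)

reached-foldl : ∀ {P n S} l → All (λ c → P (proj₂ c)) l → Reached P n S → Reached P (length l + n) (foldl fire S l)
reached-foldl [] [] r = r
reached-foldl {P} {n} {S} (c ∷ l) (p ∷ ps) r = subst (λ k → Reached P k (foldl fire (fire S c) l)) (ℕP.+-suc (length l) n) (reached-foldl {P} l ps (reached-fire {P} c p r))

SmallRow : ℕ → Row → Set
SmallRow s e = EntriesWithin (2 ^ s) e × length e ≤ s

reached-size : ∀ {s n S} → Reached (SmallRow s) n S → size S ≤ systemBound n (siegelBits n s) s
reached-size {s} {n} {S} (reached {E} b ps l) = ℕP.≤-trans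
  (system-size S (reduced-leads S (reduced (built-invariant b)))
    (All.map (λ {R} h → within-bounded (row R) (siegel-small (length E) s) h) (rows-bound {m = s} b (All.map proj₁ ps)))
    (built-lengths b (All.map proj₂ ps)))
  (systemBound-mono s (ℕP.≤-trans (ℕP.≤-reflexive (built-length b)) l) (siegelBits-mono s l))

small-heads : ∀ s (cs : List RowClause) → size cs ≤ s → All (λ c → SmallRow s (proj₂ c)) cs
small-heads s [] le = []
small-heads s (c ∷ cs) le = (bounded-within (proj₂ c) (size-bounded (proj₂ c) h≤) , ℕP.≤-trans (length≤size (proj₂ c)) h≤)
  ∷ small-heads s cs (ℕP.≤-trans (size-++ʳ (c ∷ []) cs) le)
  where
  h≤ : size (proj₂ c) ≤ s
  h≤ = ℕP.≤-trans (size-proj₂ c) (ℕP.≤-trans (size-element {l = c ∷ cs} [] c cs refl) le)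

all-copies : ∀ {A B : Set} {P : B → Set} (l : List A) {m} → All P m → All P (copies l m)
all-copies []      ps = []
all-copies (x ∷ l) ps = AllP.++⁺ ps (all-copies l ps)

length-copies : ∀ {A B : Set} (l : List A) (m : List B) → length (copies l m) ≡ length l * length m
length-copies []      m = refl
length-copies (x ∷ l) m = trans (LP.length-++ m) (cong (λ z → length m + z) (length-copies l m))

size-copies : ∀ {A B} {{_ : Enc B}} (l : List A) (m : List B) → size (copies l m) ≤ 1 + length l * size m
size-copies []      m = ℕP.≤-refl
size-copies (x ∷ l) m = ℕP.≤-trans (size-append m (copies l m)) (ℕP.≤-trans (ℕP.+-monoʳ-≤ (size m) (size-copies l m)) (ℕP.≤-reflexive (ℕP.+-suc (size m) (length l * size m))))

-- There are at most `s * s` firings, since both the passes and the clauses number at most `s`; each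
-- contributes at most one original equation.
saturateBound : ℕ → ℕ
saturateBound s = systemBound (s * s) (siegelBits (s * s) s) s

saturateBoundN : PolyN saturateBound
saturateBoundN = constN 1 +N rN *N (constN 1 +N (constN 1 +N (constN 1 +N constN 2 *N idN +N rowBoundN bitsN idN)))
  where
  rN : PolyN (λ s → s * s)
  rN = idN *N idN
  bitsN : PolyN (λ s → siegelBits (s * s) s)
  bitsN = constN 2 +N (rN +N (idN +N (constN 1 +N (constN 2 +N rN +N idN) *N rN)))

saturate-prefix-size : ∀ s cs l₁ l₂ → size cs ≤ s → copies cs cs ≡ l₁ ++ l₂ → size (foldl fire [] l₁) ≤ saturateBound s
saturate-prefix-size s cs l₁ l₂ le eq = reached-size (reached-mono short
    (reached-foldl l₁ (AllP.++⁻ˡ l₁ (subst (All (λ c → SmallRow s (proj₂ c))) eq (all-copies cs (small-heads s cs le)))) (reached [] [] z≤n)))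
  where
  short : length l₁ + 0 ≤ s * s
  short = ℕP.≤-trans (ℕP.≤-reflexive (ℕP.+-identityʳ _)) (ℕP.≤-trans (ℕP.m≤m+n (length l₁) (length l₂))
    (ℕP.≤-trans (ℕP.≤-reflexive (trans (sym (LP.length-++ l₁)) (trans (cong length (sym eq)) (length-copies cs cs))))
      (ℕP.*-mono-≤ (ℕP.≤-trans (length≤size cs) le) (ℕP.≤-trans (length≤size cs) le))))

opaque
  pt-copies : ∀ {Γ A B} {{_ : Enc Γ}} {{_ : Enc A}} {{_ : Enc B}} {l : Γ → List A} {m : Γ → List B} → PT l → PT m → PT (λ γ → copies (l γ) (m γ))
  pt-copies {Γ} {A} {B} pl pm = pt-∘ {g = λ (q : List B × List A) → copies (proj₂ q) (proj₁ q)}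
    (pt-rec {f = λ m l → copies l m} {n = λ _ → []} {c = λ m _ _ r → m ++ r} (λ _ → refl) (λ _ _ _ → refl) (pt-const [])
      (pt-++ (weaken (weaken (weaken pt-id))) var0)
      (poly-≤ (λ q → ℕP.≤-trans (size-copies (proj₂ q) (proj₁ q)) (ℕP.+-monoʳ-≤ 1 (ℕP.*-monoˡ-≤ (size (proj₁ q)) (length≤size (proj₂ q)))))
        (poly-const 1 poly-+ poly-proj₂ poly-* poly-proj₁)))
    (pt-pair pm pl)

  pt-saturate : ∀ {Γ} {{_ : Enc Γ}} {cs : Γ → List RowClause} → PT cs → PT (λ γ → saturate (cs γ))
  pt-saturate pcs = pt-∘ {g = saturate} (pt-foldl {step = λ _ S c → fire S c} {s = λ _ → []} {l = λ cs → copies cs cs}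
    (pt-fire (weaken var0) var0) (pt-const []) (pt-copies pt-id pt-id)
    (poly-N saturateBound saturateBoundN (λ _ → ℕP.≤-refl)) (λ cs l₁ l₂ eq → saturate-prefix-size (size cs) cs l₁ l₂ ℕP.≤-refl eq)) pcs

-- Solving a reduced system over the integers: column 0 must lie in the lattice spanned by the
-- other columns, where row k may be read modulo its leading coefficient.

-- The value 0 at modulus 0 makes the residue at most the modulus in all cases, so the size bounds
-- need no positivity.
modz : ℤ → ℕ → ℕ
modz z d = if isZero d then 0 else modℤ z d

reduceV : List ℕ → Row → Row
reduceV []       v = []
reduceV (d ∷ ds) v = + modz (headOr (+ 0) v) d ∷ reduceV ds (drop 1 v)

-- The first coordinate is kept apart, as a natural number that is not reduced.
Headed : Set
Headed = ℕ × Row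

-- One Euclidean column operation. The heads run through the ordinary Euclidean algorithm, while the
-- tails are brought back to residues at once and cannot grow.
vecStep : List ℕ → Headed × Headed → Headed × Headed
vecStep ds ((a , u) , (b , v)) = if isZero b then ((a , u) , (b , v))
  else ((b , v) , (rem a b , reduceV ds (comb (+ 1) u (ℤ.- (+ quot a b)) v)))

vecEuclid : List ℕ → Headed × Headed → Headed × Headed
vecEuclid ds p = steps (vecStep ds) p (euclidFuel (proj₁ (proj₁ p)) (proj₁ (proj₂ p)))

-- Euclid leaves one vector with the gcd as head and one with head 0. The first remains the
-- collecting vector; the tail of the second becomes a generator for the remaining rows.
absorb : List ℕ → ℕ → Headed × List Row → Row → Headed × List Row
absorb ds d (A , ws) g = proj₁ r , proj₂ (proj₂ r) ∷ ws
  where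
  r : Headed × Headed
  r = vecEuclid ds (A , (modz (headOr (+ 0) g) d , reduceV ds (drop 1 g)))

-- The collecting vector starts with head `d` and zero residues, since reading row 0 modulo `d`
-- amounts to having this vector as a further generator.
combine′ : List ℕ → ℕ → List Row → Headed × List Row
combine′ ds d gs = foldl (absorb ds d) ((d , reduceV ds []) , []) gs

SolveState : Set
SolveState = Bool × (List Row × Row)

-- After combination only one generator has a nonzero head `g`. So the head of the target must be a
-- multiple of `g`, its coefficient is the quotient, and the remaining rows form a smaller problem
-- of the same kind.
solveNext : List ℕ → ℕ → Row → Headed × List Row → SolveState
solveNext ds β b ((g , u) , ws) = if isZero (rem β g) then (true , (ws , reduceV ds (comb (+ 1) (drop 1 b) (ℤ.- (+ quot β g)) u))) else (false , ([] , []))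

solveStep : SolveState → ℕ × List ℕ → SolveState
solveStep (ok , (gs , b)) (d , ds) = if ok then solveNext ds (modz (headOr (+ 0) b) d) b (combine′ ds d gs) else (false , ([] , []))

suffixes : ∀ {A : Set} → List A → List (A × List A)
suffixes []      = []
suffixes (x ∷ l) = (x , l) ∷ suffixes l

solve : List ℕ → List Row → Row → Bool
solve ds gs b = proj₁ (foldl solveStep (true , (gs , b)) (suffixes ds))

-- The column numbers from `length l` down to 1. Column 0, the right-hand side, is not a generator.
indices : List ℤ → List Index
indices []      = []
indices (x ∷ l) = map (λ _ → tt) (x ∷ l) ∷ indices l

column : List Pivoted → Index → Row
column S i = map (λ R → at (proj₂ R) (length i)) S

-- A row supported on column 0 is contradictory. Otherwise each pivot variable occurs in its own row
-- only and can absorb any multiple of the leading coefficient, so a row matters only modulo that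
-- coefficient. Pivot columns are kept among the generators; being multiples of the moduli, they do
-- not change the lattice.
feasible : List ℤ → List Pivoted → Bool
feasible vs S = if anyᵇ (λ R → isZeroRow (drop 1 (proj₂ R))) S then false
  else solve (map (λ R → ℤ.∣ at (proj₂ R) (length (proj₁ R)) ∣) S) (map (column S) (indices vs)) (column S [])

-- Correctness of the congruence solver: lattices of residue vectors.

infixr 5 _◂_
_◂_ : ℤ → Point → Point
(c ◂ x) zero    = c
(c ◂ x) (suc i) = x i

Div : List ℕ → Point → Set
Div []       x = ⊤
Div (d ∷ ds) x = (Σ ℤ λ k → x 0 ≡ k ℤ.* + d) × Div ds (x ∘ suc)

-- The lattice generated by `G` and the multiples of the moduli. Coordinates beyond `ds` are free,
-- and a modulus 0 demands exactness, which is how the coordinate under elimination is treated.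
data Span (ds : List ℕ) (G : List Row) : Point → Set where
  div : ∀ {x} → Div ds x → Span ds G x
  gen : ∀ {g} → g ∈ G → Span ds G (at g)
  mix : ∀ {x y z} a b → Span ds G x → Span ds G y → (∀ i → z i ≡ a ℤ.* x i ℤ.+ b ℤ.* y i) → Span ds G z

Div-lin : ∀ ds {x y z} a b → Div ds x → Div ds y → (∀ i → z i ≡ a ℤ.* x i ℤ.+ b ℤ.* y i) → Div ds z
Div-lin [] a b _ _ _ = tt
Div-lin (d ∷ ds) a b ((k , p) , ps) ((l , q) , qs) e =
  (a ℤ.* k ℤ.+ b ℤ.* l , trans (e 0) (trans (cong₂ (λ s t → a ℤ.* s ℤ.+ b ℤ.* t) p q) (lem a k b l (+ d)))) , Div-lin ds a b ps qs (e ∘ suc)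
  where
  lem : ∀ a k b l d → a ℤ.* (k ℤ.* d) ℤ.+ b ℤ.* (l ℤ.* d) ≡ (a ℤ.* k ℤ.+ b ℤ.* l) ℤ.* d
  lem = ℤSolver.solve-∀

Div-≗ : ∀ ds {x y} → (∀ i → y i ≡ x i) → Div ds x → Div ds y
Div-≗ [] e _ = tt
Div-≗ (d ∷ ds) e ((k , p) , ps) = (k , trans (e 0) p) , Div-≗ ds (e ∘ suc) ps

Div-0 : ∀ ds {x} → (∀ i → x i ≡ + 0) → Div ds x
Div-0 [] z = tt
Div-0 (d ∷ ds) z = (+ 0 , z 0) , Div-0 ds (z ∘ suc)

span-sub : ∀ {ds G G′ x} → All (λ g → Span ds G′ (at g)) G → Span ds G x → Span ds G′ x
span-sub H (div p)       = div p
span-sub H (gen m)       = All.lookup H m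
span-sub H (mix a b p q e) = mix a b (span-sub H p) (span-sub H q) e

span-≗ : ∀ {ds G x y} → (∀ i → y i ≡ x i) → Span ds G x → Span ds G y
span-≗ {x = x} e p = mix (+ 1) (+ 0) p p (λ i → trans (e i) (lem (x i)))
  where
  lem : ∀ x → x ≡ + 1 ℤ.* x ℤ.+ + 0 ℤ.* x
  lem = ℤSolver.solve-∀

span-⊆ : ∀ {ds G G′ x} → (∀ {g} → g ∈ G → g ∈ G′) → Span ds G x → Span ds G′ x
span-⊆ sub (div p)         = div p
span-⊆ sub (gen m)         = gen (sub m)
span-⊆ sub (mix a b p q e) = mix a b (span-⊆ sub p) (span-⊆ sub q) e

record Near (ds : List ℕ) (x y : Point) : Set where
  constructor mkNear
  field divides-diff : Div ds (λ i → x i ℤ.- y i)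
open Near

span-near : ∀ {ds G x y} → Near ds x y → Span ds G y → Span ds G x
span-near {x = x} {y} n p = mix (+ 1) (+ 1) (div (divides-diff n)) p (λ i → lem (x i) (y i))
  where
  lem : ∀ x y → x ≡ + 1 ℤ.* (x ℤ.- y) ℤ.+ + 1 ℤ.* y
  lem = ℤSolver.solve-∀

near-sym : ∀ {ds x y} → Near ds x y → Near ds y x
near-sym {ds} {x} {y} (mkNear n) = mkNear (Div-lin ds -[1+ 0 ] (+ 0) n n (λ i → lem (x i) (y i)))
  where
  lem : ∀ x y → y ℤ.- x ≡ -[1+ 0 ] ℤ.* (x ℤ.- y) ℤ.+ + 0 ℤ.* (x ℤ.- y)
  lem = ℤSolver.solve-∀

modℤ-near : ∀ z d → 0 < d → Σ ℤ λ k → z ℤ.- + modℤ z d ≡ k ℤ.* + d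
modℤ-near (+ n) d d>0 = + quot n d , trans (cong (λ w → + w ℤ.- + rem n d) (quot-rem n d d>0))
  (trans (cong (ℤ._- + rem n d) (trans (ℤP.pos-+ (quot n d * d) (rem n d)) (cong (ℤ._+ + rem n d) (ℤP.pos-* (quot n d) d)))) (lem (+ quot n d) (+ d) (+ rem n d)))
  where
  lem : ∀ q d r → q ℤ.* d ℤ.+ r ℤ.- r ≡ q ℤ.* d
  lem = ℤSolver.solve-∀
modℤ-near -[1+ n ] d d>0 = ℤ.- (+ 1) ℤ.- + q , (begin
  -[1+ n ] ℤ.- + (d ∸ suc r)                    ≡⟨ cong (λ w → -[1+ n ] ℤ.- w) d∸ ⟩
  -[1+ n ] ℤ.- (+ d ℤ.- + suc r)                ≡⟨ cong₂ (λ w w′ → w ℤ.- (+ d ℤ.- w′)) (trans (cong (λ k → ℤ.- (+ suc k)) (quot-rem n d d>0)) neg) (ℤP.pos-+ 1 r) ⟩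
  (ℤ.- (+ 1 ℤ.+ (+ q ℤ.* + d ℤ.+ + r)) ℤ.- (+ d ℤ.- (+ 1 ℤ.+ + r))) ≡⟨ lem (+ q) (+ d) (+ r) ⟩
  (ℤ.- (+ 1) ℤ.- + q) ℤ.* + d ∎)
  where
  open ≡-Reasoning
  q = quot n d
  r = rem n d
  lem : ∀ q d r → (ℤ.- (+ 1 ℤ.+ (q ℤ.* d ℤ.+ r)) ℤ.- (d ℤ.- (+ 1 ℤ.+ r))) ≡ (ℤ.- (+ 1) ℤ.- q) ℤ.* d
  lem = ℤSolver.solve-∀
  d∸ : + (d ∸ suc r) ≡ + d ℤ.- + suc r
  d∸ = sym (trans (ℤP.[+m]-[+n]≡m⊖n d (suc r)) (ℤP.⊖-≥ (rem< n d d>0)))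
  neg : ℤ.- (+ suc (q * d + r)) ≡ ℤ.- (+ 1 ℤ.+ (+ q ℤ.* + d ℤ.+ + r))
  neg = cong ℤ.-_ (trans (ℤP.pos-+ 1 (q * d + r)) (cong (λ w → + 1 ℤ.+ w) (trans (ℤP.pos-+ (q * d) r) (cong (ℤ._+ + r) (ℤP.pos-* q d)))))

modz-near : ∀ z d → 0 < d → Σ ℤ λ k → z ℤ.- + modz z d ≡ k ℤ.* + d
modz-near z (suc d) d>0 = modℤ-near z (suc d) d>0

headOr-at : ∀ v → headOr (+ 0) v ≡ at v 0
headOr-at []      = refl
headOr-at (x ∷ v) = refl

drop-at : ∀ v i → at (drop 1 v) i ≡ at v (suc i)
drop-at []      i = refl
drop-at (x ∷ v) i = refl

reduceV-near : ∀ ds v → All (0 <_) ds → Near ds (at v) (at (reduceV ds v))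
reduceV-near [] v _ = mkNear tt
reduceV-near (d ∷ ds) v (p ∷ ps) =
  mkNear ((proj₁ m , trans (cong (ℤ._- + modz (headOr (+ 0) v) d) (sym (headOr-at v))) (proj₂ m)) ,
  Div-≗ ds (λ i → cong (ℤ._- at (reduceV ds (drop 1 v)) i) (sym (drop-at v i))) (divides-diff (reduceV-near ds (drop 1 v) ps)))
  where
  m = modz-near (headOr (+ 0) v) d p

headed : Headed → Row
headed (a , u) = + a ∷ u

pairRows : Headed × Headed → List Row
pairRows (A , B) = headed A ∷ headed B ∷ []

Equispan : List ℕ → List Row → List Row → Set
Equispan ds G G′ = All (λ g → Span ds G′ (at g)) G × All (λ g → Span ds G (at g)) G′

equi-trans : ∀ {ds G G′ G″} → Equispan ds G G′ → Equispan ds G′ G″ → Equispan ds G G″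
equi-trans (p , q) (p′ , q′) = All.map (span-sub p′) p , All.map (span-sub q) q′

equi-refl : ∀ {ds G} → Equispan ds G G
equi-refl = All.tabulate gen , All.tabulate gen

vecStep-equi : ∀ ds p → All (0 <_) ds → Equispan (0 ∷ ds) (pairRows p) (pairRows (vecStep ds p))
vecStep-equi ds ((a , u) , (zero , v)) pos = equi-refl
vecStep-equi ds ((a , u) , (suc b′ , v)) pos = (A∈ ∷ gen (here refl) ∷ []) , (gen (there (here refl)) ∷ C∈ ∷ [])
  where
  b = suc b′
  q = quot a b
  r = rem a b
  t : Row
  t = comb (+ 1) u (ℤ.- (+ q)) v
  A B C : Row
  A = + a ∷ u
  B = + b ∷ v
  C = + r ∷ reduceV ds t
  a≡ : + a ≡ + q ℤ.* + b ℤ.+ + r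
  a≡ = trans (cong +_ (quot-rem a b (s≤s z≤n))) (trans (ℤP.pos-+ (q * b) r) (cong (ℤ._+ + r) (ℤP.pos-* q b)))
  lem₀ : ∀ q b r → q ℤ.* b ℤ.+ r ℤ.- (r ℤ.+ q ℤ.* b) ≡ + 0 ℤ.* + 0
  lem₀ = ℤSolver.solve-∀
  lem₁ : ∀ u q v s → u ℤ.- (s ℤ.+ q ℤ.* v) ≡ + 1 ℤ.* u ℤ.+ ℤ.- q ℤ.* v ℤ.- s
  lem₁ = ℤSolver.solve-∀
  near : Near (0 ∷ ds) (at A) (λ i → at C i ℤ.+ + q ℤ.* at B i)
  near = mkNear ((+ 0 , trans (cong (λ z → z ℤ.- (+ r ℤ.+ + q ℤ.* + b)) a≡) (lem₀ (+ q) (+ b) (+ r))) ,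
    Div-≗ ds (λ i → trans (lem₁ (at u i) (+ q) (at v i) (at (reduceV ds t) i)) (cong (ℤ._- at (reduceV ds t) i) (sym (at-comb (+ 1) u (ℤ.- (+ q)) v i)))) (divides-diff (reduceV-near ds t pos)))
  lem₂ : ∀ c q b → c ℤ.+ q ℤ.* b ≡ + 1 ℤ.* c ℤ.+ q ℤ.* b
  lem₂ = ℤSolver.solve-∀
  A∈ : Span (0 ∷ ds) (B ∷ C ∷ []) (at A)
  A∈ = span-near near (mix (+ 1) (+ q) (gen (there (here refl))) (gen (here refl)) (λ i → lem₂ (at C i) (+ q) (at B i)))
  lem₃ : ∀ c q b → c ≡ + 1 ℤ.* (c ℤ.+ q ℤ.* b) ℤ.+ ℤ.- q ℤ.* b
  lem₃ = ℤSolver.solve-∀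
  C∈ : Span (0 ∷ ds) (A ∷ B ∷ []) (at C)
  C∈ = mix (+ 1) (ℤ.- (+ q)) (span-near (near-sym {0 ∷ ds} {at A} {λ i → at C i ℤ.+ + q ℤ.* at B i} near) (gen (here refl))) (gen (there (here refl))) (λ i → lem₃ (at C i) (+ q) (at B i))

vecSteps-equi : ∀ ds p l → All (0 <_) ds → Equispan (0 ∷ ds) (pairRows p) (pairRows (steps (vecStep ds) p l))
vecSteps-equi ds p []      pos = equi-refl
vecSteps-equi ds p (_ ∷ l) pos = equi-trans (vecStep-equi ds p pos) (vecSteps-equi ds (vecStep ds p) l pos)

heads : Headed × Headed → ℕ × ℕ
heads (A , B) = proj₁ A , proj₁ B

vecStep-heads : ∀ ds p → heads (vecStep ds p) ≡ euclidStep (heads p)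
vecStep-heads ds ((a , u) , (zero , v))  = refl
vecStep-heads ds ((a , u) , (suc b , v)) = refl

vecSteps-heads : ∀ ds p l → heads (steps (vecStep ds) p l) ≡ steps euclidStep (heads p) l
vecSteps-heads ds p []      = refl
vecSteps-heads ds p (_ ∷ l) = trans (vecSteps-heads ds (vecStep ds p) l) (cong (λ h → steps euclidStep h l) (vecStep-heads ds p))

vecEuclid-heads : ∀ ds p → heads (vecEuclid ds p) ≡ (gcd′ (proj₁ (proj₁ p)) (proj₁ (proj₂ p)) , 0)
vecEuclid-heads ds p = trans (vecSteps-heads ds p (euclidFuel (proj₁ (proj₁ p)) (proj₁ (proj₂ p))))
  (cong (λ z → gcd′ (proj₁ (proj₁ p)) (proj₁ (proj₂ p)) , z) (euclid-finishes (proj₁ (proj₁ p)) (proj₁ (proj₂ p))))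

divides>0 : ∀ {g a} → 0 < a → g ∣ a → 0 < g
divides>0 {zero}  a>0 g∣a = contradiction (ND.0∣⇒≡0 g∣a) (λ e → ℕP.<-irrefl (sym e) a>0)
divides>0 {suc g} _ _ = s≤s z≤n

stateRows : Headed × List Row → List Row
stateRows (A , ws) = headed A ∷ map (+ 0 ∷_) ws

module Absorb (ds : List ℕ) (d : ℕ) (pos : All (0 <_) ds) (d>0 : 0 < d) where

  -- Makes up for replacing the modulus `d` of the first coordinate by 0.
  dz : Row
  dz = + d ∷ reduceV ds []

  DZ : Headed × List Row → Set
  DZ st = Span (0 ∷ ds) (stateRows st) (at dz)

  reduced-g : Row → Row
  reduced-g g = + modz (headOr (+ 0) g) d ∷ reduceV ds (drop 1 g)

  at-zeros : Near ds (at []) (at (reduceV ds []))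
  at-zeros = reduceV-near ds [] pos

  g-near : ∀ g → Σ ℤ λ k → Near (0 ∷ ds) (at g) (λ i → at (reduced-g g) i ℤ.+ k ℤ.* at dz i)
  g-near g with modz-near (headOr (+ 0) g) d d>0
  ... | k , e = k , mkNear ((+ 0 , hd-eq) ,
      Div-lin ds (+ 1) k (divides-diff (reduceV-near ds (drop 1 g) pos)) (divides-diff at-zeros)
        (λ i → trans (cong (λ z → z ℤ.- (at (reduceV ds (drop 1 g)) i ℤ.+ k ℤ.* at (reduceV ds []) i)) (sym (drop-at g i))) (lem₁ (at (drop 1 g) i) (at (reduceV ds (drop 1 g)) i) k (at (reduceV ds []) i))))
    where
    lem₁ : ∀ g r k z → g ℤ.- (r ℤ.+ k ℤ.* z) ≡ + 1 ℤ.* (g ℤ.- r) ℤ.+ k ℤ.* (+ 0 ℤ.- z)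
    lem₁ = ℤSolver.solve-∀
    m = modz (headOr (+ 0) g) d
    lem₂ : ∀ g m k d → g ℤ.- (m ℤ.+ k ℤ.* d) ≡ (g ℤ.- m) ℤ.- k ℤ.* d
    lem₂ = ℤSolver.solve-∀
    hd-eq : at g 0 ℤ.- (+ m ℤ.+ k ℤ.* + d) ≡ + 0 ℤ.* + 0
    hd-eq = trans (cong (λ z → z ℤ.- (+ m ℤ.+ k ℤ.* + d)) (sym (headOr-at g))) (trans (lem₂ (headOr (+ 0) g) (+ m) k (+ d))
      (trans (cong (ℤ._- k ℤ.* + d) e) (ℤP.+-inverseʳ (k ℤ.* + d))))

  record Absorbed (st : Headed × List Row) (g : Row) (st′ : Headed × List Row) : Set where
    constructor absorbed
    field
      old   : All (λ r → Span (0 ∷ ds) (stateRows st′) (at r)) (stateRows st)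
      fresh : Span (0 ∷ ds) (stateRows st′) (at g)
      below : All (λ r → Span (0 ∷ ds) (g ∷ stateRows st) (at r)) (stateRows st′)
      head>0 : 0 < proj₁ (proj₁ st′)

  -- The column `g` agrees with its residue form up to a multiple of `dz`, which the span already
  -- contains, and Euclidean steps do not change the span.
  absorb-spec : ∀ st g → DZ st → 0 < proj₁ (proj₁ st) → Absorbed st g (absorb ds d st g)
  absorb-spec ((a , u) , ws) g dzs a>0 = absorbed old fresh below head>0
    where
    st st′ : Headed × List Row
    st = (a , u) , ws
    st′ = absorb ds d st g
    p r : Headed × Headed
    p = (a , u) , (modz (headOr (+ 0) g) d , reduceV ds (drop 1 g))
    r = vecEuclid ds p
    hs : heads r ≡ (gcd′ a (modz (headOr (+ 0) g) d) , 0)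
    hs = vecEuclid-heads ds p
    eq : Equispan (0 ∷ ds) (pairRows p) (pairRows r)
    eq = vecSteps-equi ds p (euclidFuel a (modz (headOr (+ 0) g) d)) pos
    last-row : headed (proj₂ r) ≡ + 0 ∷ proj₂ (proj₂ r)
    last-row = cong (λ h → + h ∷ proj₂ (proj₂ r)) (cong proj₂ hs)
    r⊆st′ : ∀ {x} → x ∈ pairRows r → x ∈ stateRows st′
    r⊆st′ (here e) = here e
    r⊆st′ (there (here e)) = there (here (trans e last-row))
    ws⊆ : ∀ {x} → x ∈ map (+ 0 ∷_) ws → x ∈ stateRows st′
    ws⊆ m = there (there m)
    old : All (λ r → Span (0 ∷ ds) (stateRows st′) (at r)) (stateRows st)
    old = span-⊆ r⊆st′ (All.head (proj₁ eq)) ∷ All.tabulate (λ m → gen (ws⊆ m))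
    k : ℤ
    k = proj₁ (g-near g)
    near : Near (0 ∷ ds) (at g) (λ i → at (reduced-g g) i ℤ.+ k ℤ.* at dz i)
    near = proj₂ (g-near g)
    lem₁ : ∀ r k z → r ℤ.+ k ℤ.* z ≡ + 1 ℤ.* r ℤ.+ k ℤ.* z
    lem₁ = ℤSolver.solve-∀
    lem₂ : ∀ r k z → r ≡ + 1 ℤ.* (r ℤ.+ k ℤ.* z) ℤ.+ ℤ.- k ℤ.* z
    lem₂ = ℤSolver.solve-∀
    fresh : Span (0 ∷ ds) (stateRows st′) (at g)
    fresh = span-near near (mix (+ 1) k (span-⊆ r⊆st′ (All.head (All.tail (proj₁ eq)))) (span-sub old dzs) (λ i → lem₁ (at (reduced-g g) i) k (at dz i)))
    g∈ : Span (0 ∷ ds) (g ∷ stateRows st) (at (reduced-g g))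
    g∈ = mix (+ 1) (ℤ.- k) (span-near (near-sym {0 ∷ ds} {at g} {λ i → at (reduced-g g) i ℤ.+ k ℤ.* at dz i} near) (gen (here refl))) (span-⊆ there dzs) (λ i → lem₂ (at (reduced-g g) i) k (at dz i))
    p⊆ : All (λ r → Span (0 ∷ ds) (g ∷ stateRows st) (at r)) (pairRows p)
    p⊆ = gen (there (here refl)) ∷ g∈ ∷ []
    below : All (λ r → Span (0 ∷ ds) (g ∷ stateRows st) (at r)) (stateRows st′)
    below = span-sub p⊆ (All.head (proj₂ eq)) ∷ subst (λ x → Span (0 ∷ ds) (g ∷ stateRows st) (at x)) last-row (span-sub p⊆ (All.head (All.tail (proj₂ eq))))
      ∷ All.tabulate (λ m → gen (there (there m)))
    head>0 : 0 < proj₁ (proj₁ r)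
    head>0 = divides>0 a>0 (subst (_∣ a) (sym (cong proj₁ hs)) (proj₁ (isGcd-gcd′ a (modz (headOr (+ 0) g) d))))

  record Combined (st : Headed × List Row) (gs : List Row) (st′ : Headed × List Row) : Set where
    constructor combined
    field
      old    : All (λ r → Span (0 ∷ ds) (stateRows st′) (at r)) (stateRows st)
      fresh  : All (λ r → Span (0 ∷ ds) (stateRows st′) (at r)) gs
      below  : All (λ r → Span (0 ∷ ds) (gs ++ stateRows st) (at r)) (stateRows st′)
      head>0 : 0 < proj₁ (proj₁ st′)

  absorbs : ∀ gs st → DZ st → 0 < proj₁ (proj₁ st) → Combined st gs (foldl (absorb ds d) st gs)
  absorbs [] st dzs a>0 = combined (All.tabulate gen) [] (All.tabulate gen) a>0
  absorbs (g ∷ gs) st dzs a>0 = chain (absorb-spec st g dzs a>0)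
    where
    chain : ∀ {st₁} → Absorbed st g st₁ → Combined st (g ∷ gs) (foldl (absorb ds d) st₁ gs)
    chain {st₁} (absorbed old fresh below h>0) = join′ (absorbs gs st₁ (span-sub old dzs) h>0)
      where
      join′ : ∀ {st₂} → Combined st₁ gs st₂ → Combined st (g ∷ gs) st₂
      join′ (combined old′ fresh′ below′ h>0′) = combined (All.map (span-sub old′) old) (span-sub old′ fresh ∷ fresh′)
        (All.map (span-sub (AllP.++⁺ (All.tabulate (λ m → gen (there (∈-++⁺ˡ m))))
          (All.map (span-⊆ (λ { (here e) → here e ; (there m) → there (∈-++⁺ʳ gs m) })) below))) below′) h>0′

  start : Headed × List Row
  start = (d , reduceV ds []) , []

  combine-spec : ∀ gs → Combined start gs (combine′ ds d gs)
  combine-spec gs = absorbs gs start (gen (here refl)) d>0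

shift-span : ∀ {ds ws x} → Span ds ws x → Span (0 ∷ ds) (map (+ 0 ∷_) ws) (+ 0 ◂ x)
shift-span (div p) = div ((+ 0 , refl) , p)
shift-span {ds} {ws} (gen {g} m) = span-≗ (λ { zero → refl ; (suc i) → refl }) (gen (∈-map⁺ (+ 0 ∷_) m))
shift-span (mix a b p q e) = mix a b (shift-span p) (shift-span q) (λ { zero → sym (trans (cong₂ ℤ._+_ (ℤP.*-zeroʳ a) (ℤP.*-zeroʳ b)) refl) ; (suc i) → e i })

-- With exactness in the first coordinate, only the first generator contributes to the head. Its
-- coefficient can therefore be split off, and the rest lies in the span of the tails.
head-quotient : ∀ {ds g u ws x} → Span (0 ∷ ds) (stateRows ((g , u) , ws)) x →
  Σ ℤ λ c → x 0 ≡ c ℤ.* + g × Span ds ws (λ i → x (suc i) ℤ.- c ℤ.* at u i)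
head-quotient {ds} {g} {u} {ws} {x} (div ((k , e) , ps)) = + 0 , trans e (ℤP.*-zeroʳ k) , div (Div-≗ ds (λ i → lem (x (suc i)) (at u i)) ps)
  where
  lem : ∀ x u → x ℤ.- + 0 ℤ.* u ≡ x
  lem = ℤSolver.solve-∀
head-quotient {ds} {g} {u} (gen (here refl)) = + 1 , sym (ℤP.*-identityˡ (+ g)) , div (Div-0 ds (λ i → lem (at u i)))
  where
  lem : ∀ u → u ℤ.- + 1 ℤ.* u ≡ + 0
  lem = ℤSolver.solve-∀
head-quotient {ds} {g} {u} {ws} (gen (there m)) with ∈-map⁻ (+ 0 ∷_) m
... | w , w∈ , refl = + 0 , refl , span-≗ (λ i → lem (at w i) (at u i)) (gen w∈)
  where
  lem : ∀ x u → x ℤ.- + 0 ℤ.* u ≡ x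
  lem = ℤSolver.solve-∀
head-quotient {ds} {g} {u} (mix {x} {y} {z} a b p q e) with head-quotient p | head-quotient q
... | c , hx , sx | c′ , hy , sy = a ℤ.* c ℤ.+ b ℤ.* c′ ,
    trans (e 0) (trans (cong₂ (λ s t → a ℤ.* s ℤ.+ b ℤ.* t) hx hy) (lem₁ a c b c′ (+ g))) ,
    mix a b sx sy (λ i → trans (cong (ℤ._- (a ℤ.* c ℤ.+ b ℤ.* c′) ℤ.* at u i) (e (suc i))) (lem₂ a b c c′ (x (suc i)) (y (suc i)) (at u i)))
  where
  lem₁ : ∀ a k b l d → a ℤ.* (k ℤ.* d) ℤ.+ b ℤ.* (l ℤ.* d) ≡ (a ℤ.* k ℤ.+ b ℤ.* l) ℤ.* d
  lem₁ = ℤSolver.solve-∀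
  lem₂ : ∀ a b c c′ x y u → a ℤ.* x ℤ.+ b ℤ.* y ℤ.- (a ℤ.* c ℤ.+ b ℤ.* c′) ℤ.* u ≡ a ℤ.* (x ℤ.- c ℤ.* u) ℤ.+ b ℤ.* (y ℤ.- c′ ℤ.* u)
  lem₂ = ℤSolver.solve-∀

isZero-true : ∀ {n} → isZero n ≡ true → n ≡ 0
isZero-true {zero} _ = refl

module Eliminate (ds : List ℕ) (d : ℕ) (pos : All (0 <_) ds) (d>0 : 0 < d) (gs : List Row) (b : Row) where
  open Absorb ds d pos d>0

  st′ : Headed × List Row
  st′ = combine′ ds d gs
  g : ℕ
  g = proj₁ (proj₁ st′)
  u : Row
  u = proj₂ (proj₁ st′)
  ws : List Row
  ws = proj₂ st′
  spec : Combined start gs st′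
  spec = combine-spec gs
  g>0 : 0 < g
  g>0 = Combined.head>0 spec
  β q : ℕ
  β = modz (headOr (+ 0) b) d
  q = quot β g
  t b′ : Row
  t = comb (+ 1) (drop 1 b) (ℤ.- (+ q)) u
  b′ = reduceV ds t

  dz-div : Div (d ∷ ds) (at dz)
  dz-div = (+ 1 , sym (ℤP.*-identityˡ (+ d))) , Div-lin ds -[1+ 0 ] (+ 0) (divides-diff at-zeros) (divides-diff at-zeros) (λ i → lem (at (reduceV ds []) i))
    where
    lem : ∀ z → z ≡ -[1+ 0 ] ℤ.* (+ 0 ℤ.- z) ℤ.+ + 0 ℤ.* (+ 0 ℤ.- z)
    lem = ℤSolver.solve-∀

  dz∈ : Span (0 ∷ ds) (stateRows st′) (at dz)
  dz∈ = All.head (Combined.old spec)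

  -- Reading the first row modulo `d` is the same as reading it exactly with `dz` as a further
  -- generator. `recall` is the converse and passes to the combined generators as well.
  forget : ∀ {x} → Span (0 ∷ ds) (gs ++ stateRows start) x → Span (d ∷ ds) gs x
  forget (div ((k , e) , ps)) = div ((+ 0 , trans e (ℤP.*-zeroʳ k)) , ps)
  forget (gen m) with ∈-++⁻ gs m
  ... | inj₁ m′          = gen m′
  ... | inj₂ (here refl) = div dz-div
  forget (mix a b p q e) = mix a b (forget p) (forget q) e

  recall : ∀ {x} → Span (d ∷ ds) gs x → Span (0 ∷ ds) (stateRows st′) x
  recall {x} (div ((k , e) , ps)) = mix k (+ 1) dz∈ (div {x = + 0 ◂ (λ i → x (suc i) ℤ.- k ℤ.* at (reduceV ds []) i)}
      ((+ 0 , refl) , Div-lin ds (+ 1) k ps (divides-diff at-zeros) (λ i → lem (x (suc i)) k (at (reduceV ds []) i))))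
      λ { zero → trans e (sym (ℤP.+-identityʳ _)) ; (suc i) → lem₂ (x (suc i)) k (at (reduceV ds []) i) }
    where
    lem : ∀ x k z → x ℤ.- k ℤ.* z ≡ + 1 ℤ.* x ℤ.+ k ℤ.* (+ 0 ℤ.- z)
    lem = ℤSolver.solve-∀
    lem₂ : ∀ x k z → x ≡ k ℤ.* z ℤ.+ + 1 ℤ.* (x ℤ.- k ℤ.* z)
    lem₂ = ℤSolver.solve-∀
  recall (gen m)         = All.lookup (Combined.fresh spec) m
  recall (mix a b p q e) = mix a b (recall p) (recall q) e

  b-near : Σ ℤ λ k → Near (0 ∷ ds) (at b) (λ i → at (+ β ∷ drop 1 b) i ℤ.+ k ℤ.* at dz i)
  b-near with modz-near (headOr (+ 0) b) d d>0
  ... | k , e = k , mkNear ((+ 0 , hd-eq) , Div-lin ds k (+ 0) (divides-diff at-zeros) (divides-diff at-zeros)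
        (λ i → trans (cong (λ z → at b (suc i) ℤ.- (z ℤ.+ k ℤ.* at (reduceV ds []) i)) (drop-at b i)) (lem₁ (at b (suc i)) k (at (reduceV ds []) i))))
    where
    lem₁ : ∀ b k z → b ℤ.- (b ℤ.+ k ℤ.* z) ≡ k ℤ.* (+ 0 ℤ.- z) ℤ.+ + 0 ℤ.* (+ 0 ℤ.- z)
    lem₁ = ℤSolver.solve-∀
    lem₂ : ∀ g m k d → g ℤ.- (m ℤ.+ k ℤ.* d) ≡ (g ℤ.- m) ℤ.- k ℤ.* d
    lem₂ = ℤSolver.solve-∀
    hd-eq : at b 0 ℤ.- (+ β ℤ.+ k ℤ.* + d) ≡ + 0 ℤ.* + 0
    hd-eq = trans (cong (λ z → z ℤ.- (+ β ℤ.+ k ℤ.* + d)) (sym (headOr-at b))) (trans (lem₂ (headOr (+ 0) b) (+ β) k (+ d))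
      (trans (cong (ℤ._- k ℤ.* + d) e) (ℤP.+-inverseʳ (k ℤ.* + d))))

  bβ : Row
  bβ = + β ∷ drop 1 b

  b→bβ : Span (0 ∷ ds) (stateRows st′) (at b) → Span (0 ∷ ds) (stateRows st′) (at bβ)
  b→bβ s = let k = proj₁ b-near in
    mix (+ 1) (ℤ.- k) (span-near (near-sym {0 ∷ ds} {at b} {λ i → at bβ i ℤ.+ k ℤ.* at dz i} (proj₂ b-near)) s) dz∈ (λ i → lem (at bβ i) k (at dz i))
    where
    lem : ∀ r k z → r ≡ + 1 ℤ.* (r ℤ.+ k ℤ.* z) ℤ.+ ℤ.- k ℤ.* z
    lem = ℤSolver.solve-∀

  bβ→b : Span (0 ∷ ds) (stateRows st′) (at bβ) → Span (0 ∷ ds) (stateRows st′) (at b)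
  bβ→b s = span-near (proj₂ b-near) (mix (+ 1) (proj₁ b-near) s dz∈ (λ i → lem (at bβ i) (proj₁ b-near) (at dz i)))
    where
    lem : ∀ r k z → r ℤ.+ k ℤ.* z ≡ + 1 ℤ.* r ℤ.+ k ℤ.* z
    lem = ℤSolver.solve-∀

  β≡ : + β ≡ + q ℤ.* + g ℤ.+ + rem β g
  β≡ = trans (cong +_ (quot-rem β g g>0)) (trans (ℤP.pos-+ (q * g) (rem β g)) (cong (ℤ._+ + rem β g) (ℤP.pos-* q g)))

  at-t : ∀ i → at t i ≡ at (drop 1 b) i ℤ.- + q ℤ.* at u i
  at-t i = trans (at-comb (+ 1) (drop 1 b) (ℤ.- (+ q)) u i) (lem (at (drop 1 b) i) (+ q) (at u i))
    where
    lem : ∀ b q u → + 1 ℤ.* b ℤ.+ ℤ.- q ℤ.* u ≡ b ℤ.- q ℤ.* u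
    lem = ℤSolver.solve-∀

  multiple⇒rem0 : ∀ c → + β ≡ c ℤ.* + g → rem β g ≡ 0
  multiple⇒rem0 c e = multiple<⇒0 (rem β g) (ND.∣m+n∣m⇒∣n (subst (g ∣_) (quot-rem β g g>0) g∣β) (ND.∣n⇒∣m*n q ND.∣-refl)) (rem< β g g>0)
    where
    g∣β : g ∣ β
    g∣β = ND.divides ℤ.∣ c ∣ (trans (cong ℤ.∣_∣ e) (ℤP.abs-* c (+ g)))

  solvable⇒ : Span (d ∷ ds) gs (at b) → rem β g ≡ 0 × Span ds ws (at b′)
  solvable⇒ s = r0 , span-near (near-sym {ds} {at t} {at b′} (reduceV-near ds t pos))
        (span-≗ (λ i → trans (at-t i) (cong (λ z → at (drop 1 b) i ℤ.- z ℤ.* at u i) (sym c≡q))) (proj₂ (proj₂ hq)))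
    where
    hq : Σ ℤ λ c → + β ≡ c ℤ.* + g × Span ds ws (λ i → at (drop 1 b) i ℤ.- c ℤ.* at u i)
    hq = head-quotient {ds} {g} {u} {ws} (b→bβ (recall s))
    c : ℤ
    c = proj₁ hq
    r0 : rem β g ≡ 0
    r0 = multiple⇒rem0 c (proj₁ (proj₂ hq))
    c≡q : c ≡ + q
    c≡q = ℤP.*-cancelʳ-≡ c (+ q) (+ g) {{ℕ.>-nonZero g>0}} (trans (sym (proj₁ (proj₂ hq))) (trans β≡ (trans (cong (λ z → + q ℤ.* + g ℤ.+ + z) r0) (ℤP.+-identityʳ _))))

  solvable⇐ : rem β g ≡ 0 → Span ds ws (at b′) → Span (d ∷ ds) gs (at b)
  solvable⇐ r0 s = forget (span-sub (Combined.below spec) (bβ→b (mix (+ q) (+ 1) (gen (here refl))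
      (span-⊆ there (shift-span (span-near (reduceV-near ds t pos) s)))
      λ { zero → trans β≡ (cong (λ z → + q ℤ.* + g ℤ.+ + z) r0) ; (suc i) → sym (trans (cong (λ z → + q ℤ.* at u i ℤ.+ + 1 ℤ.* z) (at-t i)) (lem (at (drop 1 b) i) (+ q) (at u i))) })))
    where
    lem : ∀ b q u → q ℤ.* u ℤ.+ + 1 ℤ.* (b ℤ.- q ℤ.* u) ≡ b
    lem = ℤSolver.solve-∀

failed : ∀ l → proj₁ (foldl solveStep (false , ([] , [])) l) ≡ false
failed []      = refl
failed (_ ∷ l) = failed l

isZero-0 : ∀ {n} → n ≡ 0 → isZero n ≡ true
isZero-0 refl = refl

solve-sound : ∀ ds gs b → All (0 <_) ds → solve ds gs b ≡ true → Span ds gs (at b)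
solve-sound [] gs b [] e = div tt
solve-sound (d ∷ ds) gs b (p ∷ ps) e = cases (isZero (rem β g)) refl e
  where
  open Eliminate ds d ps p gs b
  cases : ∀ z → isZero (rem β g) ≡ z →
    proj₁ (foldl solveStep (if z then (true , (ws , b′)) else (false , ([] , []))) (suffixes ds)) ≡ true → Span (d ∷ ds) gs (at b)
  cases true  eq e = solvable⇐ (isZero-true eq) (solve-sound ds ws b′ ps e)
  cases false eq e = ⊥-elim (true≢false e (failed (suffixes ds)))

solve-complete : ∀ ds gs b → All (0 <_) ds → Span ds gs (at b) → solve ds gs b ≡ true
solve-complete [] gs b [] s = refl
solve-complete (d ∷ ds) gs b (p ∷ ps) s = trans
    (cong (λ z → proj₁ (foldl solveStep (if z then (true , (ws , b′)) else (false , ([] , []))) (suffixes ds))) (isZero-0 (proj₁ next′)))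
    (solve-complete ds ws b′ ps (proj₂ next′))
  where
  open Eliminate ds d ps p gs b
  next′ : rem β g ≡ 0 × Span ds ws (at b′)
  next′ = solvable⇒ s

-- From residues back to integer points of the kernel.

-- An integer point `t` representing `y`: the rows take the values of `y` at `t`, up to multiples of
-- their leading coefficients.
Fits : List Pivoted → Point → Point → Set
Fits []      y t = ⊤
Fits (R ∷ S) y t = (Σ ℤ λ m → y 0 ≡ ev (row R) t ℤ.+ m ℤ.* + ℤ.∣ lead R ∣) × Fits S (y ∘ suc) t

moduli : List Pivoted → List ℕ
moduli = map (λ R → ℤ.∣ at (proj₂ R) (length (proj₁ R)) ∣)

fits-div : ∀ S y → Div (moduli S) y → Fits S y (λ _ → + 0)
fits-div []      y _ = tt
fits-div (R ∷ S) y ((k , e) , ps) = (k , trans e (sym (trans (cong (ℤ._+ k ℤ.* + ℤ.∣ lead R ∣) (ev-null (row R) (λ _ → refl))) (ℤP.+-identityˡ _)))) , fits-div S (y ∘ suc) ps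

fits-column : ∀ S i → Fits S (at (column S i)) (unit (length i))
fits-column []      i = tt
fits-column (R ∷ S) i = (+ 0 , trans (sym (ev-unit (row R) (length i))) (sym (ℤP.+-identityʳ _))) , fits-column S i

fits-mix : ∀ S {x y z t u} a b → Fits S x t → Fits S y u → (∀ i → z i ≡ a ℤ.* x i ℤ.+ b ℤ.* y i) → Fits S z (a · t ⊕ b · u)
fits-mix [] a b _ _ _ = tt
fits-mix (R ∷ S) {t = t} {u} a b ((m , p) , ps) ((n , q) , qs) e =
  (a ℤ.* m ℤ.+ b ℤ.* n , trans (e 0) (trans (cong₂ (λ v w → a ℤ.* v ℤ.+ b ℤ.* w) p q) (trans (lem a b m n (ev (row R) t) (ev (row R) u) (+ ℤ.∣ lead R ∣))
    (cong (ℤ._+ (a ℤ.* m ℤ.+ b ℤ.* n) ℤ.* + ℤ.∣ lead R ∣) (sym (ev-⊕ (row R) a t b u)))))) , fits-mix S a b ps qs (e ∘ suc)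
  where
  lem : ∀ a b m n t u d → a ℤ.* (t ℤ.+ m ℤ.* d) ℤ.+ b ℤ.* (u ℤ.+ n ℤ.* d) ≡ (a ℤ.* t ℤ.+ b ℤ.* u) ℤ.+ (a ℤ.* m ℤ.+ b ℤ.* n) ℤ.* d
  lem = ℤSolver.solve-∀

indices-suc : ∀ vs {i} → i ∈ indices vs → Σ ℕ λ j → length i ≡ suc j
indices-suc (v ∷ vs) (here refl) = _ , refl
indices-suc (v ∷ vs) (there m)   = indices-suc vs m

span-fits : ∀ S vs {y} → Span (moduli S) (map (column S) (indices vs)) y → Σ Point λ t → t 0 ≡ + 0 × Fits S y t
span-fits S vs {y} (div p) = (λ _ → + 0) , refl , fits-div S y p
span-fits S vs (gen m) with ∈-map⁻ (column S) m
... | i , i∈ , refl with indices-suc vs i∈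
...   | j , e = unit (length i) , subst (λ k → unit k 0 ≡ + 0) (sym e) refl , fits-column S i
span-fits S vs (mix a b p q e) with span-fits S vs p | span-fits S vs q
... | t , t0 , ft | u , u0 , fu = (a · t ⊕ b · u) , trans (cong₂ (λ v w → a ℤ.* v ℤ.+ b ℤ.* w) t0 u0) (trans (cong₂ ℤ._+_ (ℤP.*-zeroʳ a) (ℤP.*-zeroʳ b)) refl) , fits-mix S a b ft fu e

-- A point at which every row is a multiple of its leading coefficient can be corrected at the pivots.
settle : ∀ S → Reduced S → All (λ R → piv R ≢ 0) S → ∀ x₀ → All (λ R → Σ ℤ λ s → ev (row R) x₀ ≡ lead R ℤ.* s) S →
  Σ Point λ x → x 0 ≡ x₀ 0 × Ker S x × (∀ u → Clear S u → ev u x ≡ ev u x₀)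
settle [] _ [] x₀ [] = x₀ , refl , [] , (λ _ _ → refl)
settle (R ∷ S) (l , a , r) (n ∷ ns) x₀ ((s , e) ∷ es) with settle S r ns x₀ es
... | x₁ , x₁0 , k , keep = x , trans at0 x₁0 , first ∷ rest S a k , keep′
  where
  x : Point
  x = (+ 1) · x₁ ⊕ (ℤ.- s) · unit (piv R)
  eval : ∀ u → ev u x ≡ ev u x₁ ℤ.- s ℤ.* at u (piv R)
  eval u = trans (ev-⊕ u (+ 1) x₁ (ℤ.- s) (unit (piv R))) (trans (cong (λ z → + 1 ℤ.* ev u x₁ ℤ.+ ℤ.- s ℤ.* z) (ev-unit u (piv R))) (lem (ev u x₁) s (at u (piv R))))
    where
    lem : ∀ a s b → + 1 ℤ.* a ℤ.+ ℤ.- s ℤ.* b ≡ a ℤ.- s ℤ.* b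
    lem = ℤSolver.solve-∀
  at0 : x 0 ≡ x₁ 0
  at0 = trans (cong (λ z → + 1 ℤ.* x₁ 0 ℤ.+ ℤ.- s ℤ.* z) (unit-≢ (piv R) 0 (λ e → n (sym e)))) (lem (x₁ 0) s)
    where
    lem : ∀ a s → + 1 ℤ.* a ℤ.+ ℤ.- s ℤ.* + 0 ≡ a
    lem = ℤSolver.solve-∀
  vanish : ∀ u → at u (piv R) ≡ + 0 → ev u x ≡ ev u x₁
  vanish u z = trans (eval u) (x-0* (ev u x₁) (at u (piv R)) s z)
  first : ev (row R) x ≡ + 0
  first = trans (eval (row R)) (trans (cong (ℤ._- s ℤ.* lead R) (trans (keep (row R) (All.map proj₁ a)) e)) (lem (lead R) s))
    where
    lem : ∀ l s → l ℤ.* s ℤ.- s ℤ.* l ≡ + 0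
    lem = ℤSolver.solve-∀
  rest : ∀ S → All (Apart R) S → Ker S x₁ → Ker S x
  rest []       []             []       = []
  rest (R′ ∷ S) ((_ , z) ∷ as) (k ∷ ks) = trans (vanish (row R′) z) k ∷ rest S as ks
  keep′ : ∀ u → Clear (R ∷ S) u → ev u x ≡ ev u x₀
  keep′ u (c ∷ cs) = trans (vanish u c) (keep u cs)

∣∣-multiple : ∀ z → Σ ℤ λ s → + ℤ.∣ z ∣ ≡ z ℤ.* s
∣∣-multiple (+ n)    = + 1 , sym (ℤP.*-identityʳ (+ n))
∣∣-multiple -[1+ n ] = -[1+ 0 ] , sym (trans (ℤP.*-comm -[1+ n ] -[1+ 0 ]) (ℤP.-1*i≡-i -[1+ n ]))

-- If `t` represents the right-hand sides, subtracting the unit vector 0 leaves in each row only a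
-- multiple of its leading coefficient. This is the hypothesis of `settle`.
fits-multiples : ∀ S t → Fits S (at (column S [])) t → All (λ R → Σ ℤ λ s → ev (row R) ((+ 1) · t ⊕ -[1+ 0 ] · unit 0) ≡ lead R ℤ.* s) S
fits-multiples [] t _ = []
fits-multiples (R ∷ S) t ((m , e) , fs) = (ℤ.- m ℤ.* proj₁ c , (begin
  ev (row R) ((+ 1) · t ⊕ -[1+ 0 ] · unit 0)                     ≡⟨ ev-⊕ (row R) (+ 1) t -[1+ 0 ] (unit 0) ⟩
  + 1 ℤ.* ev (row R) t ℤ.+ -[1+ 0 ] ℤ.* ev (row R) (unit 0)      ≡⟨ cong (λ z → + 1 ℤ.* ev (row R) t ℤ.+ -[1+ 0 ] ℤ.* z) (trans (ev-unit (row R) 0) e) ⟩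
  + 1 ℤ.* ev (row R) t ℤ.+ -[1+ 0 ] ℤ.* (ev (row R) t ℤ.+ m ℤ.* + ℤ.∣ lead R ∣) ≡⟨ cong (λ z → + 1 ℤ.* ev (row R) t ℤ.+ -[1+ 0 ] ℤ.* (ev (row R) t ℤ.+ m ℤ.* z)) (proj₂ c) ⟩
  + 1 ℤ.* ev (row R) t ℤ.+ -[1+ 0 ] ℤ.* (ev (row R) t ℤ.+ m ℤ.* (lead R ℤ.* proj₁ c)) ≡⟨ lem (ev (row R) t) m (lead R) (proj₁ c) ⟩
  lead R ℤ.* (ℤ.- m ℤ.* proj₁ c) ∎)) ∷ fits-multiples S t fs
  where
  open ≡-Reasoning
  c = ∣∣-multiple (lead R)
  lem : ∀ t m l s → + 1 ℤ.* t ℤ.+ -[1+ 0 ] ℤ.* (t ℤ.+ m ℤ.* (l ℤ.* s)) ≡ l ℤ.* (ℤ.- m ℤ.* s)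
  lem = ℤSolver.solve-∀

sum : ℕ → (ℕ → ℤ) → ℤ
sum zero    f = + 0
sum (suc n) f = f 0 ℤ.+ sum n (f ∘ suc)

sum-0 : ∀ n {f} → (∀ j → f j ≡ + 0) → sum n f ≡ + 0
sum-0 zero    z = refl
sum-0 (suc n) z = cong₂ ℤ._+_ (z 0) (sum-0 n (z ∘ suc))

ev-sum : ∀ u n x → length u ≤ n → ev u x ≡ sum n (λ j → x j ℤ.* at u j)
ev-sum []      n       x _       = sym (sum-0 n (λ j → ℤP.*-zeroʳ (x j)))
ev-sum (a ∷ u) (suc n) x (s≤s l) = cong₂ ℤ._+_ (ℤP.*-comm a (x 0)) (ev-sum u n (x ∘ suc) l)

sum-cong : ∀ n {f g} → (∀ j → f j ≡ g j) → sum n f ≡ sum n g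
sum-cong zero    e = refl
sum-cong (suc n) e = cong₂ ℤ._+_ (e 0) (sum-cong n (e ∘ suc))

span-sum : ∀ {ds G} n (c : Point) (f : ℕ → Point) → (∀ j → j < n → Span ds G (f j)) → Span ds G (λ k → sum n (λ j → c j ℤ.* f j k))
span-sum {ds} zero c f H = div (Div-0 ds (λ _ → refl))
span-sum (suc n) c f H = mix (c 0) (+ 1) (H 0 (s≤s z≤n)) (span-sum n (c ∘ suc) (f ∘ suc) (λ j lt → H (suc j) (s≤s lt)))
  (λ k → cong (λ z → c 0 ℤ.* f 0 k ℤ.+ z) (sym (ℤP.*-identityˡ _)))

indices-complete : ∀ vs j → j < length vs → Σ Index λ i → i ∈ indices vs × length i ≡ suc j
indices-complete (v ∷ vs) j (s≤s le) with j ℕ.≟ length vs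
... | yes refl = _ , here refl , cong suc (LP.length-map (λ _ → tt) vs)
... | no ne with indices-complete vs j (ℕP.≤∧≢⇒< le ne)
...   | i , m , e = i , there m , e

at-column : ∀ S i j → length i ≡ length j → column S i ≡ column S j
at-column S i j e = LP.map-cong (λ R → cong (at (proj₂ R)) e) S

ones : ℕ → Index
ones n = replicate n tt

-- With coordinate 0 equal to -1, vanishing of a row says that its right-hand side is the
-- combination of its other entries with coefficients `x`.
target-sum : ∀ S n x → x 0 ≡ -[1+ 0 ] → All (λ R → length (row R) ≤ suc n) S → Ker S x →
  ∀ k → at (column S []) k ≡ sum n (λ j → x (suc j) ℤ.* at (column S (ones (suc j))) k)
target-sum [] n x x0 [] [] k = sym (sum-0 n (λ j → ℤP.*-zeroʳ (x (suc j))))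
target-sum (R ∷ S) n x x0 (l ∷ ls) (e ∷ es) (suc k) = target-sum S n x x0 ls es k
target-sum ((p , R) ∷ S) n x x0 (l ∷ ls) (e ∷ es) zero = trans (solve-for R l e) (sum-cong n (λ j → cong (λ m → x (suc j) ℤ.* at R (suc m)) (sym (LP.length-replicate j))))
  where
  solve-for : ∀ R → length R ≤ suc n → ev R x ≡ + 0 → at R 0 ≡ sum n (λ j → x (suc j) ℤ.* at R (suc j))
  solve-for [] _ _ = sym (sum-0 n (λ j → ℤP.*-zeroʳ (x (suc j))))
  solve-for (a ∷ R) (s≤s l) e = trans (lem a (ev R (x ∘ suc)) (trans (cong (λ z → a ℤ.* z ℤ.+ ev R (x ∘ suc)) (sym x0)) e)) (ev-sum R n (x ∘ suc) l)
    where
    lem₁ : ∀ a b → a ≡ b ℤ.- (a ℤ.* -[1+ 0 ] ℤ.+ b)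
    lem₁ = ℤSolver.solve-∀
    lem : ∀ a b → a ℤ.* -[1+ 0 ] ℤ.+ b ≡ + 0 → a ≡ b
    lem a b e = trans (lem₁ a b) (trans (cong (λ z → b ℤ.- z) e) (ℤP.+-identityʳ b))

moduli>0 : ∀ S → All (λ R → lead R ≢ + 0) S → All (0 <_) (moduli S)
moduli>0 []      []       = []
moduli>0 (R ∷ S) (n ∷ ns) = ℕP.n≢0⇒n>0 (λ e → n (ℤP.∣i∣≡0⇒i≡0 e)) ∷ moduli>0 S ns

anyᵇ-false : ∀ {A : Set} (p : A → Bool) l → anyᵇ p l ≡ false → All (λ x → p x ≡ false) l
anyᵇ-false p [] e = []
anyᵇ-false p (x ∷ l) e with p x in eq
... | false = eq ∷ anyᵇ-false p l e

anyᵇ-true : ∀ {A : Set} (p : A → Bool) l → anyᵇ p l ≡ true → Σ A λ x → x ∈ l × p x ≡ true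
anyᵇ-true p (x ∷ l) e with p x in eq
... | true  = x , here refl , eq
... | false with anyᵇ-true p l e
...   | y , m , q = y , there m , q

rhsOnly : Pivoted → Bool
rhsOnly R = isZeroRow (drop 1 (proj₂ R))

pivots≢0 : ∀ S → All RHSPivot S → All (λ R → rhsOnly R ≡ false) S → All (λ R → piv R ≢ 0) S
pivots≢0 [] [] [] = []
pivots≢0 (R ∷ S) (r ∷ rs) (e ∷ es) = (λ p0 → proj₂ ne (trans (drop-at (row R) (proj₁ ne)) (r p0 (proj₁ ne)))) ∷ pivots≢0 S rs es
  where
  ne : Σ ℕ λ i → at (drop 1 (row R)) i ≢ + 0
  ne = isZeroRow-false (drop 1 (row R)) e

feasible-sound : ∀ vs S → Invariant S → feasible vs S ≡ true → (Σ Point λ x → x 0 ≡ -[1+ 0 ] × Ker S x) × All (λ R → piv R ≢ 0) S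
feasible-sound vs S inv e = cases (anyᵇ rhsOnly S) refl e
  where
  cases : ∀ b → anyᵇ rhsOnly S ≡ b → (if b then false else solve (moduli S) (map (column S) (indices vs)) (column S [])) ≡ true →
    (Σ Point λ x → x 0 ≡ -[1+ 0 ] × Ker S x) × All (λ R → piv R ≢ 0) S
  cases false eq e = (proj₁ st , trans (proj₁ (proj₂ st)) (trans (cong (λ z → + 1 ℤ.* z ℤ.+ -[1+ 0 ] ℤ.* + 1) (proj₁ (proj₂ fit))) refl) , proj₁ (proj₂ (proj₂ st))) , ns
    where
    fit : Σ Point λ t → t 0 ≡ + 0 × Fits S (at (column S [])) t
    fit = span-fits S vs (solve-sound (moduli S) (map (column S) (indices vs)) (column S []) (moduli>0 S (reduced-leads S (reduced inv))) e)
    ns : All (λ R → piv R ≢ 0) S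
    ns = pivots≢0 S (rhs inv) (anyᵇ-false rhsOnly S eq)
    -- Since `t` is 0 at coordinate 0, the starting point is -1 there; `settle` keeps this because
    -- no pivot is 0.
    st = settle S (reduced inv) ns ((+ 1) · proj₁ fit ⊕ -[1+ 0 ] · unit 0) (fits-multiples S (proj₁ fit) (proj₂ (proj₂ fit)))

feasible-complete : ∀ vs S → Invariant S → All (λ R → length (row R) ≤ suc (length vs)) S → ∀ x → x 0 ≡ -[1+ 0 ] → Ker S x → feasible vs S ≡ true
feasible-complete vs S inv ls x x0 k = cases (anyᵇ rhsOnly S) refl
  where
  cases : ∀ b → anyᵇ rhsOnly S ≡ b → (if b then false else solve (moduli S) (map (column S) (indices vs)) (column S [])) ≡ true
  -- A row supported on column 0 would give `- b = 0` at `x`, so it would vanish everywhere, against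
  -- its nonzero leading coefficient.
  cases true eq = ⊥-elim (lead≢0 (tail-zero (piv R) refl))
    where
    wit = anyᵇ-true rhsOnly S eq
    R : Pivoted
    R = proj₁ wit
    lead≢0 : lead R ≢ + 0
    lead≢0 = All.lookup (reduced-leads S (reduced inv)) (proj₁ (proj₂ wit))
    zs : ∀ i → at (drop 1 (row R)) i ≡ + 0
    zs = isZeroRow-true (drop 1 (row R)) (proj₂ (proj₂ wit))
    head-zero : ∀ u → (∀ i → at (drop 1 u) i ≡ + 0) → ev u x ≡ + 0 → at u 0 ≡ + 0
    head-zero []      z e = refl
    head-zero (a ∷ u) z e = trans (lem a) (cong ℤ.-_ (trans (cong (λ w → a ℤ.* w) (sym x0)) (trans (sym (ℤP.+-identityʳ _)) (trans (cong (λ w → a ℤ.* x 0 ℤ.+ w) (sym (ev-zero u z (x ∘ suc)))) e))))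
      where
      lem : ∀ a → a ≡ ℤ.- (a ℤ.* -[1+ 0 ])
      lem = ℤSolver.solve-∀
    tail-zero : ∀ p → piv R ≡ p → lead R ≡ + 0
    tail-zero zero    e = trans (cong (at (row R)) e) (head-zero (row R) zs (All.lookup k (proj₁ (proj₂ wit))))
    tail-zero (suc p) e = trans (cong (at (row R)) e) (trans (sym (drop-at (row R) p)) (zs p))
  cases false eq = solve-complete (moduli S) (map (column S) (indices vs)) (column S []) (moduli>0 S (reduced-leads S (reduced inv)))
    (span-≗ (target-sum S (length vs) x x0 ls k) (span-sum (length vs) (x ∘ suc) (λ j → at (column S (ones (suc j)))) gens))
    where
    gens : ∀ j → j < length vs → Span (moduli S) (map (column S) (indices vs)) (at (column S (ones (suc j))))
    gens j lt = let (i , m , e) = indices-complete vs j lt in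
      gen (subst (_∈ map (column S) (indices vs)) (at-column S i (ones (suc j)) (trans e (cong suc (sym (LP.length-replicate j))))) (∈-map⁺ (column S) m))

-- Running time of the congruence solver.

modz≤ : ∀ z d → modz z d ≤ d
modz≤ z        zero    = z≤n
modz≤ (+ n)    (suc d) = ℕP.<⇒≤ (rem< n (suc d) (s≤s z≤n))
modz≤ -[1+ n ] (suc d) = ℕP.≤-trans (ℕP.m∸n≤m d (rem n (suc d))) (ℕP.n≤1+n d)

modz-small : ∀ z d {m} → size d ≤ m → Small m (modz z d)
modz-small z zero    le = small-0 le
modz-small z (suc d) {m} le = small-≤ (modz≤ z (suc d)) (small (ℕP.≤-trans (ℕ-value (suc d)) (2^-mono {size (suc d)} {m} le)))

-- A residue modulo `d` with its list node has size at most `4 * size d + 6`, which 10 times the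
-- size of the list node holding `d` covers.
vecBound : ℕ → ℕ
vecBound n = 10 * n

reduceV-size : ∀ ds v → size (reduceV ds v) ≤ vecBound (size ds)
reduceV-size [] v = s≤s z≤n
reduceV-size (d ∷ ds) v = begin
  suc (size (+ modz (headOr (+ 0) v) d) + size (reduceV ds (drop 1 v)))
    ≤⟨ s≤s (ℕP.+-mono-≤ (small-ℤ {+ modz (headOr (+ 0) v) d} (modz-small (headOr (+ 0) v) d {size d} ℕP.≤-refl)) (reduceV-size ds (drop 1 v))) ⟩
  suc (4 * size d + 5 + 10 * size ds)                     ≤⟨ ℕP.m≤m+n _ (6 * size d + 4) ⟩
  suc (4 * size d + 5 + 10 * size ds) + (6 * size d + 4)  ≡⟨ lem (size d) (size ds) ⟩
  10 * suc (size d + size ds) ∎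
  where
  open ℕP.≤-Reasoning
  lem : ∀ d s → suc (4 * d + 5 + 10 * s) + (6 * d + 4) ≡ 10 * suc (d + s)
  lem = solve-∀

opaque
  pt-modz : ∀ {Γ} {{_ : Enc Γ}} {z : Γ → ℤ} {d : Γ → ℕ} → PT z → PT d → PT (λ γ → modz (z γ) (d γ))
  pt-modz pz pd = pt-if (pt-isZero pd) (pt-const 0) (pt-modℤ pz pd)

  pt-reduceV : ∀ {Γ} {{_ : Enc Γ}} {ds : Γ → List ℕ} {v : Γ → Row} → PT ds → PT v → PT (λ γ → reduceV (ds γ) (v γ))
  pt-reduceV pds pv = pt-∘ {g = λ (q : (⊤ × List ℕ) × Row) → reduceV (proj₂ (proj₁ q)) (proj₂ q)}
    (pt-zrec {f = λ _ ds v → reduceV ds v} {n = λ _ _ → []} {c = λ _ d _ v r → + modz (headOr (+ 0) v) d ∷ r} {t = drop 1}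
      (λ _ _ → refl) (λ _ _ _ _ → refl) (pt-const [])
      (pt-∷ (pt-pos (pt-modz (pt-headOr (pt-const (+ 0)) (weaken var0)) (weaken (weaken (weaken var0))))) var0)
      (pt-tail pt-id) size-drop₁ (poly-≤ (λ q → reduceV-size (proj₂ (proj₁ q)) (proj₂ q)) (poly-const 10 poly-* out-poly (weaken var0))))
    (pt-pair (pt-pair (pt-const tt) pds) pv)

  pt-vecStep : ∀ {Γ} {{_ : Enc Γ}} {ds : Γ → List ℕ} {p : Γ → Headed × Headed} → PT ds → PT p → PT (λ γ → vecStep (ds γ) (p γ))
  pt-vecStep {Γ} {ds = ds} {p} pds pp = pt-if (pt-isZero b) (pt-pair (pt-∘ pt-proj₁ pp) (pt-∘ pt-proj₂ pp))
    (pt-pair (pt-∘ pt-proj₂ pp) (pt-pair (pt-rem a b) (pt-reduceV pds (pt-comb (pt-const (+ 1)) (pt-∘ (pt-∘ pt-proj₂ pt-proj₁) pp) (pt-neg (pt-pos (pt-quot a b))) (pt-∘ (pt-∘ pt-proj₂ pt-proj₂) pp)))))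
    where
    a : PT (λ γ → proj₁ (proj₁ (p γ)))
    a = pt-∘ (pt-∘ pt-proj₁ pt-proj₁) pp
    b : PT (λ γ → proj₁ (proj₂ (p γ)))
    b = pt-∘ (pt-∘ pt-proj₁ pt-proj₂) pp

record TailsWithin (M : ℕ) (p : Headed × Headed) : Set where
  constructor tailsWithin
  field
    tail₁ : size (proj₂ (proj₁ p)) ≤ M
    tail₂ : size (proj₂ (proj₂ p)) ≤ M
open TailsWithin

vecStep-tails : ∀ ds M p → vecBound (size ds) ≤ M → TailsWithin M p → TailsWithin M (vecStep ds p)
vecStep-tails ds M ((a , u) , (zero , v))  le t = t
vecStep-tails ds M ((a , u) , (suc b , v)) le (tailsWithin t₁ t₂) = tailsWithin t₂ (ℕP.≤-trans (reduceV-size ds _) le)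

vecSteps-tails : ∀ ds M p l → vecBound (size ds) ≤ M → TailsWithin M p → TailsWithin M (steps (vecStep ds) p l)
vecSteps-tails ds M p []      le t = t
vecSteps-tails ds M p (_ ∷ l) le t = vecSteps-tails ds M (vecStep ds p) l le (vecStep-tails ds M p le t)

vecSteps-sum : ∀ ds p l → proj₁ (heads (steps (vecStep ds) p l)) + proj₂ (heads (steps (vecStep ds) p l)) ≤ proj₁ (heads p) + proj₂ (heads p)
vecSteps-sum ds p l = ℕP.≤-trans (ℕP.≤-reflexive (cong (λ h → proj₁ h + proj₂ h) (vecSteps-heads ds p l))) (euclid-sums (heads p) l)

vecSteps-size : ∀ ds p l n → size (ds , p) ≤ n → size (steps (vecStep ds) p l) ≤ 3 + (4 * (n + n) + 1 + 11 * n + (4 * (n + n) + 1 + 11 * n))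
vecSteps-size ds p@((a , u) , (b , v)) l n le = s≤s (ℕP.≤-trans (ℕP.+-mono-≤ (part A< (tail₁ tl)) (part B< (tail₂ tl))) (ℕP.≤-reflexive (lem X)))
  where
  X = 4 * (n + n) + 1 + 11 * n
  lem : ∀ x → suc x + suc x ≡ 2 + (x + x)
  lem = solve-∀
  r : Headed × Headed
  r = steps (vecStep ds) p l
  ds≤ : size ds ≤ n
  ds≤ = ℕP.≤-trans (size-proj₁ (ds , p)) le
  p≤ : size p ≤ n
  p≤ = ℕP.≤-trans (size-proj₂ (ds , p)) le
  au≤ : size (a , u) ≤ n
  au≤ = ℕP.≤-trans (size-proj₁ p) p≤
  bv≤ : size (b , v) ≤ n
  bv≤ = ℕP.≤-trans (size-proj₂ p) p≤
  10n≤11n : 10 * n ≤ 11 * n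
  10n≤11n = ℕP.*-monoˡ-≤ n (ℕP.n≤1+n 10)
  n≤11n : n ≤ 11 * n
  n≤11n = ℕP.m≤m+n n (10 * n)
  tl : TailsWithin (11 * n) r
  tl = vecSteps-tails ds (11 * n) p l (ℕP.≤-trans (ℕP.*-monoʳ-≤ 10 ds≤) 10n≤11n)
    (tailsWithin (ℕP.≤-trans (ℕP.≤-trans (size-proj₂ (a , u)) au≤) n≤11n) (ℕP.≤-trans (ℕP.≤-trans (size-proj₂ (b , v)) bv≤) n≤11n))
  small′ : ∀ x → size x ≤ n → 2 + x ≤ 2 ^ n
  small′ x le = ℕP.≤-trans (ℕ-value x) (2^-mono {size x} {n} le)
  sum< : proj₁ (heads r) + proj₂ (heads r) < 2 ^ (n + n)
  sum< = ℕP.≤-<-trans (vecSteps-sum ds p l) (ℕP.≤-trans (ℕP.n≤1+n _) (+<2^ {a} {b} {n} {n} (small′ a (ℕP.≤-trans (size-proj₁ (a , u)) au≤)) (small′ b (ℕP.≤-trans (size-proj₁ (b , v)) bv≤))))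
  A< : proj₁ (heads r) < 2 ^ (n + n)
  A< = ℕP.≤-<-trans (ℕP.m≤m+n (proj₁ (heads r)) _) sum<
  B< : proj₂ (heads r) < 2 ^ (n + n)
  B< = ℕP.≤-<-trans (ℕP.m≤n+m _ (proj₁ (heads r))) sum<
  part : ∀ {x : ℕ} {w : Row} → x < 2 ^ (n + n) → size w ≤ 11 * n → size (x , w) ≤ suc X
  part {x} x< w≤ = s≤s (ℕP.+-mono-≤ (ℕ-size {x} {n + n} x<) w≤)

opaque
  pt-vecEuclid : ∀ {Γ} {{_ : Enc Γ}} {ds : Γ → List ℕ} {p : Γ → Headed × Headed} → PT ds → PT p → PT (λ γ → vecEuclid (ds γ) (p γ))
  pt-vecEuclid pds pp = pt-∘ {g = λ (q : List ℕ × (Headed × Headed)) → vecEuclid (proj₁ q) (proj₂ q)}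
    (pt-foldl {step = λ q s _ → vecStep (proj₁ q) s} {s = proj₂} {l = λ q → euclidFuel (proj₁ (proj₁ (proj₂ q))) (proj₁ (proj₂ (proj₂ q)))}
      (pt-vecStep (weaken (weaken pt-proj₁)) (weaken var0)) pt-proj₂
      (pt-∷ (pt-const true) (pt-∷ (pt-const true) (pt-dig (pt-* (pt-∘ (pt-∘ pt-proj₁ pt-proj₁) pt-proj₂) (pt-∘ (pt-∘ pt-proj₁ pt-proj₂) pt-proj₂)))))
      (poly-N h hN (λ _ → ℕP.≤-refl))
      (λ q l₁ l₂ _ → vecSteps-size (proj₁ q) (proj₂ q) l₁ (size q) ℕP.≤-refl))
    (pt-pair pds pp)
    where
    h : ℕ → ℕ
    h n = 3 + (4 * (n + n) + 1 + 11 * n + (4 * (n + n) + 1 + 11 * n))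
    xN : PolyN (λ n → 4 * (n + n) + 1 + 11 * n)
    xN = constN 4 *N (idN +N idN) +N constN 1 +N constN 11 *N idN
    hN : PolyN h
    hN = constN 3 +N (xN +N xN)

list-size : ∀ {A} {{_ : Enc A}} {M} (l : List A) → All (λ x → size x ≤ M) l → size l ≤ 1 + length l * (1 + M)
list-size [] [] = ℕP.≤-refl
list-size {M = M} (x ∷ l) (p ∷ ps) = s≤s (ℕP.≤-trans (ℕP.+-mono-≤ p (list-size l ps)) (ℕP.≤-reflexive (ℕP.+-suc M (length l * (1 + M)))))

-- The crude estimate `gcd′≤` lets the head grow by `d` with each absorbed column, which costs only
-- logarithmically many bits.
record CombineBound (M d k : ℕ) (st : Headed × List Row) : Set where
  constructor combineBound
  field
    head≤  : proj₁ (proj₁ st) ≤ (1 + k) * d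
    tail≤  : size (proj₂ (proj₁ st)) ≤ M
    rows≤  : All (λ w → size w ≤ M) (proj₂ st)
    count≤ : length (proj₂ st) ≤ k

absorb-bound : ∀ ds d k st g → CombineBound (vecBound (size ds)) d k st → CombineBound (vecBound (size ds)) d (suc k) (absorb ds d st g)
absorb-bound ds d k ((a , u) , ws) g (combineBound h t rs c) = combineBound
    (ℕP.≤-trans (ℕP.≤-reflexive (cong proj₁ (vecEuclid-heads ds p))) (ℕP.≤-trans (gcd′≤ a m) (ℕP.≤-trans (ℕP.+-mono-≤ h (modz≤ (headOr (+ 0) g) d)) (ℕP.≤-reflexive (ℕP.+-comm ((1 + k) * d) d)))))
    (tail₁ tl) (tail₂ tl ∷ rs) (s≤s c)
  where
  m = modz (headOr (+ 0) g) d
  p : Headed × Headed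
  p = (a , u) , (m , reduceV ds (drop 1 g))
  tl : TailsWithin (vecBound (size ds)) (vecEuclid ds p)
  tl = vecSteps-tails ds (vecBound (size ds)) p (euclidFuel a m) ℕP.≤-refl (tailsWithin t (reduceV-size ds (drop 1 g)))

absorbs-bound : ∀ ds d k st gs → CombineBound (vecBound (size ds)) d k st → CombineBound (vecBound (size ds)) d (length gs + k) (foldl (absorb ds d) st gs)
absorbs-bound ds d k st [] b = b
absorbs-bound ds d k st (g ∷ gs) b = subst (λ j → CombineBound (vecBound (size ds)) d j (foldl (absorb ds d) (absorb ds d st g) gs)) (ℕP.+-suc (length gs) k)
  (absorbs-bound ds d (suc k) (absorb ds d st g) gs (absorb-bound ds d k st g b))

combine-start : ∀ ds d → CombineBound (vecBound (size ds)) d 0 ((d , reduceV ds []) , [])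
combine-start ds d = combineBound (ℕP.≤-reflexive (sym (ℕP.*-identityˡ d))) (reduceV-size ds []) [] z≤n

combine-bound : ∀ ds d gs → CombineBound (vecBound (size ds)) d (length gs + 0) (combine′ ds d gs)
combine-bound ds d gs = absorbs-bound ds d 0 ((d , reduceV ds []) , []) gs (combine-start ds d)

combineSize : ℕ → ℕ
combineSize n = 2 + (4 * (2 + n + n) + 1 + 10 * n + (1 + n * (1 + 10 * n)))

size-state : ∀ (a : ℕ) (u : Row) (ws : List Row) {A U W} → size a ≤ A → size u ≤ U → size ws ≤ W → size ((a , u) , ws) ≤ 2 + (A + U + W)
size-state a u ws p q r = s≤s (s≤s (ℕP.+-mono-≤ (ℕP.+-mono-≤ p q) r))

combine-size : ∀ (ds : List ℕ) d k st n → size ds ≤ n → size d ≤ n → k ≤ n → CombineBound (vecBound (size ds)) d k st → size st ≤ combineSize n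
combine-size ds d k ((a , u) , ws) n ds≤ d≤ k≤ (combineBound h t rs c) = size-state a u ws (ℕ-size {a} {2 + n + n} a<) (ℕP.≤-trans t (ℕP.*-monoʳ-≤ 10 ds≤))
    (ℕP.≤-trans (list-size ws (All.map (λ p → ℕP.≤-trans p (ℕP.*-monoʳ-≤ 10 ds≤)) rs)) (s≤s (ℕP.*-monoˡ-≤ (1 + 10 * n) (ℕP.≤-trans c k≤))))
  where
  d-small : 2 + d ≤ 2 ^ n
  d-small = ℕP.≤-trans (ℕ-value d) (2^-mono {size d} {n} d≤)
  a< : a < 2 ^ (2 + n + n)
  a< = ℕP.≤-<-trans (ℕP.≤-trans h (ℕP.*-monoˡ-≤ d (s≤s k≤)))
    (ℕP.≤-trans (ℕP.n≤1+n _) (*<2^ {1 + n} {d} {2 + n} {n} (m<2^m (2 + n)) d-small))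

opaque
  pt-combine : ∀ {Γ} {{_ : Enc Γ}} {ds : Γ → List ℕ} {d : Γ → ℕ} {gs : Γ → List Row} → PT ds → PT d → PT gs → PT (λ γ → combine′ (ds γ) (d γ) (gs γ))
  pt-combine pds pd pgs = pt-∘ {g = λ (q : (List ℕ × ℕ) × List Row) → combine′ (proj₁ (proj₁ q)) (proj₂ (proj₁ q)) (proj₂ q)}
    (pt-foldl {step = λ q st g → absorb (proj₁ (proj₁ q)) (proj₂ (proj₁ q)) st g} {s = λ q → (proj₂ (proj₁ q) , reduceV (proj₁ (proj₁ q)) []) , []} {l = proj₂}
      (pt-∘ {g = λ (z : (Headed × Headed) × List Row) → proj₁ (proj₁ z) , proj₂ (proj₂ (proj₁ z)) ∷ proj₂ z}
        (pt-pair (pt-∘ pt-proj₁ pt-proj₁) (pt-∷ (pt-∘ (pt-∘ pt-proj₂ pt-proj₂) pt-proj₁) pt-proj₂))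
        (pt-pair (pt-vecEuclid D (pt-pair (pt-∘ pt-proj₁ (weaken var0)) (pt-pair (pt-modz (pt-headOr (pt-const (+ 0)) var0) (weaken (weaken (pt-∘ pt-proj₂ pt-proj₁)))) (pt-reduceV D (pt-tail var0)))))
          (pt-∘ pt-proj₂ (weaken var0))))
      (pt-pair (pt-pair (pt-∘ pt-proj₂ pt-proj₁) (pt-reduceV (pt-∘ pt-proj₁ pt-proj₁) (pt-const []))) (pt-const []))
      pt-proj₂
      (poly-N combineSize (constN 2 +N (constN 4 *N (constN 2 +N idN +N idN) +N constN 1 +N constN 10 *N idN +N (constN 1 +N idN *N (constN 1 +N constN 10 *N idN)))) (λ _ → ℕP.≤-refl))
      (λ { ((ds , d) , gs) l₁ l₂ eq → bound ds d gs l₁ l₂ eq (size ((ds , d) , gs)) ℕP.≤-refl }))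
    (pt-pair (pt-pair pds pd) pgs)
    where
    D : PT {(((List ℕ × ℕ) × List Row) × (Headed × List Row)) × Row} (λ q → proj₁ (proj₁ (proj₁ (proj₁ q))))
    D = weaken (weaken (pt-∘ pt-proj₁ pt-proj₁))
    bound : ∀ ds d gs l₁ l₂ → gs ≡ l₁ ++ l₂ → ∀ n → size ((ds , d) , gs) ≤ n → size (foldl (absorb ds d) ((d , reduceV ds []) , []) l₁) ≤ combineSize n
    bound ds d gs l₁ l₂ eq n le = combine-size ds d (length l₁ + 0) (foldl (absorb ds d) ((d , reduceV ds []) , []) l₁) n
      (ℕP.≤-trans (size-proj₁ (ds , d)) dd≤) (ℕP.≤-trans (size-proj₂ (ds , d)) dd≤)
      (ℕP.≤-trans (ℕP.≤-reflexive (ℕP.+-identityʳ (length l₁))) (ℕP.≤-trans (length≤size l₁) (ℕP.≤-trans (ℕP.≤-trans (size-++ˡ l₁ l₂) (ℕP.≤-reflexive (cong size (sym eq)))) (ℕP.≤-trans (size-proj₂ ((ds , d) , gs)) le))))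
      (absorbs-bound ds d 0 ((d , reduceV ds []) , []) l₁ (combine-start ds d))
      where
      dd≤ : size (ds , d) ≤ n
      dd≤ = ℕP.≤-trans (size-proj₁ ((ds , d) , gs)) le

  pt-solveStep : ∀ {Γ} {{_ : Enc Γ}} {s : Γ → SolveState} {e : Γ → ℕ × List ℕ} → PT s → PT e → PT (λ γ → solveStep (s γ) (e γ))
  pt-solveStep {Γ} {s = s} {e} ps pe = pt-if (pt-∘ pt-proj₁ ps)
    (pt-∘ {g = λ (q : ((List ℕ × ℕ) × Row) × (Headed × List Row)) → solveNext (proj₁ (proj₁ (proj₁ q))) (proj₂ (proj₁ (proj₁ q))) (proj₂ (proj₁ q)) (proj₂ q)}
      (pt-if (pt-isZero (pt-rem β g)) (pt-pair (pt-const true) (pt-pair (pt-∘ pt-proj₂ pt-proj₂)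
          (pt-reduceV (pt-∘ pt-proj₁ (pt-∘ pt-proj₁ pt-proj₁)) (pt-comb (pt-const (+ 1)) (pt-tail (pt-∘ pt-proj₂ pt-proj₁)) (pt-neg (pt-pos (pt-quot β g))) (pt-∘ pt-proj₂ (pt-∘ pt-proj₁ pt-proj₂))))))
        (pt-const (false , ([] , []))))
      (pt-pair (pt-pair (pt-pair ds (pt-modz (pt-headOr (pt-const (+ 0)) b) d)) b) (pt-combine ds d (pt-∘ pt-proj₁ (pt-∘ pt-proj₂ ps)))))
    (pt-const (false , ([] , [])))
    where
    Q : Set
    Q = ((List ℕ × ℕ) × Row) × (Headed × List Row)
    β : PT {Q} (λ q → proj₂ (proj₁ (proj₁ q)))
    β = pt-∘ pt-proj₂ (pt-∘ pt-proj₁ pt-proj₁)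
    g : PT {Q} (λ q → proj₁ (proj₁ (proj₂ q)))
    g = pt-∘ pt-proj₁ (pt-∘ pt-proj₁ pt-proj₂)
    ds : PT (λ γ → proj₂ (e γ))
    ds = pt-∘ pt-proj₂ pe
    d : PT (λ γ → proj₁ (e γ))
    d = pt-∘ pt-proj₁ pe
    b : PT (λ γ → proj₂ (proj₂ (s γ)))
    b = pt-∘ pt-proj₂ (pt-∘ pt-proj₂ ps)

-- A successful step yields one new generator per old one, all reduced modulo the remaining moduli,
-- so the bounds do not accumulate over the steps.
record SolveBound (n M : ℕ) (s : SolveState) : Set where
  constructor solveBound
  field
    count  : length (proj₁ (proj₂ s)) ≤ n
    rows   : All (λ w → size w ≤ M) (proj₁ (proj₂ s))
    target : size (proj₂ (proj₂ s)) ≤ M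

solveStep-bound : ∀ n M s d ds → 1 ≤ M → vecBound (size ds) ≤ M → SolveBound n M s → SolveBound n M (solveStep s (d , ds))
solveStep-bound n M (ok , (gs , b)) d ds 1≤ le (solveBound c r t) = if-elim (SolveBound n M) ok
  (λ _ → if-elim (SolveBound n M) (isZero (rem β (proj₁ (proj₁ (combine′ ds d gs)))))
     (λ _ → solveBound (ℕP.≤-trans (CombineBound.count≤ cb) (ℕP.≤-trans (ℕP.≤-reflexive (ℕP.+-identityʳ (length gs))) c))
              (All.map (λ p → ℕP.≤-trans p le) (CombineBound.rows≤ cb)) (ℕP.≤-trans (reduceV-size ds _) le))
     (λ _ → stop))
  (λ _ → stop)
  where
  β = modz (headOr (+ 0) b) d
  cb = combine-bound ds d gs
  stop : SolveBound n M (false , ([] , []))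
  stop = solveBound z≤n [] 1≤

solveSteps-bound : ∀ n M s l → 1 ≤ M → All (λ e → vecBound (size (proj₂ e)) ≤ M) l → SolveBound n M s → SolveBound n M (foldl solveStep s l)
solveSteps-bound n M s [] 1≤ [] b = b
solveSteps-bound n M s ((d , ds) ∷ l) 1≤ (p ∷ ps) b = solveSteps-bound n M (solveStep s (d , ds)) l 1≤ ps (solveStep-bound n M s d ds 1≤ p b)

suffixes-sizes : ∀ {A} {{_ : Enc A}} (l : List A) {M} → size l ≤ M → All (λ e → size (proj₂ e) ≤ M) (suffixes l)
suffixes-sizes []      le = []
suffixes-sizes (x ∷ l) le = l≤ ∷ suffixes-sizes l l≤
  where
  l≤ = ℕP.≤-trans (size-++ʳ (x ∷ []) l) le

suffixes-entries : ∀ {A} {{_ : Enc A}} (l : List A) {M} → size l ≤ M → All (λ e → size e ≤ M) (suffixes l)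
suffixes-entries []      le = []
suffixes-entries (x ∷ l) le = le ∷ suffixes-entries l (ℕP.≤-trans (size-++ʳ (x ∷ []) l) le)

length-suffixes : ∀ {A : Set} (l : List A) → length (suffixes l) ≡ length l
length-suffixes []      = refl
length-suffixes (x ∷ l) = cong suc (length-suffixes l)

solveSize : ℕ → ℕ
solveSize n = 1 + (3 + (1 + (1 + n * (1 + 10 * n) + 10 * n)))

sizes-All : ∀ {A} {{_ : Enc A}} (l : List A) {M} → size l ≤ M → All (λ x → size x ≤ M) l
sizes-All []      le = []
sizes-All (x ∷ l) le = ℕP.≤-trans (size-element {l = x ∷ l} [] x l refl) le ∷ sizes-All l (ℕP.≤-trans (size-++ʳ (x ∷ []) l) le)

opaque
  pt-solve : ∀ {Γ} {{_ : Enc Γ}} {ds : Γ → List ℕ} {gs : Γ → List Row} {b : Γ → Row} → PT ds → PT gs → PT b → PT (λ γ → solve (ds γ) (gs γ) (b γ))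
  pt-solve pds pgs pb = pt-∘ {g = λ (q : List ℕ × (List Row × Row)) → solve (proj₁ q) (proj₁ (proj₂ q)) (proj₂ (proj₂ q))}
    (pt-∘ pt-proj₁ (pt-foldl {step = λ _ → solveStep} {s = λ q → true , proj₂ q} {l = λ q → suffixes (proj₁ q)}
      (pt-solveStep (weaken var0) var0) (pt-pair (pt-const true) pt-proj₂)
      (pt-∘ {g = λ (q : ⊤ × List ℕ) → suffixes (proj₂ q)} psfx (pt-pair (pt-const tt) pt-proj₁))
      (poly-N solveSize (constN 1 +N (constN 3 +N (constN 1 +N (constN 1 +N idN *N (constN 1 +N constN 10 *N idN) +N constN 10 *N idN)))) (λ _ → ℕP.≤-refl))
      (λ { (ds , (gs , b)) l₁ l₂ eq → bound ds gs b l₁ l₂ eq (size (ds , (gs , b))) ℕP.≤-refl })))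
    (pt-pair pds (pt-pair pgs pb))
    where
    psfx : PT {⊤ × List ℕ} (λ q → suffixes (proj₂ q))
    psfx = pt-rec {f = λ _ l → suffixes l} {n = λ _ → []} {c = λ _ x xs r → (x , xs) ∷ r} (λ _ → refl) (λ _ _ _ → refl) (pt-const [])
      (pt-∷ (pt-pair (weaken (weaken var0)) (weaken var0)) var0)
      (poly-≤ (λ q → ℕP.≤-trans (list-size (suffixes (proj₂ q)) (suffixes-entries (proj₂ q) ℕP.≤-refl))
                 (ℕP.+-monoʳ-≤ 1 (ℕP.*-monoˡ-≤ (1 + size (proj₂ q)) (ℕP.≤-trans (ℕP.≤-reflexive (length-suffixes (proj₂ q))) (length≤size (proj₂ q))))))
        (poly-const 1 poly-+ poly-proj₂ poly-* (poly-const 1 poly-+ poly-proj₂)))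
    bound : ∀ ds gs b l₁ l₂ → suffixes ds ≡ l₁ ++ l₂ → ∀ n → size (ds , (gs , b)) ≤ n → size (foldl solveStep (true , (gs , b)) l₁) ≤ solveSize n
    bound ds gs b l₁ l₂ eq n le = s≤s (ℕP.+-mono-≤ (size-Bool≤ (proj₁ s)) (s≤s (ℕP.+-mono-≤
        (ℕP.≤-trans (list-size (proj₁ (proj₂ s)) (SolveBound.rows sb)) (s≤s (ℕP.*-monoˡ-≤ (1 + 10 * n) (SolveBound.count sb)))) (SolveBound.target sb))))
      where
      s : SolveState
      s = foldl solveStep (true , (gs , b)) l₁
      ds≤ : size ds ≤ n
      ds≤ = ℕP.≤-trans (size-proj₁ (ds , (gs , b))) le
      gsb≤ : size (gs , b) ≤ n
      gsb≤ = ℕP.≤-trans (size-proj₂ (ds , (gs , b))) le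
      gs≤ : size gs ≤ n
      gs≤ = ℕP.≤-trans (size-proj₁ (gs , b)) gsb≤
      n≤ : n ≤ 10 * n
      n≤ = ℕP.m≤m+n n (9 * n)
      sb : SolveBound n (10 * n) s
      sb = solveSteps-bound n (10 * n) (true , (gs , b)) l₁ (ℕP.≤-trans (ℕP.≤-trans (size>0 gs) gs≤) n≤)
        (AllP.++⁻ˡ l₁ (subst (All (λ e → vecBound (size (proj₂ e)) ≤ 10 * n)) eq (All.map (ℕP.*-monoʳ-≤ 10) (suffixes-sizes ds ds≤))))
        (solveBound (ℕP.≤-trans (length≤size gs) gs≤) (All.map (λ p → ℕP.≤-trans p n≤) (sizes-All gs gs≤)) (ℕP.≤-trans (ℕP.≤-trans (size-proj₂ (gs , b)) gsb≤) n≤))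

  pt-feasible : ∀ {Γ} {{_ : Enc Γ}} {vs : Γ → List ℤ} {S : Γ → List Pivoted} → PT vs → PT S → PT (λ γ → feasible (vs γ) (S γ))
  pt-feasible {Γ} {vs = vs} {S} pvs pS = pt-∘ {g = λ (q : List ℤ × List Pivoted) → feasible (proj₁ q) (proj₂ q)}
    (pt-if (pt-any {p = λ _ R → isZeroRow (drop 1 (proj₂ R))} (pt-isZeroRow (pt-tail (pt-∘ pt-proj₂ var0))) pt-proj₂) (pt-const false)
      (pt-solve (pt-map {f = λ _ R → ℤ.∣ at (proj₂ R) (length (proj₁ R)) ∣} (pt-abs (pt-at (pt-∘ pt-proj₂ var0) (pt-∘ pt-proj₁ var0))) pt-proj₂)
        (pt-map {f = λ q i → column (proj₂ q) i} (col (weaken pt-proj₂) var0) (pt-∘ {g = λ (q : ⊤ × List ℤ) → indices (proj₂ q)} pidx (pt-pair (pt-const tt) pt-proj₁)))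
        (col pt-proj₂ (pt-const []))))
    (pt-pair pvs pS)
    where
    col : ∀ {Γ} {{_ : Enc Γ}} {S : Γ → List Pivoted} {i : Γ → Index} → PT S → PT i → PT (λ γ → column (S γ) (i γ))
    col {S = S} {i} pS pi = pt-map {f = λ γ R → at (proj₂ R) (length (i γ))} (pt-at (pt-∘ pt-proj₂ var0) (weaken pi)) pS
    idx-size : ∀ (l : List ℤ) → size (map (λ _ → tt) l) ≤ 2 * size l
    idx-size l = ℕP.≤-trans (ℕP.≤-reflexive (trans (size-Index (map (λ _ → tt) l)) (cong (λ n → 1 + 2 * n) (LP.length-map (λ _ → tt) l))))
      (ℕP.≤-trans (ℕP.n≤1+n _) (ℕP.≤-trans (ℕP.≤-reflexive (sym (2*-suc (length l)))) (ℕP.*-monoʳ-≤ 2 (length<size l))))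
    indices-sizes : ∀ l {M} → size l ≤ M → All (λ i → size i ≤ 2 * M) (indices l)
    indices-sizes []      le = []
    indices-sizes (x ∷ l) le = ℕP.≤-trans (idx-size (x ∷ l)) (ℕP.*-monoʳ-≤ 2 le) ∷ indices-sizes l (ℕP.≤-trans (size-++ʳ (x ∷ []) l) le)
    length-indices : ∀ l → length (indices l) ≡ length l
    length-indices []      = refl
    length-indices (x ∷ l) = cong suc (length-indices l)
    pidx : PT {⊤ × List ℤ} (λ q → indices (proj₂ q))
    pidx = pt-rec {f = λ _ l → indices l} {n = λ _ → []} {c = λ _ x xs r → map (λ _ → tt) (x ∷ xs) ∷ r} (λ _ → refl) (λ _ _ _ → refl) (pt-const [])
      (pt-∷ (pt-map (pt-const tt) (pt-∷ (weaken (weaken var0)) (weaken var0))) var0)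
      (poly-≤ (λ q → ℕP.≤-trans (list-size (indices (proj₂ q)) (indices-sizes (proj₂ q) ℕP.≤-refl))
                 (ℕP.+-monoʳ-≤ 1 (ℕP.*-monoˡ-≤ (1 + 2 * size (proj₂ q)) (ℕP.≤-trans (ℕP.≤-reflexive (length-indices (proj₂ q))) (length≤size (proj₂ q))))))
        (poly-const 1 poly-+ poly-proj₂ poly-* (poly-const 1 poly-+ poly-const 2 poly-* poly-proj₂)))

-- Saturation reaches a fixed point, and a point of its kernel can be moved off the equations that
-- are not implied.

allᵇ-true : ∀ {A : Set} (p : A → Bool) l → allᵇ p l ≡ true → All (λ x → p x ≡ true) l
allᵇ-true p [] e = []
allᵇ-true p (x ∷ l) e with p x in eq
... | true = eq ∷ allᵇ-true p l e

allᵇ-false : ∀ {A : Set} (p : A → Bool) l → allᵇ p l ≡ false → Σ A λ x → x ∈ l × p x ≡ false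
allᵇ-false p (x ∷ l) e with p x in eq
... | false = x , here refl , eq
... | true with allᵇ-false p l e
...   | y , m , q = y , there m , q

implied-insert : ∀ S e e′ → Invariant S → implied S e ≡ true → implied (insert S e′) e ≡ true
implied-insert S e e′ inv im = implied-complete (insert S e′) e (reduced (invariant-insert S e′ inv))
  (λ x k → implied-sound S e (reduced inv) im x (proj₁ (ker-insert⁻¹ S e′ inv x k)))

implied-new : ∀ S e → Invariant S → implied (insert S e) e ≡ true
implied-new S e inv = implied-complete (insert S e) e (reduced (invariant-insert S e inv)) (λ x k → proj₂ (ker-insert⁻¹ S e inv x k))

invariant-fire : ∀ S c → Invariant S → Invariant (fire S c)
invariant-fire S c inv = if-elim Invariant (allᵇ (implied S) (proj₁ c)) (λ _ → invariant-insert S (proj₂ c) inv) (λ _ → inv)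

implied-fire : ∀ S e c → Invariant S → implied S e ≡ true → implied (fire S c) e ≡ true
implied-fire S e c inv im = if-elim (λ T → implied T e ≡ true) (allᵇ (implied S) (proj₁ c)) (λ _ → implied-insert S e (proj₂ c) inv im) (λ _ → im)

-- Potential of the stability argument: it never increases, and it drops in every pass that finds a
-- clause not idle.
unhit : List RowClause → List Pivoted → ℕ
unhit []       S = 0
unhit (c ∷ cs) S = (if implied S (proj₂ c) then 0 else 1) + unhit cs S

unhit-length : ∀ cs S → unhit cs S ≤ length cs
unhit-length []       S = z≤n
unhit-length (c ∷ cs) S = ℕP.+-mono-≤ (if-elim (_≤ 1) (implied S (proj₂ c)) (λ _ → z≤n) (λ _ → ℕP.≤-refl)) (unhit-length cs S)

Grows : List Pivoted → List Pivoted → Set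
Grows S T = ∀ e → implied S e ≡ true → implied T e ≡ true

weight-mono : ∀ {S T} (c : RowClause) → Grows S T → (if implied T (proj₂ c) then 0 else 1) ≤ (if implied S (proj₂ c) then 0 else 1)
weight-mono {S} {T} c G = lem (implied S (proj₂ c)) (implied T (proj₂ c)) (G (proj₂ c))
  where
  lem : ∀ a b → (a ≡ true → b ≡ true) → (if b then 0 else 1) ≤ (if a then 0 else 1)
  lem false false _ = ℕP.≤-refl
  lem false true  _ = z≤n
  lem true  b     f rewrite f refl = ℕP.≤-refl

unhit-mono : ∀ {S T} cs → Grows S T → unhit cs T ≤ unhit cs S
unhit-mono [] G = z≤n
unhit-mono {S} {T} (c ∷ cs) G = ℕP.+-mono-≤ (weight-mono {S} {T} c G) (unhit-mono {S} {T} cs G)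

unhit-strict : ∀ {S T c} cs → Grows S T → c ∈ cs → implied S (proj₂ c) ≡ false → implied T (proj₂ c) ≡ true → unhit cs T < unhit cs S
unhit-strict {S} {T} (c ∷ cs) G (here refl) f t rewrite f | t = s≤s (unhit-mono {S} {T} cs G)
unhit-strict {S} {T} (c ∷ cs) G (there m) f t = ℕP.+-mono-≤-< (weight-mono {S} {T} c G) (unhit-strict {S} {T} cs G m f t)

Idle : List Pivoted → RowClause → Set
Idle S c = (allᵇ (implied S) (proj₁ c) ≡ false) ⊎ (implied S (proj₂ c) ≡ true)

idle-fire : ∀ S c → Idle S c → fire S c ≡ S
idle-fire S c (inj₁ f) = cong (λ b → if b then insert S (proj₂ c) else S) f
idle-fire S c (inj₂ t) = if-elim (_≡ S) (allᵇ (implied S) (proj₁ c)) (λ _ → cong (λ b → if b then S else adjoin (normalize (reduce S (proj₂ c))) S) t) (λ _ → refl)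

fire-cases : ∀ S c → Invariant S → Idle S c ⊎ (implied S (proj₂ c) ≡ false × implied (fire S c) (proj₂ c) ≡ true)
fire-cases S c inv = cases (allᵇ (implied S) (proj₁ c)) refl (implied S (proj₂ c)) refl
  where
  cases : ∀ a → allᵇ (implied S) (proj₁ c) ≡ a → ∀ b → implied S (proj₂ c) ≡ b → Idle S c ⊎ (implied S (proj₂ c) ≡ false × implied (fire S c) (proj₂ c) ≡ true)
  cases false ea b     eb = inj₁ (inj₁ ea)
  cases true  ea true  eb = inj₁ (inj₂ eb)
  cases true  ea false eb = inj₂ (eb , subst (λ T → implied T (proj₂ c) ≡ true) (sym (cong (λ b → if b then insert S (proj₂ c) else S) ea)) (implied-new S (proj₂ c) inv))

grows-foldl : ∀ l S → Invariant S → Grows S (foldl fire S l)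
grows-foldl []      S inv e im = im
grows-foldl (c ∷ l) S inv e im = grows-foldl l (fire S c) (invariant-fire S c inv) e (implied-fire S e c inv im)

invariant-foldl : ∀ l S → Invariant S → Invariant (foldl fire S l)
invariant-foldl []      S inv = inv
invariant-foldl (c ∷ l) S inv = invariant-foldl l (fire S c) (invariant-fire S c inv)

pass-cases : ∀ cs l S → Invariant S → All (_∈ cs) l → All (Idle S) l ⊎ (unhit cs (foldl fire S l) < unhit cs S)
pass-cases cs [] S inv [] = inj₁ []
pass-cases cs (c ∷ l) S inv (m ∷ ms) = cases (fire-cases S c inv)
  where
  G : Grows S (fire S c)
  G e = implied-fire S e c inv
  cases : Idle S c ⊎ (implied S (proj₂ c) ≡ false × implied (fire S c) (proj₂ c) ≡ true) → All (Idle S) (c ∷ l) ⊎ (unhit cs (foldl fire (fire S c) l) < unhit cs S)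
  cases (inj₁ i) = [ (λ is → inj₁ (i ∷ is)) , (λ lt → inj₂ (subst (λ T → unhit cs (foldl fire T l) < unhit cs S) (sym (idle-fire S c i)) lt)) ]′ (pass-cases cs l S inv ms)
  cases (inj₂ (f , t)) = inj₂ (ℕP.≤-<-trans (unhit-mono {fire S c} {foldl fire (fire S c) l} cs (grows-foldl l (fire S c) (invariant-fire S c inv))) (unhit-strict {S} {fire S c} cs G m f t))

idle-foldl : ∀ l S → All (Idle S) l → foldl fire S l ≡ S
idle-foldl []      S []       = refl
idle-foldl (c ∷ l) S (i ∷ is) = trans (cong (λ T → foldl fire T l) (idle-fire S c i)) (idle-foldl l S is)

unhit-0 : ∀ cs S → unhit cs S ≡ 0 → All (Idle S) cs
unhit-0 [] S e = []
unhit-0 (c ∷ cs) S e with implied S (proj₂ c) in eq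
... | true = inj₂ eq ∷ unhit-0 cs S e

copies-idle : ∀ {A : Set} (l : List A) cs S → All (Idle S) cs → foldl fire S (copies l cs) ≡ S
copies-idle l cs S is = idle-foldl (copies l cs) S (all-copies l is)

-- A pass on which all clauses are idle leaves the system unchanged, and so do all later passes. Any
-- other pass lowers the potential, which can happen at most `length l` times.
stable : ∀ {A : Set} (l : List A) cs S → Invariant S → unhit cs S ≤ length l → All (Idle (foldl fire S (copies l cs))) cs
stable [] cs S inv le = unhit-0 cs S (ℕP.n≤0⇒n≡0 le)
stable (x ∷ l) cs S inv le = subst (λ T → All (Idle T) cs) (sym (LP.foldl-++ fire S cs (copies l cs))) (cases (pass-cases cs cs S inv (All.tabulate id)))
  where
  S′ : List Pivoted
  S′ = foldl fire S cs
  cases : All (Idle S) cs ⊎ (unhit cs S′ < unhit cs S) → All (Idle (foldl fire S′ (copies l cs))) cs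
  cases (inj₁ is) = subst (λ T → All (Idle T) cs) (sym (trans (cong (λ T → foldl fire T (copies l cs)) (idle-foldl cs S is)) (copies-idle l cs S is))) is
  cases (inj₂ lt) = stable l cs S′ (invariant-foldl cs S inv) (ℕP.≤-pred (ℕP.≤-trans lt le))

empty-invariant : Invariant []
empty-invariant = invariant tt [] []

saturate-stable : ∀ cs → All (Idle (saturate cs)) cs
saturate-stable cs = stable cs cs [] empty-invariant (unhit-length cs [])

saturate-invariant : ∀ cs → Invariant (saturate cs)
saturate-invariant cs = invariant-foldl (copies cs cs) [] empty-invariant

-- Solutions of the clauses and kernel points of the saturated system.

-- The implication form of a clause, which is what saturation can follow. `Satisfies` is the
-- disjunctive form, naming a body equation that fails.
Obeys : Point → RowClause → Set
Obeys x c = All (λ e → ev e x ≡ + 0) (proj₁ c) → ev (proj₂ c) x ≡ + 0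

ker-fire : ∀ S c x → Invariant S → Obeys x c → Ker S x → Ker (fire S c) x
ker-fire S c x inv ob k = if-elim (λ T → Ker T x) (allᵇ (implied S) (proj₁ c))
  (λ e → ker-insert S (proj₂ c) inv x k (ob (All.map (λ {e′} im → implied-sound S e′ (reduced inv) im x k) (allᵇ-true (implied S) (proj₁ c) e)))) (λ _ → k)

ker-foldl : ∀ l S x → Invariant S → All (Obeys x) l → Ker S x → Ker (foldl fire S l) x
ker-foldl []      S x inv []       k = k
ker-foldl (c ∷ l) S x inv (o ∷ os) k = ker-foldl l (fire S c) x (invariant-fire S c inv) os (ker-fire S c x inv o k)

saturate-ker : ∀ cs x → All (Obeys x) cs → Ker (saturate cs) x
saturate-ker cs x os = ker-foldl (copies cs cs) [] x empty-invariant (all-copies cs os) []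

saturate-lengths : ∀ cs N → All (λ c → length (proj₂ c) ≤ N) cs → All (λ R → length (row R) ≤ N) (saturate cs)
saturate-lengths cs N ls = lens (reached-foldl {λ e → length e ≤ N} {0} (copies cs cs) (all-copies cs ls) (reached [] [] z≤n))
  where
  lens : ∀ {n S} → Reached (λ e → length e ≤ N) n S → All (λ R → length (row R) ≤ N) S
  lens (reached b ps _) = built-lengths b ps

-- A number above it exceeds every single value, so one multiplier serves all equations of the list
-- at once.
total : List Row → Point → ℕ
total []       x = 0
total (e ∷ es) x = ℤ.∣ ev e x ∣ + total es x

-- Either `b` is 0 and `a` remains, or `t * b` has absolute value at least `t` and cannot cancel
-- `a`.
away-from-0 : ∀ a b t → a ≢ + 0 → ℤ.∣ a ∣ < t → a ℤ.+ + t ℤ.* b ≢ + 0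
away-from-0 a b t ne lt e with b ℤP.≟ + 0
... | yes refl = ne (trans (sym (trans (cong (λ z → a ℤ.+ z) (ℤP.*-zeroʳ (+ t))) (ℤP.+-identityʳ a))) e)
... | no b≢0 = ℕP.<-irrefl refl (ℕP.<-≤-trans lt (ℕP.≤-trans (ℕP.≤-trans (ℕP.≤-reflexive (sym (ℕP.*-identityʳ t))) (ℕP.*-monoʳ-≤ t (ℕP.n≢0⇒n>0 (λ z → b≢0 (ℤP.∣i∣≡0⇒i≡0 z)))))
      (ℕP.≤-reflexive (trans (sym (ℤP.abs-* (+ t) b)) (trans (cong ℤ.∣_∣ tb) (ℤP.∣-i∣≡∣i∣ a))))))
  where
  lem : ∀ a c → c ≡ (a ℤ.+ c) ℤ.- a
  lem = ℤSolver.solve-∀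
  tb : + t ℤ.* b ≡ ℤ.- a
  tb = trans (lem a (+ t ℤ.* b)) (trans (cong (ℤ._- a) e) (ℤP.+-identityˡ _))

shift-away : ∀ es x v t → All (λ e → ev e x ≢ + 0) es → total es x < t → All (λ e → ev e ((+ 1) · x ⊕ + t · v) ≢ + 0) es
shift-away [] x v t [] lt = []
shift-away (e ∷ es) x v t (n ∷ ns) lt =
  (λ z → away-from-0 (ev e x) (ev e v) t n (ℕP.≤-<-trans (ℕP.m≤m+n _ (total es x)) lt)
     (trans (sym (trans (ev-⊕ e (+ 1) x (+ t) v) (cong (ℤ._+ + t ℤ.* ev e v) (ℤP.*-identityˡ (ev e x))))) z))
  ∷ shift-away es x v t ns (ℕP.≤-<-trans (ℕP.m≤n+m (total es x) ℤ.∣ ev e x ∣) lt)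

ker-⊕ : ∀ S a x b y → Ker S x → Ker S y → Ker S (a · x ⊕ b · y)
ker-⊕ [] a x b y [] [] = []
ker-⊕ (R ∷ S) a x b y (k ∷ ks) (l ∷ ls) = trans (ev-⊕ (row R) a x b y) (trans (cong₂ (λ p q → a ℤ.* p ℤ.+ b ℤ.* q) k l) (trans (cong₂ ℤ._+_ (ℤP.*-zeroʳ a) (ℤP.*-zeroʳ b)) refl))
  ∷ ker-⊕ S a x b y ks ls

-- If the reduced form of `e` were supported on column 0, its vanishing at `x`, where coordinate 0
-- is -1, would make it zero. So it has an entry in another column, and the direction for that entry
-- is supported on this column and the pivots, none of which is 0.
escape : ∀ S → Reduced S → All (λ R → piv R ≢ 0) S → ∀ e → implied S e ≡ false → ∀ x → x 0 ≡ -[1+ 0 ] → Ker S x → ev e x ≡ + 0 →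
  Σ Point λ v → Ker S v × v 0 ≡ + 0 × ev e v ≢ + 0
escape S red ns e im x x0 k z = cases (isZeroRow (drop 1 w)) refl
  where
  w : Row
  w = reduce S e
  wx≡0 : ev w x ≡ + 0
  wx≡0 = trans (ev-reduce S e x k) (trans (cong (scale S ℤ.*_) z) (ℤP.*-zeroʳ (scale S)))
  rhs-only : ∀ u → (∀ i → at (drop 1 u) i ≡ + 0) → ev u x ≡ + 0 → ∀ i → at u i ≡ + 0
  rhs-only []      t h i       = refl
  rhs-only (a ∷ u) t h (suc i) = t i
  rhs-only (a ∷ u) t h zero    = trans (lem a) (cong ℤ.-_ (trans (cong (λ y → a ℤ.* y) (sym x0)) (trans (sym (ℤP.+-identityʳ _)) (trans (cong (λ y → a ℤ.* x 0 ℤ.+ y) (sym (ev-zero u t (x ∘ suc)))) h))))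
    where
    lem : ∀ a → a ≡ ℤ.- (a ℤ.* -[1+ 0 ])
    lem = ℤSolver.solve-∀
  cases : ∀ b → isZeroRow (drop 1 w) ≡ b → Σ Point λ v → Ker S v × v 0 ≡ + 0 × ev e v ≢ + 0
  cases true eq = ⊥-elim (proj₂ nz (rhs-only w (isZeroRow-true (drop 1 w) eq) wx≡0 (proj₁ nz)))
    where
    nz : Σ ℕ λ i → at w i ≢ + 0
    nz = isZeroRow-false w im
  cases false eq = v , proj₁ (proj₂ dir) , proj₂ (proj₂ (proj₂ dir)) 0 (λ ()) (All.map (λ n z → n (sym z)) ns) ,
      (λ ez → proj₁ (proj₂ (proj₂ dir)) (trans (ev-reduce S e v (proj₁ (proj₂ dir))) (trans (cong (scale S ℤ.*_) ez) (ℤP.*-zeroʳ (scale S)))))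
    where
    nz : Σ ℕ λ i → at (drop 1 w) i ≢ + 0
    nz = isZeroRow-false (drop 1 w) eq
    dir = direction S red w (suc (proj₁ nz)) (reduce-clear S e red) (λ q → proj₂ nz (trans (drop-at w (proj₁ nz)) q))
    v : Point
    v = proj₁ dir

avoid : ∀ S → Reduced S → All (λ R → piv R ≢ 0) S → ∀ x₀ → x₀ 0 ≡ -[1+ 0 ] → Ker S x₀ → ∀ es → All (λ e → implied S e ≡ false) es →
  Σ Point λ x → x 0 ≡ -[1+ 0 ] × Ker S x × All (λ e → ev e x ≢ + 0) es
avoid S red ns x₀ z₀ k₀ [] [] = x₀ , z₀ , k₀ , []
avoid S red ns x₀ z₀ k₀ (e ∷ es) (im ∷ ims) with avoid S red ns x₀ z₀ k₀ es ims
... | x , z , k , ne with ev e x ℤP.≟ + 0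
...   | no n = x , z , k , n ∷ ne
...   | yes ex = x′ , at0 , ker-⊕ S (+ 1) x (+ t) v k (proj₁ (proj₂ esc)) , new-≢ ∷ shift-away es x v t ne ℕP.≤-refl
  where
  esc : Σ Point λ v → Ker S v × v 0 ≡ + 0 × ev e v ≢ + 0
  esc = escape S red ns e im x z k ex
  v : Point
  v = proj₁ esc
  t : ℕ
  -- Large enough not to cancel any value on `es`, while `e`, being 0 at `x`, takes the value `t`
  -- times its value at `v`.
  t = suc (total es x)
  x′ : Point
  x′ = (+ 1) · x ⊕ + t · v
  at0 : x′ 0 ≡ -[1+ 0 ]
  at0 = trans (cong₂ (λ p q → + 1 ℤ.* p ℤ.+ + t ℤ.* q) z (proj₁ (proj₂ (proj₂ esc)))) (trans (cong (λ y → + 1 ℤ.* -[1+ 0 ] ℤ.+ y) (ℤP.*-zeroʳ (+ t))) refl)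
  new-≢ : ev e x′ ≢ + 0
  new-≢ q = *-≢0 (+ t) (ev e v) (λ ()) (proj₂ (proj₂ (proj₂ esc)))
    (trans (sym (trans (ev-⊕ e (+ 1) x (+ t) v) (trans (cong (λ y → + 1 ℤ.* y ℤ.+ + t ℤ.* ev e v) ex) (ℤP.+-identityˡ _)))) q)

Witnessed : List Pivoted → List Row → RowClause → Set
Witnessed S es c = (Σ Row λ e → e ∈ proj₁ c × e ∈ es) ⊎ (implied S (proj₂ c) ≡ true)

choose-witnesses : ∀ S cs → All (Idle S) cs → Σ (List Row) λ es → All (λ e → implied S e ≡ false) es × All (Witnessed S es) cs
choose-witnesses S [] [] = [] , [] , []
choose-witnesses S (c ∷ cs) (i ∷ is) with choose-witnesses S cs is
... | es , ims , ws with i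
...   | inj₂ t = es , ims , inj₂ t ∷ ws
...   | inj₁ f with allᵇ-false (implied S) (proj₁ c) f
...     | e , m , im = e ∷ es , im ∷ ims , inj₁ (e , m , here refl) ∷ All.map (λ { (inj₁ (e′ , m′ , m″)) → inj₁ (e′ , m′ , there m″) ; (inj₂ t) → inj₂ t }) ws

Satisfies : Point → RowClause → Set
Satisfies x c = (Σ Row λ e → e ∈ proj₁ c × ev e x ≢ + 0) ⊎ (ev (proj₂ c) x ≡ + 0)

rows-sound : ∀ vs cs → feasible vs (saturate cs) ≡ true → Σ Point λ x → x 0 ≡ -[1+ 0 ] × All (Satisfies x) cs
rows-sound vs cs e = finish (choose-witnesses S cs (saturate-stable cs))
  where
  S : List Pivoted
  S = saturate cs
  inv : Invariant S
  inv = saturate-invariant cs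
  fs : (Σ Point λ x → x 0 ≡ -[1+ 0 ] × Ker S x) × All (λ R → piv R ≢ 0) S
  fs = feasible-sound vs S inv e
  finish : (Σ (List Row) λ es → All (λ e → implied S e ≡ false) es × All (Witnessed S es) cs) → Σ Point λ x → x 0 ≡ -[1+ 0 ] × All (Satisfies x) cs
  finish (es , ims , ws) = x , proj₁ (proj₂ av) , All.map sat ws
    where
    av : Σ Point λ x → x 0 ≡ -[1+ 0 ] × Ker S x × All (λ e → ev e x ≢ + 0) es
    av = avoid S (reduced inv) (proj₂ fs) (proj₁ (proj₁ fs)) (proj₁ (proj₂ (proj₁ fs))) (proj₂ (proj₂ (proj₁ fs))) es ims
    x : Point
    x = proj₁ av
    sat : ∀ {c} → Witnessed S es c → Satisfies x c
    sat (inj₁ (e′ , m , m′)) = inj₁ (e′ , m , All.lookup (proj₂ (proj₂ (proj₂ av))) m′)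
    sat {c} (inj₂ t) = inj₂ (implied-sound S (proj₂ c) (reduced inv) t x (proj₁ (proj₂ (proj₂ av))))

rows-complete : ∀ vs cs → All (λ c → length (proj₂ c) ≤ suc (length vs)) cs → ∀ x → x 0 ≡ -[1+ 0 ] → All (Obeys x) cs → feasible vs (saturate cs) ≡ true
rows-complete vs cs ls x x0 os = feasible-complete vs (saturate cs) (saturate-invariant cs) (saturate-lengths cs (suc (length vs)) ls) x x0 (saturate-ker cs x os)

-- Parsing

symCase : ∀ {A : Set} (a b c d e f g h : A) → Sym → A
symCase a b c d e f g h one       = a
symCase a b c d e f g h two       = b
symCase a b c d e f g h plus      = c
symCase a b c d e f g h minus     = d
symCase a b c d e f g h sep       = e
symCase a b c d e f g h eqEnd     = f
symCase a b c d e f g h arrow     = g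
symCase a b c d e f g h clauseEnd = h

symBits : Sym → Bool × (Bool × Bool)
symBits = symCase (false , false , false) (false , false , true) (false , true , false) (false , true , true)
                  (true , false , false) (true , false , true) (true , true , false) (true , true , true)

instance
  enc-Sym : Enc Sym
  enc-Sym = record { enc = λ s → enc (symBits s) }

opaque
  pt-symCase : ∀ {Γ A} {{_ : Enc Γ}} {{_ : Enc A}} {s : Γ → Sym} {a b c d e f g h : Γ → A} → PT s →
    PT a → PT b → PT c → PT d → PT e → PT f → PT g → PT h → PT (λ γ → symCase (a γ) (b γ) (c γ) (d γ) (e γ) (f γ) (g γ) (h γ) (s γ))
  pt-symCase {Γ} {A} {s = s} ps pa pb pc pd pe pf pg ph = pt-≗ (λ γ → l (s γ))
    (pt-if (pt-∘ pt-proj₁ bs) (pt-if (pt-∘ (pt-∘ pt-proj₁ pt-proj₂) bs) (pt-if b₃ ph pg) (pt-if b₃ pf pe))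
      (pt-if (pt-∘ (pt-∘ pt-proj₁ pt-proj₂) bs) (pt-if b₃ pd pc) (pt-if b₃ pb pa)))
    where
    bs : PT (λ γ → symBits (s γ))
    bs = pt-∘ {g = symBits} (pt-recode (λ _ → refl)) ps
    b₃ : PT (λ γ → proj₂ (proj₂ (symBits (s γ))))
    b₃ = pt-∘ (pt-∘ pt-proj₂ pt-proj₂) bs
    l : ∀ {a b c d e f g h : A} s → (if proj₁ (symBits s) then (if proj₁ (proj₂ (symBits s)) then (if proj₂ (proj₂ (symBits s)) then h else g) else (if proj₂ (proj₂ (symBits s)) then f else e))
        else (if proj₁ (proj₂ (symBits s)) then (if proj₂ (proj₂ (symBits s)) then d else c) else (if proj₂ (proj₂ (symBits s)) then b else a))) ≡ symCase a b c d e f g h s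
    l one = refl
    l two = refl
    l plus = refl
    l minus = refl
    l sep = refl
    l eqEnd = refl
    l arrow = refl
    l clauseEnd = refl

-- Equations with integer keys: variable k has key + k, and the right-hand side is the coefficient
-- of the key -1, whose value is fixed to -1.
KeyedEq : Set
KeyedEq = List (ℤ × ℤ)

KeyedClause : Set
KeyedClause = List KeyedEq × KeyedEq

rhsKey : ℤ
rhsKey = -[1+ 0 ]

keyTerm : Term → ℤ × ℤ
keyTerm (a , k) = a , + k

keyEq : Equation → KeyedEq
keyEq (ts , b) = map keyTerm ts ++ (b , rhsKey) ∷ []

keyClause : Clause → KeyedClause
keyClause (body , hd) = map keyEq body , keyEq hd

-- The equation being read is the first body equation of the first clause. The default cases arise
-- only on words that encode no formula.
addTerm : ℤ × ℤ → List KeyedClause → List KeyedClause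
addTerm t F = listCase [] (λ c F′ → (listCase [] (λ e es → (t ∷ e) ∷ es) (proj₁ c) , proj₂ c) ∷ F′) F

newEq : List KeyedClause → List KeyedClause
newEq F = listCase [] (λ c F′ → ([] ∷ proj₁ c , proj₂ c) ∷ F′) F

-- Read from the right, the head comes first and is at first stored as a body equation; the arrow
-- moves it to its place.
splitHead : List KeyedClause → List KeyedClause
splitHead F = listCase [] (λ c F′ → ([] , headOr [] (proj₁ c)) ∷ F′) F

-- The parser reads from right to left; the state is the number being read, the key of the term
-- being read, and the clauses read so far.
ParseState : Set
ParseState = (ℕ × ℤ) × List KeyedClause

parseStep : Sym → ParseState → ParseState
parseStep s ((n , k) , F) = symCase
  ((bcons false n , k) , F)
  ((bcons true n , k) , F)
  ((0 , + 0) , addTerm (+ n , k) F)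
  ((0 , + 0) , addTerm (-[1+ n ] , k) F)
  -- A term contains two separators: the trailing one stores a provisional key, and the inner one
  -- overwrites it with the variable number.
  ((0 , + n) , F)
  -- The right-hand side has no separator, so it is taken as a term with the key set here.
  ((0 , rhsKey) , newEq F)
  ((0 , + 0) , splitHead F)
  ((0 , + 0) , ([] , []) ∷ F) s

parseFrom : ParseState → List Sym → ParseState
parseFrom = foldr parseStep

parse : List Sym → List KeyedClause
parse w = proj₂ (parseFrom ((0 , + 0) , []) w)

parse-++ : ∀ st v w → parseFrom st (v ++ w) ≡ parseFrom (parseFrom st w) v
parse-++ st v w = LP.foldr-++ parseStep st v w

parse-ℕᵇ : ∀ x k F → parseFrom ((0 , k) , F) (encℕᵇ x) ≡ ((ℕᵇ.toℕ x , k) , F)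
parse-ℕᵇ ℕᵇ.zero k F = refl
parse-ℕᵇ ℕᵇ.2[1+ x ] k F = trans (cong (parseStep two) (parse-ℕᵇ x k F)) (cong (λ n → (n , k) , F) (sym (2*-suc (ℕᵇ.toℕ x))))
parse-ℕᵇ ℕᵇ.1+[2 x ] k F = cong (parseStep one) (parse-ℕᵇ x k F)

parse-ℕ : ∀ n k F → parseFrom ((0 , k) , F) (encℕ n) ≡ ((n , k) , F)
parse-ℕ n k F = trans (parse-ℕᵇ (ℕᵇ.fromℕ n) k F) (cong (λ m → (m , k) , F) (ℕᵇP.toℕ-fromℕ n))

parse-ℤ : ∀ a k F → parseFrom ((0 , k) , F) (encℤ a) ≡ ((0 , + 0) , addTerm (a , k) F)
parse-ℤ (+ n)    k F = cong (parseStep plus) (parse-ℕ n k F)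
parse-ℤ -[1+ n ] k F = cong (parseStep minus) (parse-ℕ n k F)

parse-Term : ∀ t nk F → parseFrom (nk , F) (encTerm t) ≡ ((0 , + 0) , addTerm (keyTerm t) F)
parse-Term (a , k) (n , k₀) F = begin
  parseFrom ((n , k₀) , F) (encℤ a ++ sep ∷ encℕ k ++ sep ∷ [])         ≡⟨ parse-++ _ (encℤ a) (sep ∷ encℕ k ++ sep ∷ []) ⟩
  parseFrom (parseStep sep (parseFrom ((n , k₀) , F) (encℕ k ++ sep ∷ []))) (encℤ a) ≡⟨ cong (λ st → parseFrom (parseStep sep st) (encℤ a)) (trans (parse-++ _ (encℕ k) (sep ∷ [])) (parse-ℕ k (+ n) F)) ⟩
  parseFrom ((0 , + k) , F) (encℤ a)                                    ≡⟨ parse-ℤ a (+ k) F ⟩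
  (0 , + 0) , addTerm (a , + k) F ∎
  where open ≡-Reasoning

parse-Terms : ∀ ts e es h F → parseFrom ((0 , + 0) , (e ∷ es , h) ∷ F) (concatMap encTerm ts) ≡ ((0 , + 0) , ((map keyTerm ts ++ e) ∷ es , h) ∷ F)
parse-Terms [] e es h F = refl
parse-Terms (t ∷ ts) e es h F = trans (parse-++ _ (encTerm t) (concatMap encTerm ts))
  (trans (cong (λ st → parseFrom st (encTerm t)) (parse-Terms ts e es h F)) (parse-Term t (0 , + 0) _))

parse-Eq : ∀ eq nk es h F → parseFrom (nk , (es , h) ∷ F) (encEq eq) ≡ ((0 , + 0) , (keyEq eq ∷ es , h) ∷ F)
parse-Eq (ts , b) nk es h F = trans (parse-++ _ (concatMap encTerm ts) (encℤ b ++ eqEnd ∷ []))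
  (trans (cong (λ st → parseFrom st (concatMap encTerm ts)) (trans (parse-++ _ (encℤ b) (eqEnd ∷ [])) (parse-ℤ b rhsKey (([] ∷ es , h) ∷ F))))
    (parse-Terms ts ((b , rhsKey) ∷ []) es h F))

parse-Eqs : ∀ eqs es h F → parseFrom ((0 , + 0) , (es , h) ∷ F) (concatMap encEq eqs) ≡ ((0 , + 0) , (map keyEq eqs ++ es , h) ∷ F)
parse-Eqs [] es h F = refl
parse-Eqs (q ∷ eqs) es h F = trans (parse-++ _ (encEq q) (concatMap encEq eqs))
  (trans (cong (λ st → parseFrom st (encEq q)) (parse-Eqs eqs es h F)) (parse-Eq q (0 , + 0) (map keyEq eqs ++ es) h F))

parse-Clause : ∀ c F → parseFrom ((0 , + 0) , F) (encClause c) ≡ ((0 , + 0) , keyClause c ∷ F)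
parse-Clause (body , hd) F = trans (parse-++ _ (concatMap encEq body) (arrow ∷ encEq hd ++ clauseEnd ∷ []))
  (trans (cong (λ st → parseFrom (parseStep arrow st) (concatMap encEq body)) (trans (parse-++ _ (encEq hd) (clauseEnd ∷ [])) (parse-Eq hd (0 , + 0) [] [] F)))
    (trans (parse-Eqs body [] (keyEq hd) F) (cong (λ b → (0 , + 0) , (b , keyEq hd) ∷ F) (LP.++-identityʳ (map keyEq body)))))

parse-Clauses : ∀ φ → parseFrom ((0 , + 0) , []) (encode φ) ≡ ((0 , + 0) , map keyClause φ)
parse-Clauses [] = refl
parse-Clauses (c ∷ φ) = trans (parse-++ _ (encClause c) (encode φ)) (trans (cong (λ st → parseFrom st (encClause c)) (parse-Clauses φ)) (parse-Clause c (map keyClause φ)))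

parse-encode : ∀ φ → parse (encode φ) ≡ map keyClause φ
parse-encode φ = cong proj₂ (parse-Clauses φ)

size-bcons : ∀ b n → size (bcons b n) ≤ 4 + size n
size-bcons b n = ℕP.≤-trans (ℕP.≤-reflexive (cong size (dig-bcons b n))) (s≤s (ℕP.+-monoˡ-≤ (size n) (size-Bool≤ b)))

size-addTerm : ∀ t F → size (addTerm t F) ≤ suc (size t) + size F
size-addTerm t [] = s≤s z≤n
size-addTerm t (([] , h) ∷ F) = ℕP.m≤n+m _ (suc (size t))
size-addTerm t ((e ∷ es , h) ∷ F) = ℕP.≤-reflexive (lem (size t) (size e) (size es) (size h) (size F))
  where
  lem : ∀ t e es h F → suc (suc (suc (suc (t + e) + es) + h) + F) ≡ suc t + suc (suc (suc (e + es) + h) + F)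
  lem = solve-∀

size-newEq : ∀ F → size (newEq F) ≤ 2 + size F
size-newEq []            = s≤s z≤n
size-newEq ((es , h) ∷ F) = ℕP.≤-refl

size-splitHead : ∀ F → size (splitHead F) ≤ 2 + size F
size-splitHead [] = s≤s z≤n
size-splitHead ((es , h) ∷ F) = s≤s (ℕP.≤-trans (ℕP.+-monoˡ-≤ (size F) (s≤s (s≤s (hd≤ es)))) (ℕP.≤-trans (ℕP.+-monoˡ-≤ (size F) (s≤s (s≤s (ℕP.m≤m+n (size es) (size h))))) (ℕP.n≤1+n _)))
  where
  hd≤ : ∀ (es : List KeyedEq) → size (headOr [] es) ≤ size es
  hd≤ []       = ℕP.≤-refl
  hd≤ (e ∷ es) = size-element {l = e ∷ es} [] e es refl

stateSize : ∀ n k F {N K M} → size n ≤ N → size k ≤ K → size F ≤ M → size {A = ParseState} ((n , k) , F) ≤ 2 + (N + K + M)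
stateSize n k F p q r = s≤s (s≤s (ℕP.+-mono-≤ (ℕP.+-mono-≤ p q) r))

-- Growth by a constant per symbol makes the parser linear on all words, including those that encode
-- no formula.
parseStep-size : ∀ s st → size (parseStep s st) ≤ 20 + size st
parseStep-size s ((n , k) , F) = cases s
  where
  N = size n
  K = size k
  M = size F
  rearr : ∀ a {x} → x ≤ a + (N + K + M) → a ≤ 20 → 2 + x ≤ 20 + (2 + (N + K + M))
  rearr a p q = ℕP.≤-trans (s≤s (s≤s (ℕP.≤-trans p (ℕP.+-monoˡ-≤ (N + K + M) q)))) (ℕP.≤-reflexive (lem (N + K + M)))
    where
    lem : ∀ x → 2 + (20 + x) ≡ 20 + (2 + x)
    lem = solve-∀
  digit : ∀ b → size {A = ParseState} ((bcons b n , k) , F) ≤ 20 + size {A = ParseState} ((n , k) , F)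
  digit b = ℕP.≤-trans (stateSize (bcons b n) k F (size-bcons b n) ℕP.≤-refl ℕP.≤-refl) (rearr 4 ℕP.≤-refl (ℕP.≤ᵇ⇒≤ 4 20 tt))
  m≤ : M ≤ N + K + M
  m≤ = ℕP.m≤n+m M (N + K)
  cases : ∀ s → size (parseStep s ((n , k) , F)) ≤ 20 + size {A = ParseState} ((n , k) , F)
  cases one = digit false
  cases two = digit true
  cases plus = ℕP.≤-trans (stateSize 0 (+ 0) _ ℕP.≤-refl ℕP.≤-refl (size-addTerm (+ n , k) F)) (rearr 8 (ℕP.≤-reflexive (lem N K M)) (ℕP.≤ᵇ⇒≤ 8 20 tt))
    where
    lem : ∀ n k F → 4 + (suc (suc (suc (suc n) + k)) + F) ≡ 8 + (n + k + F)
    lem = solve-∀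
  cases minus = ℕP.≤-trans (stateSize 0 (+ 0) _ ℕP.≤-refl ℕP.≤-refl (size-addTerm (-[1+ n ] , k) F)) (rearr 10 (ℕP.≤-reflexive (lem N K M)) (ℕP.≤ᵇ⇒≤ 10 20 tt))
    where
    lem : ∀ n k F → 4 + (suc (suc (suc (3 + n) + k)) + F) ≡ 10 + (n + k + F)
    lem = solve-∀
  cases sep = ℕP.≤-trans (stateSize 0 (+ n) F ℕP.≤-refl ℕP.≤-refl ℕP.≤-refl) (rearr 3 (ℕP.+-monoʳ-≤ 3 (ℕP.+-monoˡ-≤ M (ℕP.m≤m+n N K))) (ℕP.≤ᵇ⇒≤ 3 20 tt))
  cases eqEnd = ℕP.≤-trans (stateSize 0 rhsKey (newEq F) ℕP.≤-refl ℕP.≤-refl (size-newEq F)) (rearr 8 (ℕP.+-monoʳ-≤ 8 m≤) (ℕP.≤ᵇ⇒≤ 8 20 tt))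
  cases arrow = ℕP.≤-trans (stateSize 0 (+ 0) (splitHead F) ℕP.≤-refl ℕP.≤-refl (size-splitHead F)) (rearr 6 (ℕP.+-monoʳ-≤ 6 m≤) (ℕP.≤ᵇ⇒≤ 6 20 tt))
  cases clauseEnd = ℕP.≤-trans (stateSize 0 (+ 0) (([] , []) ∷ F) ℕP.≤-refl ℕP.≤-refl ℕP.≤-refl) (rearr 8 (ℕP.+-monoʳ-≤ 8 m≤) (ℕP.≤ᵇ⇒≤ 8 20 tt))

parse-size : ∀ w → size (parseFrom ((0 , + 0) , []) w) ≤ 7 + 20 * length w
parse-size [] = ℕP.≤-refl
parse-size (s ∷ w) = ℕP.≤-trans (parseStep-size s (parseFrom ((0 , + 0) , []) w)) (ℕP.≤-trans (ℕP.+-monoʳ-≤ 20 (parse-size w)) (ℕP.≤-reflexive (lem (length w))))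
  where
  lem : ∀ n → 20 + (7 + 20 * n) ≡ 7 + 20 * suc n
  lem = solve-∀

opaque
  pt-addTerm : ∀ {Γ} {{_ : Enc Γ}} {t : Γ → ℤ × ℤ} {F : Γ → List KeyedClause} → PT t → PT F → PT (λ γ → addTerm (t γ) (F γ))
  pt-addTerm {Γ} {t = t} pt′ pF = pt-listCase {n = λ _ → []} {c = λ γ c F′ → (listCase [] (λ e es → (t γ ∷ e) ∷ es) (proj₁ c) , proj₂ c) ∷ F′} pF (pt-const [])
    (pt-∷ (pt-pair (pt-listCase {n = λ _ → []} {c = λ γ e es → (t (proj₂ γ) ∷ e) ∷ es} (pt-∘ pt-proj₁ (pt-∘ pt-proj₁ pt-proj₁)) (pt-const [])
        (pt-∷ (pt-∷ (pt-∘ pt′ (pt-∘ pt-proj₂ pt-proj₂)) (pt-∘ pt-proj₁ pt-proj₁)) (pt-∘ pt-proj₂ pt-proj₁)))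
      (pt-∘ pt-proj₂ (pt-∘ pt-proj₁ pt-proj₁))) (pt-∘ pt-proj₂ pt-proj₁))

  pt-newEq : ∀ {Γ} {{_ : Enc Γ}} {F : Γ → List KeyedClause} → PT F → PT (λ γ → newEq (F γ))
  pt-newEq {Γ} pF = pt-listCase {n = λ _ → []} {c = λ γ c F′ → ([] ∷ proj₁ c , proj₂ c) ∷ F′} pF (pt-const [])
    (pt-∷ (pt-pair (pt-∷ (pt-const []) (pt-∘ pt-proj₁ (pt-∘ pt-proj₁ pt-proj₁))) (pt-∘ pt-proj₂ (pt-∘ pt-proj₁ pt-proj₁))) (pt-∘ pt-proj₂ pt-proj₁))

  pt-splitHead : ∀ {Γ} {{_ : Enc Γ}} {F : Γ → List KeyedClause} → PT F → PT (λ γ → splitHead (F γ))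
  pt-splitHead {Γ} pF = pt-listCase {n = λ _ → []} {c = λ γ c F′ → ([] , headOr [] (proj₁ c)) ∷ F′} pF (pt-const [])
    (pt-∷ (pt-pair (pt-const []) (pt-headOr (pt-const []) (pt-∘ pt-proj₁ (pt-∘ pt-proj₁ pt-proj₁)))) (pt-∘ pt-proj₂ pt-proj₁))

  pt-parse : PT parse
  pt-parse = pt-∘ pt-proj₂ (pt-foldr {c = λ _ → parseStep} {n = λ _ → (0 , + 0) , []} {l = λ w → w}
    (pt-symCase {s = λ γ → proj₂ γ} var0
      (pt-pair (pt-pair (pt-bcons (pt-const false) n) k) F)
      (pt-pair (pt-pair (pt-bcons (pt-const true) n) k) F)
      (pt-pair (pt-const (0 , + 0)) (pt-addTerm (pt-pair (pt-pos n) k) F))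
      (pt-pair (pt-const (0 , + 0)) (pt-addTerm (pt-pair pt--[1+ n ] k) F))
      (pt-pair (pt-pair (pt-const 0) (pt-pos n)) F)
      (pt-pair (pt-const (0 , rhsKey)) (pt-newEq F))
      (pt-pair (pt-const (0 , + 0)) (pt-splitHead F))
      (pt-pair (pt-const (0 , + 0)) (pt-∷ (pt-const ([] , [])) F)))
    (pt-const ((0 , + 0) , [])) pt-id
    (poly-N (λ n → 7 + 20 * n) (constN 7 +N constN 20 *N idN) (λ _ → ℕP.≤-refl))
    (λ w l₁ l₂ eq → ℕP.≤-trans (parse-size l₂) (ℕP.+-monoʳ-≤ 7 (ℕP.*-monoʳ-≤ 20 (ℕP.≤-trans (length≤size l₂) (ℕP.≤-trans (size-++ʳ l₁ l₂) (ℕP.≤-reflexive (cong size (sym eq)))))))))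
    where
    C : Set
    C = (List Sym × ParseState) × Sym
    n : PT {C} (λ γ → proj₁ (proj₁ (proj₂ (proj₁ γ))))
    n = weaken (pt-∘ (pt-∘ pt-proj₁ pt-proj₁) pt-proj₂)
    k : PT {C} (λ γ → proj₂ (proj₁ (proj₂ (proj₁ γ))))
    k = weaken (pt-∘ (pt-∘ pt-proj₂ pt-proj₁) pt-proj₂)
    F : PT {C} (λ γ → proj₂ (proj₂ (proj₁ γ)))
    F = weaken (pt-∘ pt-proj₂ pt-proj₂)

-- From keyed equations to rows.

sameKey : ℤ → ℤ → Bool
sameKey a b = isZeroℤ (a ℤ.+ ℤ.- b)

sameKey-true : ∀ a b → sameKey a b ≡ true → a ≡ b
sameKey-true a b e = ℤP.i-j≡0⇒i≡j a b (isZeroℤ-true e)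

sameKey-refl : ∀ a → sameKey a a ≡ true
sameKey-refl a = cong isZeroℤ (ℤP.+-inverseʳ a)

sameKey-≢ : ∀ a b → a ≢ b → sameKey a b ≡ false
sameKey-≢ a b ne with sameKey a b in eq
... | false = refl
... | true  = contradiction (sameKey-true a b eq) ne

coef : ℤ → KeyedEq → ℤ
coef k []            = + 0
coef k ((a , k′) ∷ e) = if sameKey k k′ then a ℤ.+ coef k e else coef k e

rowOf : List ℤ → KeyedEq → Row
rowOf cols e = map (λ k → coef k e) cols

member : ℤ → List ℤ → Bool
member k l = anyᵇ (sameKey k) l

-- Removes `rhsKey` along with the repetitions, because `columns` puts it in front as column 0.
distinct : List ℤ → List ℤ
distinct []       = []
distinct (k ∷ ks) = if member k (rhsKey ∷ distinct ks) then distinct ks else k ∷ distinct ks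

keysOfEqs : List KeyedEq → List ℤ
keysOfEqs []       = []
keysOfEqs (e ∷ es) = map proj₂ e ++ keysOfEqs es

keysOf : List KeyedClause → List ℤ
keysOf []      = []
keysOf (c ∷ F) = keysOfEqs (proj₂ c ∷ proj₁ c) ++ keysOf F

-- Variable numbers are written in binary and may be exponentially large, so only the occurring ones
-- receive a column.
variables : List KeyedClause → List ℤ
variables F = distinct (keysOf F)

columns : List KeyedClause → List ℤ
columns F = rhsKey ∷ variables F

rowClause : List ℤ → KeyedClause → RowClause
rowClause cols c = map (rowOf cols) (proj₁ c) , rowOf cols (proj₂ c)

decide : List KeyedClause → Bool
decide F = feasible (variables F) (saturate (map (rowClause (columns F)) F))

NoDup : List ℤ → Set
NoDup []      = ⊤
NoDup (k ∷ l) = All (k ≢_) l × NoDup l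

member-true : ∀ k l → member k l ≡ true → k ∈ l
member-true k l e with anyᵇ-true (sameKey k) l e
... | x , m , s = subst (_∈ l) (sym (sameKey-true k x s)) m

member-false : ∀ k l → member k l ≡ false → All (k ≢_) l
member-false k l e = All.map (λ {x} f eq → true≢false (trans (cong (sameKey k) (sym eq)) (sameKey-refl k)) f) (anyᵇ-false (sameKey k) l e)

distinct-noDup : ∀ ks → NoDup (rhsKey ∷ distinct ks)
distinct-noDup [] = [] , tt
distinct-noDup (k ∷ ks) with member k (rhsKey ∷ distinct ks) in eq
... | true  = distinct-noDup ks
... | false with member-false k (rhsKey ∷ distinct ks) eq | distinct-noDup ks
...   | n ∷ ns | r , d = ((λ e → n (sym e)) ∷ r) , ns , d

distinct-⊇ : ∀ ks {k} → k ∈ ks → k ∈ rhsKey ∷ distinct ks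
distinct-⊇ (k ∷ ks) m with member k (rhsKey ∷ distinct ks) in eq
distinct-⊇ (k ∷ ks) (here refl) | true  = member-true k (rhsKey ∷ distinct ks) eq
distinct-⊇ (k ∷ ks) (there m)   | true  = distinct-⊇ ks m
distinct-⊇ (k ∷ ks) (here refl) | false = there (here refl)
distinct-⊇ (k ∷ ks) (there m)   | false with distinct-⊇ ks m
... | here e   = here e
... | there m′ = there (there m′)

evK : (ℤ → ℤ) → KeyedEq → ℤ
evK τ []            = + 0
evK τ ((a , k) ∷ e) = a ℤ.* τ k ℤ.+ evK τ e

dot : (ℤ → ℤ) → (ℤ → ℤ) → List ℤ → ℤ
dot f τ []       = + 0
dot f τ (c ∷ cs) = f c ℤ.* τ c ℤ.+ dot f τ cs

-- The effect of one more term on the coefficient function of an equation.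
bump : ℤ → ℤ → (ℤ → ℤ) → ℤ → ℤ
bump a k f c = if sameKey c k then a ℤ.+ f c else f c

dot-bump-∉ : ∀ a k f τ cs → All (k ≢_) cs → dot (bump a k f) τ cs ≡ dot f τ cs
dot-bump-∉ a k f τ [] [] = refl
dot-bump-∉ a k f τ (c ∷ cs) (n ∷ ns) = cong₂ (λ b d → (if b then a ℤ.+ f c else f c) ℤ.* τ c ℤ.+ d) (sameKey-≢ c k (λ e → n (sym e))) (dot-bump-∉ a k f τ cs ns)

dot-bump-∈ : ∀ a k f τ cs → NoDup cs → k ∈ cs → dot (bump a k f) τ cs ≡ a ℤ.* τ k ℤ.+ dot f τ cs
dot-bump-∈ a k f τ (c ∷ cs) (n , d) (here refl) = trans (cong₂ (λ b d → (if b then a ℤ.+ f c else f c) ℤ.* τ c ℤ.+ d) (sameKey-refl c) (dot-bump-∉ a c f τ cs n))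
  (lem a (f c) (τ c) (dot f τ cs))
  where
  lem : ∀ a f t d → (a ℤ.+ f) ℤ.* t ℤ.+ d ≡ a ℤ.* t ℤ.+ (f ℤ.* t ℤ.+ d)
  lem = ℤSolver.solve-∀
dot-bump-∈ a k f τ (c ∷ cs) (n , d) (there m) = trans (cong₂ (λ b d → (if b then a ℤ.+ f c else f c) ℤ.* τ c ℤ.+ d) (sameKey-≢ c k (All.lookup n m)) (dot-bump-∈ a k f τ cs d m))
  (lem (f c ℤ.* τ c) (a ℤ.* τ k) (dot f τ cs))
  where
  lem : ∀ x y d → x ℤ.+ (y ℤ.+ d) ≡ y ℤ.+ (x ℤ.+ d)
  lem = ℤSolver.solve-∀

dot-0 : ∀ τ cs → dot (λ _ → + 0) τ cs ≡ + 0
dot-0 τ []       = refl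
dot-0 τ (c ∷ cs) = trans (ℤP.+-identityˡ _) (dot-0 τ cs)

coef-dot : ∀ τ cols e → NoDup cols → All (_∈ cols) (map proj₂ e) → dot (λ k → coef k e) τ cols ≡ evK τ e
coef-dot τ cols [] d [] = dot-0 τ cols
coef-dot τ cols ((a , k) ∷ e) d (m ∷ ms) = trans (dot-bump-∈ a k (λ c → coef c e) τ cols d m) (cong (λ z → a ℤ.* τ k ℤ.+ z) (coef-dot τ cols e d ms))

-- Keys without a column get the position past the end; no equation of the formula mentions them, so
-- any value will do there.
position : ℤ → List ℤ → ℕ
position k []       = 0
position k (c ∷ cs) = if sameKey k c then 0 else suc (position k cs)

dot-cong : ∀ f {τ τ′} cs → All (λ c → τ c ≡ τ′ c) cs → dot f τ cs ≡ dot f τ′ cs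
dot-cong f [] [] = refl
dot-cong f (c ∷ cs) (e ∷ es) = cong₂ (λ t d → f c ℤ.* t ℤ.+ d) e (dot-cong f cs es)

ev-position : ∀ f cs (x : Point) → NoDup cs → ev (map f cs) x ≡ dot f (λ k → x (position k cs)) cs
ev-position f [] x d = refl
ev-position f (c ∷ cs) x (n , d) = cong₂ (λ i r → f c ℤ.* x i ℤ.+ r) (sym (cong (λ b → if b then 0 else suc (position c cs)) (sameKey-refl c)))
  (trans (ev-position f cs (x ∘ suc) d) (dot-cong f cs (All.map (λ {k} c≢k → cong x (sym (cong (λ b → if b then 0 else suc (position k cs)) (sameKey-≢ k c (λ e → c≢k (sym e)))))) n)))

ev-values : ∀ f cs τ → ev (map f cs) (at (map τ cs)) ≡ dot f τ cs
ev-values f []       τ = refl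
ev-values f (c ∷ cs) τ = cong (λ z → f c ℤ.* τ c ℤ.+ z) (ev-values f cs τ)

evK-++ : ∀ τ e e′ → evK τ (e ++ e′) ≡ evK τ e ℤ.+ evK τ e′
evK-++ τ [] e′ = sym (ℤP.+-identityˡ _)
evK-++ τ ((a , k) ∷ e) e′ = trans (cong (λ z → a ℤ.* τ k ℤ.+ z) (evK-++ τ e e′)) (sym (ℤP.+-assoc (a ℤ.* τ k) (evK τ e) (evK τ e′)))

evK-terms : ∀ τ ts → evK τ (map keyTerm ts) ≡ evalTerms (λ k → τ (+ k)) ts
evK-terms τ []             = refl
evK-terms τ ((a , k) ∷ ts) = cong (λ z → a ℤ.* τ (+ k) ℤ.+ z) (evK-terms τ ts)

evK-keyEq : ∀ τ ts b → τ rhsKey ≡ -[1+ 0 ] → evK τ (keyEq (ts , b)) ≡ evalTerms (λ k → τ (+ k)) ts ℤ.- b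
evK-keyEq τ ts b e = trans (evK-++ τ (map keyTerm ts) ((b , rhsKey) ∷ [])) (cong₂ ℤ._+_ (evK-terms τ ts) (trans (cong (λ t → b ℤ.* t ℤ.+ + 0) e) (lem b)))
  where
  lem : ∀ b → b ℤ.* -[1+ 0 ] ℤ.+ + 0 ≡ ℤ.- b
  lem = ℤSolver.solve-∀

holds⇒ : ∀ τ q → τ rhsKey ≡ -[1+ 0 ] → HoldsEq (λ k → τ (+ k)) q → evK τ (keyEq q) ≡ + 0
holds⇒ τ (ts , b) e h = trans (evK-keyEq τ ts b e) (trans (cong (ℤ._- b) h) (ℤP.+-inverseʳ b))

holds⇐ : ∀ τ q → τ rhsKey ≡ -[1+ 0 ] → evK τ (keyEq q) ≡ + 0 → HoldsEq (λ k → τ (+ k)) q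
holds⇐ τ (ts , b) e z = ℤP.i-j≡0⇒i≡j _ b (trans (sym (evK-keyEq τ ts b e)) z)

KeysIn : List ℤ → KeyedEq → Set
KeysIn cols e = All (_∈ cols) (map proj₂ e)

keysOfEqs-in : ∀ cols es → All (_∈ cols) (keysOfEqs es) → All (KeysIn cols) es
keysOfEqs-in cols [] _ = []
keysOfEqs-in cols (e ∷ es) ms with AllP.++⁻ (map proj₂ e) ms
... | m , ms′ = m ∷ keysOfEqs-in cols es ms′

keysOf-in : ∀ cols F → All (_∈ cols) (keysOf F) → All (λ c → All (KeysIn cols) (proj₂ c ∷ proj₁ c)) F
keysOf-in cols [] _ = []
keysOf-in cols (c ∷ F) ms with AllP.++⁻ (keysOfEqs (proj₂ c ∷ proj₁ c)) ms
... | m , ms′ = keysOfEqs-in cols (proj₂ c ∷ proj₁ c) m ∷ keysOf-in cols F ms′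

keys-in-columns : ∀ F → All (λ c → All (KeysIn (columns F)) (proj₂ c ∷ proj₁ c)) F
keys-in-columns F = keysOf-in (columns F) F (All.tabulate (distinct-⊇ (keysOf F)))

module Decide (φ : HornFormula) where
  F : List KeyedClause
  F = map keyClause φ
  cols : List ℤ
  cols = columns F
  noDup : NoDup cols
  noDup = distinct-noDup (keysOf F)

  row-value : ∀ τ e → KeysIn cols e → dot (λ k → coef k e) τ cols ≡ evK τ e
  row-value τ e m = coef-dot τ cols e noDup m

  keyed : ∀ {φ′} → All (λ c → All (KeysIn cols) (proj₂ c ∷ proj₁ c)) (map keyClause φ′) → All (λ c → All (λ q → KeysIn cols (keyEq q)) (proj₂ c ∷ proj₁ c)) φ′
  keyed {[]} [] = []
  keyed {(body , hd) ∷ φ′} ((h ∷ bs) ∷ cs) = (h ∷ AllP.map⁻ bs) ∷ keyed cs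

  all-keyed : All (λ c → All (λ q → KeysIn cols (keyEq q)) (proj₂ c ∷ proj₁ c)) φ
  all-keyed = keyed (keys-in-columns F)

  module FromPoint (x : Point) (x0 : x 0 ≡ -[1+ 0 ]) where
    τ : ℤ → ℤ
    τ k = x (position k cols)

    τ-rhs : τ rhsKey ≡ -[1+ 0 ]
    τ-rhs = x0

    σ : Assignment
    σ k = τ (+ k)

    ev-eq : ∀ q → KeysIn cols (keyEq q) → ev (rowOf cols (keyEq q)) x ≡ evK τ (keyEq q)
    ev-eq q m = trans (ev-position (λ k → coef k (keyEq q)) cols x noDup) (row-value τ (keyEq q) m)

    clause : ∀ c → All (λ q → KeysIn cols (keyEq q)) (proj₂ c ∷ proj₁ c) → Satisfies x (rowClause cols (keyClause c)) → HoldsClause σ c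
    clause (body , hd) (h ∷ bs) (inj₂ z) = inj₂ (holds⇐ τ hd τ-rhs (trans (sym (ev-eq hd h)) z))
    clause (body , hd) (h ∷ bs) (inj₁ (e , m , ne)) = inj₁ (find body bs m)
      where
      find : ∀ body → All (λ q → KeysIn cols (keyEq q)) body → e ∈ map (rowOf cols) (map keyEq body) → Any (λ q → ¬ HoldsEq σ q) body
      find (q ∷ body) (m ∷ ms) (here refl) = here (λ h → ne (trans (ev-eq q m) (holds⇒ τ q τ-rhs h)))
      find (q ∷ body) (m ∷ ms) (there e∈)  = there (find body ms e∈)

    clauses : ∀ φ′ → All (λ c → All (λ q → KeysIn cols (keyEq q)) (proj₂ c ∷ proj₁ c)) φ′ → All (Satisfies x) (map (rowClause cols) (map keyClause φ′)) → All (HoldsClause σ) φ′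
    clauses []       []       []       = []
    clauses (c ∷ φ′) (k ∷ ks) (s ∷ ss) = clause c k s ∷ clauses φ′ ks ss

  module FromAssignment (σ : Assignment) where
    τ : ℤ → ℤ
    τ (+ k)    = σ k
    τ -[1+ _ ] = -[1+ 0 ]

    x : Point
    x = at (map τ cols)

    ev-eq : ∀ q → KeysIn cols (keyEq q) → ev (rowOf cols (keyEq q)) x ≡ evK τ (keyEq q)
    ev-eq q m = trans (ev-values (λ k → coef k (keyEq q)) cols τ) (row-value τ (keyEq q) m)

    clause : ∀ c → All (λ q → KeysIn cols (keyEq q)) (proj₂ c ∷ proj₁ c) → HoldsClause σ c → Obeys x (rowClause cols (keyClause c))
    clause (body , hd) (h ∷ bs) (inj₂ z) _ = trans (ev-eq hd h) (holds⇒ τ hd refl z)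
    clause (body , hd) (h ∷ bs) (inj₁ a) zs = ⊥-elim (refute body bs a zs)
      where
      refute : ∀ body → All (λ q → KeysIn cols (keyEq q)) body → Any (λ q → ¬ HoldsEq σ q) body → All (λ e → ev e x ≡ + 0) (map (rowOf cols) (map keyEq body)) → ⊥
      refute (q ∷ body) (m ∷ ms) (here n)  (z ∷ zs) = n (holds⇐ τ q refl (trans (sym (ev-eq q m)) z))
      refute (q ∷ body) (m ∷ ms) (there a) (z ∷ zs) = refute body ms a zs

    clauses : ∀ φ′ → All (λ c → All (λ q → KeysIn cols (keyEq q)) (proj₂ c ∷ proj₁ c)) φ′ → All (HoldsClause σ) φ′ → All (Obeys x) (map (rowClause cols) (map keyClause φ′))
    clauses []       []       []       = []
    clauses (c ∷ φ′) (k ∷ ks) (s ∷ ss) = clause c k s ∷ clauses φ′ ks ss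

  head-lengths : ∀ F′ → All (λ c → length (proj₂ c) ≤ suc (length (variables F))) (map (rowClause cols) F′)
  head-lengths []       = []
  head-lengths (c ∷ F′) = ℕP.≤-reflexive (LP.length-map (λ k → coef k (proj₂ c)) cols) ∷ head-lengths F′

  decide-sound : decide F ≡ true → Satisfiable φ
  decide-sound e = FromPoint.σ x x0 , FromPoint.clauses x x0 φ all-keyed (proj₂ (proj₂ rs))
    where
    rs : Σ Point λ x → x 0 ≡ -[1+ 0 ] × All (Satisfies x) (map (rowClause cols) F)
    rs = rows-sound (variables F) (map (rowClause cols) F) e
    x : Point
    x = proj₁ rs
    x0 : x 0 ≡ -[1+ 0 ]
    x0 = proj₁ (proj₂ rs)

  decide-complete : Satisfiable φ → decide F ≡ true
  decide-complete (σ , hs) = rows-complete (variables F) (map (rowClause cols) F) (head-lengths F) (FromAssignment.x σ) refl (FromAssignment.clauses σ φ all-keyed hs)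

-- Running time of the decision procedure.

-- Repeated occurrences of a key are added up, and adding numbers at most adds their sizes.
coef-small : ∀ k e → Small (size e) ℤ.∣ coef k e ∣
coef-small k [] = small-0 ℕP.≤-refl
coef-small k ((a , k′) ∷ e) = if-elim (λ z → Small (size ((a , k′) ∷ e)) ℤ.∣ z ∣) (sameKey k k′) (λ _ → add (coef-small k e)) (λ _ → small-mono (size-++ʳ ((a , k′) ∷ []) e) (coef-small k e))
  where
  add : Small (size e) ℤ.∣ coef k e ∣ → Small (size ((a , k′) ∷ e)) ℤ.∣ a ℤ.+ coef k e ∣
  add (small p) = small-≤ (ℤP.∣i+j∣≤∣i∣+∣j∣ a (coef k e))
    (small-mono (ℕP.≤-trans (ℕP.+-monoˡ-≤ (size e) (size-proj₁ (a , k′))) (ℕP.n≤1+n _)) (small (+<2^ {m = size a} {size e} (ℤ-value a) p)))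

size-keysOfEqs : ∀ es → size (keysOfEqs es) ≤ size es
size-keysOfEqs [] = ℕP.≤-refl
size-keysOfEqs (e ∷ es) = ℕP.≤-trans (keys e (keysOfEqs es)) (ℕP.≤-trans (ℕP.+-monoʳ-≤ (size e) (size-keysOfEqs es)) (ℕP.n≤1+n _))
  where
  keys : ∀ (e : KeyedEq) (r : List ℤ) → size (map proj₂ e ++ r) ≤ size e + size r
  keys [] r = ℕP.n≤1+n _
  keys ((a , k) ∷ e) r = s≤s (ℕP.≤-trans (ℕP.+-mono-≤ (size-proj₂ (a , k)) (keys e r)) (ℕP.≤-reflexive (sym (ℕP.+-assoc (size (a , k)) (size e) (size r)))))

size-keysOf : ∀ F → size (keysOf F) ≤ size F
size-keysOf [] = ℕP.≤-refl
size-keysOf ((body , hd) ∷ F) = ℕP.≤-trans (size-append (keysOfEqs (hd ∷ body)) (keysOf F))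
  (ℕP.≤-trans (ℕP.+-mono-≤ (ℕP.≤-trans (size-keysOfEqs (hd ∷ body)) (ℕP.≤-reflexive (cong suc (ℕP.+-comm (size hd) (size body))))) (size-keysOf F)) (ℕP.n≤1+n _))

size-distinct : ∀ ks → size (distinct ks) ≤ size ks
size-distinct [] = ℕP.≤-refl
size-distinct (k ∷ ks) = if-elim (λ (l : List ℤ) → size l ≤ size (k ∷ ks)) (member k (rhsKey ∷ distinct ks))
  (λ _ → ℕP.≤-trans (size-distinct ks) (size-++ʳ (k ∷ []) ks)) (λ _ → s≤s (ℕP.+-monoʳ-≤ (size k) (size-distinct ks)))

opaque
  pt-sameKey : ∀ {Γ} {{_ : Enc Γ}} {a b : Γ → ℤ} → PT a → PT b → PT (λ γ → sameKey (a γ) (b γ))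
  pt-sameKey pa pb = pt-isZeroℤ (pt-addℤ pa (pt-neg pb))

  pt-coef : PT {ℤ × KeyedEq} (λ q → coef (proj₁ q) (proj₂ q))
  pt-coef = pt-rec {f = coef} {n = λ _ → + 0} {c = λ k t _ r → if sameKey k (proj₂ t) then proj₁ t ℤ.+ r else r} (λ _ → refl) (λ _ _ _ → refl) (pt-const (+ 0))
    (pt-if (pt-sameKey (weaken (weaken (weaken pt-id))) (pt-∘ pt-proj₂ (weaken (weaken var0)))) (pt-addℤ (pt-∘ pt-proj₁ (weaken (weaken var0))) var0) var0)
    (poly-≤ (λ q → small-ℤ {coef (proj₁ q) (proj₂ q)} (coef-small (proj₁ q) (proj₂ q))) (poly-const 4 poly-* poly-proj₂ poly-+ poly-const 5))

  pt-rowOf : ∀ {Γ} {{_ : Enc Γ}} {cols : Γ → List ℤ} {e : Γ → KeyedEq} → PT cols → PT e → PT (λ γ → rowOf (cols γ) (e γ))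
  pt-rowOf {cols = cols} {e} pc pe = pt-map {f = λ γ k → coef k (e γ)} (pt-app₂ {g = coef} pt-coef var0 (weaken pe)) pc

  pt-distinct : ∀ {Γ} {{_ : Enc Γ}} {ks : Γ → List ℤ} → PT ks → PT (λ γ → distinct (ks γ))
  pt-distinct pks = pt-∘ {g = λ (q : ⊤ × List ℤ) → distinct (proj₂ q)}
    (pt-rec {f = λ _ ks → distinct ks} {n = λ _ → []} {c = λ _ k _ r → if member k (rhsKey ∷ r) then r else k ∷ r} (λ _ → refl) (λ _ _ _ → refl) (pt-const [])
      (pt-if (pt-any {p = λ γ x → sameKey (proj₂ (proj₁ (proj₁ γ))) x} (pt-sameKey (weaken (weaken (weaken var0))) var0) (pt-∷ (pt-const rhsKey) var0)) var0 (pt-∷ (weaken (weaken var0)) var0))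
      (poly-≤ (λ q → size-distinct (proj₂ q)) poly-proj₂))
    (pt-pair (pt-const tt) pks)

  pt-keysOfEqs : ∀ {Γ} {{_ : Enc Γ}} {es : Γ → List KeyedEq} → PT es → PT (λ γ → keysOfEqs (es γ))
  pt-keysOfEqs pes = pt-∘ {g = λ (q : ⊤ × List KeyedEq) → keysOfEqs (proj₂ q)}
    (pt-rec {f = λ _ es → keysOfEqs es} {n = λ _ → []} {c = λ _ e _ r → map proj₂ e ++ r} (λ _ → refl) (λ _ _ _ → refl) (pt-const [])
      (pt-++ (pt-map {f = λ _ t → proj₂ t} (pt-∘ pt-proj₂ var0) (weaken (weaken var0))) var0) (poly-≤ (λ q → size-keysOfEqs (proj₂ q)) poly-proj₂))
    (pt-pair (pt-const tt) pes)

  pt-keysOf : ∀ {Γ} {{_ : Enc Γ}} {F : Γ → List KeyedClause} → PT F → PT (λ γ → keysOf (F γ))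
  pt-keysOf pF = pt-∘ {g = λ (q : ⊤ × List KeyedClause) → keysOf (proj₂ q)}
    (pt-rec {f = λ _ F → keysOf F} {n = λ _ → []} {c = λ _ c _ r → keysOfEqs (proj₂ c ∷ proj₁ c) ++ r} (λ _ → refl) (λ _ _ _ → refl) (pt-const [])
      (pt-++ (pt-keysOfEqs (pt-∷ (pt-∘ pt-proj₂ (weaken (weaken var0))) (pt-∘ pt-proj₁ (weaken (weaken var0))))) var0) (poly-≤ (λ q → size-keysOf (proj₂ q)) poly-proj₂))
    (pt-pair (pt-const tt) pF)

  pt-decide : PT decide
  pt-decide = pt-feasible vars (pt-saturate (pt-map {f = λ F c → rowClause (columns F) c}
    (pt-pair (pt-map {f = λ (q : List KeyedClause × KeyedClause) e → rowOf (columns (proj₁ q)) e} (pt-rowOf (weaken (weaken (pt-∷ (pt-const rhsKey) vars))) var0) (pt-∘ pt-proj₁ var0))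
      (pt-rowOf (weaken (pt-∷ (pt-const rhsKey) vars)) (pt-∘ pt-proj₂ var0))) pt-id))
    where
    vars : PT {List KeyedClause} variables
    vars = pt-distinct (pt-keysOf pt-id)

pt-decideInput : PT (λ w → decide (parse w))
pt-decideInput = pt-∘ pt-decide pt-parse

-- Loading the input: the last symbol is on top of the scratch stack, so the list is built from its end.

isSym : Sym → Maybe Sym → Bool
isSym s nothing   = false
isSym s (just s′) = does (index finite-Sym s FP.≟ index finite-Sym s′)

load : Sym → Prog
load s = pop scratch ⨾ pushAll (two ∷ ser s)

dispatch : Prog
dispatch = cond scratch (isSym one) (load one) (cond scratch (isSym two) (load two) (cond scratch (isSym plus) (load plus)
  (cond scratch (isSym minus) (load minus) (cond scratch (isSym sep) (load sep) (cond scratch (isSym eqEnd) (load eqEnd)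
  (cond scratch (isSym arrow) (load arrow) (load clauseEnd)))))))

-- 40 is a generous common bound: at most seven tests, one pop, and the pushes of at most 12
-- symbols.
exec-dispatch : ∀ s {a v} → Exec dispatch ((s ∷ a) ∷ v ∷ [] ∷ [] ∷ []) (a ∷ (two ∷ ser s ++ v) ∷ [] ∷ [] ∷ []) 40
exec-dispatch one       = relax (ℕP.≤ᵇ⇒≤ _ _ tt) (then refl (pop ⨾ exec-pushAll (two ∷ ser one)))
exec-dispatch two       = relax (ℕP.≤ᵇ⇒≤ _ _ tt) (else refl (then refl (pop ⨾ exec-pushAll (two ∷ ser two))))
exec-dispatch plus      = relax (ℕP.≤ᵇ⇒≤ _ _ tt) (else refl (else refl (then refl (pop ⨾ exec-pushAll (two ∷ ser plus)))))
exec-dispatch minus     = relax (ℕP.≤ᵇ⇒≤ _ _ tt) (else refl (else refl (else refl (then refl (pop ⨾ exec-pushAll (two ∷ ser minus))))))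
exec-dispatch sep       = relax (ℕP.≤ᵇ⇒≤ _ _ tt) (else refl (else refl (else refl (else refl (then refl (pop ⨾ exec-pushAll (two ∷ ser sep)))))))
exec-dispatch eqEnd     = relax (ℕP.≤ᵇ⇒≤ _ _ tt) (else refl (else refl (else refl (else refl (else refl (then refl (pop ⨾ exec-pushAll (two ∷ ser eqEnd))))))))
exec-dispatch arrow     = relax (ℕP.≤ᵇ⇒≤ _ _ tt) (else refl (else refl (else refl (else refl (else refl (else refl (then refl (pop ⨾ exec-pushAll (two ∷ ser arrow)))))))))
exec-dispatch clauseEnd = relax (ℕP.≤ᵇ⇒≤ _ _ tt) (else refl (else refl (else refl (else refl (else refl (else refl (else refl (pop ⨾ exec-pushAll (two ∷ ser clauseEnd)))))))))

exec-loading : ∀ (r acc : List Sym) → Exec (while scratch nonEmpty dispatch) (r ∷ ser acc ∷ [] ∷ [] ∷ []) ([] ∷ ser (r ʳ++ acc) ∷ [] ∷ [] ∷ []) (41 * length r + 1)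
exec-loading []      acc = done refl
exec-loading (s ∷ r) acc = exec-≡ refl refl (lem (length r))
  (again refl (exec-dispatch s) (exec-≡ (cong (λ v → r ∷ v ∷ [] ∷ [] ∷ []) (cong (two ∷_) (LP.map-++ sym? (bits (enc s)) (bits (enc acc))))) refl refl (exec-loading r (s ∷ acc))))
  where
  lem : ∀ n → suc (40 + (41 * n + 1)) ≡ 41 * suc n + 1
  lem = solve-∀

-- The symbol `one` pushed first is the code of the empty list, onto which the input symbols are
-- consed.
decider : Prog
decider = push values one ⨾ while scratch nonEmpty dispatch ⨾ PT.prog pt-decideInput

decideInput : List Sym → Bool
decideInput w = decide (parse w)

size-Sym : ∀ (s : Sym) → size s ≤ 11
size-Sym one       = ℕP.≤ᵇ⇒≤ _ _ tt
size-Sym two       = ℕP.≤ᵇ⇒≤ _ _ tt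
size-Sym plus      = ℕP.≤ᵇ⇒≤ _ _ tt
size-Sym minus     = ℕP.≤ᵇ⇒≤ _ _ tt
size-Sym sep       = ℕP.≤ᵇ⇒≤ _ _ tt
size-Sym eqEnd     = ℕP.≤ᵇ⇒≤ _ _ tt
size-Sym arrow     = ℕP.≤ᵇ⇒≤ _ _ tt
size-Sym clauseEnd = ℕP.≤ᵇ⇒≤ _ _ tt

opaque
  -- Opaque, since the exponent is an enormous numeral that must not be evaluated during type
  -- checking.
  decider-degree : ℕ
  decider-degree = Poly.degree (PT.time-poly pt-decideInput)

  -- A symbol has a code of size at most 11 and its list node adds 1, whence the factor 12 per input
  -- symbol.
  time-bound : ∀ w → PT.time pt-decideInput w ≤ pw decider-degree (1 + length w * 12)
  time-bound w = ℕP.≤-trans (Poly.bound (PT.time-poly pt-decideInput) w) (pw-monoʳ decider-degree (list-size w (All.tabulate (λ {s} _ → size-Sym s))))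

deciderTime : ℕ → ℕ
deciderTime n = 1 + (41 * n + 1 + pw decider-degree (1 + n * 12))

exec-decider : ∀ w → Exec decider (reverse w ∷ [] ∷ [] ∷ [] ∷ []) ([] ∷ (ser (decideInput w) ++ []) ∷ [] ∷ [] ∷ []) (deciderTime (length w))
exec-decider w = push ⨾ exec-≡ refl (cong (λ v → values-dump v []) loaded) (cong (λ n → 41 * n + 1) (LP.length-reverse w)) (exec-loading (reverse w) [])
    ⨾ relax (time-bound w) (PT.exec pt-decideInput w [] [])
  where
  loaded : ser (reverse w ʳ++ []) ≡ ser w ++ []
  loaded = trans (cong ser (LP.reverse-involutive w)) (sym (LP.++-identityʳ (ser w)))

-- The deciding machine and its final time bound.

pwN : ∀ d {f} → PolyN f → PolyN (λ n → pw d (f n))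
pwN d (polyN k p) = polyN ((2 + k) * d) (λ n → ℕP.≤-trans (pw-monoʳ d (p n)) (pw-pw k d n))

module HornMachine = Compile decider values isTwo

machineTime : ℕ → ℕ
machineTime n = suc (deciderTime n * (n + deciderTime n + (n + deciderTime n + 3)) + (n + deciderTime n + (n + deciderTime n + 3))) + 1

machineTimeN : PolyN machineTime
machineTimeN = constN 1 +N (dN *N sN +N sN) +N constN 1
  where
  dN : PolyN deciderTime
  dN = constN 1 +N (constN 41 *N idN +N constN 1 +N pwN decider-degree (constN 1 +N idN *N constN 12))
  sN : PolyN (λ n → n + deciderTime n + (n + deciderTime n + 3))
  sN = idN +N dN +N (idN +N dN +N constN 3)

isTwo-answer : ∀ b → isTwo (head (ser b ++ [])) ≡ b
isTwo-answer true  = refl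
isTwo-answer false = refl

halts : ∀ w → HaltsWithin HornMachine.machine w (machineTime (length w)) (decideInput w)
halts w = subst (HaltsWithin HornMachine.machine w (machineTime (length w))) (isTwo-answer (decideInput w)) (HornMachine.compiled w (exec-decider w))

-- The exponent has to absorb the constants for inputs of length 0 and 1 as well.
exponent : ℕ → ℕ
exponent d = 2 * d + 3 ^ d

pw≤^+ : ∀ d n → pw d n ≤ n ^ exponent d + exponent d
pw≤^+ d zero = begin
  pw d 0                          ≡⟨ pw-def d 0 ⟩
  2 ^ d                           ≤⟨ ℕP.^-monoˡ-≤ d (ℕP.n≤1+n 2) ⟩
  3 ^ d                           ≤⟨ ℕP.m≤n+m (3 ^ d) (2 * d) ⟩
  exponent d                      ≤⟨ ℕP.m≤n+m (exponent d) (0 ^ exponent d) ⟩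
  0 ^ exponent d + exponent d ∎
  where open ℕP.≤-Reasoning
pw≤^+ d (suc zero) = begin
  pw d 1                          ≡⟨ pw-def d 1 ⟩
  3 ^ d                           ≤⟨ ℕP.m≤n+m (3 ^ d) (2 * d) ⟩
  exponent d                      ≤⟨ ℕP.m≤n+m (exponent d) (1 ^ exponent d) ⟩
  1 ^ exponent d + exponent d ∎
  where open ℕP.≤-Reasoning
pw≤^+ d n@(suc (suc m)) = begin
  pw d n                          ≡⟨ pw-def d n ⟩
  (2 + n) ^ d                     ≤⟨ ℕP.^-monoˡ-≤ d 2+n≤ ⟩
  (n ^ 2) ^ d                     ≡⟨ ℕP.^-*-assoc n 2 d ⟩
  n ^ (2 * d)                     ≤⟨ ℕP.^-monoʳ-≤ n (ℕP.m≤m+n (2 * d) (3 ^ d)) ⟩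
  n ^ exponent d                  ≤⟨ ℕP.m≤m+n _ (exponent d) ⟩
  n ^ exponent d + exponent d ∎
  where
  open ℕP.≤-Reasoning
  2+n≤ : 2 + n ≤ n ^ 2
  2+n≤ = begin
    2 + n       ≤⟨ ℕP.+-monoˡ-≤ n (s≤s (s≤s z≤n)) ⟩
    n + n       ≡⟨ cong (λ z → n + z) (sym (ℕP.+-identityʳ n)) ⟩
    2 * n       ≤⟨ ℕP.*-monoˡ-≤ n {2} {n} (s≤s (s≤s z≤n)) ⟩
    n * n       ≡⟨ cong (n *_) (sym (ℕP.*-identityʳ n)) ⟩
    n ^ 2 ∎

theorem22 : Σ TM λ M → Σ ℕ λ k → PolyTimeDecidesHornSat M k
theorem22 = HornMachine.machine , exponent d , λ φ → decideInput (encode φ) ,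
    HornMachine.run-mono (ℕP.≤-trans (PolyN.bound machineTimeN (length (encode φ))) (pw≤^+ d (length (encode φ)))) (halts (encode φ)) ,
    (λ e → Decide.decide-sound φ (trans (sym (cong decide (parse-encode φ))) e)) ,
    (λ s → trans (cong decide (parse-encode φ)) (Decide.decide-complete φ s))
  where
  d : ℕ
  d = PolyN.degree machineTimeN
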